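{- Let $1\le m\le n$ and $p\ge 2$ be integers and let $D_{m,n,p}$ be the double-broom. Then $\mathrm{adern}(D_{m,n,p})=1$ for $D_{m,n,2}$ with $2\notin\{m,n\}$ and $m\ne n-2$, or $D_{m,n,3}$ with $m\ge 4$ and $m\ne n-2$; $\mathrm{adern}(D_{m,n,p})=5$ for $D_{1,2,4}$, $D_{1,2,p}$ with $p\ge 6$, or $D_{m,m+2,3}$ with $m\ge 2$; $\mathrm{adern}(D_{m,n,p})=4$ for $D_{1,2,5}$, $D_{1,3,3}$, or $D_{2,n,p}$ with $p\ge 5$; $\mathrm{adern}(D_{m,n,p})=3$ for $D_{1,1,p}$ with $p\ge 3$, $D_{1,2,p}$ with $p\le 3$, $D_{1,n,p}$ with $n\ge 4$ and $p\ge 4$, $D_{2,n,p}$ with $p\le 4$ except $D_{2,4,3}$, $D_{3,n,p}$ with $p\ge 4$, $D_{m,m,p}$ with $m\ge 4$ and $p\ge 5$, $D_{m,m+1,p}$ with $m\ge 4$ and $p\ge 4$, $D_{m,m+2,p}$ with $m\notin\{2,3\}$ and $p\ne 3$, or $D_{3,5,2}$; and $\mathrm{adern}(D_{m,n,p})=2$ otherwise.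
   Context: All graphs are finite and simple. For integers $m,n\ge 1$, $p\ge 2$, the double-broom $D_{m,n,p}$ is the tree on $m+n+p$ vertices obtained from a path on $p$ vertices by attaching $m$ new leaf neighbours to one end of the path and $n$ new leaf neighbours to the other end. The degree $d(e)$ of an edge $e$ is the number of edges sharing an endpoint with $e$. A decard of $G$ is the pair $(G-e,d(e))$ with $G-e$ taken up to isomorphism; the dedeck of $G$ is the multiset of its decards over all edges $e$. A multiset $\mathcal S$ of decards of $G$ determines $G$ if every graph whose dedeck contains $\mathcal S$ as a sub-multiset is isomorphic to $G$. The adversary degree-associated edge-reconstruction number $\mathrm{adern}(G)$ is the least $k$ such that every sub-multiset of size $k$ of the dedeck of $G$ determines $G$. -}

module Defs where

open import Data.Nat using (ℕ; zero; suc; _+_; _∸_; _≤_; _<_; _≡ᵇ_; _<ᵇ_; _≤ᵇ_)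
open import Data.Fin as Fin using (Fin; toℕ)
open import Data.Bool using (Bool; true; false; _∧_; _∨_; not; if_then_else_)
open import Data.List using (List; map; allFin)
open import Data.Nat.ListAction using (sum)
open import Data.Product using (Σ; _×_; _,_)
open import Data.Sum using (_⊎_)
open import Relation.Nullary using (¬_)
open import Relation.Binary.PropositionalEquality using (_≡_; _≢_)
open import Function.Bundles using (_↔_; Inverse)

Adj : ℕ → Set
Adj n = Fin n → Fin n → Bool

record Graph (n : ℕ) : Set where
  field
    adj    : Adj n
    sym    : ∀ i j → adj i j ≡ adj j i
    irrefl : ∀ i → adj i i ≡ false
open Graph public

Iso : ∀ {n n'} → Adj n → Adj n' → Set
Iso {n} {n'} a b =
  Σ (Fin n ↔ Fin n') λ f → ∀ i j → a i j ≡ b (Inverse.to f i) (Inverse.to f j)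

record Edge {n : ℕ} (a : Adj n) : Set where
  constructor edge
  field
    u v   : Fin n
    u<v   : u Fin.< v
    isAdj : a u v ≡ true
open Edge public

EdgeInjective : ∀ {k n} {a : Adj n} → (Fin k → Edge a) → Set
EdgeInjective {k} τ = ∀ (i j : Fin k) → u (τ i) ≡ u (τ j) → v (τ i) ≡ v (τ j) → i ≡ j

deg : ∀ {n} → Adj n → Fin n → ℕ
deg {n} a x = sum (map (λ y → if a x y then 1 else 0) (allFin n))

-- degree of an edge uv: number of other edges sharing an endpoint
edgeDeg : ∀ {n} {a : Adj n} → Edge a → ℕ
edgeDeg {a = a} e = deg a (u e) + deg a (v e) ∸ 2

_==_ : ∀ {n} → Fin n → Fin n → Bool
x == y = (toℕ x) ≡ᵇ (toℕ y)

deleteEdge : ∀ {n} {a : Adj n} → Edge a → Adj n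
deleteEdge {a = a} e i j =
  a i j ∧ not ((i == u e ∧ j == v e) ∨ (i == v e ∧ j == u e))

SameDecard : ∀ {n n'} {a : Adj n} {b : Adj n'} → Edge a → Edge b → Set
SameDecard e f = Iso (deleteEdge e) (deleteEdge f) × (edgeDeg e ≡ edgeDeg f)

-- The sub-multiset of the dedeck of G given by k distinct edges σ
-- determines G: every simple graph H whose dedeck contains it is ≅ G.
Determines : ∀ {n k} (a : Adj n) → (Fin k → Edge a) → Set
Determines {n} {k} a σ =
  ∀ (n' : ℕ) (H : Graph n') (τ : Fin k → Edge (adj H)) →
    EdgeInjective τ →
    (∀ i → SameDecard (τ i) (σ i)) →
    Iso (adj H) a

AllDetermine : ∀ {n} → Adj n → ℕ → Set
AllDetermine a k = ∀ (σ : Fin k → Edge a) → EdgeInjective σ → Determines a σ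

AdernIs : ∀ {n} → Adj n → ℕ → Set
AdernIs a k = AllDetermine a k × (∀ j → j < k → ¬ AllDetermine a j)

-- Double broom D_{m,n,p} on vertices 0..m+n+p-1:
-- path 0 - 1 - ... - (p-1); leaves p..p+m-1 attached to 0;
-- leaves p+m..p+m+n-1 attached to p-1.
broomRel : ℕ → ℕ → ℕ → ℕ → ℕ → Bool
broomRel m n p i j =
     ((j ≡ᵇ suc i) ∧ (j <ᵇ p))
  ∨ ((i ≡ᵇ 0) ∧ (p ≤ᵇ j) ∧ (j <ᵇ p + m))
  ∨ ((i ≡ᵇ p ∸ 1) ∧ (p + m ≤ᵇ j) ∧ (j <ᵇ p + m + n))

DoubleBroom : (m n p : ℕ) → Adj (m + n + p)
DoubleBroom m n p i j = broomRel m n p (toℕ i) (toℕ j) ∨ broomRel m n p (toℕ j) (toℕ i)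

CaseAdern1 : ℕ → ℕ → ℕ → Set
CaseAdern1 m n p =
    (p ≡ 2 × m ≢ 2 × n ≢ 2 × m + 2 ≢ n)
  ⊎ (p ≡ 3 × 4 ≤ m × m + 2 ≢ n)

CaseAdern5 : ℕ → ℕ → ℕ → Set
CaseAdern5 m n p =
    (m ≡ 1 × n ≡ 2 × p ≡ 4)
  ⊎ (m ≡ 1 × n ≡ 2 × 6 ≤ p)
  ⊎ (n ≡ m + 2 × p ≡ 3 × 2 ≤ m)

CaseAdern4 : ℕ → ℕ → ℕ → Set
CaseAdern4 m n p =
    (m ≡ 1 × n ≡ 2 × p ≡ 5)
  ⊎ (m ≡ 1 × n ≡ 3 × p ≡ 3)
  ⊎ (m ≡ 2 × 5 ≤ p)

CaseAdern3 : ℕ → ℕ → ℕ → Set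
CaseAdern3 m n p =
    (m ≡ 1 × n ≡ 1 × 3 ≤ p)
  ⊎ (m ≡ 1 × n ≡ 2 × p ≤ 3)
  ⊎ (m ≡ 1 × 4 ≤ n × 4 ≤ p)
  ⊎ (m ≡ 2 × p ≤ 4 × ¬ (n ≡ 4 × p ≡ 3))
  ⊎ (m ≡ 3 × 4 ≤ p)
  ⊎ (4 ≤ m × n ≡ m × 5 ≤ p)
  ⊎ (4 ≤ m × n ≡ m + 1 × 4 ≤ p)
  ⊎ (m ≢ 2 × m ≢ 3 × n ≡ m + 2 × p ≢ 3)
  ⊎ (m ≡ 3 × n ≡ 5 × p ≡ 2)

{-# OPTIONS --safe #-}
-- If H shares a decard with the broom G, then H ≅ (G − e) + xy for an edge e of G and vertices x, y
-- whose degrees in G − e have the same sum as those of the ends of e. If such an H is not G, then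
-- few of its edges can be cut to leave a graph G − e′: an edge near each vertex with three neighbours
-- two of which are not leaves has to go, cutting a cycle must not separate the hubs, and the orders
-- of the two parts determine a path edge e′ up to one alternative. Conversely, for each type of
-- parameters some (G − e) + xy has the maximal number of such edges: cutting at another edge gives a
-- copy of some G − e′ because a permutation exchanges two arms of the graph or reverses a path.
module Submission where

open import Defs hiding (_==_; sym; u; v)
open import Data.Nat using (ℕ; zero; suc; _+_; _∸_; _⊓_; _≤_; _<_; z≤n; s≤s; pred; _≡ᵇ_; _<ᵇ_; _≤ᵇ_)
import Data.Nat.Properties as ℕ
open import Data.Fin as Fin using (Fin; toℕ; punchIn; punchOut)
import Data.Fin.Properties as Fin
open import Data.Fin.Patterns using (0F; 1F; 2F; 3F)
open import Data.Bool using (Bool; true; false; _∧_; _∨_; not; if_then_else_; T)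
import Data.Bool.Properties as Bool
open import Data.List using (List; []; _∷_; _++_; length; map; filter; allFin; tabulate)
import Data.List.Properties as List
open import Data.Nat.ListAction using (sum)
open import Data.List.Relation.Unary.Any as Any using (Any; here; there)
import Data.List.Relation.Unary.Any.Properties as Any
open import Data.List.Relation.Unary.All as All using (All; []; _∷_)
open import Data.List.Relation.Unary.AllPairs using ([]; _∷_)
open import Data.List.Relation.Unary.Unique.Propositional using (Unique)
import Data.List.Relation.Unary.Unique.Propositional.Properties as Unique
open import Data.List.Membership.Propositional using (_∈_; _∉_)
import Data.List.Membership.Propositional.Properties as ∈
open import Data.Product using (Σ; ∃; _×_; _,_; proj₁; proj₂)
open import Data.Sum using (_⊎_; inj₁; inj₂; [_,_]′)
open import Data.Empty using (⊥; ⊥-elim)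
open import Relation.Nullary using (¬_; Dec; yes; no; contradiction)
open import Relation.Nullary.Decidable using (recompute)
open import Relation.Binary using (DecidableEquality; tri<; tri≈; tri>)
open import Relation.Binary.PropositionalEquality using (_≡_; _≢_; refl; sym; trans; cong; cong₂; subst; subst₂; ≢-sym)
open import Function using (_∘_; id)
open import Function.Bundles using (Inverse; mk↔ₛ′)

-- The degree of the cut edge is used for one common decard only: it fixes the sum of the degrees of
-- x and y in G - e (the sum is `m`, say, when e is a left leaf edge), so that few types of pairs
-- remain. The other decards enter through their isomorphism types alone. A family of common decards
-- is injective on edges of H and on edges of G; each decard may therefore be charged to an edge of
-- H or to an edge of G, whichever is forced, and the pigeonhole principle bounds the family by the
-- number of possible charges. This matters where several edges of H can be cut but all of them
-- stand for the same edge of G. The number k of prescribed decards stays a parameter: the analysis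
-- of H is made once for all m, n, p, and `Req`, `LeafReq` and `SideReq` record how large k has to
-- be for each type of H. The values in the theorem result from comparing these demands with the
-- explicit graphs H; one graph with k - 1 common decards refutes all smaller numbers at once, since
-- part of its common decards is common too.

Rel : Set → Set₁
Rel V = V → V → Set

-- Relations as graphs, isomorphism, cardinality and degree.

Same : {V : Set} → V → V → Rel V
Same a b u v = (u ≡ a × v ≡ b) ⊎ (u ≡ b × v ≡ a)

Del Add : {V : Set} → Rel V → V → V → Rel V
Del E a b u v = E u v × ¬ Same a b u v
Add E a b u v = E u v ⊎ Same a b u v

Symm : {V : Set} → Rel V → Set
Symm E = ∀ {u v} → E u v → E v u

Irr : {V : Set} → Rel V → Set
Irr E = ∀ {u v} → E u v → u ≢ v

module _ {V : Set} where

  same-swap : ∀ {a b u v : V} → Same a b u v → Same a b v u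
  same-swap (inj₁ (p , q)) = inj₂ (q , p)
  same-swap (inj₂ (p , q)) = inj₁ (q , p)

  same-flip : ∀ {a b u v : V} → Same a b u v → Same b a u v
  same-flip (inj₁ p) = inj₂ p
  same-flip (inj₂ p) = inj₁ p

  same-sym : ∀ {a b u v : V} → Same a b u v → Same u v a b
  same-sym (inj₁ (refl , refl)) = inj₁ (refl , refl)
  same-sym (inj₂ (refl , refl)) = inj₂ (refl , refl)

  same-trans : ∀ {a b c d u v : V} → Same a b c d → Same c d u v → Same a b u v
  same-trans (inj₁ (refl , refl)) s = s
  same-trans (inj₂ (refl , refl)) s = same-flip s

  same? : DecidableEquality V → ∀ a b u v → Dec (Same {V} a b u v)
  same? _≟_ a b u v with u ≟ a | v ≟ b | u ≟ b | v ≟ a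
  ... | yes p | yes q | _     | _     = yes (inj₁ (p , q))
  ... | _     | _     | yes p | yes q = yes (inj₂ (p , q))
  ... | no ¬p | _     | no ¬q | _     = no λ { (inj₁ (p , _)) → ¬p p ; (inj₂ (q , _)) → ¬q q }
  ... | no ¬p | _     | yes _ | no ¬q = no λ { (inj₁ (p , _)) → ¬p p ; (inj₂ (_ , q)) → ¬q q }
  ... | yes _ | no ¬p | no ¬q | _     = no λ { (inj₁ (_ , p)) → ¬p p ; (inj₂ (q , _)) → ¬q q }
  ... | yes _ | no ¬p | yes _ | no ¬q = no λ { (inj₁ (_ , p)) → ¬p p ; (inj₂ (_ , q)) → ¬q q }

  off : ∀ {a b u v : V} → u ≢ a → u ≢ b → ¬ Same a b u v
  off p q (inj₁ (r , _)) = p r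
  off p q (inj₂ (r , _)) = q r

  off′ : ∀ {a b u v : V} → v ≢ a → v ≢ b → ¬ Same a b u v
  off′ p q (inj₁ (_ , r)) = q r
  off′ p q (inj₂ (_ , r)) = p r

  add-symm : ∀ {E : Rel V} {a b} → Symm E → Symm (Add E a b)
  add-symm s (inj₁ e) = inj₁ (s e)
  add-symm s (inj₂ e) = inj₂ (same-swap e)

  add-irr : ∀ {E : Rel V} {a b} → a ≢ b → Irr E → Irr (Add E a b)
  add-irr a≢b i (inj₁ e) = i e
  add-irr a≢b i (inj₂ (inj₁ (refl , refl))) = a≢b
  add-irr a≢b i (inj₂ (inj₂ (refl , refl))) = a≢b ∘ sym

record _≅_ {V W : Set} (E : Rel V) (F : Rel W) : Set where
  field
    to      : V → W
    from    : W → V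
    to-from : ∀ w → to (from w) ≡ w
    from-to : ∀ v → from (to v) ≡ v
    pres    : ∀ {u v} → E u v → F (to u) (to v)
    reflect : ∀ {u v} → F (to u) (to v) → E u v

  back : ∀ {u v} → F u v → E (from u) (from v)
  back f = reflect (subst₂ F (sym (to-from _)) (sym (to-from _)) f)

  to-inj : ∀ {u v} → to u ≡ to v → u ≡ v
  to-inj p = trans (sym (from-to _)) (trans (cong from p) (from-to _))

  from-inj : ∀ {u v} → from u ≡ from v → u ≡ v
  from-inj p = trans (sym (to-from _)) (trans (cong to p) (to-from _))

  same-to : ∀ {a b u v} → Same a b u v → Same (to a) (to b) (to u) (to v)
  same-to (inj₁ (p , q)) = inj₁ (cong to p , cong to q)
  same-to (inj₂ (p , q)) = inj₂ (cong to p , cong to q)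

  same-to⁻ : ∀ {a b u v} → Same (to a) (to b) (to u) (to v) → Same a b u v
  same-to⁻ (inj₁ (p , q)) = inj₁ (to-inj p , to-inj q)
  same-to⁻ (inj₂ (p , q)) = inj₂ (to-inj p , to-inj q)

open _≅_

mkIso : ∀ {V W : Set} {E : Rel V} {F : Rel W} (t : V → W) (f : W → V) →
        (∀ w → t (f w) ≡ w) → (∀ v → f (t v) ≡ v) →
        (∀ {u v} → E u v → F (t u) (t v)) → (∀ {u v} → F u v → E (f u) (f v)) → E ≅ F
mkIso {E = E} t f tf ft p b = record
  { to = t ; from = f ; to-from = tf ; from-to = ft ; pres = p
  ; reflect = λ h → subst₂ E (ft _) (ft _) (b h) }

module _ {V W : Set} {E : Rel V} {F : Rel W} where

  ≅-sym : E ≅ F → F ≅ E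
  ≅-sym φ = mkIso (from φ) (to φ) (from-to φ) (to-from φ) (back φ) (pres φ)

  ≅-del : (φ : E ≅ F) → ∀ a b → Del E a b ≅ Del F (to φ a) (to φ b)
  ≅-del φ a b = record
    { to = to φ ; from = from φ ; to-from = to-from φ ; from-to = from-to φ
    ; pres = λ { (e , n) → pres φ e , n ∘ same-to⁻ φ }
    ; reflect = λ { (e , n) → reflect φ e , n ∘ same-to φ } }

  ≅-add : (φ : E ≅ F) → ∀ a b → Add E a b ≅ Add F (to φ a) (to φ b)
  ≅-add φ a b = record
    { to = to φ ; from = from φ ; to-from = to-from φ ; from-to = from-to φ
    ; pres = λ { (inj₁ e) → inj₁ (pres φ e) ; (inj₂ s) → inj₂ (same-to φ s) }
    ; reflect = λ { (inj₁ e) → inj₁ (reflect φ e) ; (inj₂ s) → inj₂ (same-to⁻ φ s) } }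

≅-trans : ∀ {V W X : Set} {E : Rel V} {F : Rel W} {G : Rel X} → E ≅ F → F ≅ G → E ≅ G
≅-trans φ ψ = record
  { to = to ψ ∘ to φ ; from = from φ ∘ from ψ
  ; to-from = λ w → trans (cong (to ψ) (to-from φ _)) (to-from ψ w)
  ; from-to = λ v → trans (cong (from φ) (from-to ψ _)) (from-to φ v)
  ; pres = pres ψ ∘ pres φ ; reflect = reflect φ ∘ reflect ψ }

module _ {V : Set} where

  ≅-id : ∀ {E F : Rel V} → (∀ {u v} → E u v → F u v) → (∀ {u v} → F u v → E u v) → E ≅ F
  ≅-id = mkIso id id (λ _ → refl) (λ _ → refl)

  del-same : ∀ {E : Rel V} {a b c d} → Same a b c d → Del E a b ≅ Del E c d
  del-same s = ≅-id (λ { (e , n) → e , n ∘ same-trans s }) (λ { (e , n) → e , n ∘ same-trans (same-sym s) })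

  add-flip : ∀ {E : Rel V} {a b} → Add E a b ≅ Add E b a
  add-flip = ≅-id (λ { (inj₁ e) → inj₁ e ; (inj₂ s) → inj₂ (same-flip s) })
                  (λ { (inj₁ e) → inj₁ e ; (inj₂ s) → inj₂ (same-flip s) })

  del-add : ∀ {E : Rel V} {a b} → ¬ E a b → Symm E → Del (Add E a b) a b ≅ E
  del-add ¬e s = ≅-id (λ { (inj₁ e , n) → e ; (inj₂ e , n) → ⊥-elim (n e) })
                      (λ e → inj₁ e , λ { (inj₁ (refl , refl)) → ¬e e ; (inj₂ (refl , refl)) → ¬e (s e) })

  add-del : DecidableEquality V → ∀ {E : Rel V} {a b} → E a b → Symm E → Add (Del E a b) a b ≅ E
  add-del _≟_ {E} {a} {b} e s = ≅-id
    (λ { (inj₁ (h , _)) → h ; (inj₂ (inj₁ (refl , refl))) → e ; (inj₂ (inj₂ (refl , refl))) → s e })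
    (λ {u} {v} h → split h (same? _≟_ a b u v))
    where
    split : ∀ {u v} → E u v → Dec (Same a b u v) → Add (Del E a b) a b u v
    split h (yes p) = inj₂ p
    split h (no p)  = inj₁ (h , p)

-- A duplicate-free enumeration is carried as data, so that cardinalities can be compared by
-- `unique-⊆` and moved along isomorphisms although `P` need not be decidable.
record Card {V : Set} (P : V → Set) (k : ℕ) : Set where
  constructor card
  field
    elems    : List V
    uniq     : Unique elems
    sound    : ∀ {v} → v ∈ elems → P v
    complete : ∀ {v} → P v → v ∈ elems
    len      : length elems ≡ k

open Card

module _ {V : Set} where

  unique⇒∉ : ∀ {x : V} {xs} → Unique (x ∷ xs) → x ∉ xs
  unique⇒∉ = Unique.Unique[x∷xs]⇒x∉xs

  ∈-remove : ∀ {x y : V} as {bs} → y ∈ as ++ x ∷ bs → y ≢ x → y ∈ as ++ bs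
  ∈-remove []       (here p)  n = ⊥-elim (n p)
  ∈-remove []       (there p) n = p
  ∈-remove (a ∷ as) (here p)  n = here p
  ∈-remove (a ∷ as) (there p) n = there (∈-remove as p n)

  ∈-insert : ∀ {x y : V} as {bs} → y ∈ as ++ bs → y ∈ as ++ x ∷ bs
  ∈-insert []       p         = there p
  ∈-insert (a ∷ as) (here p)  = here p
  ∈-insert (a ∷ as) (there p) = there (∈-insert as p)

  length-remove : ∀ {x : V} as {bs} → length (as ++ x ∷ bs) ≡ suc (length (as ++ bs))
  length-remove []       = refl
  length-remove (a ∷ as) = cong suc (length-remove as)

  unique-remove : ∀ {x : V} as {bs} → Unique (as ++ x ∷ bs) → Unique (as ++ bs) × x ∉ as ++ bs
  unique-remove []       u@(_ ∷ us) = us , unique⇒∉ u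
  unique-remove {x} (a ∷ as) (h ∷ us) with unique-remove as us
  ... | us′ , x∉ = (All.tabulate (λ y∈ → All.lookup h (∈-insert as y∈)) ∷ us′) , go
    where
    go : x ∉ a ∷ as ++ _
    go (here refl) = All.lookup h (∈.∈-++⁺ʳ as (here refl)) refl
    go (there p)   = x∉ p

  unique-⊆ : ∀ {xs ys : List V} → Unique xs → (∀ {v} → v ∈ xs → v ∈ ys) → length xs ≤ length ys
  unique-⊆ {[]}     _ _ = z≤n
  unique-⊆ {x ∷ xs} u@(_ ∷ us) sub with ∈.∈-∃++ (sub (here refl))
  ... | as , bs , refl = subst (suc (length xs) ≤_) (sym (length-remove as))
    (s≤s (unique-⊆ us λ v∈ → ∈-remove as (sub (there v∈)) λ { refl → unique⇒∉ u v∈ }))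

  card-≤ : ∀ {P Q : V → Set} {k l} → (∀ {v} → P v → Q v) → Card P k → Card Q l → k ≤ l
  card-≤ f c d = subst₂ _≤_ (len c) (len d) (unique-⊆ (uniq c) (complete d ∘ f ∘ sound c))

  card-unique : ∀ {P : V → Set} {k l} → Card P k → Card P l → k ≡ l
  card-unique c d = ℕ.≤-antisym (card-≤ id c d) (card-≤ id d c)

  card-≐ : ∀ {P Q : V → Set} {k} → (∀ {v} → P v → Q v) → (∀ {v} → Q v → P v) → Card P k → Card Q k
  card-≐ f g (card xs u s c l) = card xs u (f ∘ s) (c ∘ g) l

  card-del : ∀ {P : V → Set} {k v} → P v → Card P (suc k) → Card (λ w → P w × w ≢ v) k
  card-del {v = v} pv (card xs u s c l) with ∈.∈-∃++ (c pv)
  ... | as , bs , refl with unique-remove as u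
  ...   | us , v∉ = card (as ++ bs) us (λ p → s (∈-insert as p) , λ { refl → v∉ p })
                      (λ { (p , n) → ∈-remove as (c p) n }) (ℕ.suc-injective (trans (sym (length-remove as)) l))

  card-add : ∀ {P : V → Set} {k v} → ¬ P v → Card P k → Card (λ w → P w ⊎ w ≡ v) (suc k)
  card-add {v = v} ¬p (card xs u s c l) = card (v ∷ xs)
    (All.tabulate (λ { w∈ refl → ¬p (s w∈) }) ∷ u)
    (λ { (here p) → inj₂ p ; (there p) → inj₁ (s p) })
    (λ { (inj₁ p) → there (c p) ; (inj₂ p) → here p }) (cong suc l)

card-iso : ∀ {V W : Set} {E : Rel V} {F : Rel W} (φ : E ≅ F) {P : V → Set} {Q : W → Set} {k} →
           (∀ {v} → P v → Q (to φ v)) → (∀ {w} → Q w → P (from φ w)) → Card P k → Card Q k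
card-iso φ {Q = Q} f g (card xs u s c l) = card (map (to φ) xs) (Unique.map⁺ (to-inj φ) u)
  (λ p → let w , w∈ , eq = ∈.∈-map⁻ (to φ) p in subst Q (sym eq) (f (s w∈)))
  (λ q → subst (_∈ _) (to-from φ _) (∈.∈-map⁺ (to φ) (c (g q))))
  (trans (List.length-map (to φ) xs) l)

Deg : {V : Set} → Rel V → V → ℕ → Set
Deg E v k = Card (E v) k

deg-iso : ∀ {V W : Set} {E : Rel V} {F : Rel W} (φ : E ≅ F) {v k} → Deg E v k → Deg F (to φ v) k
deg-iso {E = E} φ {v} = card-iso φ (pres φ) (λ f → subst (λ t → E t _) (from-to φ v) (back φ f))

module _ {V : Set} (E : Rel V) where

  deg-del : ∀ {a b k} → a ≢ b → E a b → Deg E a (suc k) → Deg (Del E a b) a k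
  deg-del a≢b e d = card-≐
    (λ { (h , n) → h , λ { (inj₁ (_ , p)) → n p ; (inj₂ (p , _)) → a≢b p } })
    (λ { (h , n) → h , λ p → n (inj₁ (refl , p)) }) (card-del e d)

  deg-delʳ : ∀ {a b k} → a ≢ b → E b a → Deg E b (suc k) → Deg (Del E a b) b k
  deg-delʳ a≢b e d = card-≐
    (λ { (h , n) → h , λ { (inj₂ (_ , p)) → n p ; (inj₁ (p , _)) → a≢b (sym p) } })
    (λ { (h , n) → h , λ p → n (inj₂ (refl , p)) }) (card-del e d)

  deg-del-off : ∀ {a b u k} → u ≢ a → u ≢ b → Deg E u k → Deg (Del E a b) u k
  deg-del-off p q = card-≐ (λ h → h , off p q) proj₁

  deg-add : ∀ {a b k} → a ≢ b → ¬ E a b → Deg E a k → Deg (Add E a b) a (suc k)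
  deg-add a≢b ¬e d = card-≐
    (λ { (inj₁ h) → inj₁ h ; (inj₂ p) → inj₂ (inj₁ (refl , p)) })
    (λ { (inj₁ h) → inj₁ h ; (inj₂ (inj₁ (_ , p))) → inj₂ p ; (inj₂ (inj₂ (p , _))) → ⊥-elim (a≢b p) })
    (card-add ¬e d)

  deg-addʳ : ∀ {a b k} → a ≢ b → ¬ E b a → Deg E b k → Deg (Add E a b) b (suc k)
  deg-addʳ a≢b ¬e d = card-≐
    (λ { (inj₁ h) → inj₁ h ; (inj₂ p) → inj₂ (inj₂ (refl , p)) })
    (λ { (inj₁ h) → inj₁ h ; (inj₂ (inj₂ (_ , p))) → inj₂ p ; (inj₂ (inj₁ (p , _))) → ⊥-elim (a≢b (sym p)) })
    (card-add ¬e d)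

  deg-add-off : ∀ {a b u k} → u ≢ a → u ≢ b → Deg E u k → Deg (Add E a b) u k
  deg-add-off p q = card-≐ inj₁ (λ { (inj₁ h) → h ; (inj₂ s) → ⊥-elim (off p q s) })

-- Colourings constant along edges replace walks: a part of the graph is cut off when such a
-- colouring distinguishes it, and two vertices count as joined when all such colourings agree on
-- them.
Closed : {V : Set} → Rel V → (V → Bool) → Set
Closed E c = ∀ {u v} → E u v → c u ≡ c v

closed-iso : ∀ {V W : Set} {E : Rel V} {F : Rel W} (φ : E ≅ F) {c} → Closed E c → Closed F (c ∘ from φ)
closed-iso φ h f = h (back φ f)


-- The double-broom: vertices, named edges, neighbours and reflection.

-- The path of the broom has p = 2 + q vertices pv 0 , … , pv (1 + q).
data V (m n q : ℕ) : Set where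
  pv : (i : ℕ) → .(i ≤ suc q) → V m n q
  lv : Fin m → V m n q
  rv : Fin n → V m n q

data GEdge (m n q : ℕ) : Set where
  pE : (i : ℕ) → .(i ≤ q) → GEdge m n q
  lE : Fin m → GEdge m n q
  rE : Fin n → GEdge m n q

-- Each edge has a name, and both orientations are links of that name. Deleting an edge then amounts
-- to avoiding one name (`D-link`, `D-link⁻`), and common decards can be charged to names.
data Link {m n q : ℕ} : GEdge m n q → Rel (V m n q) where
  p→ : ∀ {i} .{h h₁ h₂} → Link (pE i h) (pv i h₁) (pv (suc i) h₂)
  p← : ∀ {i} .{h h₁ h₂} → Link (pE i h) (pv (suc i) h₂) (pv i h₁)
  l→ : ∀ {a} .{h} → Link (lE a) (pv 0 h) (lv a)
  l← : ∀ {a} .{h} → Link (lE a) (lv a) (pv 0 h)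
  r→ : ∀ {b} .{h} → Link (rE b) (pv (suc q) h) (rv b)
  r← : ∀ {b} .{h} → Link (rE b) (rv b) (pv (suc q) h)

-- The bounds on path indices are irrelevant arguments, so equality of the indices is enough;
-- `recompute` recovers a bound where arithmetic needs it.
pv-cong : ∀ {m n q i j} .{h : i ≤ suc q} .{h′ : j ≤ suc q} → i ≡ j → pv {m} {n} i h ≡ pv j h′
pv-cong refl = refl

pE-cong : ∀ {m n q i j} .{h : i ≤ q} .{h′ : j ≤ q} → i ≡ j → pE {m} {n} i h ≡ pE j h′
pE-cong refl = refl

module _ {m n q : ℕ} where

  A B : V m n q
  A = pv 0 z≤n
  B = pv (suc q) ℕ.≤-refl

  G : Rel (V m n q)
  G u v = ∃ λ e → Link e u v

  src tgt : GEdge m n q → V m n q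
  src (pE i h) = pv i (ℕ.m≤n⇒m≤1+n h)
  src (lE a)   = A
  src (rE b)   = B
  tgt (pE i h) = pv (suc i) (s≤s h)
  tgt (lE a)   = lv a
  tgt (rE b)   = rv b

  -- The same relation as `Del G (src e) (tgt e)` (see `D≅Del`); being a record, it keeps the edge
  -- `e` visible to unification.
  record D (e : GEdge m n q) (u v : V m n q) : Set where
    constructor _,_
    field
      edgeᴳ : G u v
      other : ¬ Same (src e) (tgt e) u v

  pv-inj : ∀ {i j} .{h h′} → pv {m} {n} {q} i h ≡ pv j h′ → i ≡ j
  pv-inj refl = refl

  lv-inj : ∀ {a b} → lv {m} {n} {q} a ≡ lv b → a ≡ b
  lv-inj refl = refl

  rv-inj : ∀ {a b} → rv {m} {n} {q} a ≡ rv b → a ≡ b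
  rv-inj refl = refl

  pE-inj : ∀ {i j} .{h h′} → pE {m} {n} {q} i h ≡ pE j h′ → i ≡ j
  pE-inj refl = refl

  infix 4 _≟_ _≟ᴱ_

  _≟_ : DecidableEquality (V m n q)
  pv i _ ≟ pv j _ with i ℕ.≟ j
  ... | yes p = yes (pv-cong p)
  ... | no p  = no (p ∘ pv-inj)
  lv a ≟ lv b with a Fin.≟ b
  ... | yes p = yes (cong lv p)
  ... | no p  = no (p ∘ lv-inj)
  rv a ≟ rv b with a Fin.≟ b
  ... | yes p = yes (cong rv p)
  ... | no p  = no (p ∘ rv-inj)
  pv _ _ ≟ lv _ = no λ ()
  pv _ _ ≟ rv _ = no λ ()
  lv _ ≟ pv _ _ = no λ ()
  lv _ ≟ rv _ = no λ ()
  rv _ ≟ pv _ _ = no λ ()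
  rv _ ≟ lv _ = no λ ()

  _≟ᴱ_ : DecidableEquality (GEdge m n q)
  pE i _ ≟ᴱ pE j _ with i ℕ.≟ j
  ... | yes p = yes (pE-cong p)
  ... | no p  = no (p ∘ pE-inj)
  lE a ≟ᴱ lE b with a Fin.≟ b
  ... | yes p = yes (cong lE p)
  ... | no p  = no λ { refl → p refl }
  rE a ≟ᴱ rE b with a Fin.≟ b
  ... | yes p = yes (cong rE p)
  ... | no p  = no λ { refl → p refl }
  pE _ _ ≟ᴱ lE _ = no λ ()
  pE _ _ ≟ᴱ rE _ = no λ ()
  lE _ ≟ᴱ pE _ _ = no λ ()
  lE _ ≟ᴱ rE _ = no λ ()
  rE _ ≟ᴱ pE _ _ = no λ ()
  rE _ ≟ᴱ lE _ = no λ ()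

  link-symm : ∀ {e : GEdge m n q} {u v} → Link e u v → Link e v u
  link-symm p→ = p←
  link-symm p← = p→
  link-symm l→ = l←
  link-symm l← = l→
  link-symm r→ = r←
  link-symm r← = r→

  G-symm : Symm G
  G-symm (e , l) = e , link-symm l

  G-irr : Irr G
  G-irr (_ , p→) ()
  G-irr (_ , p←) ()
  G-irr (_ , l→) ()
  G-irr (_ , l←) ()
  G-irr (_ , r→) ()
  G-irr (_ , r←) ()

  link : ∀ e → Link e (src e) (tgt e)
  link (pE i h) = p→
  link (lE a) = l→
  link (rE b) = r→

  link⇒same : ∀ {e u v} → Link e u v → Same (src e) (tgt e) u v
  link⇒same p→ = inj₁ (refl , refl)
  link⇒same p← = inj₂ (refl , refl)
  link⇒same l→ = inj₁ (refl , refl)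
  link⇒same l← = inj₂ (refl , refl)
  link⇒same r→ = inj₁ (refl , refl)
  link⇒same r← = inj₂ (refl , refl)

  same⇒link : ∀ {e u v} → Same (src e) (tgt e) u v → Link e u v
  same⇒link {e} (inj₁ (refl , refl)) = link e
  same⇒link {e} (inj₂ (refl , refl)) = link-symm (link e)

  link-unique : ∀ {e e′ : GEdge m n q} {u v} → Link e u v → Link e′ u v → e ≡ e′
  link-unique p→ p→ = refl
  link-unique p← p← = refl
  link-unique l→ l→ = refl
  link-unique l← l← = refl
  link-unique r→ r→ = refl
  link-unique r← r← = refl

  D-link : ∀ {e e′ u v} → e′ ≢ e → Link e′ u v → D e u v
  D-link ne l = (_ , l) , λ s → ne (link-unique l (same⇒link s))

  D-link⁻ : ∀ {e u v} → D e u v → ∃ λ e′ → e′ ≢ e × Link e′ u v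
  D-link⁻ {e} ((e′ , l) , n) = e′ , (λ { refl → n (link⇒same l) }) , l

  D-symm : ∀ {e} → Symm (D e)
  D-symm (g , n) = G-symm g , n ∘ same-swap

  D-irr : ∀ {e} → Irr (D e)
  D-irr (g , _) = G-irr g

  G? : ∀ u v → Dec (G u v)
  G? (pv i hi) (pv j hj) with j ℕ.≟ suc i | i ℕ.≟ suc j
  ... | yes refl | _ = yes (pE i (ℕ.≤-pred hj) , p→)
  ... | no _ | yes refl = yes (pE j (ℕ.≤-pred hi) , p←)
  ... | no p | no p′ = no λ { (_ , p→) → p refl ; (_ , p←) → p′ refl }
  G? (pv zero _) (lv a) = yes (_ , l→)
  G? (pv (suc i) _) (lv a) = no λ ()
  G? (lv a) (pv zero _) = yes (_ , l←)
  G? (lv a) (pv (suc i) _) = no λ ()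
  G? (pv i _) (rv b) with i ℕ.≟ suc q
  ... | yes refl = yes (_ , r→)
  ... | no p = no λ { (_ , r→) → p refl }
  G? (rv b) (pv i _) with i ℕ.≟ suc q
  ... | yes refl = yes (_ , r←)
  ... | no p = no λ { (_ , r←) → p refl }
  G? (lv _) (lv _) = no λ ()
  G? (lv _) (rv _) = no λ ()
  G? (rv _) (lv _) = no λ ()
  G? (rv _) (rv _) = no λ ()

  nbr-lv : ∀ {a w} → G (lv a) w → w ≡ A
  nbr-lv (_ , l←) = refl

  nbr-rv : ∀ {b w} → G (rv b) w → w ≡ B
  nbr-rv (_ , r←) = refl

  nbr-int : ∀ {i w} .{h} → i ≢ q → G (pv (suc i) h) w →
            w ≡ pv i (ℕ.<⇒≤ h) ⊎ Σ (suc i ≤ q) λ h′ → w ≡ pv (suc (suc i)) (s≤s h′)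
  nbr-int i≢q (pE _ h , p→) = inj₂ (recompute (_ ℕ.≤? q) h , refl)
  nbr-int i≢q (_ , p←) = inj₁ refl
  nbr-int i≢q (_ , r→) = ⊥-elim (i≢q refl)

  hub : ∀ {v w₁ w₂ w₃} → G v w₁ → G v w₂ → G v w₃ → w₁ ≢ w₂ → w₁ ≢ w₃ → w₂ ≢ w₃ → v ≡ A ⊎ v ≡ B
  hub {pv zero _} _ _ _ _ _ _ = inj₁ refl
  hub {pv (suc i) h} g₁ g₂ g₃ n₁ n₂ n₃ with i ℕ.≟ q
  ... | yes refl = inj₂ refl
  ... | no i≢q with nbr-int i≢q g₁ | nbr-int i≢q g₂ | nbr-int i≢q g₃
  ...   | inj₁ refl | inj₁ refl | _ = ⊥-elim (n₁ refl)
  ...   | inj₂ (_ , refl) | inj₂ (_ , refl) | _ = ⊥-elim (n₁ refl)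
  ...   | inj₁ refl | _ | inj₁ refl = ⊥-elim (n₂ refl)
  ...   | inj₂ (_ , refl) | _ | inj₂ (_ , refl) = ⊥-elim (n₂ refl)
  ...   | _ | inj₁ refl | inj₁ refl = ⊥-elim (n₃ refl)
  ...   | _ | inj₂ (_ , refl) | inj₂ (_ , refl) = ⊥-elim (n₃ refl)
  hub {lv a} g₁ g₂ _ n₁ _ _ = ⊥-elim (n₁ (trans (nbr-lv g₁) (sym (nbr-lv g₂))))
  hub {rv a} g₁ g₂ _ n₁ _ _ = ⊥-elim (n₁ (trans (nbr-rv g₁) (sym (nbr-rv g₂))))

  inner-A : ∀ {w z} → G A w → G w z → z ≢ A → w ≡ pv 1 (s≤s z≤n)
  inner-A (_ , p→) _ _ = refl
  inner-A (_ , l→) g n = ⊥-elim (n (nbr-lv g))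

  inner-B : ∀ {w z} → G B w → G w z → z ≢ B → w ≡ pv q (ℕ.n≤1+n q)
  inner-B (pE i h , p→) _ _ = ⊥-elim (ℕ.1+n≰n (recompute (_ ℕ.≤? q) h))
  inner-B (_ , p←) _ _ = refl
  inner-B (_ , r→) g n = ⊥-elim (n (nbr-rv g))

  -- Each hub has only one neighbour that is not a leaf, the next vertex on the path (`inner-A`,
  -- `inner-B`). The configuration only asks for edges to be present, so it is absent from every G -
  -- e as well; most upper bounds rest on this obstruction.
  bushy : ∀ {v w₁ w₂ w₃ z₁ z₂} → G v w₁ → G v w₂ → G v w₃ → w₁ ≢ w₂ → w₁ ≢ w₃ → w₂ ≢ w₃ →
          G w₁ z₁ → z₁ ≢ v → G w₂ z₂ → z₂ ≢ v → ⊥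
  bushy g₁ g₂ g₃ n₁₂ n₁₃ n₂₃ h₁ k₁ h₂ k₂ with hub g₁ g₂ g₃ n₁₂ n₁₃ n₂₃
  ... | inj₁ refl = n₁₂ (trans (inner-A g₁ h₁ k₁) (sym (inner-A g₂ h₂ k₂)))
  ... | inj₂ refl = n₁₂ (trans (inner-B g₁ h₁ k₁) (sym (inner-B g₂ h₂ k₂)))

  deg-A : Deg G A (suc m)
  deg-A = card (pv 1 (s≤s z≤n) ∷ map lv (allFin m))
    (All.tabulate (λ { p refl → case p }) ∷ Unique.map⁺ lv-inj (Unique.allFin⁺ m))
    (λ { (here refl) → pE 0 z≤n , p→ ; (there p) → leaf p })
    (λ { (_ , p→) → here refl ; (_ , l→) → there (∈.∈-map⁺ lv (∈.∈-allFin _)) })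
    (cong suc (trans (List.length-map lv (allFin m)) (List.length-tabulate id)))
    where
    case : ∀ {i} .{h} → pv {m} {n} {q} i h ∉ map lv (allFin m)
    case p with ∈.∈-map⁻ lv p
    ... | _ , _ , ()
    leaf : ∀ {v} → v ∈ map lv (allFin m) → G A v
    leaf p with ∈.∈-map⁻ lv p
    ... | _ , _ , refl = _ , l→

  deg-B : Deg G B (suc n)
  deg-B = card (pv q (ℕ.n≤1+n q) ∷ map rv (allFin n))
    (All.tabulate (λ { p refl → case p }) ∷ Unique.map⁺ rv-inj (Unique.allFin⁺ n))
    (λ { (here refl) → pE q ℕ.≤-refl , p← ; (there p) → leaf p })
    (λ { (pE i h , p→) → ⊥-elim (ℕ.1+n≰n (recompute (_ ℕ.≤? q) h)) ; (_ , p←) → here refl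
       ; (_ , r→) → there (∈.∈-map⁺ rv (∈.∈-allFin _)) })
    (cong suc (trans (List.length-map rv (allFin n)) (List.length-tabulate id)))
    where
    case : ∀ {i} .{h} → pv {m} {n} {q} i h ∉ map rv (allFin n)
    case p with ∈.∈-map⁻ rv p
    ... | _ , _ , ()
    leaf : ∀ {v} → v ∈ map rv (allFin n) → G B v
    leaf p with ∈.∈-map⁻ rv p
    ... | _ , _ , refl = _ , r→

  deg-int : ∀ {i} (h : i < q) → Deg G (pv (suc i) (ℕ.m≤n⇒m≤1+n h)) 2
  deg-int {i} h = card (pv i (ℕ.≤-trans (ℕ.n≤1+n i) (ℕ.m≤n⇒m≤1+n h)) ∷ pv (suc (suc i)) (s≤s h) ∷ [])
    (((λ ()) ∷ []) ∷ [] ∷ [])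
    (λ { (here refl) → pE i (ℕ.<⇒≤ h) , p← ; (there (here refl)) → pE (suc i) h , p→ })
    (λ g → case (nbr-int (λ { refl → ℕ.<-irrefl refl h }) g)) refl
    where
    case : ∀ {w x y : V m n q} → w ≡ x ⊎ Σ (suc i ≤ q) (λ h′ → w ≡ y) → w ∈ x ∷ y ∷ []
    case (inj₁ p) = here p
    case (inj₂ (_ , p)) = there (here p)

  deg-l : ∀ a → Deg G (lv a) 1
  deg-l a = card (A ∷ []) ([] ∷ []) (λ { (here refl) → _ , l← }) (λ g → here (nbr-lv g)) refl

  deg-r : ∀ b → Deg G (rv b) 1
  deg-r b = card (B ∷ []) ([] ∷ []) (λ { (here refl) → _ , r← }) (λ g → here (nbr-rv g)) refl

ρ : ∀ {m n q} → V m n q → V n m q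
ρ {q = q} (pv i _) = pv (suc q ∸ i) (ℕ.m∸n≤m (suc q) i)
ρ (lv a) = rv a
ρ (rv b) = lv b

ρᴱ : ∀ {m n q} → GEdge m n q → GEdge n m q
ρᴱ {q = q} (pE i _) = pE (q ∸ i) (ℕ.m∸n≤m q i)
ρᴱ (lE a) = rE a
ρᴱ (rE b) = lE b

ρ-invol : ∀ {m n q} (v : V m n q) → ρ (ρ v) ≡ v
ρ-invol {q = q} (pv i h) = pv-cong (ℕ.m∸[m∸n]≡n (recompute (i ℕ.≤? suc q) h))
ρ-invol (lv a) = refl
ρ-invol (rv b) = refl

ρᴱ-invol : ∀ {m n q} (e : GEdge m n q) → ρᴱ (ρᴱ e) ≡ e
ρᴱ-invol {q = q} (pE i h) = pE-cong (ℕ.m∸[m∸n]≡n (recompute (i ℕ.≤? q) h))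
ρᴱ-invol (lE a) = refl
ρᴱ-invol (rE b) = refl

link-resp : ∀ {m n q} {e : GEdge m n q} {u u′ v v′} → u ≡ u′ → v ≡ v′ → Link e u v → Link e u′ v′
link-resp refl refl l = l

ρ-link : ∀ {m n q} {e : GEdge m n q} {u v} → Link e u v → Link (ρᴱ e) (ρ u) (ρ v)
ρ-link {q = q} (p→ {i} {h}) = link-resp {v = pv (q ∸ i) (ℕ.m≤n⇒m≤1+n (ℕ.m∸n≤m q i))}
  (pv-cong (sym (ℕ.+-∸-assoc 1 (recompute (i ℕ.≤? q) h)))) refl (p← {h₂ = s≤s (ℕ.m∸n≤m q i)})
ρ-link {q = q} (p← {i} {h}) = link-resp {u = pv (q ∸ i) (ℕ.m≤n⇒m≤1+n (ℕ.m∸n≤m q i))} refl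
  (pv-cong (sym (ℕ.+-∸-assoc 1 (recompute (i ℕ.≤? q) h)))) (p→ {h₂ = s≤s (ℕ.m∸n≤m q i)})
ρ-link l→ = r→
ρ-link l← = r←
ρ-link {q = q} r→ = link-resp {u = A} (pv-cong (sym (ℕ.n∸n≡0 q))) refl l→
ρ-link {q = q} r← = link-resp {v = A} refl (pv-cong (sym (ℕ.n∸n≡0 q))) l←

ρ-iso : ∀ {m n q} → G {m} {n} {q} ≅ G {n} {m} {q}
ρ-iso = mkIso ρ ρ ρ-invol ρ-invol (λ { (e , l) → ρᴱ e , ρ-link l }) (λ { (e , l) → ρᴱ e , ρ-link l })

D≅Del : ∀ {m n q} (e : GEdge m n q) → D e ≅ Del G (src e) (tgt e)
D≅Del e = ≅-id (λ { (g , n) → g , n }) (λ { (g , n) → g , n })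

ρ-D : ∀ {m n q} (e : GEdge m n q) → D e ≅ D (ρᴱ e)
ρ-D e = ≅-trans (D≅Del e) (≅-trans (≅-del ρ-iso (src e) (tgt e))
  (≅-trans (del-same (same-sym (link⇒same (ρ-link (link e))))) (≅-sym (D≅Del (ρᴱ e)))))

-- Components and hub degrees of G - e.

bool-case : (b : Bool) → b ≡ true ⊎ b ≡ false
bool-case true  = inj₁ refl
bool-case false = inj₂ refl

card-∅ : ∀ {V : Set} {P : V → Set} {k} → (∀ v → ¬ P v) → Card P k → k ≡ 0
card-∅ n (card [] _ _ _ l) = sym l
card-∅ n (card (x ∷ xs) _ s _ _) = ⊥-elim (n x (s (here refl)))

card-one : ∀ {V : Set} {P : V → Set} v → P v → (∀ {w} → P w → w ≡ v) → Card P 1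
card-one v p f = card (v ∷ []) ([] ∷ []) (λ { (here refl) → p }) (λ q → here (f q)) refl

module _ {m n q : ℕ} where

  D⇒G : ∀ {e : GEdge m n q} {u v} → D e u v → G u v
  D⇒G (g , _) = g

  deg-D : ∀ {e : GEdge m n q} {v k} → Deg (Del G (src e) (tgt e)) v k → Deg (D e) v k
  deg-D = card-≐ (λ { (g , n) → g , n }) (λ { (g , n) → g , n })

  -- The side of the path edge i containing A.
  side : ℕ → V m n q → Bool
  side i (pv j _) with j ℕ.≤? i
  ... | yes _ = true
  ... | no _  = false
  side i (lv a) = true
  side i (rv b) = false

  side-≤ : ∀ {i j} .{h} → j ≤ i → side i (pv j h) ≡ true
  side-≤ {i} {j} p with j ℕ.≤? i
  ... | yes _ = refl
  ... | no n  = ⊥-elim (n p)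

  side-> : ∀ {i j} .{h} → i < j → side i (pv j h) ≡ false
  side-> {i} {j} p with j ℕ.≤? i
  ... | yes r = ⊥-elim (ℕ.<⇒≱ p r)
  ... | no _  = refl

  side-true : ∀ {i j} .{h} → side i (pv j h) ≡ true → j ≤ i
  side-true {i} {j} p with j ℕ.≤? i | p
  ... | yes r | _ = r
  ... | no _  | ()

  side-false : ∀ {i j} .{h} → side i (pv j h) ≡ false → i < j
  side-false {i} {j} p with j ℕ.≤? i | p
  ... | yes r | ()
  ... | no r  | _ = ℕ.≰⇒> r

  module _ {i : ℕ} .{h : i ≤ q} where

    side-A : side i A ≡ true
    side-A = refl

    side-B : side i B ≡ false
    side-B = side-> {h = ℕ.≤-refl} (s≤s (recompute (i ℕ.≤? q) h))

    side-closed : Closed (D (pE i h)) (side i)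
    side-closed d with D-link⁻ d
    ... | _ , ne , p→ {j} = go j (λ { refl → ne refl })
      where
      go : ∀ j → j ≢ i → ∀ .{h₁ h₂} → side i (pv j h₁) ≡ side i (pv (suc j) h₂)
      go j j≢i with ℕ.<-cmp j i
      ... | tri< j<i _ _ = trans (side-≤ (ℕ.<⇒≤ j<i)) (sym (side-≤ j<i))
      ... | tri≈ _ p _   = ⊥-elim (j≢i p)
      ... | tri> _ _ i<j = trans (side-> i<j) (sym (side-> (ℕ.m≤n⇒m≤1+n i<j)))
    ... | _ , ne , p← {j} = go j (λ { refl → ne refl })
      where
      go : ∀ j → j ≢ i → ∀ .{h₁ h₂} → side i (pv (suc j) h₁) ≡ side i (pv j h₂)
      go j j≢i with ℕ.<-cmp j i
      ... | tri< j<i _ _ = trans (side-≤ j<i) (sym (side-≤ (ℕ.<⇒≤ j<i)))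
      ... | tri≈ _ p _   = ⊥-elim (j≢i p)
      ... | tri> _ _ i<j = trans (side-> (ℕ.m≤n⇒m≤1+n i<j)) (sym (side-> i<j))
    ... | _ , ne , l→ = side-A
    ... | _ , ne , l← = sym side-A
    ... | _ , ne , r→ = side-B
    ... | _ , ne , r← = sym side-B

    module _ {c : V m n q → Bool} (cl : Closed (D (pE i h)) c) where

      left-path : ∀ j → .(g : j ≤ suc q) → j ≤ i → c (pv j g) ≡ c A
      left-path zero    g p = refl
      left-path (suc j) g p = trans
        (cl (D-link {e′ = pE j (ℕ.≤-pred g)} (λ { refl → ℕ.1+n≰n p }) p←))
        (left-path j (ℕ.<⇒≤ g) (ℕ.<⇒≤ p))

      right-path : ∀ d j → .(g : j ≤ suc q) → j + d ≡ suc q → i < j → c (pv j g) ≡ c B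
      right-path zero j g p i<j = cong c (pv-cong (trans (sym (ℕ.+-identityʳ j)) p))
      right-path (suc d) j g p i<j = trans
        (cl (D-link {e′ = pE j (ℕ.≤-pred g′)} (λ { refl → ℕ.1+n≰n i<j }) p→))
        (right-path d (suc j) g′ (trans (sym (ℕ.+-suc j d)) p) (ℕ.m≤n⇒m≤1+n i<j))
        where
        g′ : suc j ≤ suc q
        g′ = ℕ.m+n≤o⇒m≤o (suc j) (ℕ.≤-reflexive (trans (sym (ℕ.+-suc j d)) p))

      -- In G - e every vertex is still joined along the path to `A` or to `B`, according to its
      -- side; `right-path` recurses on the distance to `B`.
      two-colours : ∀ v → c v ≡ (if side i v then c A else c B)
      two-colours (pv j g) with j ℕ.≤? i
      ... | yes p = left-path j g p
      ... | no p  = right-path (suc q ∸ j) j g (ℕ.m+[n∸m]≡n (recompute (j ℕ.≤? suc q) g)) (ℕ.≰⇒> p)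
      two-colours (lv a) = cl (D-link (λ ()) l←)
      two-colours (rv b) = cl (D-link (λ ()) r←)

  one-colourˡ : ∀ {a} {c : V m n q → Bool} → Closed (D (lE a)) c → ∀ v → v ≢ lv a → c v ≡ c A
  one-colourˡ {a} {c} cl = go
    where
    path : ∀ j → .(g : j ≤ suc q) → c (pv j g) ≡ c A
    path zero g = refl
    path (suc j) g = trans (cl (D-link {e′ = pE j (ℕ.≤-pred g)} (λ ()) p←)) (path j (ℕ.<⇒≤ g))
    go : ∀ v → v ≢ lv a → c v ≡ c A
    go (pv j g) _ = path j g
    go (lv a′) ne = cl (D-link {e′ = lE a′} (λ { refl → ne refl }) l←)
    go (rv b) _   = trans (cl (D-link {e′ = rE b} (λ ()) r←)) (path (suc q) ℕ.≤-refl)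

  one-colourʳ : ∀ {b} {c : V m n q → Bool} → Closed (D (rE b)) c → ∀ v → v ≢ rv b → c v ≡ c A
  one-colourʳ {b} {c} cl = go
    where
    path : ∀ j → .(g : j ≤ suc q) → c (pv j g) ≡ c A
    path zero g = refl
    path (suc j) g = trans (cl (D-link {e′ = pE j (ℕ.≤-pred g)} (λ ()) p←)) (path j (ℕ.<⇒≤ g))
    go : ∀ v → v ≢ rv b → c v ≡ c A
    go (pv j g) _ = path j g
    go (lv a) _   = cl (D-link {e′ = lE a} (λ ()) l←)
    go (rv b′) ne = trans (cl (D-link {e′ = rE b′} (λ { refl → ne refl }) r←)) (path (suc q) ℕ.≤-refl)

  pathTo : (i : ℕ) → .(i ≤ suc q) → List (V m n q)
  pathTo zero    h = A ∷ []
  pathTo (suc i) h = pv (suc i) h ∷ pathTo i (ℕ.<⇒≤ h)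

  pathTo-sound : ∀ i .{h} {v} → v ∈ pathTo i h → ∃ λ j → Σ (j ≤ suc q) λ g → v ≡ pv j g × j ≤ i
  pathTo-sound zero (here refl) = 0 , z≤n , refl , z≤n
  pathTo-sound (suc i) {h} (here refl) = suc i , recompute (_ ℕ.≤? _) h , refl , ℕ.≤-refl
  pathTo-sound (suc i) (there p) with pathTo-sound i p
  ... | j , g , eq , le = j , g , eq , ℕ.m≤n⇒m≤1+n le

  pathTo-complete : ∀ i .{h} {j} .{g} → j ≤ i → pv j g ∈ pathTo i h
  pathTo-complete zero z≤n = here refl
  pathTo-complete (suc i) {j = j} p with j ℕ.≟ suc i
  ... | yes refl = here refl
  ... | no ne    = there (pathTo-complete i (ℕ.≤-pred (ℕ.≤∧≢⇒< p ne)))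

  pathTo-unique : ∀ i .{h} → Unique (pathTo i h)
  pathTo-unique zero = [] ∷ []
  pathTo-unique (suc i) = All.tabulate (λ { p refl → no-top p }) ∷ pathTo-unique i
    where
    no-top : ∀ .{h h′} → pv (suc i) h ∉ pathTo i h′
    no-top p with pathTo-sound i p
    ... | _ , _ , refl , le = ℕ.1+n≰n le

  pathTo-length : ∀ i .{h} → length (pathTo i h) ≡ suc i
  pathTo-length zero = refl
  pathTo-length (suc i) = cong suc (pathTo-length i)

  side-card : ∀ {i} → i ≤ q → Card (λ v → side i v ≡ true) (m + suc i)
  side-card {i} h = card (map lv (allFin m) ++ pathTo i (ℕ.m≤n⇒m≤1+n h))
    (Unique.++⁺ (Unique.map⁺ lv-inj (Unique.allFin⁺ m)) (pathTo-unique i) disj)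
    (λ p → [ leaf , path ]′ (∈.∈-++⁻ (map lv (allFin m)) p)) comp
    (trans (List.length-++ (map lv (allFin m)))
      (cong₂ _+_ (trans (List.length-map lv (allFin m)) (List.length-tabulate id)) (pathTo-length i)))
    where
    disj : ∀ {v} → ¬ (v ∈ map lv (allFin m) × v ∈ pathTo i (ℕ.m≤n⇒m≤1+n h))
    disj (p , r) with ∈.∈-map⁻ lv p | pathTo-sound i r
    ... | _ , _ , refl | _ , _ , () , _
    leaf : ∀ {v} → v ∈ map lv (allFin m) → side i v ≡ true
    leaf p with ∈.∈-map⁻ lv p
    ... | _ , _ , refl = refl
    path : ∀ {v} → v ∈ pathTo i (ℕ.m≤n⇒m≤1+n h) → side i v ≡ true
    path p with pathTo-sound i p
    ... | _ , _ , refl , le = side-≤ le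
    comp : ∀ {v} → side i v ≡ true → v ∈ map lv (allFin m) ++ pathTo i (ℕ.m≤n⇒m≤1+n h)
    comp {pv j g} p = ∈.∈-++⁺ʳ (map lv (allFin m)) (pathTo-complete i (side-true p))
    comp {lv a} p   = ∈.∈-++⁺ˡ (∈.∈-map⁺ lv (∈.∈-allFin a))

  -- `suc k` and `suc l` make both colour classes nonempty, so by `two-colours` the colours of `A`
  -- and `B` differ and the class of `A` is its side of the cut. The size of that class determines
  -- the edge.
  closed-size-path : ∀ {i} (h : i ≤ q) {c k l} → Closed (D (pE i h)) c →
    Card (λ v → c v ≡ true) (suc k) → Card (λ v → c v ≡ false) (suc l) →
    (c A ≡ true × suc k ≡ m + suc i) ⊎ (c A ≡ false × suc l ≡ m + suc i)
  closed-size-path {i} h {c} cl ct cf with bool-case (c A) | bool-case (c B) | two-colours {h = h} cl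
  ... | inj₁ a | inj₁ b | col = ⊥-elim (ℕ.1+n≢0 (card-∅ no-false cf))
    where
    no-false : ∀ v → c v ≢ false
    no-false v p with side i v | col v
    ... | true  | e with trans (sym p) (trans e a)
    ...   | ()
    no-false v p | false | e with trans (sym p) (trans e b)
    ...   | ()
  ... | inj₂ a | inj₂ b | col = ⊥-elim (ℕ.1+n≢0 (card-∅ no-true ct))
    where
    no-true : ∀ v → c v ≢ true
    no-true v p with side i v | col v
    ... | true  | e with trans (sym p) (trans e a)
    ...   | ()
    no-true v p | false | e with trans (sym p) (trans e b)
    ...   | ()
  ... | inj₁ a | inj₂ b | col = inj₁ (a , card-unique ct (card-≐ f g (side-card h)))
    where
    f : ∀ {v} → side i v ≡ true → c v ≡ true
    f {v} p with side i v | col v | p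
    ... | true | e | _ = trans e a
    g : ∀ {v} → c v ≡ true → side i v ≡ true
    g {v} p with side i v | col v
    ... | true  | e = refl
    ... | false | e with trans (sym p) (trans e b)
    ...   | ()
  ... | inj₂ a | inj₁ b | col = inj₂ (a , card-unique cf (card-≐ f g (side-card h)))
    where
    f : ∀ {v} → side i v ≡ true → c v ≡ false
    f {v} p with side i v | col v | p
    ... | true | e | _ = trans e a
    g : ∀ {v} → c v ≡ false → side i v ≡ true
    g {v} p with side i v | col v
    ... | true  | e = refl
    ... | false | e with trans (sym p) (trans e b)
    ...   | ()

  -- Off `x` the colouring is constant, so with both classes nonempty `x` is a class of its own.
  -- This is used for leaf edges, with the cut-off leaf as `x`.
  one-size : ∀ {c : V m n q → Bool} {x k l} → (∀ v → v ≢ x → c v ≡ c A) →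
    Card (λ v → c v ≡ true) (suc k) → Card (λ v → c v ≡ false) (suc l) → k ≡ 0 ⊎ l ≡ 0
  one-size {c} {x} col ct cf with bool-case (c A) | bool-case (c x)
  ... | inj₁ a | inj₁ b = ⊥-elim (ℕ.1+n≢0 (card-∅ (λ v p → go v p) cf))
    where
    go : ∀ v → c v ≢ false
    go v p with v ≟ x
    ... | yes refl with trans (sym p) b
    ...   | ()
    go v p | no ne with trans (sym p) (trans (col v ne) a)
    ...   | ()
  ... | inj₂ a | inj₂ b = ⊥-elim (ℕ.1+n≢0 (card-∅ (λ v p → go v p) ct))
    where
    go : ∀ v → c v ≢ true
    go v p with v ≟ x
    ... | yes refl with trans (sym p) b
    ...   | ()
    go v p | no ne with trans (sym p) (trans (col v ne) a)
    ...   | ()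
  ... | inj₁ a | inj₂ b = inj₂ (ℕ.suc-injective (card-unique cf (card-one x b go)))
    where
    go : ∀ {v} → c v ≡ false → v ≡ x
    go {v} p with v ≟ x
    ... | yes r = r
    ... | no ne with trans (sym p) (trans (col v ne) a)
    ...   | ()
  ... | inj₂ a | inj₁ b = inj₁ (ℕ.suc-injective (card-unique ct (card-one x b go)))
    where
    go : ∀ {v} → c v ≡ true → v ≡ x
    go {v} p with v ≟ x
    ... | yes r = r
    ... | no ne with trans (sym p) (trans (col v ne) a)
    ...   | ()

  -- The degrees of `A` and `B` left by each edge. The case `q = 0` stands apart (`h00`) because
  -- there the only path edge joins the hubs and lowers both degrees.
  data HubDeg : GEdge m n q → ℕ → ℕ → Set where
    hl  : ∀ {a} → HubDeg (lE a) m (suc n)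
    hr  : ∀ {b} → HubDeg (rE b) (suc m) n
    h00 : ∀ .{h} → q ≡ 0 → HubDeg (pE 0 h) m n
    h0  : ∀ .{h} → q ≢ 0 → HubDeg (pE 0 h) m (suc n)
    hq  : ∀ {i} .{h} → suc i ≡ q → HubDeg (pE (suc i) h) (suc m) n
    hi  : ∀ {i} .{h} → suc i < q → HubDeg (pE (suc i) h) (suc m) (suc n)

  degD-src : ∀ (e : GEdge m n q) {k} → Deg G (src e) (suc k) → Deg (D e) (src e) k
  degD-src e d = deg-D {e} (deg-del G (G-irr (_ , link e)) (_ , link e) d)

  degD-tgt : ∀ (e : GEdge m n q) {k} → Deg G (tgt e) (suc k) → Deg (D e) (tgt e) k
  degD-tgt e d = deg-D {e} (deg-delʳ G (G-irr (_ , link e)) (_ , link-symm (link e)) d)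

  degD-off : ∀ (e : GEdge m n q) {v k} → v ≢ src e → v ≢ tgt e → Deg G v k → Deg (D e) v k
  degD-off e p r d = deg-D {e} (deg-del-off G p r d)

  hub-deg : ∀ e → ∃ λ a → ∃ λ b → HubDeg e a b × Deg (D e) A a × Deg (D e) B b
  hub-deg (lE a) = _ , _ , hl , degD-src (lE a) deg-A , degD-off (lE a) (λ ()) (λ ()) deg-B
  hub-deg (rE b) = _ , _ , hr , degD-off (rE b) (λ ()) (λ ()) deg-A , degD-src (rE b) deg-B
  hub-deg (pE zero h) with q ℕ.≟ 0
  ... | yes refl = _ , _ , h00 refl , degD-src (pE 0 h) deg-A , degD-tgt (pE 0 h) deg-B
  ... | no ne    = _ , _ , h0 ne , degD-src (pE 0 h) deg-A
                 , degD-off (pE 0 h) (λ ()) (λ p → ne (ℕ.suc-injective (pv-inj p))) deg-B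
  hub-deg (pE (suc i) h) with suc i ℕ.≟ q
  ... | yes refl = _ , _ , hq refl , degD-off (pE (suc i) h) (λ ()) (λ ()) deg-A
                 , degD-tgt (pE (suc i) h) deg-B
  ... | no ne    = _ , _ , hi i<q , degD-off (pE (suc i) h) (λ ()) (λ ()) deg-A
                 , degD-off (pE (suc i) h) (λ { refl → ℕ.1+n≰n (ℕ.<⇒≤ i<q) }) (λ { refl → ne refl }) deg-B
    where i<q = ℕ.≤∧≢⇒< (recompute (suc i ℕ.≤? q) h) ne

  leaf-isolatedˡ : ∀ {a w} → ¬ D {m} {n} {q} (lE a) (lv a) w
  leaf-isolatedˡ (g , ne) with nbr-lv g
  ... | refl = ne (inj₂ (refl , refl))

  leaf-isolatedʳ : ∀ {b w} → ¬ D {m} {n} {q} (rE b) (rv b) w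
  leaf-isolatedʳ (g , ne) with nbr-rv g
  ... | refl = ne (inj₂ (refl , refl))

  path-nbr : Fin m → Fin n → ∀ {i} .{h : i ≤ q} v → ∃ λ w → D (pE i h) v w
  path-nbr a b (lv a′) = A , D-link (λ ()) l←
  path-nbr a b (rv b′) = B , D-link (λ ()) r←
  path-nbr a b (pv zero _) = lv a , D-link (λ ()) l→
  path-nbr a b {i} (pv (suc j) g) with j ℕ.≟ q | j ℕ.≟ i
  ... | yes refl | _ = rv b , D-link (λ ()) r→
  ... | no _ | no ne = pv j (ℕ.<⇒≤ g) , D-link {e′ = pE j (ℕ.≤-pred g)} (λ { refl → ne refl }) p←
  ... | no ne | yes refl = pv (suc (suc j)) (s≤s j<q) , D-link {e′ = pE (suc j) j<q} (λ ()) p→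
    where j<q = ℕ.≤∧≢⇒< (recompute (j ℕ.≤? q) (ℕ.≤-pred g)) ne

-- Recognising the edge e from a graph isomorphic to G - e.

record Three {V : Set} (F : Rel V) (v : V) : Set where
  constructor mk3
  field
    {w₁ w₂ w₃} : V
    e₁ : F v w₁
    e₂ : F v w₂
    e₃ : F v w₃
    ne₁₂ : w₁ ≢ w₂
    ne₁₃ : w₁ ≢ w₃
    ne₂₃ : w₂ ≢ w₃

deg-resp : ∀ {V : Set} (F : Rel V) {u v k} → u ≡ v → Deg F u k → Deg F v k
deg-resp F refl d = d

three : ∀ {V : Set} {F : Rel V} {v k} → Deg F v k → 3 ≤ k → Three F v
three (card (x ∷ y ∷ z ∷ _) ((p ∷ r ∷ _) ∷ (t ∷ _) ∷ _) s _ _) _ =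
  mk3 (s (here refl)) (s (there (here refl))) (s (there (there (here refl)))) p r t
three (card [] _ _ _ refl) ()
three (card (_ ∷ []) _ _ _ refl) (s≤s ())
three (card (_ ∷ _ ∷ []) _ _ _ refl) (s≤s (s≤s ()))

module _ {m n q : ℕ} {V : Set} {F : Rel V} {e : GEdge m n q} (ψ : F ≅ D e) where

  no-bad : ∀ {v w₁ w₂ w₃ z₁ z₂} → F v w₁ → F v w₂ → F v w₃ → w₁ ≢ w₂ → w₁ ≢ w₃ → w₂ ≢ w₃ →
           F w₁ z₁ → z₁ ≢ v → F w₂ z₂ → z₂ ≢ v → ⊥
  no-bad a₁ a₂ a₃ n₁ n₂ n₃ b₁ k₁ b₂ k₂ =
    bushy (im a₁) (im a₂) (im a₃) (n₁ ∘ to-inj ψ) (n₂ ∘ to-inj ψ) (n₃ ∘ to-inj ψ)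
      (im b₁) (k₁ ∘ to-inj ψ) (im b₂) (k₂ ∘ to-inj ψ)
    where
    im : ∀ {u v} → F u v → G (to ψ u) (to ψ v)
    im f = D⇒G (pres ψ f)

  to-hub : ∀ {v} → Three F v → to ψ v ≡ A ⊎ to ψ v ≡ B
  to-hub (mk3 a b c p r s) =
    hub (D⇒G (pres ψ a)) (D⇒G (pres ψ b)) (D⇒G (pres ψ c)) (p ∘ to-inj ψ) (r ∘ to-inj ψ) (s ∘ to-inj ψ)

  deg-hub : ∀ {v k} → 3 ≤ k → Deg F v k → ∃ λ a → ∃ λ b → HubDeg e a b ×
            ((to ψ v ≡ A × k ≡ a) ⊎ (to ψ v ≡ B × k ≡ b))
  deg-hub {v} l d with hub-deg e | to-hub (three d l)
  ... | a , b , h , da , db | inj₁ p = a , b , h ,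
    inj₁ (p , card-unique (deg-resp (D e) p (deg-iso ψ d)) da)
  ... | a , b , h , da , db | inj₂ p = a , b , h ,
    inj₂ (p , card-unique (deg-resp (D e) p (deg-iso ψ d)) db)

  deg-hubs : ∀ {v w k l} → v ≢ w → 3 ≤ k → 3 ≤ l → Deg F v k → Deg F w l →
             ∃ λ a → ∃ λ b → HubDeg e a b × ((k ≡ a × l ≡ b) ⊎ (k ≡ b × l ≡ a))
  deg-hubs ne p r d d′ with hub-deg e | to-hub (three d p) | to-hub (three d′ r)
  ... | _ | inj₁ s | inj₁ t = ⊥-elim (ne (to-inj ψ (trans s (sym t))))
  ... | _ | inj₂ s | inj₂ t = ⊥-elim (ne (to-inj ψ (trans s (sym t))))
  ... | a , b , h , da , db | inj₁ s | inj₂ t = a , b , h , inj₁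
    ( card-unique (deg-resp (D e) s (deg-iso ψ d)) da
    , card-unique (deg-resp (D e) t (deg-iso ψ d′)) db)
  ... | a , b , h , da , db | inj₂ s | inj₁ t = a , b , h , inj₂
    ( card-unique (deg-resp (D e) s (deg-iso ψ d)) db
    , card-unique (deg-resp (D e) t (deg-iso ψ d′)) da)

  degA-back : ∃ λ a → ∃ λ b → HubDeg e a b × Deg F (from ψ A) a × Deg F (from ψ B) b
  degA-back with hub-deg e
  ... | a , b , h , da , db = a , b , h , deg-iso (≅-sym ψ) da , deg-iso (≅-sym ψ) db

data Kind {m n q : ℕ} : GEdge m n q → Set where
  path  : ∀ i (h : i ≤ q) → Kind (pE i h)
  leafˡ : ∀ a → Kind (lE a)
  leafʳ : ∀ b → Kind (rE b)

kind : ∀ {m n q} (e : GEdge m n q) → Kind e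
kind {q = q} (pE i h) = path i (recompute (i ℕ.≤? q) h)
kind (lE a) = leafˡ a
kind (rE b) = leafʳ b

data IsPath {m n q : ℕ} : GEdge m n q → Set where
  path : ∀ i (h : i ≤ q) → IsPath (pE i h)

data IsLeaf {m n q : ℕ} : GEdge m n q → Set where
  leafˡ : ∀ a → IsLeaf (lE a)
  leafʳ : ∀ b → IsLeaf (rE b)

module _ {m n q : ℕ} {V : Set} {F : Rel V} {e : GEdge m n q} where

  -- An isolated vertex tells the two kinds of edges apart: cutting a leaf edge isolates the leaf,
  -- whereas cutting a path edge leaves every vertex a neighbour as long as both hubs carry leaves
  -- (`path-nbr`).
  total⇒path : F ≅ D e → (∀ v → ∃ (F v)) → IsPath e
  total⇒path ψ t with kind e
  ... | path i h = path i h
  ... | leafˡ a = ⊥-elim (leaf-isolatedˡ (subst (λ v → D (lE a) v (to ψ (proj₁ (t _)))) (to-from ψ (lv a)) (pres ψ (proj₂ (t _)))))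
  ... | leafʳ b = ⊥-elim (leaf-isolatedʳ (subst (λ v → D (rE b) v (to ψ (proj₁ (t _)))) (to-from ψ (rv b)) (pres ψ (proj₂ (t _)))))

  isolated⇒leaf : Fin m → Fin n → F ≅ D e → ∀ {v} → (∀ w → ¬ F v w) → IsLeaf e
  isolated⇒leaf a b ψ {v} iso with kind e
  ... | leafˡ a = leafˡ a
  ... | leafʳ b = leafʳ b
  ... | path i h = ⊥-elim (iso (from ψ (proj₁ nb)) (subst (λ t → F t (from ψ (proj₁ nb))) (from-to ψ v) (back ψ (proj₂ nb))))
    where nb = path-nbr a b {h = h} (to ψ v)

module _ {m n q : ℕ} {V : Set} {F : Rel V} {i : ℕ} .{h : i ≤ q} (ψ : F ≅ D {m} {n} (pE i h)) where

  -- Only the images of the hubs have three neighbours, and the removed path edge was the only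
  -- connection between the hubs.
  hubs-apart : ∀ {v w} → v ≢ w → Three F v → Three F w → ∃ λ c → Closed F c × c v ≢ c w
  hubs-apart {v} {w} ne tv tw = side i ∘ to ψ , closed-iso (≅-sym ψ) (side-closed {h = h}) , go (to-hub ψ tv) (to-hub ψ tw)
    where
    go : to ψ v ≡ A ⊎ to ψ v ≡ B → to ψ w ≡ A ⊎ to ψ w ≡ B → side i (to ψ v) ≢ side i (to ψ w)
    go (inj₁ p) (inj₁ r) _ = ne (to-inj ψ (trans p (sym r)))
    go (inj₂ p) (inj₂ r) _ = ne (to-inj ψ (trans p (sym r)))
    go (inj₁ p) (inj₂ r) s with trans (sym (cong (side i) p)) (trans s (trans (cong (side i) r) (side-B {m} {n} {h = h})))
    ... | ()
    go (inj₂ p) (inj₁ r) s with trans (sym (trans (cong (side i) p) (side-B {m} {n} {h = h}))) (trans s (cong (side i) r))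
    ... | ()

-- Common decards and the pigeonhole bound.

record Share (m n q : ℕ) {W : Set} (H : Rel W) : Set where
  constructor share
  field
    fa fb : W
    fab   : H fa fb
    e     : GEdge m n q
    iso   : Del H fa fb ≅ D e

open Share

-- Injectivity is asked on both sides, since the decards come from distinct edges of H and from
-- distinct edges of the broom. The degrees of the cut edges are absent: the upper bounds use one of
-- them only, through `Base`.
record Family (m n q k : ℕ) {W : Set} (H : Rel W) : Set where
  field
    sh    : Fin k → Share m n q H
    f-inj : ∀ i j → Same (fa (sh i)) (fb (sh i)) (fa (sh j)) (fb (sh j)) → i ≡ j
    e-inj : ∀ i j → e (sh i) ≡ e (sh j) → i ≡ j

open Family

module _ {m n q : ℕ} {W : Set} {H : Rel W} where

  -- A share is recognised by its edge of H or by its edge of the broom.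
  Code : Set
  Code = (W × W) ⊎ GEdge m n q

  Match : Share m n q H → Code → Set
  Match s (inj₁ (u , v)) = Same u v (fa s) (fb s)
  Match s (inj₂ d)       = e s ≡ d

  at : ∀ {u v} (s : Share m n q H) → Same u v (fa s) (fb s) → Del H u v ≅ D (e s)
  at s p = ≅-trans (del-same p) (iso s)

  index : ∀ {P : Code → Set} {L} → Any P L → Fin (length L)
  index (here _)  = Fin.zero
  index (there p) = Fin.suc (index p)

  index-match : ∀ {s t L} (p : Any (Match s) L) (r : Any (Match t) L) → index p ≡ index r →
                ∃ λ c → Match s c × Match t c
  index-match (here p) (here r) _ = _ , p , r
  index-match (there p) (there r) eq = index-match p r (Fin.suc-injective eq)
  index-match (here _) (there _) ()
  index-match (there _) (here _) ()

  -- Two shares with the same code agree in their edge of H or in their edge of the broom, and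
  -- either contradicts the injectivity of a family. Hence codes of the two sorts may be mixed in
  -- one list.
  bounded : ∀ {k} (L : List Code) → (∀ s → Any (Match s) L) → length L < k → ¬ Family m n q k H
  bounded L cl lt fam with Fin.pigeonhole lt (λ i → index (cl (sh fam i)))
  ... | i , j , i<j , eq with index-match (cl (sh fam i)) (cl (sh fam j)) eq
  ...   | inj₁ _ , p , r = Fin.<⇒≢ i<j (f-inj fam i j (same-trans (same-sym p) r))
  ...   | inj₂ _ , p , r = Fin.<⇒≢ i<j (e-inj fam i j (trans p (sym r)))

module _ {m n q m′ n′ q′ : ℕ} {H : Rel (V m′ n′ q′)} where

  -- The edges whose removal can cure a vertex v of degree at least 3 with two non-leaf neighbours.
  candidates : (s : Share m n q H) → ∀ {v w₁ w₂ w₃ z₁ z₂} → H v w₁ → H v w₂ → H v w₃ →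
    w₁ ≢ w₂ → w₁ ≢ w₃ → w₂ ≢ w₃ → H w₁ z₁ → z₁ ≢ v → H w₂ z₂ → z₂ ≢ v →
    Any (Match s) (inj₁ (v , w₁) ∷ inj₁ (v , w₂) ∷ inj₁ (v , w₃) ∷ inj₁ (w₁ , z₁) ∷ inj₁ (w₂ , z₂) ∷ [])
  candidates s {v} {w₁} {w₂} {w₃} {z₁} {z₂} a₁ a₂ a₃ n₁ n₂ n₃ b₁ k₁ b₂ k₂
    with dec v w₁ | dec v w₂ | dec v w₃ | dec w₁ z₁ | dec w₂ z₂
    where
    dec : ∀ u w → Dec (Same (fa s) (fb s) u w)
    dec = same? _≟_ (fa s) (fb s)
  ... | yes p | _ | _ | _ | _ = here (same-sym p)
  ... | no _ | yes p | _ | _ | _ = there (here (same-sym p))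
  ... | no _ | no _ | yes p | _ | _ = there (there (here (same-sym p)))
  ... | no _ | no _ | no _ | yes p | _ = there (there (there (here (same-sym p))))
  ... | no _ | no _ | no _ | no _ | yes p = there (there (there (there (here (same-sym p)))))
  ... | no p₁ | no p₂ | no p₃ | no p₄ | no p₅ =
    ⊥-elim (no-bad (iso s) (a₁ , p₁) (a₂ , p₂) (a₃ , p₃) n₁ n₂ n₃ (b₁ , p₄) k₁ (b₂ , p₅) k₂)

-- New edges on one side of a removed path edge.

module _ {m n q i : ℕ} (h : i ≤ q) where

  side-card′ : Card (λ (v : V m n q) → side i v ≡ false) (n + suc (q ∸ i))
  side-card′ = card-iso ρ-iso (λ {v} → f v) (λ {v} → g v) (side-card {n} {m} {q} (ℕ.m∸n≤m q i))
    where
    f : ∀ (v : V n m q) → side (q ∸ i) v ≡ true → side i (ρ v) ≡ false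
    f (pv j g) p = side-> {n} {m} {i = i} {j = suc q ∸ j} {h = ℕ.m∸n≤m (suc q) j} (begin
        suc i               ≡⟨ cong suc (ℕ.m∸[m∸n]≡n h) ⟨
        suc (q ∸ (q ∸ i))   ≤⟨ s≤s (ℕ.∸-monoʳ-≤ q (side-true {n} {m} {i = q ∸ i} {j = j} {h = g} p)) ⟩
        suc (q ∸ j)         ≡⟨ ℕ.+-∸-assoc 1 (ℕ.≤-trans (side-true {n} {m} {i = q ∸ i} {j = j} {h = g} p) (ℕ.m∸n≤m q i)) ⟨
        suc q ∸ j           ∎)
      where open ℕ.≤-Reasoning
    f (lv a) _ = refl
    g : ∀ (v : V m n q) → side i v ≡ false → side (q ∸ i) (ρ v) ≡ true
    g (pv j g) p = side-≤ {n} {m} {i = q ∸ i} {j = suc q ∸ j} {h = ℕ.m∸n≤m (suc q) j} (ℕ.∸-monoʳ-≤ (suc q) (side-false {m} {n} {i = i} {j = j} {h = g} p))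
    g (rv b) _ = refl

module _ {m n q i : ℕ} (h : i ≤ q) {x y : V m n q} (xy : side i x ≡ side i y) (a₀ : Fin m) (b₀ : Fin n) where

  private
    H : Rel (V m n q)
    H = Add (D (pE i h)) x y

  side-closedᴴ : Closed H (side i)
  side-closedᴴ (inj₁ d) = side-closed {h = h} d
  side-closedᴴ (inj₂ (inj₁ (refl , refl))) = xy
  side-closedᴴ (inj₂ (inj₂ (refl , refl))) = sym xy

  -- If both ends of the new edge lie on one side then H is disconnected, and the sizes of the sides
  -- determine the broom edge up to one alternative.
  same-side : ∀ {e u v} (ψ : Del H u v ≅ D e) → ∃ λ j → Σ (j ≤ q) λ g → e ≡ pE j g ×
    ((side i (from ψ A) ≡ true × j ≡ i) ⊎ (side i (from ψ A) ≡ false × m + suc j ≡ n + suc (q ∸ i)))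
  same-side {e} ψ = go (kind e) ψ
    where
    c : ∀ {e u v} → Del H u v ≅ D e → V m n q → Bool
    c ψ = side i ∘ from ψ
    cl : ∀ {e u v} (ψ : Del H u v ≅ D e) → Closed (D e) (c ψ)
    cl ψ = closed-iso ψ (side-closedᴴ ∘ proj₁)
    ct : ∀ {e u v} (ψ : Del H u v ≅ D e) → Card (λ v → c ψ v ≡ true) (suc (m + i))
    ct ψ = subst (Card _) (ℕ.+-suc m i) (card-iso ψ (λ p → trans (cong (side i) (from-to ψ _)) p) id (side-card h))
    cf : ∀ {e u v} (ψ : Del H u v ≅ D e) → Card (λ v → c ψ v ≡ false) (suc (n + (q ∸ i)))
    cf ψ = subst (Card _) (ℕ.+-suc n (q ∸ i)) (card-iso ψ (λ p → trans (cong (side i) (from-to ψ _)) p) id (side-card′ h))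
    pos : ∀ {k l} → Fin k → k + l ≢ 0
    pos Fin.zero ()
    pos (Fin.suc _) ()
    go : ∀ {e u v} → Kind e → (ψ : Del H u v ≅ D e) → ∃ λ j → Σ (j ≤ q) λ g → e ≡ pE j g ×
      ((side i (from ψ A) ≡ true × j ≡ i) ⊎ (side i (from ψ A) ≡ false × m + suc j ≡ n + suc (q ∸ i)))
    go (path j g) ψ with closed-size-path g (cl ψ) (ct ψ) (cf ψ)
    ... | inj₁ (p , r) = j , g , refl , inj₁ (p , ℕ.suc-injective (ℕ.+-cancelˡ-≡ m _ _ (trans (sym r) (sym (ℕ.+-suc m i)))))
    ... | inj₂ (p , r) = j , g , refl , inj₂ (p , trans (sym r) (sym (ℕ.+-suc n (q ∸ i))))
    go (leafˡ a) ψ with one-size (one-colourˡ (cl ψ)) (ct ψ) (cf ψ)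
    ... | inj₁ z = ⊥-elim (pos a₀ z)
    ... | inj₂ z = ⊥-elim (pos b₀ z)
    go (leafʳ a) ψ with one-size (one-colourʳ (cl ψ)) (ct ψ) (cf ψ)
    ... | inj₁ z = ⊥-elim (pos a₀ z)
    ... | inj₂ z = ⊥-elim (pos b₀ z)

  same-side-bound : ∀ {k} → 2 < k → ¬ Family m n q k H
  same-side-bound lt = bounded (inj₂ (pE i h) ∷ inj₂ (pE (j* ⊓ q) (ℕ.m⊓n≤n j* q)) ∷ []) cl lt
    where
    -- `j*` solves `m + suc j ≡ n + suc (q ∸ i)`, the case in which `A` goes to the far part. The
    -- minimum with `q` makes it an admissible index without further argument and changes nothing
    -- for an actual solution `j ≤ q`.
    j* = n + suc (q ∸ i) ∸ suc m
    cl : ∀ s → Any (Match s) (inj₂ (pE i h) ∷ inj₂ (pE (j* ⊓ q) (ℕ.m⊓n≤n j* q)) ∷ [])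
    cl s with same-side (iso s)
    ... | j , g , eq , inj₁ (_ , refl) = here eq
    ... | j , g , eq , inj₂ (_ , r) = there (here (trans eq (pE-cong (trans
            (sym (ℕ.m≤n⇒m⊓n≡m g)) (cong (_⊓ q) j≡)))))
      where
      j≡ : j ≡ j*
      j≡ = trans (sym (ℕ.m+n∸m≡n (suc m) j)) (cong (_∸ suc m) (trans (sym (ℕ.+-suc m j)) r))

-- Vertices with two long arms; trees with two hubs.

fan : ∀ {V : Set} {v w w′ : V} → w ≢ w′ → v ≢ w′ → ¬ Same v w v w′
fan p r (inj₁ (_ , e)) = p (sym e)
fan p r (inj₂ (_ , e)) = r (sym e)

¬three : ∀ {V : Set} {F : Rel V} {v k} → Deg F v k → k ≤ 2 → ¬ Three F v
¬three {F = F} {v} d l (mk3 {x} {y} {z} a b c p r s) = ℕ.<⇒≱ (s≤s l) (subst (3 ≤_) (Card.len d)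
  (unique-⊆ {xs = x ∷ y ∷ z ∷ []} ((p ∷ r ∷ []) ∷ (s ∷ []) ∷ [] ∷ [])
    λ { (here refl) → Card.complete d a ; (there (here refl)) → Card.complete d b
      ; (there (there (here refl))) → Card.complete d c }))

three-mono : ∀ {V : Set} {E F : Rel V} {v} → (∀ {w} → E v w → F v w) → Three E v → Three F v
three-mono f (mk3 a b c p r s) = mk3 (f a) (f b) (f c) p r s

-- The configuration excluded by `bushy`, with all witnesses named because the codes refer to them.
record Bad {V : Set} (H : Rel V) (v w₁ w₂ w₃ z₁ z₂ : V) : Set where
  constructor mkBad
  field
    a₁ : H v w₁
    a₂ : H v w₂
    a₃ : H v w₃
    n₁₂ : w₁ ≢ w₂
    n₁₃ : w₁ ≢ w₃
    n₂₃ : w₂ ≢ w₃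
    b₁ : H w₁ z₁
    k₁ : z₁ ≢ v
    b₂ : H w₂ z₂
    k₂ : z₂ ≢ v

Total : {V : Set} → Rel V → Set
Total H = ∀ v → ∃ (H v)

module _ {V : Set} {H : Rel V} where

  bad-swap : ∀ {v w₁ w₂ w₃ z₁ z₂} → Bad H v w₁ w₂ w₃ z₁ z₂ → Bad H v w₂ w₁ w₃ z₂ z₁
  bad-swap (mkBad a₁ a₂ a₃ n₁ n₂ n₃ b₁ k₁ b₂ k₂) = mkBad a₂ a₁ a₃ (n₁ ∘ sym) n₃ n₂ b₂ k₂ b₁ k₁

  del-total : DecidableEquality V → ∀ {v w x y} → Symm H → Total H → H v x → x ≢ w → H w y → y ≢ v → v ≢ w →
              Total (Del H v w)
  del-total _≟′_ {v} {w} {x} {y} sy t hx x≢w hy y≢v v≢w u with u ≟′ v | u ≟′ w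
  ... | yes refl | _ = x , hx , λ { (inj₁ (_ , p)) → x≢w p ; (inj₂ (p , _)) → v≢w p }
  ... | no _ | yes refl = y , hy , λ { (inj₁ (p , _)) → v≢w (sym p) ; (inj₂ (_ , p)) → y≢v p }
  ... | no p | no r = proj₁ (t u) , proj₂ (t u) , off p r

module _ {m n q : ℕ} where

  -- Removing a leaf edge lowers the degree of one hub by one and leaves the other alone, so the sum
  -- would be one short of `suc m + suc n`.
  hub-deg-cases : ∀ {e : GEdge m n q} {a b} → HubDeg e a b → a + b ≡ suc m + suc n → IsPath e
  hub-deg-cases hl p = ⊥-elim (ℕ.1+n≢n (sym p))
  hub-deg-cases hr p = ⊥-elim (ℕ.1+n≢n (sym (trans (ℕ.suc-injective p) (ℕ.+-suc m n))))
  hub-deg-cases (h00 _) p = path 0 z≤n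
  hub-deg-cases (h0 _) p = path 0 z≤n
  hub-deg-cases (hq {h = h} _) p = path _ (recompute (_ ℕ.≤? q) h)
  hub-deg-cases (hi {h = h} _) p = path _ (recompute (_ ℕ.≤? q) h)

  apart : ∀ {V : Set} {F : Rel V} {e : GEdge m n q} → F ≅ D e → IsPath e → ∀ {v w} → v ≢ w → Three F v → Three F w →
          (∀ c → Closed F c → c v ≡ c w) → ⊥
  apart ψ (path i h) ne tv tw con with hubs-apart {h = h} ψ ne tv tw
  ... | c , cl , ne′ = ne′ (con c cl)

  leafy-A : ∀ .{h} {w z} → D {m} {n} {q} (pE 0 h) A w → G w z → z ≡ A
  leafy-A {w = w} {z} (g , ne) g′ with z ≟ A
  ... | yes p = p
  ... | no p  = ⊥-elim (ne (inj₁ (refl , inner-A g g′ p)))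

  leafy-B : ∀ {i} .{h} {w z} → i ≡ q → D {m} {n} {q} (pE i h) B w → G w z → z ≡ B
  leafy-B {w = w} {z} refl (g , ne) g′ with z ≟ B
  ... | yes p = p
  ... | no p  = ⊥-elim (ne (inj₂ (refl , inner-B g g′ p)))

  module _ {V : Set} {F : Rel V} {e : GEdge m n q} (ψ : F ≅ D e) where

    -- A vertex with three neighbours is a hub, and in a path decard a hub of degree other than
    -- `suc m` and `suc n` has lost its path edge. All its neighbours are then leaves, so no edge
    -- leads on from `w`.
    leafy-hub : ∀ {v w z k} → IsPath e → 3 ≤ k → Deg F v k → k ≢ suc m → k ≢ suc n → F v w → F w z → z ≢ v → ⊥
    leafy-hub {v} {w} {z} (path _ _) l d ≢m ≢n f g ne with deg-hub ψ l d
    ... | _ , _ , h00 p , inj₁ (t , r) = ne (to-inj ψ (trans (leafy-A (subst (λ x → D _ x (to ψ w)) t (pres ψ f)) (D⇒G (pres ψ g))) (sym t)))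
    ... | _ , _ , h0 p , inj₁ (t , r)  = ne (to-inj ψ (trans (leafy-A (subst (λ x → D _ x (to ψ w)) t (pres ψ f)) (D⇒G (pres ψ g))) (sym t)))
    ... | _ , _ , hq p , inj₁ (t , r)  = ≢m r
    ... | _ , _ , hi p , inj₁ (t , r)  = ≢m r
    ... | _ , _ , h00 p , inj₂ (t , r) = ne (to-inj ψ (trans (leafy-B (sym p) (subst (λ x → D _ x (to ψ w)) t (pres ψ f)) (D⇒G (pres ψ g))) (sym t)))
    ... | _ , _ , hq p , inj₂ (t , r)  = ne (to-inj ψ (trans (leafy-B p (subst (λ x → D _ x (to ψ w)) t (pres ψ f)) (D⇒G (pres ψ g))) (sym t)))
    ... | _ , _ , h0 p , inj₂ (t , r)  = ≢n r
    ... | _ , _ , hi p , inj₂ (t , r)  = ≢n r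

module _ {m n q m′ n′ q′ : ℕ} {H : Rel (V m′ n′ q′)} (sy : Symm H) (ir : Irr H) where

  bad-list : (s : Share m n q H) → ∀ {v w₁ w₂ w₃ z₁ z₂} → Bad H v w₁ w₂ w₃ z₁ z₂ →
    Any (Match s) (inj₁ (v , w₁) ∷ inj₁ (v , w₂) ∷ inj₁ (v , w₃) ∷ inj₁ (w₁ , z₁) ∷ inj₁ (w₂ , z₂) ∷ [])
  bad-list s (mkBad a₁ a₂ a₃ n₁ n₂ n₃ b₁ k₁ b₂ k₂) = candidates s a₁ a₂ a₃ n₁ n₂ n₃ b₁ k₁ b₂ k₂

  not-w₃ : ∀ {e : GEdge m n q} {v w₁ w₂ w₃ z₁ z₂ w₃′} → Bad H v w₁ w₂ w₃ z₁ z₂ →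
           H v w₃′ → w₃′ ≢ w₁ → w₃′ ≢ w₂ → w₃′ ≢ w₃ → ¬ (Del H v w₃ ≅ D e)
  not-w₃ (mkBad a₁ a₂ a₃ n₁₂ n₁₃ n₂₃ b₁ k₁ b₂ k₂) a₄ n₁ n₂ n₃ ψ =
    no-bad ψ (a₁ , fan (n₁₃ ∘ sym) (ir a₁)) (a₂ , fan (n₂₃ ∘ sym) (ir a₂)) (a₄ , fan (n₃ ∘ sym) (ir a₄))
      n₁₂ (n₁ ∘ sym) (n₂ ∘ sym) (b₁ , off (ir a₁ ∘ sym) n₁₃) k₁ (b₂ , off (ir a₂ ∘ sym) n₂₃) k₂

  -- A fourth neighbour can take the place of `w₃`, so cutting `v w₃` does not cure `v` (`not-w₃`).
  bad-list₄ : (s : Share m n q H) → ∀ {v w₁ w₂ w₃ z₁ z₂ w₃′} → Bad H v w₁ w₂ w₃ z₁ z₂ →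
    H v w₃′ → w₃′ ≢ w₁ → w₃′ ≢ w₂ → w₃′ ≢ w₃ →
    Any (Match s) (inj₁ (v , w₁) ∷ inj₁ (v , w₂) ∷ inj₁ (w₁ , z₁) ∷ inj₁ (w₂ , z₂) ∷ [])
  bad-list₄ s bd a₄ n₁ n₂ n₃ with bad-list s bd
  ... | here p = here p
  ... | there (here p) = there (here p)
  ... | there (there (here p)) = ⊥-elim (not-w₃ bd a₄ n₁ n₂ n₃ (at s p))
  ... | there (there (there p)) = there (there p)

  -- `v` has two long arms and has to be cured; `u` is the second hub. In the intended graphs `u`
  -- lies behind `w₁`, while `w₂` starts another arm: the hypotheses on closed colourings in the
  -- lemmas say that `v` and `u` stay joined when that arm is cut. By `kl` the degrees of `v` and
  -- `u` add up to those of the hubs of the broom.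
  module Tree {v w₁ w₂ w₃ z₁ z₂ u} (bd : Bad H v w₁ w₂ w₃ z₁ z₂) (v≢u : v ≢ u) (t : Total H)
    (u≢w₂ : u ≢ w₂) (u≢z₂ : u ≢ z₂) {k l} (dv : Deg H v (suc k)) (du : Deg H u l) (l≥3 : 3 ≤ l)
    (kl : suc k + l ≡ suc m + suc n) where

    open Bad bd

    total-vw₁ : Total (Del H v w₁)
    total-vw₁ = del-total _≟_ sy t a₂ (n₁₂ ∘ sym) b₁ k₁ (ir a₁)

    total-vw₂ : Total (Del H v w₂)
    total-vw₂ = del-total _≟_ sy t a₁ n₁₂ b₂ k₂ (ir a₂)

    -- The cut leaves both degrees intact, so their sum forces a path edge (`hub-deg-cases`). That
    -- edge would have to separate the hubs, but they stay joined.
    not-w₂z₂ : ∀ {e : GEdge m n q} → 2 ≤ k → (∀ c → Closed (Del H w₂ z₂) c → c v ≡ c u) → ¬ (Del H w₂ z₂ ≅ D e)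
    not-w₂z₂ k≥2 con ψ = go ψ (deg-hubs ψ v≢u (s≤s k≥2) l≥3 dv′ du′)
      where
      dv′ = deg-del-off H (ir a₂) (k₂ ∘ sym) dv
      du′ = deg-del-off H u≢w₂ u≢z₂ du
      go : ∀ {e : GEdge m n q} (ψ : Del H w₂ z₂ ≅ D e) → (∃ λ a → ∃ λ b → HubDeg e a b × ((suc k ≡ a × l ≡ b) ⊎ (suc k ≡ b × l ≡ a))) → ⊥
      go ψ (_ , _ , h , inj₁ (refl , refl)) =
        apart ψ (hub-deg-cases h kl) v≢u (three dv′ (s≤s k≥2)) (three du′ l≥3) con
      go ψ (_ , _ , h , inj₂ (refl , refl)) =
        apart ψ (hub-deg-cases h (trans (ℕ.+-comm l (suc k)) kl)) v≢u (three dv′ (s≤s k≥2)) (three du′ l≥3) con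

    -- Every vertex keeps a neighbour, so a path edge is removed, and `v` still has three
    -- neighbours; again the hubs would have to be separated.
    not-vw₂ : ∀ {e : GEdge m n q} → 3 ≤ k → (∀ c → Closed (Del H v w₂) c → c v ≡ c u) → ¬ (Del H v w₂ ≅ D e)
    not-vw₂ k≥3 con ψ = apart ψ (total⇒path ψ total-vw₂) v≢u
      (three (deg-del H (ir a₂) a₂ dv) k≥3) (three (deg-del-off H (v≢u ∘ sym) u≢w₂ du) l≥3) con

    bound₂ : (s : Share m n q H) → ∀ {w₃′} → H v w₃′ → w₃′ ≢ w₁ → w₃′ ≢ w₂ → w₃′ ≢ w₃ → 3 ≤ k →
      (∀ c → Closed (Del H v w₂) c → c v ≡ c u) → (∀ c → Closed (Del H w₂ z₂) c → c v ≡ c u) →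
      Any (Match s) (inj₁ (v , w₁) ∷ inj₁ (w₁ , z₁) ∷ [])
    bound₂ s a₄ r₁ r₂ r₃ k≥3 con con′ with bad-list₄ s bd a₄ r₁ r₂ r₃
    ... | here p = here p
    ... | there (here p) = ⊥-elim (not-vw₂ k≥3 con (at s p))
    ... | there (there (here p)) = there (here p)
    ... | there (there (there (here p))) = ⊥-elim (not-w₂z₂ (ℕ.<⇒≤ k≥3) con′ (at s p))

    -- Beyond `bound₂` only the cut `v w₁` has to be excluded. It would leave `v` with degree `k`,
    -- the degree of no hub that keeps its path edge, although the arm `w₂`, `z₂` leads on from `v`.
    bound₁ : (s : Share m n q H) → ∀ {w₃′} → H v w₃′ → w₃′ ≢ w₁ → w₃′ ≢ w₂ → w₃′ ≢ w₃ → 3 ≤ k →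
      (∀ c → Closed (Del H v w₂) c → c v ≡ c u) → (∀ c → Closed (Del H w₂ z₂) c → c v ≡ c u) →
      k ≢ suc m → k ≢ suc n → Any (Match s) (inj₁ (w₁ , z₁) ∷ [])
    bound₁ s a₄ r₁ r₂ r₃ k≥3 con con′ ≢m ≢n with bound₂ s a₄ r₁ r₂ r₃ k≥3 con con′
    ... | here p = ⊥-elim (leafy-hub (at s p) (total⇒path (at s p) total-vw₁) k≥3 (deg-del H (ir a₁) a₁ dv) ≢m ≢n
                     (a₂ , fan n₁₂ (ir a₂)) (b₂ , off (ir a₂ ∘ sym) (n₁₂ ∘ sym)) k₂)
    ... | there p = p

    module _ (c* : V m′ n′ q′ → Bool) (cl : Closed (Del H v w₁) c*) (sep : c* v ≢ c* u) (2≤m : 2 ≤ m) (2≤n : 2 ≤ n)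
      (only : ∀ x → Three (Del H v w₁) x → x ≡ u) where

      -- Here v has degree 3, so that without the edge vw₁ it is an inner vertex of a path; this
      -- path would have to be the star with two leaves.
      not-vw₁ : ∀ {e : GEdge m n q} → q ≢ 0 → ¬ (Del H v w₁ ≅ D e)
      not-vw₁ {e} q≢0 ψ with total⇒path ψ total-vw₁ | degA-back ψ
      ... | path _ _ | _ , _ , h00 p , _ = q≢0 p
      ... | path _ g | _ , _ , hi _ , da , db =
        contradiction (from-inj ψ (trans (only _ (three da (s≤s 2≤m))) (sym (only _ (three db (s≤s 2≤n)))))) λ ()
      ... | path _ g | _ , _ , h0 _ , da , db = go (side 0 (to ψ v)) refl
        where
        fB = only _ (three db (s≤s 2≤n))
        col = two-colours {h = g} (closed-iso ψ cl)
        go : ∀ b → side 0 (to ψ v) ≡ b → ⊥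
        go false eq with col (to ψ v)
        ... | r rewrite eq = sep (trans (sym (cong c* (from-to ψ v))) (trans r (cong c* fB)))
        go true eq = left (to ψ v) refl eq
          where
          f₂ = pres ψ (a₂ , fan n₁₂ (ir a₂))
          f₃ = pres ψ (a₃ , fan n₁₃ (ir a₃))
          g₂ = D⇒G (pres ψ (b₂ , off (ir a₂ ∘ sym) (n₁₂ ∘ sym)))
          left : ∀ x → to ψ v ≡ x → side 0 x ≡ true → ⊥
          left (pv zero _) p _ = k₂ (to-inj ψ (trans (leafy-A (subst (λ x → D _ x (to ψ w₂)) p f₂) g₂) (sym p)))
          left (pv (suc i) _) p ()
          left (lv a) p _ = n₂₃ (to-inj ψ (trans (nbr-lv (subst (λ x → G x (to ψ w₂)) p (D⇒G f₂)))
                                           (sym (nbr-lv (subst (λ x → G x (to ψ w₃)) p (D⇒G f₃))))))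
      ... | path (suc i) g | _ , _ , hq refl , da , db = go (side (suc i) (to ψ v)) refl
        where
        fA = only _ (three da (s≤s 2≤m))
        col = two-colours {h = g} (closed-iso ψ cl)
        go : ∀ b → side (suc i) (to ψ v) ≡ b → ⊥
        go true eq with col (to ψ v)
        ... | r rewrite eq = sep (trans (sym (cong c* (from-to ψ v))) (trans r (cong c* fA)))
        go false eq = right (to ψ v) refl eq
          where
          f₂ = pres ψ (a₂ , fan n₁₂ (ir a₂))
          f₃ = pres ψ (a₃ , fan n₁₃ (ir a₃))
          g₂ = D⇒G (pres ψ (b₂ , off (ir a₂ ∘ sym) (n₁₂ ∘ sym)))
          right : ∀ x → to ψ v ≡ x → side (suc i) x ≡ false → ⊥
          right (pv j hj) p eq = k₂ (to-inj ψ (trans (leafy-B refl (subst (λ x → D _ x (to ψ w₂)) (trans p top) f₂) g₂) (sym (trans p top))))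
            where
            top : pv j hj ≡ B
            top = pv-cong (ℕ.≤-antisym (recompute (j ℕ.≤? suc (suc i)) hj) (side-false {m} {n} {i = suc i} {j = j} {h = hj} eq))
          right (rv a) p _ = n₂₃ (to-inj ψ (trans (nbr-rv (subst (λ x → G x (to ψ w₂)) p (D⇒G f₂)))
                                           (sym (nbr-rv (subst (λ x → G x (to ψ w₃)) p (D⇒G f₃))))))

      bound₃ : (s : Share m n q H) → q ≢ 0 → 2 ≤ k → (∀ c → Closed (Del H w₂ z₂) c → c v ≡ c u) →
        Any (Match s) (inj₁ (v , w₂) ∷ inj₁ (v , w₃) ∷ inj₁ (w₁ , z₁) ∷ [])
      bound₃ s q≢0 k≥2 con with bad-list s bd
      ... | here p = ⊥-elim (not-vw₁ q≢0 (at s p))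
      ... | there (here p) = here p
      ... | there (there (here p)) = there (here p)
      ... | there (there (there (here p))) = there (there (here p))
      ... | there (there (there (there (here p)))) = ⊥-elim (not-w₂z₂ k≥2 con (at s p))

      -- A second continuation `z₁′` of the arm keeps `v` bad when `w₁ z₁` is cut, unless that edge
      -- is `w₂ z₂` at the same time, which `not-w₂z₂` excludes.
      bound₃-adj : (s : Share m n q H) → q ≢ 0 → 2 ≤ k → (∀ c → Closed (Del H w₂ z₂) c → c v ≡ c u) →
        ∀ {z₁′} → H w₁ z₁′ → z₁′ ≢ v → z₁′ ≢ z₁ → Any (Match s) (inj₁ (v , w₂) ∷ inj₁ (v , w₃) ∷ [])
      bound₃-adj s q≢0 k≥2 con b₁′ k₁′ ne with bound₃ s q≢0 k≥2 con
      ... | here p = here p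
      ... | there (here p) = there (here p)
      ... | there (there (here p)) with same? _≟_ (fa s) (fb s) w₂ z₂
      ...   | yes r = ⊥-elim (not-w₂z₂ k≥2 con (at s (same-sym r)))
      ...   | no r = ⊥-elim (no-bad (at s p) (a₁ , off (ir a₁) (k₁ ∘ sym)) (a₂ , off (ir a₁) (k₁ ∘ sym))
                       (a₃ , off (ir a₁) (k₁ ∘ sym)) n₁₂ n₁₃ n₂₃ (b₁′ , fan (ne ∘ sym) (ir b₁′)) k₁′
                       (b₂ , λ x → r (same-trans (same-sym p) x)) k₂)

another : ∀ {m} → m ≢ 1 → (a : Fin m) → ∃ λ a′ → a′ ≢ a
another {suc zero} ne _ = ⊥-elim (ne refl)
another {suc (suc m)} ne Fin.zero = Fin.suc Fin.zero , λ ()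
another {suc (suc m)} ne (Fin.suc a) = Fin.zero , λ ()

apart-edge : ∀ {V : Set} {a b c d : V} → c ≢ a → d ≢ a → ¬ Same a b c d
apart-edge p r (inj₁ (x , _)) = p x
apart-edge p r (inj₂ (_ , y)) = r y

-- Isolated edges and spiders.

K₂ : {V : Set} → Rel V → V → V → Set
K₂ F x y = F x y × (∀ z → F x z → z ≡ y) × (∀ z → F y z → z ≡ x)

K₂-iso : ∀ {V W : Set} {E : Rel V} {F : Rel W} (φ : E ≅ F) {x y} → K₂ E x y → K₂ F (to φ x) (to φ y)
K₂-iso {E = E} {F} φ {x} {y} (e , kx , ky) = pres φ e , (λ z f → lift kx f) , (λ z f → lift ky f)
  where
  lift : ∀ {x y z} → (∀ z → E x z → z ≡ y) → F (to φ x) z → z ≡ to φ y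
  lift {x} k f = trans (sym (to-from φ _)) (cong (to φ) (k _ (subst (λ t → E t _) (from-to φ x) (back φ f))))

module _ {m n q : ℕ} where

  module _ (a₀ : Fin m) (b₀ : Fin n) {i : ℕ} (h : i ≤ q) where

    private
      F : Rel (V m n q)
      F = D (pE i h)

    end-A : ∀ {a} → (∀ z → F A z → z ≡ lv a) → m ≡ 1 × i ≡ 0
    end-A {a} k with m ℕ.≟ 1 | i ℕ.≟ 0
    ... | yes p | yes r = p , r
    ... | no p | _ = ⊥-elim (proj₂ (another p a) (lv-inj (k _ (D-link {e′ = lE (proj₁ (another p a))} (λ ()) l→))))
    ... | yes _ | no r with k (pv 1 (s≤s z≤n)) (D-link {e′ = pE 0 z≤n} (λ s → r (sym (pE-inj s))) p→)
    ...   | ()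

    end-B : ∀ {b} → (∀ z → F B z → z ≡ rv b) → n ≡ 1 × i ≡ q
    end-B {b} k with n ℕ.≟ 1 | i ℕ.≟ q
    ... | yes p | yes r = p , r
    ... | no p | _ = ⊥-elim (proj₂ (another p b) (rv-inj (k _ (D-link {e′ = rE (proj₁ (another p b))} (λ ()) r→))))
    ... | yes _ | no r with k (pv q (ℕ.n≤1+n q)) (D-link {e′ = pE q ℕ.≤-refl} (λ s → r (sym (pE-inj s))) p←)
    ...   | ()

    no-end : ∀ j .(g : j ≤ q) → j ≢ i → (∀ z → F (pv j (ℕ.m≤n⇒m≤1+n g)) z → z ≡ pv (suc j) (s≤s g)) →
             (∀ z → F (pv (suc j) (s≤s g)) z → z ≡ pv j (ℕ.m≤n⇒m≤1+n g)) → ⊥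
    no-end j g j≢i k l with ℕ.<-cmp j i
    ... | tri≈ _ p _ = j≢i p
    ... | tri> _ _ i<j with j ℕ.≟ q
    ...   | yes refl with l _ (D-link {e′ = rE b₀} (λ ()) r→)
    ...     | ()
    no-end j g j≢i k l | tri> _ _ i<j | no j≢q
      with l (pv (suc (suc j)) (s≤s (ℕ.≤∧≢⇒< g j≢q))) (D-link {e′ = pE (suc j) (ℕ.≤∧≢⇒< g j≢q)}
             (λ p → ℕ.<⇒≢ (ℕ.m≤n⇒m≤1+n i<j) (sym (pE-inj p))) p→)
    ... | ()
    no-end zero g j≢i k l | tri< j<i _ _ with k _ (D-link {e′ = lE a₀} (λ ()) l→)
    ... | ()
    no-end (suc j) g j≢i k l | tri< j<i _ _
      with k (pv j (ℕ.<⇒≤ (ℕ.m≤n⇒m≤1+n g))) (D-link {e′ = pE j (ℕ.<⇒≤ g)} (λ p → ℕ.<⇒≢ (ℕ.<⇒≤ j<i) (pE-inj p)) p←)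
    ... | ()

    -- Such a component has to consist of a hub and its only leaf, with the path edge at this hub
    -- removed. It serves to read off from a decard where an arm of H was cut.
    K₂-edge : ∀ {x y : V m n q} → K₂ F x y → (m ≡ 1 × i ≡ 0) ⊎ (n ≡ 1 × i ≡ q)
    K₂-edge (d , kx , ky) with D-link⁻ d
    ... | _ , ne , l→ = inj₁ (end-A kx)
    ... | _ , ne , l← = inj₁ (end-A ky)
    ... | _ , ne , r→ = inj₂ (end-B kx)
    ... | _ , ne , r← = inj₂ (end-B ky)
    ... | _ , ne , p→ {j} {g} = ⊥-elim (no-end j g (λ p → ne (pE-cong p)) kx ky)
    ... | _ , ne , p← {j} {g} = ⊥-elim (no-end j g (λ p → ne (pE-cong p)) ky kx)

-- H is a spider with centre v; the broom it is compared with is itself a spider, with centre A.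
module Spider {m q m′ n′ q′ : ℕ} {H : Rel (V m′ n′ q′)} (sy : Symm H) (ir : Irr H) (t : Total H)
  {v w₁ w₂ w₃ z₁ z₂} (bd : Bad H v w₁ w₂ w₃ z₁ z₂) (dv : Deg H v (suc m)) where

  open Bad bd

  total-vw₁ : Total (Del H v w₁)
  total-vw₁ = del-total _≟_ sy t a₂ (n₁₂ ∘ sym) b₁ k₁ (ir a₁)

  total-vw₂ : Total (Del H v w₂)
  total-vw₂ = del-total _≟_ sy t a₁ n₁₂ b₂ k₂ (ir a₂)

  -- A cut of `v w₁` or `v w₂` would leave `v` with degree `m`, which is neither `suc m` nor `2`; by
  -- `leafy-hub` all neighbours of `v` would be leaves, but the other long arm remains. The fourth
  -- neighbour makes the cut at `w₃` useless.
  big-bound : (s : Share m 1 q H) → 3 ≤ m → ∀ {w₃′} → H v w₃′ → w₃′ ≢ w₁ → w₃′ ≢ w₂ → w₃′ ≢ w₃ →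
              Any (Match s) (inj₁ (w₁ , z₁) ∷ inj₁ (w₂ , z₂) ∷ [])
  big-bound s m≥3 a₄ r₁ r₂ r₃ with bad-list₄ sy ir s bd a₄ r₁ r₂ r₃
  ... | here p = ⊥-elim (leafy-hub (at s p) (total⇒path (at s p) total-vw₁) m≥3 (deg-del H (ir a₁) a₁ dv)
                   (ℕ.<⇒≢ (ℕ.n<1+n m)) (λ { refl → ℕ.1+n≰n m≥3 }) (a₂ , fan n₁₂ (ir a₂)) (b₂ , off (ir a₂ ∘ sym) (n₁₂ ∘ sym)) k₂)
  ... | there (here p) = ⊥-elim (leafy-hub (at s p) (total⇒path (at s p) total-vw₂) m≥3 (deg-del H (ir a₂) a₂ dv)
                   (ℕ.<⇒≢ (ℕ.n<1+n m)) (λ { refl → ℕ.1+n≰n m≥3 }) (a₁ , fan (n₁₂ ∘ sym) (ir a₁)) (b₁ , off (ir a₁ ∘ sym) n₁₂) k₁)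
  ... | there (there (here p)) = here p
  ... | there (there (there p)) = there p

module Spider₂ {q m′ n′ q′ : ℕ} {H : Rel (V m′ n′ q′)} (sy : Symm H) (ir : Irr H) (t : Total H)
  {v w₁ w₂ w₃ z₁ z₂} (bd : Bad H v w₁ w₂ w₃ z₁ z₂) (dv : Deg H v 3) (only : ∀ x → Three H x → x ≡ v) where

  open Bad bd
  open Spider {2} {q} sy ir t bd dv using (total-vw₁; total-vw₂)

  -- After a cut at `v` no vertex has three neighbours. Among the path edges of the broom `2 1 q`
  -- only the first one achieves this, since any other leaves `A` with degree three.
  star-edge : ∀ {w} → H v w → Total (Del H v w) → ∀ {e : GEdge 2 1 q} → Del H v w ≅ D e → e ≡ pE 0 z≤n
  star-edge {w} a tot {e} ψ with total⇒path ψ tot | degA-back ψ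
  ... | path _ _ | _ , _ , h00 _ , _ = refl
  ... | path _ _ | _ , _ , h0 _ , _ = refl
  ... | path _ _ | _ , _ , hq _ , da , _ = ⊥-elim (small (three da ℕ.≤-refl))
    where
    small : ∀ {x} → ¬ Three (Del H v w) x
    small th = ¬three (deg-del H (ir a) a dv) ℕ.≤-refl (subst (Three _) (only _ (three-mono proj₁ th)) th)
  ... | path _ _ | _ , _ , hi _ , da , _ = ⊥-elim (small (three da ℕ.≤-refl))
    where
    small : ∀ {x} → ¬ Three (Del H v w) x
    small th = ¬three (deg-del H (ir a) a dv) ℕ.≤-refl (subst (Three _) (only _ (three-mono proj₁ th)) th)

  -- The cuts at `w₁` and at `w₂` both stand for the first path edge of the broom, so they have a
  -- common code: five cuts, four codes.
  bound₄ : (s : Share 2 1 q H) → Any (Match s) (inj₂ (pE 0 z≤n) ∷ inj₁ (v , w₃) ∷ inj₁ (w₁ , z₁) ∷ inj₁ (w₂ , z₂) ∷ [])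
  bound₄ s with bad-list sy ir s bd
  ... | here p = here (star-edge a₁ total-vw₁ (at s p))
  ... | there (here p) = here (star-edge a₂ total-vw₂ (at s p))
  ... | there (there p) = there p

  -- All three arms are long here: a cut within one arm leaves `v` with the other two, so only the
  -- cuts at `v` remain, and these all stand for one edge of the broom.
  bound₁ : (s : Share 2 1 q H) → ∀ {z₃} → H w₃ z₃ → z₃ ≢ v → z₂ ≢ w₁ → z₃ ≢ w₁ → z₁ ≢ w₂ → z₃ ≢ w₂ →
           Any (Match s) (inj₂ (pE 0 z≤n) ∷ [])
  bound₁ s {z₃} b₃ k₃ x₂₁ x₃₁ x₁₂ x₃₂ with bad-list sy ir s bd
  ... | here p = here (star-edge a₁ total-vw₁ (at s p))
  ... | there (here p) = here (star-edge a₂ total-vw₂ (at s p))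
  ... | there (there (here p)) = here (star-edge a₃ (del-total _≟_ sy t a₁ n₁₃ b₃ k₃ (ir a₃)) (at s p))
  ... | there (there (there (here p))) =
    ⊥-elim (no-bad (at s p) (a₂ , off (ir a₁) (k₁ ∘ sym)) (a₃ , off (ir a₁) (k₁ ∘ sym)) (a₁ , off (ir a₁) (k₁ ∘ sym))
      n₂₃ (n₁₂ ∘ sym) (n₁₃ ∘ sym) (b₂ , apart-edge (n₁₂ ∘ sym) x₂₁) k₂ (b₃ , apart-edge (n₁₃ ∘ sym) x₃₁) k₃)
  ... | there (there (there (there (here p)))) =
    ⊥-elim (no-bad (at s p) (a₁ , off (ir a₂) (k₂ ∘ sym)) (a₃ , off (ir a₂) (k₂ ∘ sym)) (a₂ , off (ir a₂) (k₂ ∘ sym))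
      n₁₃ n₁₂ (n₂₃ ∘ sym) (b₁ , apart-edge n₁₂ x₁₂) k₁ (b₃ , apart-edge (n₂₃ ∘ sym) x₃₂) k₃)

  leaf-leg : ∀ {w z} → H v w → H w z → z ≢ v → (∀ x → H w x → x ≡ v ⊎ x ≡ z) → (∀ x → H z x → x ≡ w) → K₂ (Del H v w) w z
  leaf-leg {w} {z} a b k nw nz = (b , fan′) , f , λ x h → nz x (proj₁ h)
    where
    fan′ : ¬ Same v w w z
    fan′ = apart-edge (ir a ∘ sym) k
    f : ∀ x → Del H v w w x → x ≡ z
    f x (h , n) with nw x h
    ... | inj₁ refl = ⊥-elim (n (inj₂ (refl , refl)))
    ... | inj₂ r = r

  -- The arm `w z` would become an isolated edge next to the removed `pE 0`; with two left leaves
  -- and one right leaf this happens only for `q = 0`.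
  not-short : ∀ {w z} → H v w → H w z → z ≢ v → (∀ x → H w x → x ≡ v ⊎ x ≡ z) → (∀ x → H z x → x ≡ w) → q ≢ 0 →
              Total (Del H v w) → ∀ {e : GEdge 2 1 q} → ¬ (Del H v w ≅ D e)
  not-short a b k nw nz q≢0 tot ψ with star-edge a tot ψ
  ... | refl with K₂-edge Fin.zero Fin.zero z≤n (K₂-iso {F = D (pE 0 z≤n)} ψ (leaf-leg a b k nw nz))
  ...   | inj₂ (_ , p) = q≢0 (sym p)

  -- `z` becomes isolated, so a leaf edge is removed; as `v` keeps degree three, it is not a left
  -- one, which would leave both hubs with degree two.
  pendant-edge : ∀ {w z} → H v w → H w z → z ≢ v → (∀ x → H z x → x ≡ w) → ∀ {e : GEdge 2 1 q} → Del H w z ≅ D e → e ≡ rE Fin.zero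
  pendant-edge {w} {z} a b k nz ψ with isolated⇒leaf Fin.zero Fin.zero ψ {z} alone | deg-hub ψ ℕ.≤-refl (deg-del-off H (ir a) (k ∘ sym) dv)
    where
    alone : ∀ x → ¬ Del H w z z x
    alone x (h , n) with nz x h
    ... | refl = n (inj₂ (refl , refl))
  ... | leafˡ _ | _ , _ , hl , inj₁ (_ , ())
  ... | leafˡ _ | _ , _ , hl , inj₂ (_ , ())
  ... | leafʳ Fin.zero | _ = refl

  -- The arm has length three and the cut leaves `z y` as an isolated edge, which in the broom
  -- `2 1 q` can only be `B` with its leaf.
  middle-edge : ∀ {w z y} → H v w → H w z → z ≢ v → H z y → y ≢ w → (∀ x → H z x → x ≡ w ⊎ x ≡ y) → (∀ x → H y x → x ≡ z) →
                ∀ {e : GEdge 2 1 q} → Del H w z ≅ D e → e ≡ pE q ℕ.≤-refl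
  middle-edge {w} {z} {y} a b k c y≢w nz ny ψ
    with total⇒path ψ (del-total _≟_ sy t (sy a) (k ∘ sym) c y≢w (ir b))
  ... | path i h with K₂-edge Fin.zero Fin.zero h (K₂-iso {F = D (pE i h)} ψ
        ((c , apart-edge (ir b ∘ sym) y≢w) , f , λ x p → ny x (proj₁ p)))
    where
    f : ∀ x → Del H w z z x → x ≡ y
    f x (p , n) with nz x p
    ... | inj₁ refl = ⊥-elim (n (inj₂ (refl , refl)))
    ... | inj₂ r = r
  ...   | inj₂ (_ , r) = pE-cong r

  short-short : (s : Share 2 1 q H) → q ≢ 0 →
    (∀ x → H w₁ x → x ≡ v ⊎ x ≡ z₁) → (∀ x → H z₁ x → x ≡ w₁) →
    (∀ x → H w₂ x → x ≡ v ⊎ x ≡ z₂) → (∀ x → H z₂ x → x ≡ w₂) →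
    Any (Match s) (inj₁ (v , w₃) ∷ inj₂ (rE Fin.zero) ∷ [])
  short-short s q≢0 f₁ g₁ f₂ g₂ with bad-list sy ir s bd
  ... | here p = ⊥-elim (not-short a₁ b₁ k₁ f₁ g₁ q≢0 total-vw₁ (at s p))
  ... | there (here p) = ⊥-elim (not-short a₂ b₂ k₂ f₂ g₂ q≢0 total-vw₂ (at s p))
  ... | there (there (here p)) = here p
  ... | there (there (there (here p))) = there (here (pendant-edge a₁ b₁ k₁ g₁ (at s p)))
  ... | there (there (there (there (here p)))) = there (here (pendant-edge a₂ b₂ k₂ g₂ (at s p)))

  long-long : (s : Share 2 1 q H) → ∀ {y₁ y₂} →
    H z₁ y₁ → y₁ ≢ w₁ → (∀ x → H z₁ x → x ≡ w₁ ⊎ x ≡ y₁) → (∀ x → H y₁ x → x ≡ z₁) →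
    H z₂ y₂ → y₂ ≢ w₂ → (∀ x → H z₂ x → x ≡ w₂ ⊎ x ≡ y₂) → (∀ x → H y₂ x → x ≡ z₂) →
    Any (Match s) (inj₂ (pE 0 z≤n) ∷ inj₁ (v , w₃) ∷ inj₂ (pE q ℕ.≤-refl) ∷ [])
  long-long s c₁ d₁ f₁ g₁ c₂ d₂ f₂ g₂ with bound₄ s
  ... | here p = here p
  ... | there (here p) = there (here p)
  ... | there (there (here p)) = there (there (here (middle-edge a₁ b₁ k₁ c₁ d₁ f₁ g₁ (at s p))))
  ... | there (there (there (here p))) = there (there (here (middle-edge a₂ b₂ k₂ c₂ d₂ f₂ g₂ (at s p))))

  -- The second leg has length two, and cutting off the first one leaves two parts of four vertices.
  long-short : (s : Share 2 1 q H) → q ≢ 0 → (∀ x → H w₂ x → x ≡ v ⊎ x ≡ z₂) → (∀ x → H z₂ x → x ≡ w₂) →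
    (c : V m′ n′ q′ → Bool) → Closed (Del H v w₁) c → Card (λ x → c x ≡ true) 4 → Card (λ x → c x ≡ false) 4 →
    Any (Match s) (inj₁ (v , w₃) ∷ inj₁ (w₁ , z₁) ∷ inj₁ (w₂ , z₂) ∷ [])
  long-short s q≢0 f g c cl ct cf with bad-list sy ir s bd
  ... | there (here p) = ⊥-elim (not-short a₂ b₂ k₂ f g q≢0 total-vw₂ (at s p))
  ... | there (there p) = p
  ... | here p = ⊥-elim (uneven (at s p))
    where
    uneven : ∀ {e : GEdge 2 1 q} → ¬ (Del H v w₁ ≅ D e)
    uneven ψ with star-edge a₁ total-vw₁ ψ
    ... | refl with closed-size-path z≤n (closed-iso ψ cl)
                      (card-iso ψ (λ p → trans (cong c (from-to ψ _)) p) id ct) (card-iso ψ (λ p → trans (cong c (from-to ψ _)) p) id cf)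
    ...   | inj₁ (_ , ())
    ...   | inj₂ (_ , ())

-- Automorphisms of G - e, and new edges that give back the broom.

module _ {V : Set} (_≟′_ : DecidableEquality V) where

  swap : V → V → V → V
  swap u v w with w ≟′ u | w ≟′ v
  ... | yes _ | _     = v
  ... | no _  | yes _ = u
  ... | no _  | no _  = w

  swap-u : ∀ u v → swap u v u ≡ v
  swap-u u v with u ≟′ u | u ≟′ v
  ... | yes _ | _ = refl
  ... | no p  | _ = ⊥-elim (p refl)

  swap-v : ∀ u v → swap u v v ≡ u
  swap-v u v with v ≟′ u | v ≟′ v
  ... | yes refl | _ = refl
  ... | no _ | yes _ = refl
  ... | no _ | no p  = ⊥-elim (p refl)

  swap-off : ∀ {u v w} → w ≢ u → w ≢ v → swap u v w ≡ w
  swap-off {u} {v} {w} p r with w ≟′ u | w ≟′ v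
  ... | yes x | _ = ⊥-elim (p x)
  ... | no _ | yes x = ⊥-elim (r x)
  ... | no _ | no _ = refl

  swap-invol : ∀ u v w → swap u v (swap u v w) ≡ w
  swap-invol u v w with w ≟′ u | w ≟′ v
  ... | yes refl | _     = swap-v u v
  ... | no _  | yes refl = swap-u u v
  ... | no p  | no r     = swap-off p r

  twins : ∀ {F : Rel V} → Symm F → Irr F → ∀ u v → (∀ {w} → w ≢ v → F u w → F v w) → (∀ {w} → w ≢ u → F v w → F u w) → F ≅ F
  twins {F} sy ir u v f g = mkIso (swap u v) (swap u v) (swap-invol u v) (swap-invol u v) pr pr
    where
    pr : ∀ {x y} → F x y → F (swap u v x) (swap u v y)
    pr {x} {y} h with x ≟′ u | x ≟′ v | y ≟′ u | y ≟′ v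
    ... | yes refl | _ | yes refl | _ = ⊥-elim (ir h refl)
    ... | yes refl | _ | no _ | yes refl = sy h
    ... | yes refl | _ | no _ | no r = f r h
    ... | no _ | yes refl | yes refl | _ = sy h
    ... | no _ | yes refl | no _ | yes refl = ⊥-elim (ir h refl)
    ... | no _ | yes refl | no p | no _ = g p h
    ... | no p | no r | yes refl | _ = sy (f r (sy h))
    ... | no p | no r | no _ | yes refl = sy (g p (sy h))
    ... | no _ | no _ | no _ | no _ = h

module _ {m n q : ℕ} where

  lE-inj : ∀ {a b} → lE {m} {n} {q} a ≡ lE b → a ≡ b
  lE-inj refl = refl

  -- If an automorphism of G - e takes the new edge to the removed one, then H is the broom again.
  -- Most of the harmless pairs `x`, `y` are settled in this way.
  restore : ∀ {e : GEdge m n q} {x y} (φ : D e ≅ D e) → Same (src e) (tgt e) (to φ x) (to φ y) → Add (D e) x y ≅ G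
  restore {e} {x} {y} φ s = ≅-trans (≅-add φ x y) (≅-trans (≅-id fwd bwd) (add-del _≟_ (e , link e) G-symm))
    where
    fwd : ∀ {u v} → Add (D e) (to φ x) (to φ y) u v → Add (Del G (src e) (tgt e)) (src e) (tgt e) u v
    fwd (inj₁ (g , n)) = inj₁ (g , n)
    fwd (inj₂ r) = inj₂ (same-trans s r)
    bwd : ∀ {u v} → Add (Del G (src e) (tgt e)) (src e) (tgt e) u v → Add (D e) (to φ x) (to φ y) u v
    bwd (inj₁ (g , n)) = inj₁ (g , n)
    bwd (inj₂ r) = inj₂ (same-trans (same-sym s) r)

  D-id : ∀ {e : GEdge m n q} → D e ≅ D e
  D-id = ≅-id id id

  restore-swap : ∀ {e : GEdge m n q} u v → (∀ {w} → w ≢ v → D e u w → D e v w) → (∀ {w} → w ≢ u → D e v w → D e u w) → D e ≅ D e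
  restore-swap u v = twins _≟_ D-symm D-irr u v

  mirror : ∀ {i} .{h : i ≤ q} .{h₁ h₂} → Link {m} {n} (pE (q ∸ i) (ℕ.m∸n≤m q i)) (pv (suc q ∸ i) h₁) (pv (q ∸ i) h₂)
  mirror {i} {h} = link-resp (pv-cong (sym (ℕ.+-∸-assoc 1 (recompute (i ℕ.≤? q) h)))) refl (p← {h₂ = s≤s (ℕ.m∸n≤m q i)})

module Mirror {n q : ℕ} (a : Fin (suc n)) where

  private
    H : Rel (V (suc n) n q)
    H = Add (D (lE a)) (lv a) B

  -- With the leaf `lv a` moved to `B` the hubs exchange their numbers `suc n` and `n` of leaves.
  -- `θ` reflects the path, keeps `lv a`, and pairs the other left leaves with the right ones by
  -- `punchOut` and `punchIn`.
  θ : V (suc n) n q → V (suc n) n q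
  θ (pv i _) = pv (suc q ∸ i) (ℕ.m∸n≤m (suc q) i)
  θ (lv a′) with a Fin.≟ a′
  ... | yes _ = lv a
  ... | no p  = rv (punchOut p)
  θ (rv b) = lv (punchIn a b)

  θ-invol : ∀ v → θ (θ v) ≡ v
  θ-invol (pv i h) = pv-cong (ℕ.m∸[m∸n]≡n (recompute (i ℕ.≤? suc q) h))
  θ-invol (lv a′) with a Fin.≟ a′
  ... | no p = cong lv (Fin.punchIn-punchOut p)
  ... | yes refl with a Fin.≟ a
  ...   | yes _ = refl
  ...   | no p  = ⊥-elim (p refl)
  θ-invol (rv b) with a Fin.≟ punchIn a b
  ... | yes p = ⊥-elim (Fin.punchInᵢ≢i a b (sym p))
  ... | no p  = cong rv (trans (Fin.punchOut-cong a refl) (Fin.punchOut-punchIn a))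

  fwd : ∀ {u v} → H u v → G (θ u) (θ v)
  fwd (inj₁ d) with D-link⁻ d
  ... | _ , _ , p→ {h = h} = _ , mirror {h = h}
  ... | _ , _ , p← {h = h} = _ , link-symm (mirror {h = h})
  ... | _ , ne , l→ {a′} with a Fin.≟ a′
  ...   | yes refl = ⊥-elim (ne refl)
  ...   | no _ = _ , r→
  fwd (inj₁ d) | _ , ne , l← {a′} with a Fin.≟ a′
  ...   | yes refl = ⊥-elim (ne refl)
  ...   | no _ = _ , r←
  fwd (inj₁ d) | _ , _ , r→ = _ , link-resp {u = A} (pv-cong (sym (ℕ.n∸n≡0 q))) refl l→
  fwd (inj₁ d) | _ , _ , r← = _ , link-resp {v = A} refl (pv-cong (sym (ℕ.n∸n≡0 q))) l←
  fwd (inj₂ (inj₁ (refl , refl))) with a Fin.≟ a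
  ... | yes _ = _ , link-resp {v = A} refl (pv-cong (sym (ℕ.n∸n≡0 q))) l←
  ... | no p  = ⊥-elim (p refl)
  fwd (inj₂ (inj₂ (refl , refl))) with a Fin.≟ a
  ... | yes _ = _ , link-resp {u = A} (pv-cong (sym (ℕ.n∸n≡0 q))) refl l→
  ... | no p  = ⊥-elim (p refl)

  bwd : ∀ {u v} → G u v → H (θ u) (θ v)
  bwd (_ , p→ {h = h}) = inj₁ (D-link (λ ()) (mirror {h = h}))
  bwd (_ , p← {h = h}) = inj₁ (D-link (λ ()) (link-symm (mirror {h = h})))
  bwd (_ , l→ {a′}) with a Fin.≟ a′
  ... | yes refl = inj₂ (inj₂ (refl , refl))
  ... | no p = inj₁ (D-link (λ ()) r→)
  bwd (_ , l← {a′}) with a Fin.≟ a′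
  ... | yes refl = inj₂ (inj₁ (refl , refl))
  ... | no p = inj₁ (D-link (λ ()) r←)
  bwd (_ , r→ {b}) = inj₁ (D-link (Fin.punchInᵢ≢i a b ∘ lE-inj)
    (link-resp {e = lE (punchIn a b)} {u = A} (pv-cong (sym (ℕ.n∸n≡0 q))) refl l→))
  bwd (_ , r← {b}) = inj₁ (D-link (Fin.punchInᵢ≢i a b ∘ lE-inj)
    (link-resp {e = lE (punchIn a b)} {v = A} refl (pv-cong (sym (ℕ.n∸n≡0 q))) l←))

  leaf-to-B : H ≅ G {suc n} {n} {q}
  leaf-to-B = mkIso θ θ θ-invol θ-invol fwd bwd

-- For m = 1 the left component of G - e, e the path edge i, is a path, which can be reversed.
module Reverse {n q i : ℕ} (h : i ≤ q) where

  rev : V 1 n q → V 1 n q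
  rev (pv j g) with ℕ.<-cmp j i
  ... | tri< _ _ _ = pv (i ∸ suc j) (ℕ.≤-trans (ℕ.m∸n≤m i (suc j)) (ℕ.m≤n⇒m≤1+n h))
  ... | tri≈ _ _ _ = lv Fin.zero
  ... | tri> _ _ _ = pv j g
  rev (lv _) = pv i (ℕ.m≤n⇒m≤1+n h)
  rev (rv b) = rv b

  rev-< : ∀ {j} .{g} → j < i → rev (pv j g) ≡ pv (i ∸ suc j) (ℕ.≤-trans (ℕ.m∸n≤m i (suc j)) (ℕ.m≤n⇒m≤1+n h))
  rev-< {j} p with ℕ.<-cmp j i
  ... | tri< _ _ _ = refl
  ... | tri≈ ¬p _ _ = ⊥-elim (¬p p)
  ... | tri> ¬p _ _ = ⊥-elim (¬p p)

  rev-≡ : ∀ .{g} → rev (pv i g) ≡ lv Fin.zero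
  rev-≡ with ℕ.<-cmp i i
  ... | tri< _ ¬p _ = ⊥-elim (¬p refl)
  ... | tri≈ _ _ _ = refl
  ... | tri> _ ¬p _ = ⊥-elim (¬p refl)

  rev-> : ∀ {j} .{g} → i < j → rev (pv j g) ≡ pv j g
  rev-> {j} p with ℕ.<-cmp j i
  ... | tri< _ _ ¬p = ⊥-elim (¬p p)
  ... | tri≈ _ _ ¬p = ⊥-elim (¬p p)
  ... | tri> _ _ _ = refl

  rev-invol : ∀ v → rev (rev v) ≡ v
  rev-invol (lv Fin.zero) = rev-≡
  rev-invol (rv b) = refl
  rev-invol (pv j g) with ℕ.<-cmp j i
  ... | tri> _ _ p = rev-> p
  ... | tri≈ _ refl _ = refl
  ... | tri< p _ _ = trans (rev-< (ℕ.∸-monoʳ-< {i} {suc j} {0} (s≤s z≤n) p)) (pv-cong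
    (trans (cong (i ∸_) (sym (ℕ.+-∸-assoc 1 p))) (ℕ.m∸[m∸n]≡n (ℕ.<⇒≤ p))))

  step : ∀ j .{g₁ g₂} → j ≢ i → j ≤ q → D (pE i h) (rev (pv j g₁)) (rev (pv (suc j) g₂))
  step j {g₁} {g₂} ne j≤q with ℕ.<-cmp j i
  ... | tri≈ _ p _ = ⊥-elim (ne p)
  ... | tri> _ _ i<j rewrite rev-> {suc j} {g₂} (ℕ.m≤n⇒m≤1+n i<j) = D-link {e′ = pE j j≤q} (ne ∘ pE-inj) p→
  ... | tri< j<i _ _ with ℕ.<-cmp (suc j) i
  ...   | tri> _ _ i≤j = ⊥-elim (ℕ.<⇒≱ j<i (ℕ.≤-pred i≤j))
  ...   | tri≈ _ refl _ = D-link (λ ()) (link-resp {u = A} (pv-cong (sym (ℕ.n∸n≡0 (suc j)))) refl l→)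
  ...   | tri< sj<i _ _ = D-link {e′ = pE (i ∸ suc (suc j)) (ℕ.≤-trans (ℕ.m∸n≤m i (suc (suc j))) h)}
          (λ p → ℕ.<⇒≢ (ℕ.∸-monoʳ-< {i} {suc (suc j)} {0} (s≤s z≤n) sj<i) (pE-inj p))
          (link-resp {u = pv (suc (i ∸ suc (suc j))) (s≤s (ℕ.≤-trans (ℕ.m∸n≤m i (suc (suc j))) h))}
            (pv-cong (sym (ℕ.+-∸-assoc 1 sj<i))) refl p←)

  leaf : ∀ {a} → D {1} {n} (pE i h) (rev A) (rev (lv a))
  leaf with ℕ.<-cmp 0 i
  ... | tri≈ _ refl _ = D-link (λ ()) l←
  ... | tri< (s≤s {n = i′} _) _ _ = D-link {e′ = pE i′ (ℕ.≤-trans (ℕ.n≤1+n i′) h)} (λ p → ℕ.1+n≢n (sym (pE-inj p))) p→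

  right : ∀ {b} → D {1} {n} (pE i h) (rev B) (rv b)
  right rewrite rev-> {suc q} {ℕ.≤-refl} (s≤s h) = D-link (λ ()) r→

  pres-rev : ∀ {u v} → D (pE i h) u v → D (pE i h) (rev u) (rev v)
  pres-rev d with D-link⁻ d
  ... | _ , ne , p→ {j} {g} = step j (ne ∘ pE-cong) (recompute (j ℕ.≤? q) g)
  ... | _ , ne , p← {j} {g} = D-symm (step j (ne ∘ pE-cong) (recompute (j ℕ.≤? q) g))
  ... | _ , _ , l→ {a} = leaf {a}
  ... | _ , _ , l← {a} = D-symm (leaf {a})
  ... | _ , _ , r→ = right
  ... | _ , _ , r← = D-symm right

  rev-iso : D (pE {1} {n} i h) ≅ D (pE i h)
  rev-iso = mkIso rev rev rev-invol rev-invol pres-rev pres-rev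

module ReverseRight {m q i : ℕ} (h : i ≤ q) where

  private
    i′ = q ∸ i
    h′ = ℕ.m∸n≤m q i
    e₀ : GEdge m 1 q
    e₀ = pE i h
  open Reverse {m} {q} {i′} h′

  D-resp : ∀ {d d′ : GEdge m 1 q} → d ≡ d′ → D d ≅ D d′
  D-resp p = ≅-id (λ {u} {v} → subst (λ d → D d u v) p) (λ {u} {v} → subst (λ d → D d u v) (sym p))

  rev-isoʳ : D e₀ ≅ D e₀
  rev-isoʳ = ≅-trans (ρ-D e₀) (≅-trans rev-iso (≅-trans (ρ-D (pE i′ h′)) (D-resp (ρᴱ-invol e₀))))

  revʳ-rv : to rev-isoʳ (rv Fin.zero) ≡ pv (suc i) (s≤s h)
  revʳ-rv = pv-cong (trans (ℕ.+-∸-assoc 1 h′) (cong suc (ℕ.m∸[m∸n]≡n h)))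

  revʳ-left : ∀ {j} .{g} → j ≤ i → to rev-isoʳ (pv j g) ≡ pv j g
  revʳ-left {j} {g} j≤i = trans (cong ρ (rev-> {suc q ∸ j} {ℕ.m∸n≤m (suc q) j} lt)) (ρ-invol (pv j g))
    where
    lt : q ∸ i < suc q ∸ j
    lt = ℕ.≤-trans (ℕ.≤-reflexive (sym (ℕ.+-∸-assoc 1 h))) (ℕ.∸-monoʳ-≤ (suc q) j≤i)

-- Adding an edge to G - e; branching vertices of leaf decards.

module AddEdge {m n q : ℕ} {e₀ : GEdge m n q} {x y : V m n q} (x≢y : x ≢ y) (¬xy : ¬ D e₀ x y) where

  H : Rel (V m n q)
  H = Add (D e₀) x y

  sy : Symm H
  sy = add-symm D-symm

  ir : Irr H
  ir = add-irr x≢y D-irr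

  lk : ∀ {e u v} → e ≢ e₀ → Link e u v → H u v
  lk ne l = inj₁ (D-link ne l)

  xy : H x y
  xy = inj₂ (inj₁ (refl , refl))

  yx : H y x
  yx = inj₂ (inj₂ (refl , refl))

  degH-x : ∀ {k} → Deg (D e₀) x k → Deg H x (suc k)
  degH-x = deg-add (D e₀) x≢y ¬xy

  degH-y : ∀ {k} → Deg (D e₀) y k → Deg H y (suc k)
  degH-y = deg-addʳ (D e₀) x≢y (¬xy ∘ D-symm)

  degH-off : ∀ {v k} → v ≢ x → v ≢ y → Deg (D e₀) v k → Deg H v k
  degH-off = deg-add-off (D e₀)

  three-H : ∀ {v} → Three H v → v ≡ A ⊎ v ≡ B ⊎ v ≡ x ⊎ v ≡ y
  three-H {v} t with v ≟ x | v ≟ y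
  ... | yes p | _ = inj₂ (inj₂ (inj₁ p))
  ... | no _ | yes p = inj₂ (inj₂ (inj₂ p))
  ... | no p | no r with three-mono {F = G} old t
    where
    old : ∀ {w} → H v w → G v w
    old (inj₁ d) = D⇒G d
    old (inj₂ s) = ⊥-elim (off p r s)
  ...   | mk3 a b c n₁ n₂ n₃ with hub a b c n₁ n₂ n₃
  ...     | inj₁ s = inj₁ s
  ...     | inj₂ s = inj₂ (inj₁ s)

  old-nbr : ∀ {v} → v ≢ x → v ≢ y → ∀ {w} → H v w → D e₀ v w
  old-nbr p r (inj₁ d) = d
  old-nbr p r (inj₂ s) = ⊥-elim (off p r s)

deg-drop : ∀ {V : Set} (_≟′_ : DecidableEquality V) {H : Rel V} → Symm H → Irr H → ∀ {u v w k} → H u v → Deg H w (suc k) →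
           ∃ λ k′ → k ≤ k′ × Deg (Del H u v) w k′
deg-drop _≟′_ {H} sy ir {u} {v} {w} h d with w ≟′ u | w ≟′ v
... | yes refl | _ = _ , ℕ.≤-refl , deg-del H (ir h) h d
... | no _ | yes refl = _ , ℕ.≤-refl , deg-delʳ H (ir h) (sy h) d
... | no p | no r = _ , ℕ.n≤1+n _ , deg-del-off H p r d

module _ {m n q : ℕ} where

  leaf-deg : ∀ {e : GEdge m n q} {a b} → IsLeaf e → HubDeg e a b → (a ≡ m × b ≡ suc n) ⊎ (a ≡ suc m × b ≡ n)
  leaf-deg _ hl = inj₁ (refl , refl)
  leaf-deg _ hr = inj₂ (refl , refl)

  module _ {V : Set} {F : Rel V} {e : GEdge m n q} (ψ : F ≅ D e) where

    two-hubs : ∀ {u v w} → Three F u → Three F v → Three F w → u ≢ v → u ≢ w → v ≢ w → ⊥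
    two-hubs tu tv tw n₁ n₂ n₃ with to-hub ψ tu | to-hub ψ tv | to-hub ψ tw
    ... | inj₁ p | inj₁ r | _ = n₁ (to-inj ψ (trans p (sym r)))
    ... | inj₂ p | inj₂ r | _ = n₁ (to-inj ψ (trans p (sym r)))
    ... | inj₁ p | _ | inj₁ r = n₂ (to-inj ψ (trans p (sym r)))
    ... | inj₂ p | _ | inj₂ r = n₂ (to-inj ψ (trans p (sym r)))
    ... | _ | inj₁ p | inj₁ r = n₃ (to-inj ψ (trans p (sym r)))
    ... | _ | inj₂ p | inj₂ r = n₃ (to-inj ψ (trans p (sym r)))

    -- With one right leaf, `B` has degree at most two in a leaf decard, so only `A` can have three
    -- neighbours.
    one-hub : IsLeaf e → n ≡ 1 → ∀ {u v k l} → u ≢ v → 3 ≤ k → 3 ≤ l → Deg F u k → Deg F v l → ⊥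
    one-hub il refl ne k≥3 l≥3 du dv with deg-hubs ψ ne k≥3 l≥3 du dv
    ... | _ , _ , h , p with leaf-deg il h | p
    ...   | inj₁ (refl , refl) | inj₁ (_ , refl) = case l≥3 where
      case : ¬ 3 ≤ 2
      case (s≤s (s≤s ()))
    ...   | inj₁ (refl , refl) | inj₂ (refl , _) = case k≥3 where
      case : ¬ 3 ≤ 2
      case (s≤s (s≤s ()))
    ...   | inj₂ (refl , refl) | inj₁ (_ , refl) = case l≥3 where
      case : ¬ 3 ≤ 1
      case (s≤s ())
    ...   | inj₂ (refl , refl) | inj₂ (refl , _) = case k≥3 where
      case : ¬ 3 ≤ 1
      case (s≤s ())

    some-hub : IsLeaf e → 3 ≤ m ⊎ 2 ≤ n × 2 ≤ m → ∃ (Three F)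
    some-hub il r with degA-back ψ
    ... | _ , _ , h , da , db with leaf-deg il h | r
    ...   | inj₁ (refl , refl) | inj₁ m≥3 = _ , three da m≥3
    ...   | inj₂ (refl , refl) | inj₁ m≥3 = _ , three da (ℕ.m≤n⇒m≤1+n m≥3)
    ...   | inj₁ (refl , refl) | inj₂ (n≥2 , _) = _ , three db (s≤s n≥2)
    ...   | inj₂ (refl , refl) | inj₂ (_ , m≥2) = _ , three da (s≤s m≥2)

-- The added edge avoids the isolated vertex lv a of D (lE a).
module Isolated {m n q : ℕ} (a : Fin m) (b₀ : Fin n) {x y : V m n q} (x≢y : x ≢ y) (¬xy : ¬ D (lE a) x y)
  (x≢a : x ≢ lv a) (y≢a : y ≢ lv a) where

  open AddEdge {e₀ = lE a} x≢y ¬xy public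

  lonely : ∀ w → ¬ H (lv a) w
  lonely w (inj₁ d) = leaf-isolatedˡ d
  lonely w (inj₂ s) = off (x≢a ∘ sym) (y≢a ∘ sym) s

  -- The isolated leaf survives every further cut, so only leaf edges of the broom can be involved.
  is-leaf : ∀ {u v} {e : GEdge m n q} → Del H u v ≅ D e → IsLeaf e
  is-leaf ψ = isolated⇒leaf a b₀ ψ {lv a} (λ w h → lonely w (proj₁ h))

  degD-A : Deg (D {m} {n} {q} (lE a)) A m
  degD-A = degD-src (lE a) deg-A

  degD-B : Deg (D {m} {n} {q} (lE a)) B (suc n)
  degD-B = degD-off (lE a) (λ ()) (λ ()) deg-B

  degD-int : ∀ {i} (h : i < q) → Deg (D {m} {n} {q} (lE a)) (pv (suc i) (ℕ.m≤n⇒m≤1+n h)) 2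
  degD-int h = degD-off (lE a) (λ ()) (λ ()) (deg-int h)

  degD-l : ∀ {a′} → a′ ≢ a → Deg (D {m} {n} {q} (lE a)) (lv a′) 1
  degD-l ne = degD-off (lE a) (λ ()) (ne ∘ lv-inj) (deg-l _)

  degD-r : ∀ {b} → Deg (D {m} {n} {q} (lE a)) (rv b) 1
  degD-r = degD-off (lE a) (λ ()) (λ ()) (deg-r _)

  -- The neighbour of pv (1 + j) on the far side from A.
  above : ∀ j → .(j ≤ q) → V m n q
  above j h with j ℕ.≟ q
  ... | yes _ = rv b₀
  ... | no ne = pv (suc (suc j)) (s≤s (ℕ.≤∧≢⇒< h ne))

  above-link : ∀ j .{h : j ≤ q} .{g} → H (pv (suc j) g) (above j h)
  above-link j {h} with j ℕ.≟ q
  ... | yes refl = lk (λ ()) r→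
  ... | no ne = lk {pE (suc j) (ℕ.≤∧≢⇒< h ne)} (λ ()) p→

  above≢ : ∀ j .{h : j ≤ q} {k} .{g} → k ≤ suc j → above j h ≢ pv k g
  above≢ j k≤ p with j ℕ.≟ q | p
  ... | no _ | refl = ℕ.1+n≰n k≤

  up : ∀ j .{g} .{g′} → H (pv j g) (pv (suc j) g′)
  up j {g} {g′} = lk {pE j (ℕ.≤-pred g′)} (λ ()) p→

  down : ∀ j .{g} .{g′} → H (pv (suc j) g′) (pv j g)
  down j {g} {g′} = sy (up j {g} {g′})

pv≢ : ∀ {m n q i j} .{h : i ≤ suc q} .{h′ : j ≤ suc q} → i ≢ j → pv {m} {n} i h ≢ pv j h′
pv≢ ne p = ne (pv-inj p)

¬3≤2 : ¬ 3 ≤ 2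
¬3≤2 (s≤s (s≤s ()))

2≤ : ∀ {n} → Fin n → n ≢ 1 → 2 ≤ n
2≤ {1} _ p = ⊥-elim (p refl)
2≤ {suc (suc n)} _ _ = s≤s (s≤s z≤n)

1≤ : ∀ {n} → Fin n → 1 ≤ n
1≤ {suc n} _ = s≤s z≤n

touches : ∀ {m n q} (w u v : V m n q) → (w ≡ u ⊎ w ≡ v) ⊎ (w ≢ u × w ≢ v)
touches w u v with w ≟ u | w ≟ v
... | yes p | _ = inj₁ (inj₁ p)
... | no _ | yes p = inj₁ (inj₂ p)
... | no p | no r = inj₂ (p , r)

both : ∀ {V : Set} {x y u v : V} → x ≢ y → x ≡ u ⊎ x ≡ v → y ≡ u ⊎ y ≡ v → Same x y u v
both x≢y (inj₁ p) (inj₁ r) = ⊥-elim (x≢y (trans p (sym r)))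
both x≢y (inj₂ p) (inj₂ r) = ⊥-elim (x≢y (trans p (sym r)))
both _ (inj₁ p) (inj₂ r) = inj₁ (sym p , sym r)
both _ (inj₂ p) (inj₁ r) = inj₂ (sym r , sym p)

-- A left leaf edge removed, and a new edge that closes a cycle.

module IntInt {n q i j : ℕ} (a : Fin 4) (b₀ : Fin n) (i<j : suc i < j) (j<q : j < q) where

  private
    i<q : i < q
    i<q = ℕ.<-trans (ℕ.<-trans (ℕ.n<1+n i) i<j) j<q
    x y : V 4 n q
    x = pv (suc i) (ℕ.m≤n⇒m≤1+n i<q)
    y = pv (suc j) (ℕ.m≤n⇒m≤1+n j<q)

  ¬adj : ¬ D (lE a) x y
  ¬adj d with D⇒G d
  ... | _ , p→ = ℕ.<-irrefl refl i<j
  ... | _ , p← = ℕ.<-asym (ℕ.<-trans (ℕ.n<1+n _) i<j) (ℕ.n<1+n j)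

  x≢y : x ≢ y
  x≢y = pv≢ (λ p → ℕ.<⇒≢ (ℕ.<-trans (ℕ.n<1+n i) i<j) (ℕ.suc-injective p))

  open Isolated a b₀ x≢y ¬adj (λ ()) (λ ()) hiding (xy)

  int≢B : ∀ {k} (h : k < q) → pv {4} {n} {q} (suc k) (ℕ.m≤n⇒m≤1+n h) ≢ B
  int≢B h = pv≢ (λ p → ℕ.<⇒≢ h (ℕ.suc-injective p))

  dA : Deg H A 4
  dA = degH-off (λ ()) (λ ()) degD-A

  dB : Deg H B (suc n)
  dB = degH-off (int≢B i<q ∘ sym) (int≢B j<q ∘ sym) degD-B

  dx : Deg H x 3
  dx = degH-x (degD-int i<q)

  dy : Deg H y 3
  dy = degH-y (degD-int j<q)

  module _ (s : Share 4 n q H) where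

    private
      F : Rel (V 4 n q)
      F = Del H (fa s) (fb s)
      il : IsLeaf (e s)
      il = is-leaf (iso s)

    tA : Three F A
    tA with deg-drop _≟_ sy ir (fab s) dA
    ... | _ , l , d = three d l

    keep : ∀ {v k} → v ≢ fa s × v ≢ fb s → Deg H v k → Deg F v k
    keep (p , r) d = deg-del-off H p r d

    -- A leaf decard has at most two vertices with three neighbours, and for `n = 1` only one. `A`
    -- remains such a vertex after any cut, so a further one `v` leaves no room for `B`: this needs
    -- `n = 2` and a cut at `B`.
    extra : ∀ {v} → A ≢ v → B ≢ v → Deg F v 3 → n ≡ 2 × (B ≡ fa s ⊎ B ≡ fb s)
    extra A≢v B≢v dv with n ℕ.≟ 1 | n ℕ.≟ 2 | touches B (fa s) (fb s)
    ... | yes p | _ | _ with deg-drop _≟_ sy ir (fab s) dA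
    ...   | _ , l , d = ⊥-elim (one-hub (iso s) il p A≢v l ℕ.≤-refl d dv)
    extra A≢v B≢v dv | no _ | yes p | inj₁ r = p , r
    extra A≢v B≢v dv | no p | _ | inj₂ r =
      ⊥-elim (two-hubs (iso s) tA (three (keep r dB) (s≤s (2≤ b₀ p))) (three dv ℕ.≤-refl) (λ ()) A≢v B≢v)
    extra A≢v B≢v dv | no p | no r | inj₁ _ with deg-drop _≟_ sy ir (fab s) dB
    ... | _ , l , d = ⊥-elim (two-hubs (iso s) tA (three d (ℕ.≤-trans (3≤ b₀ p r) l)) (three dv ℕ.≤-refl) (λ ()) A≢v B≢v)
      where
      3≤ : ∀ {n} → Fin n → n ≢ 1 → n ≢ 2 → 3 ≤ n
      3≤ {1} _ p _ = ⊥-elim (p refl)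
      3≤ {2} _ _ p = ⊥-elim (p refl)
      3≤ {suc (suc (suc n))} _ _ _ = s≤s (s≤s (s≤s z≤n))

    -- By `extra` neither end of the new edge may keep its degree, so the cut edge contains both.
    bound₁ : n ≢ 2 → Any (Match s) (inj₁ (x , y) ∷ [])
    bound₁ n≢2 with touches x (fa s) (fb s) | touches y (fa s) (fb s)
    ... | inj₁ p | inj₁ r = here (both x≢y p r)
    ... | inj₂ p | _ = ⊥-elim (n≢2 (proj₁ (extra (λ ()) (int≢B i<q ∘ sym) (keep p dx))))
    ... | inj₁ _ | inj₂ p = ⊥-elim (n≢2 (proj₁ (extra (λ ()) (int≢B j<q ∘ sym) (keep p dy))))

    -- The cut may also lower `B` and one of `x`, `y`. Of the two edges concerned only `y B` can be
    -- present, because `x` lies further from `B`.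
    bound₂ : Any (Match s) (inj₁ (x , y) ∷ inj₁ (y , B) ∷ [])
    bound₂ with touches x (fa s) (fb s) | touches y (fa s) (fb s)
    ... | inj₁ p | inj₁ r = here (both x≢y p r)
    ... | inj₂ p | inj₁ r = there (here (both (int≢B j<q) r (proj₂ (extra (λ ()) (int≢B i<q ∘ sym) (keep p dx)))))
    ... | inj₂ p | inj₂ r = ⊥-elim (two-hubs (iso s) tA (three (keep p dx) ℕ.≤-refl) (three (keep r dy) ℕ.≤-refl) (λ ()) (λ ()) x≢y)
    ... | inj₁ p | inj₂ r = ⊥-elim (far (both (int≢B i<q) p (proj₂ (extra (λ ()) (int≢B j<q ∘ sym) (keep r dy)))))
      where
      xB : ¬ H x B
      xB (inj₂ t) = off′ (int≢B i<q ∘ sym) (int≢B j<q ∘ sym) t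
      xB (inj₁ d) with D⇒G d
      ... | _ , p→ = ℕ.<-asym i<j j<q
      ... | _ , p← = ℕ.<⇒≢ (ℕ.<-trans i<q (ℕ.n<1+n q)) refl
      far : ¬ Same x B (fa s) (fb s)
      far (inj₁ (refl , refl)) = xB (fab s)
      far (inj₂ (refl , refl)) = xB (sy (fab s))

third : ∀ {k} (a b : Fin (3 + k)) → ∃ λ c → c ≢ a × c ≢ b
third Fin.zero Fin.zero = Fin.suc Fin.zero , (λ ()) , λ ()
third Fin.zero (Fin.suc Fin.zero) = Fin.suc (Fin.suc Fin.zero) , (λ ()) , λ ()
third Fin.zero (Fin.suc (Fin.suc b)) = Fin.suc Fin.zero , (λ ()) , λ ()
third (Fin.suc Fin.zero) Fin.zero = Fin.suc (Fin.suc Fin.zero) , (λ ()) , λ ()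
third (Fin.suc (Fin.suc a)) Fin.zero = Fin.suc Fin.zero , (λ ()) , λ ()
third (Fin.suc a) (Fin.suc b) = Fin.zero , (λ ()) , λ ()

avoid : ∀ {m n q} {V : Set} {H : Rel V} {e : GEdge m n q} {v w₁ w₂ w₃ z₁ z₂ a b} → Bad H v w₁ w₂ w₃ z₁ z₂ →
        v ≢ a → v ≢ b → w₁ ≢ a → w₁ ≢ b → w₂ ≢ a → w₂ ≢ b → ¬ (Del H a b ≅ D e)
avoid (mkBad a₁ a₂ a₃ n₁ n₂ n₃ b₁ k₁ b₂ k₂) p p′ r r′ t t′ ψ =
  no-bad ψ (a₁ , off p p′) (a₂ , off p p′) (a₃ , off p p′) n₁ n₂ n₃ (b₁ , off r r′) k₁ (b₂ , off t t′) k₂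

odd-vertex : ∀ {m n q} {V : Set} {F : Rel V} {e : GEdge m n q} (ψ : F ≅ D e) → IsLeaf e → ∀ {c} → Closed F c →
             ∃ λ l → ∀ x → x ≢ l → c (from ψ x) ≡ c (from ψ A)
odd-vertex ψ (leafˡ a) cl = lv a , one-colourˡ (closed-iso ψ cl)
odd-vertex ψ (leafʳ b) cl = rv b , one-colourʳ (closed-iso ψ cl)

-- A leaf decard is connected apart from a single vertex, so no closed colouring has two vertices of
-- each colour.
one-odd : ∀ {m n q} {V : Set} {F : Rel V} {e : GEdge m n q} (ψ : F ≅ D e) → IsLeaf e → ∀ {c} → Closed F c →
          ∀ {u v w t} → u ≢ v → w ≢ t → c u ≡ true → c v ≡ true → c w ≡ false → c t ≡ false → ⊥
one-odd {m} {n} {q} {V} {F} {e} ψ il {c} cl {u} {v} {w} {t} u≢v w≢t cu cv cw ct = clash (proj₁ odd) (proj₂ odd)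
  where
  c′ : _ → Bool
  c′ = c ∘ from ψ
  col : ∀ (x : V) → c′ (to ψ x) ≡ c x
  col x = cong c (from-to ψ x)
  odd = odd-vertex ψ il cl
  pick : ∀ l {x y} → x ≢ y → to ψ x ≢ l ⊎ to ψ y ≢ l
  pick l {x} {y} ne with to ψ x ≟ l
  ... | no p = inj₁ p
  ... | yes p = inj₂ λ r → ne (to-inj ψ (trans p (sym r)))
  clash : ∀ l → (∀ x → x ≢ l → c′ x ≡ c′ A) → ⊥
  clash l f with [ (λ p → trans (sym cu) (trans (sym (col u)) (f _ p))) , (λ p → trans (sym cv) (trans (sym (col v)) (f _ p))) ]′ (pick l u≢v)
                | [ (λ p → trans (sym cw) (trans (sym (col w)) (f _ p))) , (λ p → trans (sym ct) (trans (sym (col t)) (f _ p))) ]′ (pick l w≢t)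
  ... | p | r with trans p (sym r)
  ...   | ()

module IntHub {n q j : ℕ} (a : Fin (3 + n)) (b₀ : Fin n) (j<q : suc j < q) where

  private
    h₁ = ℕ.<⇒≤ j<q
    x : V (3 + n) n q
    x = pv (suc j) (ℕ.m≤n⇒m≤1+n h₁)

  x≢B : x ≢ B
  x≢B = pv≢ (ℕ.<⇒≢ (s≤s h₁))

  ¬adj : ¬ D (lE a) x B
  ¬adj d with D⇒G d
  ... | _ , p→ = ℕ.<-irrefl refl j<q
  ... | _ , p← = ℕ.<-asym j<q (ℕ.m<n⇒m<1+n (ℕ.n<1+n q))

  open Isolated a b₀ x≢B ¬adj (λ ()) (λ ())

  -- `B` has degree `n + 2`, while the hubs of a leaf decard have degrees `n + 3`, `n + 1` or
  -- `n + 4`, `n`; so the cut touches `B`. It touches `x` as well, since otherwise `x` would be one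
  -- vertex with three neighbours too many.
  bound : ∀ (s : Share (3 + n) n q H) → Any (Match s) (inj₁ (x , B) ∷ [])
  bound s with touches B (fa s) (fb s) | touches x (fa s) (fb s) | deg-drop _≟_ sy ir (fab s) (degH-off {A} (λ ()) (λ ()) degD-A)
  ... | inj₁ p | inj₁ r | _ = here (both x≢B r p)
  ... | inj₂ (p , r) | _ | _ , l , d = ⊥-elim (go (deg-hubs (iso s) (λ ()) (ℕ.≤-trans (s≤s (s≤s (1≤ b₀))) l) (s≤s (s≤s (1≤ b₀))) d (deg-del-off H p r (degH-y degD-B))))
    where
    go : ∀ {k} → ∃ (λ a → ∃ λ b → HubDeg (e s) a b × ((k ≡ a × 2 + n ≡ b) ⊎ (k ≡ b × 2 + n ≡ a))) → ⊥
    go (_ , _ , h , p) with leaf-deg (is-leaf (iso s)) h | p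
    ... | inj₁ (refl , refl) | inj₁ (_ , r) = ℕ.1+n≢n r
    ... | inj₁ (refl , refl) | inj₂ (_ , r) = ℕ.1+n≢n (sym r)
    ... | inj₂ (refl , refl) | inj₁ (_ , r) = ℕ.<⇒≢ (ℕ.m<n⇒m<1+n (ℕ.n<1+n n)) (sym r)
    ... | inj₂ (refl , refl) | inj₂ (_ , r) = ℕ.<⇒≢ (ℕ.m<n⇒m<1+n (ℕ.n<1+n _)) r
  ... | inj₁ _ | inj₂ (p , r) | _ , l , d with n ℕ.≟ 1 | deg-drop _≟_ sy ir (fab s) (degH-y degD-B)
  ...   | yes n≡1 | _ = ⊥-elim (one-hub (iso s) (is-leaf (iso s)) n≡1 (λ ()) (ℕ.≤-trans (s≤s (s≤s (1≤ b₀))) l) ℕ.≤-refl d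
                          (deg-del-off H p r (degH-x (degD-int h₁))))
  ...   | no n≢1 | _ , l′ , d′ = ⊥-elim (two-hubs (iso s) (three d (ℕ.≤-trans (s≤s (s≤s (1≤ b₀))) l)) (three d′ (ℕ.≤-trans (s≤s (2≤ b₀ n≢1)) l′))
                          (three (deg-del-off H p r (degH-x (degD-int h₁))) ℕ.≤-refl) (λ ()) (λ ()) (x≢B ∘ sym))

module LeafInt {n q j : ℕ} (a : Fin 3) (b₀ : Fin n) (a′ : Fin 3) (a′≢a : a′ ≢ a) (j<q : j < q) where

  private
    x y : V 3 n q
    x = lv a′
    y = pv (suc j) (ℕ.m≤n⇒m≤1+n j<q)
    a″ : Fin 3
    a″ = proj₁ (third a a′)
    a″≢a : a″ ≢ a
    a″≢a = proj₁ (proj₂ (third a a′))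
    a″≢a′ : a″ ≢ a′
    a″≢a′ = proj₂ (proj₂ (third a a′))

  ¬adj : ¬ D (lE a) x y
  ¬adj d with D⇒G d
  ... | _ , ()

  open Isolated a b₀ {x} {y} (λ ()) ¬adj (a′≢a ∘ lv-inj) (λ ()) public

  y≢B : y ≢ B
  y≢B = pv≢ (ℕ.<⇒≢ (s≤s j<q))

  Ax : H A x
  Ax = lk (λ { refl → a′≢a refl }) l→

  Al : H A (lv a″)
  Al = lk (a″≢a ∘ lE-inj) l→

  U : V 3 n q
  U = pv (suc (suc j)) (s≤s j<q)

  badA : Bad H A x (pv 1 (s≤s z≤n)) (lv a″) y (pv 2 (s≤s (ℕ.≤-trans (s≤s z≤n) j<q)))
  badA = mkBad Ax (up 0) Al (λ ()) (a″≢a′ ∘ sym ∘ lv-inj) (λ ()) xy (λ ()) (up 1) (λ ())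

  dA : Deg H A 3
  dA = degH-off (λ ()) (λ ()) degD-A

module LeafInt₀ {n q : ℕ} (a : Fin 3) (b₀ : Fin n) (a′ : Fin 3) (a′≢a : a′ ≢ a) (0<q : 0 < q) where

  open LeafInt a b₀ a′ a′≢a 0<q

  private
    x y : V 3 n q
    x = lv a′
    y = pv 1 (s≤s z≤n)
    a″ : Fin 3
    a″ = proj₁ (third a a′)
    a″≢a′ : a″ ≢ a′
    a″≢a′ = proj₂ (proj₂ (third a a′))

  -- `A`, `x`, `y` form a triangle. Cutting `A x` or the pendant edge at `A` leaves `y` with two
  -- non-leaf neighbours, so the triangle edges at `y` are what remains.
  bound₂ : ∀ (s : Share 3 n q H) → Any (Match s) (inj₁ (x , y) ∷ inj₁ (A , y) ∷ [])
  bound₂ s with bad-list sy ir s (mkBad Ax (up 0) Al (λ ()) (a″≢a′ ∘ sym ∘ lv-inj) (λ ()) xy (λ ()) yx (λ ()))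
  ... | here p = ⊥-elim (no-bad (at s p) (down 0 , off (λ ()) (λ ())) (up 1 {g′ = s≤s 0<q} , off (λ ()) (λ ())) (yx , off (λ ()) (λ ()))
                   (λ ()) (λ ()) (λ ()) (Al , fan (a″≢a′ ∘ sym ∘ lv-inj) (λ ())) (λ ()) (above-link 1 , off (λ ()) (λ ())) (above≢ 1 {h = 0<q} (s≤s z≤n)))
  ... | there (here p) = there (here p)
  ... | there (there (here p)) = ⊥-elim (avoid (mkBad yx (up 1 {g′ = s≤s 0<q}) (down 0 {g = z≤n}) (λ ()) (λ ()) (λ ()) (sy Ax) (λ ())
          (above-link 1) (above≢ 1 {h = 0<q} (s≤s z≤n))) (λ ()) (λ ()) (λ ()) (a″≢a′ ∘ sym ∘ lv-inj) (λ ()) (λ ()) (at s p))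
  ... | there (there (there (here p))) = here p
  ... | there (there (there (there (here p)))) = here (same-flip p)

  -- Cutting `A y` would leave `B` as the only vertex with three neighbours, but for `n ≥ 3` both
  -- hubs of a leaf decard have three.
  bound₁ : 3 ≤ n → ∀ (s : Share 3 n q H) → Any (Match s) (inj₁ (x , y) ∷ [])
  bound₁ n≥3 s with bound₂ s
  ... | here p = here p
  ... | there (here p) = ⊥-elim (lone (degA-back (at s p)))
    where
    F : Rel (V 3 n q)
    F = Del H A y
    only : ∀ {v} → Three F v → v ≡ B
    only t with three-H (three-mono proj₁ t)
    ... | inj₁ refl = ⊥-elim (¬three (deg-del H (λ ()) (up 0) dA) ℕ.≤-refl t)
    ... | inj₂ (inj₁ r) = r
    ... | inj₂ (inj₂ (inj₁ refl)) = ⊥-elim (¬three (deg-del-off H (λ ()) (λ ()) (degH-x (degD-l a′≢a))) ℕ.≤-refl t)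
    ... | inj₂ (inj₂ (inj₂ refl)) = ⊥-elim (¬three (deg-delʳ H (λ ()) (down 0) (degH-y (degD-int 0<q))) ℕ.≤-refl t)
    lone : ∃ (λ k → ∃ λ l → HubDeg (e s) k l × Deg F (from (at s p) A) k × Deg F (from (at s p) B) l) → ⊥
    lone (_ , _ , h , da , db) with leaf-deg (is-leaf (at s p)) h
    ... | inj₁ (refl , refl) = contradiction (from-inj (at s p)
            (trans (only (three da ℕ.≤-refl)) (sym (only (three db (ℕ.m≤n⇒m≤1+n n≥3)))))) λ ()
    ... | inj₂ (refl , refl) = contradiction (from-inj (at s p)
            (trans (only (three da (ℕ.n≤1+n 3))) (sym (only (three db n≥3))))) λ ()

module LeafInt₊ {n q j : ℕ} (a : Fin 3) (b₀ : Fin n) (a′ : Fin 3) (a′≢a : a′ ≢ a) (j<q : suc j < q) where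

  open LeafInt a b₀ a′ a′≢a j<q

  private
    x y : V 3 n q
    x = lv a′
    y = pv (2 + j) (ℕ.m≤n⇒m≤1+n j<q)
    a″ : Fin 3
    a″ = proj₁ (third a a′)
    a″≢a′ : a″ ≢ a′
    a″≢a′ = proj₂ (proj₂ (third a a′))
    ab = above-link (2 + j) {h = j<q}
    ab≢ : above (2 + j) j<q ≢ y
    ab≢ = above≢ (2 + j) {h = j<q} (ℕ.n≤1+n _)

  -- `A` and `y` both have two long arms, and one cut has to cure both. The candidates at `A` leave
  -- `y` as it is, so an edge further along the cycle has to be cut.
  bound : ∀ (s : Share 3 n q H) → Any (Match s) (inj₁ (x , y) ∷ inj₁ (pv 1 (s≤s z≤n) , pv 2 (s≤s (ℕ.≤-trans (s≤s z≤n) j<q))) ∷ [])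
  bound s with bad-list sy ir s badA
  ... | here p = ⊥-elim (avoid (mkBad (down (suc j) {g = ℕ.m≤n⇒m≤1+n (ℕ.<⇒≤ j<q)}) (up (2 + j) {g′ = s≤s j<q}) yx (λ ()) (λ ()) (λ ())
          (down j {g = ℕ.m≤n⇒m≤1+n (ℕ.<⇒≤ (ℕ.<⇒≤ j<q))}) (pv≢ (ℕ.<⇒≢ (ℕ.m<n⇒m<1+n (ℕ.n<1+n j)))) ab ab≢)
          (λ ()) (λ ()) (λ ()) (λ ()) (λ ()) (λ ()) (at s p))
  ... | there (here p) = ⊥-elim (avoid (mkBad yx (up (2 + j) {g′ = s≤s j<q}) (down (suc j) {g = ℕ.m≤n⇒m≤1+n (ℕ.<⇒≤ j<q)}) (λ ()) (λ ()) (λ ())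
          (sy Ax) (λ ()) ab ab≢) (λ ()) (λ ()) (λ ()) (λ ()) (λ ()) (λ ()) (at s p))
  ... | there (there (here p)) = ⊥-elim (avoid (mkBad yx (up (2 + j) {g′ = s≤s j<q}) (down (suc j) {g = ℕ.m≤n⇒m≤1+n (ℕ.<⇒≤ j<q)}) (λ ()) (λ ()) (λ ())
          (sy Ax) (λ ()) ab ab≢) (λ ()) (λ ()) (λ ()) (a″≢a′ ∘ sym ∘ lv-inj) (λ ()) (λ ()) (at s p))
  ... | there (there (there (here p))) = here p
  ... | there (there (there (there (here p)))) = there (here p)

module RightInt {n q j : ℕ} (a : Fin 3) (b : Fin n) (j<q : j < q) where

  x y : V 3 n q
  x = rv b
  y = pv (suc j) (ℕ.m≤n⇒m≤1+n j<q)

  y≢B : y ≢ B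
  y≢B = pv≢ (ℕ.<⇒≢ (s≤s j<q))

  ¬adj : ¬ D (lE a) x y
  ¬adj d with D⇒G d
  ... | _ , r← = y≢B refl

  open Isolated a b {x} {y} (λ ()) ¬adj (λ ()) (λ ()) public

  a′ : Fin 3
  a′ = proj₁ (third a a)

  Al : H A (lv a′)
  Al = lk (proj₁ (proj₂ (third a a)) ∘ lE-inj) l→

  Br : ∀ {b′} → H B (rv b′)
  Br = lk (λ ()) r→

  U : V 3 n q
  U = pv (suc (suc j)) (s≤s j<q)

  below : ∀ i → .(i ≤ suc q) → V 3 n q
  below zero h = lv a′
  below (suc i) h = pv i (ℕ.<⇒≤ h)

  below-link : ∀ i .{h : i ≤ suc q} → H (pv i h) (below i h)
  below-link zero = Al
  below-link (suc i) = down i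

  below≢ : ∀ i .{h : i ≤ suc q} {k} .{g} → i ≤ k → below i h ≢ pv k g
  below≢ (suc i) le p = ℕ.1+n≰n (subst (suc i ≤_) (sym (pv-inj p)) le)

  dA : Deg H A 3
  dA = degH-off (λ ()) (λ ()) degD-A

module RightIntTop {n j : ℕ} (a : Fin 3) (b b′ : Fin n) (b′≢b : b′ ≢ b) where

  open RightInt {q = suc j} {j} a b ℕ.≤-refl

  private
    r≢ : _≢_ {A = V 3 n (suc j)} (rv b) (rv b′)
    r≢ p = b′≢b (sym (rv-inj p))
    w : V 3 n (suc j)
    w = pv j (ℕ.m≤n⇒m≤1+n (ℕ.n≤1+n j))
    w≢B : w ≢ B
    w≢B = pv≢ (ℕ.<⇒≢ (ℕ.m<n⇒m<1+n (ℕ.n<1+n j)))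

  -- The triangle now is `x`, `y`, `B`; the argument is that for a triangle at `A`, with the hubs
  -- exchanged.
  bound₂ : ∀ (s : Share 3 n (suc j) H) → Any (Match s) (inj₁ (x , y) ∷ inj₁ (B , y) ∷ [])
  bound₂ s with bad-list sy ir s (mkBad (Br {b}) (down (suc j) {g = ℕ.n≤1+n _}) (Br {b′}) (λ ()) r≢ (λ ()) xy y≢B yx (λ ()))
  ... | here p = ⊥-elim (no-bad (at s p) (down j , off y≢B (λ ())) (up (suc j) {g′ = ℕ.≤-refl} , off y≢B (λ ())) (yx , off y≢B (λ ()))
                   w≢B (λ ()) (λ ()) (below-link j , off w≢B (λ ())) (below≢ j {g = ℕ.n≤1+n _} (ℕ.n≤1+n j)) (Br {b′} , fan r≢ (λ ())) (λ ()))
  ... | there (here p) = there (here p)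
  ... | there (there (here p)) = ⊥-elim (avoid (mkBad yx (down j {g = ℕ.m≤n⇒m≤1+n (ℕ.n≤1+n j)}) (up (suc j) {g′ = ℕ.≤-refl}) (λ ()) (λ ()) w≢B
          (sy (Br {b})) (y≢B ∘ sym) (below-link j) (below≢ j {g = ℕ.n≤1+n _} (ℕ.n≤1+n j))) y≢B (λ ()) (λ ()) r≢ w≢B (λ ()) (at s p))
  ... | there (there (there (here p))) = here p
  ... | there (there (there (there (here p)))) = here (same-flip p)

  -- Cutting `B y` leaves degree `3` at `A` and `n` at `B`, while the hubs of a leaf decard have
  -- degrees `3`, `n + 1` or `4`, `n`.
  bound₁ : 3 ≤ n → ∀ (s : Share 3 n (suc j) H) → Any (Match s) (inj₁ (x , y) ∷ [])
  bound₁ n≥3 s with bound₂ s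
  ... | here p = here p
  ... | there (here p) = ⊥-elim (go (deg-hubs (at s p) (λ ()) ℕ.≤-refl n≥3 (deg-del-off H (λ ()) (λ ()) dA)
                           (deg-del H (y≢B ∘ sym) (down (suc j)) (degH-off (λ ()) (y≢B ∘ sym) degD-B))))
    where
    go : ∃ (λ k → ∃ λ l → HubDeg (e s) k l × ((3 ≡ k × n ≡ l) ⊎ (3 ≡ l × n ≡ k))) → ⊥
    go (_ , _ , h , t) with leaf-deg (is-leaf (at s p)) h | t
    ... | inj₁ (refl , refl) | inj₁ (_ , r) = ℕ.1+n≢n (sym r)
    ... | inj₁ (refl , refl) | inj₂ (r , t) = ℕ.1+n≢n (trans (sym r) (sym t))
    ... | inj₂ (refl , refl) | inj₁ (() , _)
    ... | inj₂ (refl , refl) | inj₂ (refl , ())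

module RightIntInner {n q j : ℕ} (a : Fin 3) (b b′ : Fin n) (b′≢b : b′ ≢ b) (j<q : suc j < suc q) where

  open RightInt {q = suc q} {j} a b (ℕ.<⇒≤ j<q)

  private
    r≢ : _≢_ {A = V 3 n (suc q)} (rv b) (rv b′)
    r≢ p = b′≢b (sym (rv-inj p))
    w top : V 3 n (suc q)
    w = pv j (ℕ.m≤n⇒m≤1+n (ℕ.<⇒≤ (ℕ.<⇒≤ j<q)))
    top = pv (suc q) (ℕ.n≤1+n _)
    w≢B : w ≢ B
    w≢B = pv≢ (ℕ.<⇒≢ (ℕ.<⇒≤ (ℕ.m<n⇒m<1+n j<q)))
    w≢top : w ≢ top
    w≢top = pv≢ (ℕ.<⇒≢ (ℕ.<⇒≤ j<q))
    U≢B : U ≢ B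
    U≢B = pv≢ (ℕ.<⇒≢ (s≤s j<q))
    y≢top : y ≢ top
    y≢top = pv≢ (ℕ.<⇒≢ j<q)
    w≢U : w ≢ U
    w≢U = pv≢ (ℕ.<⇒≢ (ℕ.m<n⇒m<1+n (ℕ.n<1+n j)))
    ab = above-link (suc j) {h = ℕ.<⇒≤ j<q}
    ab≢ = above≢ (suc j) {h = ℕ.<⇒≤ j<q} {g = ℕ.m≤n⇒m≤1+n (ℕ.<⇒≤ j<q)} (ℕ.n≤1+n _)
    y-w = down j {g = ℕ.m≤n⇒m≤1+n (ℕ.<⇒≤ (ℕ.<⇒≤ j<q))} {g′ = ℕ.m≤n⇒m≤1+n (ℕ.<⇒≤ j<q)}
    y-U = up (suc j) {g = ℕ.m≤n⇒m≤1+n (ℕ.<⇒≤ j<q)} {g′ = s≤s (ℕ.<⇒≤ j<q)}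

  bound : ∀ (s : Share 3 n (suc q) H) → Any (Match s) (inj₁ (x , y) ∷ inj₁ (top , pv q (ℕ.m≤n⇒m≤1+n (ℕ.n≤1+n q))) ∷ [])
  bound s with bad-list sy ir s (mkBad (Br {b}) (down (suc q) {g = ℕ.n≤1+n _}) (Br {b′}) (λ ()) r≢ (λ ()) xy y≢B
                  (down q {g = ℕ.m≤n⇒m≤1+n (ℕ.n≤1+n q)}) (pv≢ (ℕ.<⇒≢ (ℕ.m<n⇒m<1+n (ℕ.n<1+n q)))))
  ... | here p = ⊥-elim (avoid (mkBad y-w y-U yx w≢U (λ ()) (λ ()) (below-link j) (below≢ j (ℕ.n≤1+n j)) ab ab≢)
                   y≢B (λ ()) w≢B (λ ()) U≢B (λ ()) (at s p))
  ... | there (here p) = ⊥-elim (avoid (mkBad yx y-w y-U (λ ()) (λ ()) w≢U (sy (Br {b})) (y≢B ∘ sym) (below-link j) (below≢ j (ℕ.n≤1+n j)))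
                   y≢B y≢top (λ ()) (λ ()) w≢B w≢top (at s p))
  ... | there (there (here p)) = ⊥-elim (avoid (mkBad yx y-w y-U (λ ()) (λ ()) w≢U (sy (Br {b})) (y≢B ∘ sym) (below-link j) (below≢ j (ℕ.n≤1+n j)))
                   y≢B (λ ()) (λ ()) r≢ w≢B (λ ()) (at s p))
  ... | there (there (there (here p))) = here p
  ... | there (there (there (there (here p)))) = there (here p)

-- n = 1: the cycle through y, B and x must be destroyed at y.
module RightInt¹ {q j : ℕ} (a : Fin 3) (j<q : j < q) where

  open RightInt {n = 1} a Fin.zero j<q

  private
    w : V 3 1 q
    w = pv j (ℕ.m≤n⇒m≤1+n (ℕ.<⇒≤ j<q))
    w≢U : w ≢ U
    w≢U = pv≢ (ℕ.<⇒≢ (ℕ.m<n⇒m<1+n (ℕ.n<1+n j)))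
    dy : Deg H y 3
    dy = degH-y (degD-int j<q)

  other : ∃ λ z → H U z × z ≢ y × z ≢ A
  other = above (suc j) j<q , above-link (suc j) , above≢ (suc j) {h = j<q} (ℕ.n≤1+n _) , above≢ (suc j) {h = j<q} z≤n

  bound : ∀ (s : Share 3 1 q H) → Any (Match s) (inj₁ (y , x) ∷ inj₁ (y , U) ∷ [])
  bound s with bad-list sy ir s (mkBad yx (up (suc j) {g′ = s≤s j<q}) (down j) (λ ()) (λ ()) (w≢U ∘ sym) (sy Br) (y≢B ∘ sym)
                 (proj₁ (proj₂ other)) (proj₁ (proj₂ (proj₂ other))))
  ... | here p = here p
  ... | there (here p) = there (here p)
  ... | there (there (there (here p))) = ⊥-elim (one-hub (at s p) (is-leaf (at s p)) refl {A} {y} (λ ()) ℕ.≤-refl ℕ.≤-refl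
          (deg-del-off H (λ ()) (λ ()) dA) (deg-del-off H (λ ()) y≢B dy))
  ... | there (there (there (there (here p)))) = ⊥-elim (one-hub (at s p) (is-leaf (at s p)) refl {A} {y} (λ ()) ℕ.≤-refl ℕ.≤-refl
          (deg-del-off H (λ ()) (proj₂ (proj₂ (proj₂ other)) ∘ sym) dA)
          (deg-del-off H (λ ()) (proj₁ (proj₂ (proj₂ other)) ∘ sym) dy))
  ... | there (there (here p)) = ⊥-elim (cycle j refl (at s p))
    where
    F : Rel (V 3 1 q)
    F = Del H y w
    cl : Closed F (side j)
    cl (inj₂ (inj₁ (refl , refl)) , _) = sym (side-> {3} {1} {i = j} {j = suc j} {h = ℕ.m≤n⇒m≤1+n j<q} (ℕ.n<1+n j))
    cl (inj₂ (inj₂ (refl , refl)) , _) = side-> {3} {1} {i = j} {j = suc j} {h = ℕ.m≤n⇒m≤1+n j<q} (ℕ.n<1+n j)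
    cl (inj₁ d , ne) = side-closed {h = ℕ.<⇒≤ j<q} (D⇒G d , ne ∘ same-flip)
    cycle : ∀ k → k ≡ j → ¬ (F ≅ D (e s))
    cycle (suc k) refl ψ = one-odd ψ (is-leaf ψ) cl {A} {lv a} {x} {B} (λ ()) (λ ()) refl refl refl (side-B {3} {1} {h = ℕ.<⇒≤ j<q})
    cycle zero refl ψ with some-hub ψ (is-leaf ψ) (inj₁ ℕ.≤-refl)
    ... | v , t with three-H (three-mono proj₁ t)
    ...   | inj₁ refl = ¬three (deg-delʳ H (λ ()) (up 0) dA) ℕ.≤-refl t
    ...   | inj₂ (inj₁ refl) = ¬three (deg-del-off H (y≢B ∘ sym) (λ ()) (degH-off (λ ()) (y≢B ∘ sym) degD-B)) ℕ.≤-refl t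
    ...   | inj₂ (inj₂ (inj₁ refl)) = ¬three (deg-del-off H (λ ()) (λ ()) (degH-x degD-r)) ℕ.≤-refl t
    ...   | inj₂ (inj₂ (inj₂ refl)) = ¬three (deg-del H (λ ()) (down 0) dy) ℕ.≤-refl t

module _ {m n q : ℕ} where

  -- Removing a right leaf leaves `A` with degree `suc m`. Where no such vertex exists, all edges
  -- concerned are left leaf edges, which gives `m` codes on the side of the broom.
  left-edge : ∀ {V : Set} {F : Rel V} {e : GEdge m n q} → F ≅ D e → IsLeaf e → (∀ v → ¬ Deg F v (suc m)) → ∃ λ a → e ≡ lE a
  left-edge ψ (leafˡ a) _ = a , refl
  left-edge ψ (leafʳ b) n with degA-back ψ
  ... | _ , _ , hr , da , _ = ⊥-elim (n _ da)

  left-codes : ∀ {V : Set} {H : Rel V} (s : Share m n q H) → (∃ λ a → e s ≡ lE a) → Any (Match s) (map (inj₂ ∘ lE) (allFin m))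
  left-codes s (a , eq) = Any.map⁺ (Any.map (λ { refl → eq }) (∈.∈-allFin a))

module LeafHub {n q : ℕ} (a : Fin (2 + suc n)) (a′ : Fin (2 + suc n)) (a′≢a : a′ ≢ a) where

  W : Set
  W = V (3 + n) (suc n) q

  x : W
  x = lv a′

  ¬adj : ¬ D (lE a) x B
  ¬adj d with D⇒G d
  ... | _ , ()

  open Isolated a Fin.zero {x} {B} (λ ()) ¬adj (a′≢a ∘ lv-inj) (λ ()) public

  a″ : Fin (3 + n)
  a″ = proj₁ (third a a′)

  l≢ : _≢_ {A = W} (lv a″) x
  l≢ p = proj₂ (proj₂ (third a a′)) (lv-inj p)

  Ax : H A x
  Ax = lk (a′≢a ∘ lE-inj) l→

  Al : H A (lv a″)
  Al = lk (proj₁ (proj₂ (third a a′)) ∘ lE-inj) l→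

  Br : H B (rv Fin.zero)
  Br = lk (λ ()) r→

  dA : Deg H A (3 + n)
  dA = degH-off (λ ()) (λ ()) degD-A

  dB : Deg H B (3 + n)
  dB = degH-y degD-B

  dx : Deg H x 2
  dx = degH-x (degD-l a′≢a)

  hubs-only : ∀ {v} → Three H v → v ≡ A ⊎ v ≡ B
  hubs-only t with three-H t
  ... | inj₁ r = inj₁ r
  ... | inj₂ (inj₁ r) = inj₂ r
  ... | inj₂ (inj₂ (inj₁ refl)) = ⊥-elim (¬three dx ℕ.≤-refl t)
  ... | inj₂ (inj₂ (inj₂ r)) = inj₂ r

  -- In H both hubs have degree `3 + n`, whereas the hubs of a leaf decard have degrees `3 + n`,
  -- `2 + n` or `4 + n`, `1 + n`.
  untouched : ∀ {u v} {e : GEdge (3 + n) (suc n) q} → A ≢ u → A ≢ v → B ≢ u → B ≢ v → ¬ (Del H u v ≅ D e)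
  untouched {e = e} p p′ r r′ ψ
    with deg-hubs ψ {A} {B} (λ ()) (s≤s (s≤s (s≤s z≤n))) (s≤s (s≤s (s≤s z≤n))) (deg-del-off H p p′ dA) (deg-del-off H r r′ dB)
  ... | _ , _ , h , t with leaf-deg (is-leaf ψ) h | t
  ...   | inj₁ (refl , refl) | inj₁ (_ , z) = ℕ.1+n≢n z
  ...   | inj₁ (refl , refl) | inj₂ (z , _) = ℕ.1+n≢n z
  ...   | inj₂ (refl , refl) | inj₁ (z , _) = ℕ.1+n≢n (sym z)
  ...   | inj₂ (refl , refl) | inj₂ (_ , z) = ℕ.1+n≢n (sym z)

module LeafHub₀ {n : ℕ} (a a′ : Fin (3 + n)) (a′≢a : a′ ≢ a) where

  open LeafHub {n} {0} a a′ a′≢a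

  -- For `q = 0` the hubs and `x` form a triangle. Its edge `A B` would lower both hubs to degree
  -- `2 + n`, but in a leaf decard `A` has degree at least `3 + n`.
  bound : ∀ (s : Share (3 + n) (suc n) 0 H) → Any (Match s) (inj₁ (A , x) ∷ inj₁ (x , B) ∷ [])
  bound s with bad-list sy ir s (mkBad Ax (up 0) Al (λ ()) (l≢ ∘ sym) (λ ()) xy (λ ()) yx (λ ()))
  ... | here p = here p
  ... | there (there (here p)) = ⊥-elim (no-bad (at s p) (yx , off (λ ()) (λ ())) (down 0 {g = z≤n} , off (λ ()) (λ ())) (Br , off (λ ()) (λ ()))
          (λ ()) (λ ()) (λ ()) (sy Ax , off (λ ()) (l≢ ∘ sym)) (λ ()) (Ax , fan l≢ (λ ())) (λ ()))
  ... | there (there (there (here p))) = there (here p)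
  ... | there (there (there (there (here p)))) = there (here (same-flip p))
  ... | there (here p) = ⊥-elim (lone (degA-back (at s p)))
    where
    F : Rel W
    F = Del H A B
    small : ∀ {v k} → Deg F v k → 3 ≤ k → k ≡ 2 + n
    small {v} d l with hubs-only {v} (three-mono {E = F} {F = H} proj₁ (three d l))
    ... | inj₁ refl = card-unique d (deg-del H (λ ()) (up 0) dA)
    ... | inj₂ refl = card-unique d (deg-delʳ H (λ ()) (down 0) dB)
    lone : ∃ (λ k → ∃ λ l → HubDeg (e s) k l × Deg F (from (at s p) A) k × Deg F (from (at s p) B) l) → ⊥
    lone (_ , _ , h , da , _) with leaf-deg (is-leaf (at s p)) h
    ... | inj₁ (refl , _) = ℕ.1+n≢n (small da (s≤s (s≤s (s≤s z≤n))))
    ... | inj₂ (refl , _) = ℕ.<⇒≢ (ℕ.m<n⇒m<1+n (ℕ.n<1+n _)) (sym (small da (s≤s (s≤s (s≤s z≤n)))))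

module LeafHub₁ {n : ℕ} (a a′ : Fin (3 + n)) (a′≢a : a′ ≢ a) where

  open LeafHub {n} {1} a a′ a′≢a

  private
    w : W
    w = pv 1 (s≤s z≤n)

  -- For `q = 1` the new edge closes the four-cycle `A`, `x`, `B`, `w`, and each of its edges
  -- remains possible. These four codes are the reason for the value five when the path has three
  -- vertices and the leaf numbers differ by two.
  bound : ∀ (s : Share (3 + n) (suc n) 1 H) → Any (Match s) (inj₁ (A , x) ∷ inj₁ (A , w) ∷ inj₁ (x , B) ∷ inj₁ (w , B) ∷ [])
  bound s with bad-list sy ir s (mkBad Ax (up 0) Al (λ ()) (l≢ ∘ sym) (λ ()) xy (λ ()) (up 1) (λ ()))
  ... | here p = here p
  ... | there (here p) = there (here p)
  ... | there (there (here p)) = ⊥-elim (avoid (mkBad yx (down 1 {g = s≤s z≤n}) Br (λ ()) (λ ()) (λ ()) (sy Ax) (λ ()) (down 0 {g = z≤n}) (λ ()))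
          (λ ()) (λ ()) (λ ()) (l≢ ∘ sym) (λ ()) (λ ()) (at s p))
  ... | there (there (there (here p))) = there (there (here p))
  ... | there (there (there (there (here p)))) = there (there (there (here p)))

module LeafHub₁¹ (a a′ : Fin 3) (a′≢a : a′ ≢ a) where

  open LeafHub {0} {1} a a′ a′≢a

  -- No vertex of H has degree four here, so every edge concerned is one of the three left leaf
  -- edges: three codes, although the cycle has four edges.
  bound : ∀ (s : Share 3 1 1 H) → Any (Match s) (map (inj₂ ∘ lE) (allFin 3))
  bound s = left-codes s (left-edge (iso s) (is-leaf (iso s)) small)
    where
    F : Rel W
    F = Del H (fa s) (fb s)
    small : ∀ v → ¬ Deg F v 4
    small v d with hubs-only {v} (three-mono {E = F} proj₁ (three d (ℕ.n≤1+n 3)))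
    ... | inj₁ refl = ℕ.1+n≰n (card-≤ proj₁ d dA)
    ... | inj₂ refl = ℕ.1+n≰n (card-≤ proj₁ d dB)

module LeafHub₂ {n q : ℕ} (a a′ : Fin (3 + n)) (a′≢a : a′ ≢ a) where

  open LeafHub {n} {2 + q} a a′ a′≢a

  -- On this longer cycle, cutting the path edge at `A` leaves `B` with two long arms, and cutting
  -- the next one changes neither hub degree; so the two edges at `x` remain.
  bound : ∀ (s : Share (3 + n) (suc n) (2 + q) H) → Any (Match s) (inj₁ (A , x) ∷ inj₁ (x , B) ∷ [])
  bound s with bad-list sy ir s (mkBad Ax (up 0 {g′ = s≤s z≤n}) Al (λ ()) (l≢ ∘ sym) (λ ()) xy (λ ()) (up 1 {g′ = s≤s (s≤s z≤n)}) (λ ()))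
  ... | here p = here p
  ... | there (here p) = ⊥-elim (avoid (mkBad yx (down (2 + q) {g = ℕ.n≤1+n _}) Br (λ ()) (λ ()) (λ ()) (sy Ax) (λ ())
          (down (1 + q) {g = ℕ.m≤n⇒m≤1+n (ℕ.n≤1+n _)}) (pv≢ (ℕ.<⇒≢ (ℕ.m<n⇒m<1+n (ℕ.n<1+n _))))) (λ ()) (λ ()) (λ ()) (λ ()) (λ ()) (λ ()) (at s p))
  ... | there (there (here p)) = ⊥-elim (avoid (mkBad yx (down (2 + q) {g = ℕ.n≤1+n _}) Br (λ ()) (λ ()) (λ ()) (sy Ax) (λ ())
          (down (1 + q) {g = ℕ.m≤n⇒m≤1+n (ℕ.n≤1+n _)}) (pv≢ (ℕ.<⇒≢ (ℕ.m<n⇒m<1+n (ℕ.n<1+n _))))) (λ ()) (λ ()) (λ ()) (l≢ ∘ sym) (λ ()) (λ ()) (at s p))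
  ... | there (there (there (here p))) = there (here p)
  ... | there (there (there (there (here p)))) = ⊥-elim (untouched (λ ()) (λ ()) (λ ()) (λ ()) (at s p))

module OneHub {n q : ℕ} {H : Rel (V 2 n q)} (sy : Symm H) (ir : Irr H) (dB : Deg H B (suc n))
  (is-leaf : ∀ {u v} {e : GEdge 2 n q} → Del H u v ≅ D e → IsLeaf e) (hub-only : ∀ {v} → Three H v → v ≡ B) where

  only : ∀ {u w v k} → Deg (Del H u w) v k → 3 ≤ k → v ≡ B
  only {u} {w} {v} d l = hub-only {v} (three-mono {E = Del H u w} proj₁ (three d l))

  -- A cut at `B` leaves at most one vertex with three neighbours, of degree `n`. In a leaf decard
  -- some hub has degree `suc n`, or the hubs have degrees `3` and `n`; the latter would make
  -- `n = 3` and give two such vertices.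
  not-B : 2 ≤ n → ∀ {w} → H B w → ∀ {e : GEdge 2 n q} → ¬ (Del H B w ≅ D e)
  not-B n≥2 {w} h ψ with degA-back ψ
  ... | _ , _ , hd , da , db with leaf-deg (is-leaf ψ) hd
  ...   | inj₁ (refl , refl) = ℕ.1+n≢n (card-unique (deg-resp (Del H B w) (only {B} {w} db (s≤s n≥2)) db) (deg-del H (ir h) h dB))
  ...   | inj₂ (refl , refl) = contradiction (from-inj ψ (trans (only {B} {w} da ℕ.≤-refl) (sym (only {B} {w} db (ℕ.≤-reflexive 3≡n))))) λ ()
    where
    3≡n : 3 ≡ n
    3≡n = card-unique (deg-resp (Del H B w) (only {B} {w} da ℕ.≤-refl) da) (deg-del H (ir h) h dB)

module LeafLeaf {n q : ℕ} (a a′ : Fin 2) (a′≢a : a′ ≢ a) (b : Fin n) where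

  x y : V 2 n q
  x = lv a′
  y = rv b

  ¬adj : ¬ D (lE a) x y
  ¬adj d with D⇒G d
  ... | _ , ()

  open Isolated a b {x} {y} (λ ()) ¬adj (a′≢a ∘ lv-inj) (λ ())

  hub-only : ∀ {v} → Three H v → v ≡ B
  hub-only t with three-H t
  ... | inj₁ refl = ⊥-elim (¬three (degH-off (λ ()) (λ ()) degD-A) ℕ.≤-refl t)
  ... | inj₂ (inj₁ r) = r
  ... | inj₂ (inj₂ (inj₁ refl)) = ⊥-elim (¬three (degH-x (degD-l a′≢a)) ℕ.≤-refl t)
  ... | inj₂ (inj₂ (inj₂ refl)) = ⊥-elim (¬three (degH-y degD-r) ℕ.≤-refl t)

  dB : Deg H B (suc n)
  dB = degH-off (λ ()) (λ ()) degD-B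

  open OneHub sy ir dB is-leaf hub-only

  Br : ∀ {b′} → H B (rv b′)
  Br = lk (λ ()) r→

  Ax : H A x
  Ax = lk (a′≢a ∘ lE-inj) l→

  w : V 2 n q
  w = pv q (ℕ.n≤1+n q)

  far : ∃ λ z → H w z × z ≢ B
  far = go q refl
    where
    go : ∀ r → r ≡ q → ∃ λ z → H w z × z ≢ B
    go zero eq = x , subst (λ t → H t x) (pv-cong eq) Ax , λ ()
    go (suc r) eq = pv r (ℕ.<⇒≤ r≤) , subst (λ t → H t (pv r (ℕ.<⇒≤ r≤))) (pv-cong eq) (down r {g = ℕ.<⇒≤ r≤} {g′ = r≤}) , pv≢ (ℕ.<⇒≢ r≤)
      where
      r≤ : suc r ≤ suc q
      r≤ = ℕ.m≤n⇒m≤1+n (ℕ.≤-reflexive eq)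

  -- `B` is the only branching vertex, and by `not-B` it is not an end of the cut edge. What cures
  -- it are the two cycle edges one step away.
  bound : n ≢ 1 → ∀ (s : Share 2 n q H) → Any (Match s) (inj₁ (y , x) ∷ inj₁ (w , proj₁ far) ∷ [])
  bound n≢1 s with another n≢1 b
  ... | b′ , ne with bad-list sy ir s (mkBad (Br {b}) (down q {g = ℕ.n≤1+n q}) (Br {b′}) (λ ()) (ne ∘ sym ∘ rv-inj) (λ ())
                     yx (λ ()) (proj₁ (proj₂ far)) (proj₂ (proj₂ far)))
  ...   | here p = ⊥-elim (not-B (2≤ b n≢1) Br (at s p))
  ...   | there (here p) = ⊥-elim (not-B (2≤ b n≢1) (down q {g = ℕ.n≤1+n q}) (at s p))
  ...   | there (there (here p)) = ⊥-elim (not-B (2≤ b n≢1) Br (at s p))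
  ...   | there (there (there p)) = p

  -- For `n = 1` no vertex of H has degree three, so only the two left leaf edges are possible.
  bound¹ : n ≡ 1 → ∀ (s : Share 2 n q H) → Any (Match s) (map (inj₂ ∘ lE) (allFin 2))
  bound¹ refl s = left-codes s (left-edge (iso s) (is-leaf (iso s)) small)
    where
    F : Rel (V 2 n q)
    F = Del H (fa s) (fb s)
    small : ∀ v → ¬ Deg F v 3
    small v d with hub-only {v} (three-mono {E = F} proj₁ (three d ℕ.≤-refl))
    ... | refl = ¬3≤2 (card-≤ proj₁ d dB)

module RightLeaves {n q : ℕ} (a : Fin 2) (b b′ : Fin n) (b≢b′ : b ≢ b′) where

  x y : V 2 n q
  x = rv b
  y = rv b′

  ¬adj : ¬ D (lE a) x y
  ¬adj d with D⇒G d
  ... | _ , ()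

  open Isolated a b {x} {y} (b≢b′ ∘ rv-inj) ¬adj (λ ()) (λ ())

  hub-only : ∀ {v} → Three H v → v ≡ B
  hub-only t with three-H t
  ... | inj₁ refl = ⊥-elim (¬three (degH-off (λ ()) (λ ()) degD-A) ℕ.≤-refl t)
  ... | inj₂ (inj₁ r) = r
  ... | inj₂ (inj₂ (inj₁ refl)) = ⊥-elim (¬three (degH-x degD-r) ℕ.≤-refl t)
  ... | inj₂ (inj₂ (inj₂ refl)) = ⊥-elim (¬three (degH-y degD-r) ℕ.≤-refl t)

  open OneHub sy ir (degH-off (λ ()) (λ ()) degD-B) is-leaf hub-only

  n≥2 : 2 ≤ n
  n≥2 = 2≤ b λ { refl → b≢b′ (unique₁ b b′) }
    where
    unique₁ : ∀ (i j : Fin 1) → i ≡ j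
    unique₁ Fin.zero Fin.zero = refl

  Br : ∀ {c} → H B (rv c)
  Br = lk (λ ()) r→

  -- `x`, `y`, `B` form a triangle, and `not-B` excludes cuts at `B`; the new edge is all that is
  -- left.
  bound : ∀ (s : Share 2 n q H) → Any (Match s) (inj₁ (x , y) ∷ [])
  bound s with bad-list sy ir s (mkBad (Br {b}) (Br {b′}) (down q {g = ℕ.n≤1+n q}) (b≢b′ ∘ rv-inj) (λ ()) (λ ()) xy (λ ()) yx (λ ()))
  ... | here p = ⊥-elim (not-B n≥2 Br (at s p))
  ... | there (here p) = ⊥-elim (not-B n≥2 Br (at s p))
  ... | there (there (here p)) = ⊥-elim (not-B n≥2 (down q {g = ℕ.n≤1+n q}) (at s p))
  ... | there (there (there (here p))) = here p
  ... | there (there (there (there (here p)))) = here (same-flip p)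

fourth : ∀ {V : Set} → DecidableEquality V → ∀ {H : Rel V} {v k} → Deg H v k → 4 ≤ k → ∀ a b c →
         ∃ λ w → H v w × w ≢ a × w ≢ b × w ≢ c
fourth {V} _≟′_ {H} {v} (card xs u s _ l) k≥4 a b c with split xs
  where
  split : ∀ xs → (∃ λ w → w ∈ xs × w ≢ a × w ≢ b × w ≢ c) ⊎ (∀ {w} → w ∈ xs → w ∈ a ∷ b ∷ c ∷ [])
  split [] = inj₂ λ ()
  split (x ∷ xs) with x ≟′ a | x ≟′ b | x ≟′ c | split xs
  ... | _ | _ | _ | inj₁ (w , p , r) = inj₁ (w , there p , r)
  ... | no p | no r | no t | inj₂ _ = inj₁ (x , here refl , p , r , t)
  ... | yes refl | _ | _ | inj₂ f = inj₂ λ { (here refl) → here refl ; (there m) → f m }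
  ... | no _ | yes refl | _ | inj₂ f = inj₂ λ { (here refl) → there (here refl) ; (there m) → f m }
  ... | no _ | no _ | yes refl | inj₂ f = inj₂ λ { (here refl) → there (there (here refl)) ; (there m) → f m }
... | inj₁ (w , p , r) = w , s p , r
... | inj₂ f = ⊥-elim (ℕ.<⇒≱ k≥4 (subst (_≤ 3) l (unique-⊆ u f)))

-- Bounds for trees and spiders in packaged form.

record SpiderData (m : ℕ) {m′ n′ q′ : ℕ} (H : Rel (V m′ n′ q′)) : Set where
  constructor mkSpider
  field
    sy : Symm H
    ir : Irr H
    total : Total H
    {v w₁ w₂ w₃ z₁ z₂} : V m′ n′ q′
    bd : Bad H v w₁ w₂ w₃ z₁ z₂
    dv : Deg H v (suc m)
    only : ∀ x → Three H x → x ≡ v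

-- The data for `Tree`, with `v` of the degree of `A` and `u` of the degree of `B`. By `con` and
-- `con′`, cutting the arm of `w₂` leaves `v` and `u` joined.
record TreeData (m n : ℕ) {m′ n′ q′ : ℕ} (H : Rel (V m′ n′ q′)) : Set where
  constructor mkTree
  field
    sy : Symm H
    ir : Irr H
    total : Total H
    {v w₁ w₂ w₃ z₁ z₂ u} : V m′ n′ q′
    bd : Bad H v w₁ w₂ w₃ z₁ z₂
    v≢u : v ≢ u
    u≢w₂ : u ≢ w₂
    u≢z₂ : u ≢ z₂
    dv : Deg H v (suc m)
    du : Deg H u (suc n)
    hubs : ∀ x → Three H x → x ≡ v ⊎ x ≡ u
    con : ∀ c → Closed (Del H v w₂) c → c v ≡ c u
    con′ : ∀ c → Closed (Del H w₂ z₂) c → c v ≡ c u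

module BigSpider {m q m′ n′ q′ : ℕ} {H : Rel (V m′ n′ q′)} (S : SpiderData m H) where

  open SpiderData S

  no-family : 3 ≤ m → ∀ {k} → 2 < k → ¬ Family m 1 q k H
  no-family m≥3 lt with fourth _≟_ {H = H} dv (s≤s m≥3) w₁ w₂ w₃
  ... | _ , a₄ , r₁ , r₂ , r₃ = bounded _ (λ s → Spider.big-bound sy ir total bd dv s m≥3 a₄ r₁ r₂ r₃) lt

module SmallSpider {q m′ n′ q′ : ℕ} {H : Rel (V m′ n′ q′)} (S : SpiderData 2 H) where

  open SpiderData S
  open Spider₂ {q} sy ir total bd dv only public

  no-family : ∀ {k} → 4 < k → ¬ Family 2 1 q k H
  no-family = bounded _ bound₄

module TreeBound {m n q m′ n′ q′ : ℕ} {H : Rel (V m′ n′ q′)} (T : TreeData m n H) where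

  open TreeData T

  -- For `n = 1` the vertex `u` has degree two, so `v` is the only branching vertex.
  tree⇒spider : n ≡ 1 → SpiderData m H
  tree⇒spider refl = mkSpider sy ir total bd dv only
    where
    only : ∀ x → Three H x → x ≡ v
    only x t with hubs x t
    ... | inj₁ p = p
    ... | inj₂ refl = ⊥-elim (¬three du ℕ.≤-refl t)

  module _ (n≥2 : 2 ≤ n) where

    open Tree {m} {n} {q} sy ir bd v≢u total u≢w₂ u≢z₂ dv du (s≤s n≥2) refl

    bound-3 : 3 ≤ m → ∀ {k} → 2 < k → ¬ Family m n q k H
    bound-3 m≥3 lt with fourth _≟_ {H = H} dv (s≤s m≥3) w₁ w₂ w₃
    ... | _ , a₄ , r₁ , r₂ , r₃ = bounded _ (λ s → bound₂ s a₄ r₁ r₂ r₃ m≥3 con con′) lt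

    bound-2 : 3 ≤ m → m ≢ suc n → ∀ {k} → 1 < k → ¬ Family m n q k H
    bound-2 m≥3 ne lt with fourth _≟_ {H = H} dv (s≤s m≥3) w₁ w₂ w₃
    ... | _ , a₄ , r₁ , r₂ , r₃ = bounded _ (λ s → bound₁ s a₄ r₁ r₂ r₃ m≥3 con con′ (ℕ.<⇒≢ (ℕ.n<1+n m)) ne) lt

    module Two (m≡2 : m ≡ 2) (q≢0 : q ≢ 0) (c* : V m′ n′ q′ → Bool) (cl : Closed (Del H v w₁) c*) (sep : c* v ≢ c* u) where

      m≥2 : 2 ≤ m
      m≥2 = ℕ.≤-reflexive (sym m≡2)

      only₁ : ∀ x → Three (Del H v w₁) x → x ≡ u
      only₁ x t with hubs x (three-mono proj₁ t)
      ... | inj₂ p = p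
      ... | inj₁ refl = ⊥-elim (¬three (deg-del H (ir (Bad.a₁ bd)) (Bad.a₁ bd) dv) (ℕ.≤-reflexive m≡2) t)

      three-codes : (s : Share m n q H) → Any (Match s) (inj₁ (v , w₂) ∷ inj₁ (v , w₃) ∷ inj₁ (w₁ , z₁) ∷ [])
      three-codes s = bound₃ c* cl sep m≥2 n≥2 only₁ s q≢0 m≥2 con′

      bound-4 : ∀ {k} → 3 < k → ¬ Family m n q k H
      bound-4 = bounded _ three-codes

      bound-adj : ∀ {z₁′} → H w₁ z₁′ → z₁′ ≢ v → z₁′ ≢ z₁ → ∀ {k} → 2 < k → ¬ Family m n q k H
      bound-adj b k ne = bounded _ (λ s → bound₃-adj c* cl sep m≥2 n≥2 only₁ s q≢0 m≥2 con′ b k ne)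

      -- The arm of `w₂` has length two, so cutting it at `v` leaves an isolated edge. By `K₂-edge`
      -- this needs a hub with one leaf, but `m = 2` and `n ≥ 2`.
      bound-short : (∀ x → H w₂ x → x ≡ v ⊎ x ≡ z₂) → (∀ x → H z₂ x → x ≡ w₂) → ∀ {k} → 2 < k → ¬ Family m n q k H
      bound-short f g = bounded (inj₁ (v , w₃) ∷ inj₁ (w₁ , z₁) ∷ []) (λ s → drop s (three-codes s))
        where
        open Bad bd
        isolates : K₂ (Del H v w₂) w₂ z₂
        isolates = (b₂ , apart-edge (ir a₂ ∘ sym) k₂) , h , λ x p → g x (proj₁ p)
          where
          h : ∀ x → Del H v w₂ w₂ x → x ≡ z₂
          h x (p , ne) with f x p
          ... | inj₁ refl = ⊥-elim (ne (inj₂ (refl , refl)))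
          ... | inj₂ r = r
        short : ∀ {e : GEdge m n q} → ¬ (Del H v w₂ ≅ D e)
        short ψ with total⇒path ψ total-vw₂
        ... | path i h with K₂-edge (Fin.fromℕ< (ℕ.<⇒≤ m≥2)) (Fin.fromℕ< (ℕ.<⇒≤ n≥2)) h (K₂-iso {F = D (pE i h)} ψ isolates)
        ...   | inj₁ (p , _) = contradiction (trans (sym p) m≡2) λ ()
        ...   | inj₂ (p , _) = ℕ.<⇒≢ n≥2 (sym p)
        drop : (s : Share m n q H) → Any (Match s) (inj₁ (v , w₂) ∷ inj₁ (v , w₃) ∷ inj₁ (w₁ , z₁) ∷ []) →
               Any (Match s) (inj₁ (v , w₃) ∷ inj₁ (w₁ , z₁) ∷ [])
        drop s (here p) = ⊥-elim (short (at s p))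
        drop s (there p) = p

family-reflect : ∀ {m n q k} {W : Set} {H : Rel W} → Family m n q k H → Family n m q k H
family-reflect fam = record
  { sh = λ i → share (fa (sh fam i)) (fb (sh fam i)) (fab (sh fam i)) (ρᴱ (e (sh fam i))) (≅-trans (iso (sh fam i)) (ρ-D _))
  ; f-inj = f-inj fam
  ; e-inj = λ i j p → e-inj fam i j (trans (sym (ρᴱ-invol _)) (trans (cong ρᴱ p) (ρᴱ-invol _))) }

-- Demands on k, and trees from a left leaf hung on an inner vertex.

-- What the number k of prescribed decards has to satisfy for trees to be excluded.
record Req (m n q k : ℕ) : Set where
  field
    big    : 3 ≤ m → 2 ≤ n → 2 ≤ q → 2 < k ⊎ (1 < k × m ≢ suc n)
    two    : m ≡ 2 → 2 ≤ n → 1 ≤ q → 2 < k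
    two′   : m ≡ 2 → 2 ≤ n → 3 ≤ q → 3 < k
    single : n ≡ 1 → 3 ≤ m → 2 ≤ q → 2 < k
    pair   : n ≡ 1 → 3 ≤ m → q ≡ 1 → 1 < k
    small  : n ≡ 1 → m ≡ 2 → q ≡ 1 → 2 < k
    small′ : n ≡ 1 → m ≡ 2 → q ≡ 3 → 3 < k
    small″ : n ≡ 1 → m ≡ 2 → 2 ≤ q → q ≢ 3 → 4 < k

module _ {m n q : ℕ} where

  climb : ∀ (c : V m n q → Bool) {j} → (∀ k → j ≤ k → (h : k ≤ q) → c (pv k (ℕ.m≤n⇒m≤1+n h)) ≡ c (pv (suc k) (s≤s h))) →
          ∀ k .{g} → j ≤ k → c (pv k g) ≡ c B
  climb c {j} f k {g} j≤k = go (suc q ∸ k) k j≤k (ℕ.m+[n∸m]≡n (recompute (k ℕ.≤? suc q) g))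
    where
    go : ∀ d k .{g} → j ≤ k → k + d ≡ suc q → c (pv k g) ≡ c B
    go zero k j≤k p = cong c (pv-cong (trans (sym (ℕ.+-identityʳ k)) p))
    go (suc d) k j≤k p = trans (f k j≤k k≤q) (go d (suc k) (ℕ.m≤n⇒m≤1+n j≤k) p′)
      where
      p′ : suc k + d ≡ suc q
      p′ = trans (sym (ℕ.+-suc k d)) p
      k≤q : k ≤ q
      k≤q = ℕ.≤-pred (ℕ.m+n≤o⇒m≤o (suc k) (ℕ.≤-reflexive p′))

  nbr-B : ∀ {w} → G {m} {n} {q} B w → w ≡ pv q (ℕ.n≤1+n q) ⊎ ∃ λ b → w ≡ rv b
  nbr-B (pE i h , p→) = ⊥-elim (ℕ.1+n≰n (recompute (_ ℕ.≤? q) h))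
  nbr-B (_ , p←) = inj₁ refl
  nbr-B (_ , r→) = inj₂ (_ , refl)

fin1 : ∀ (i j : Fin 1) → i ≡ j
fin1 Fin.zero Fin.zero = refl

fin2 : ∀ {a a′ : Fin 2} → a′ ≢ a → ∀ c → c ≡ a ⊎ c ≡ a′
fin2 {a} {a′} ne c with c Fin.≟ a | c Fin.≟ a′
... | yes p | _ = inj₁ p
... | no _ | yes p = inj₂ p
fin2 {Fin.zero} {Fin.zero} ne _ | no _ | no _ = ⊥-elim (ne refl)
fin2 {Fin.suc Fin.zero} {Fin.suc Fin.zero} ne _ | no _ | no _ = ⊥-elim (ne refl)
fin2 {Fin.zero} {Fin.suc Fin.zero} ne Fin.zero | no p | _ = ⊥-elim (p refl)
fin2 {Fin.zero} {Fin.suc Fin.zero} ne (Fin.suc Fin.zero) | _ | no p = ⊥-elim (p refl)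
fin2 {Fin.suc Fin.zero} {Fin.zero} ne Fin.zero | _ | no p = ⊥-elim (p refl)
fin2 {Fin.suc Fin.zero} {Fin.zero} ne (Fin.suc Fin.zero) | no p | _ = ⊥-elim (p refl)

-- For `m = 2` the isolated leaf `lv a` may be hung on an inner vertex `y`, since the degrees
-- `0 + 2` add up to `m`. Then `y` branches: `w₁` leads to `B`, and `w₂` through `A` to the leaf
-- `lv a′`.
module LeafToInt {n q j : ℕ} (a a′ : Fin 2) (a′≢a : a′ ≢ a) (b₀ : Fin n) (j<q : j < q) where

  W : Set
  W = V 2 n q

  x y w₁ w₂ : W
  x = lv a
  y = pv (suc j) (ℕ.m≤n⇒m≤1+n j<q)
  w₁ = pv (2 + j) (s≤s j<q)
  w₂ = pv j (ℕ.m≤n⇒m≤1+n (ℕ.<⇒≤ j<q))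

  y≢B : y ≢ B
  y≢B = pv≢ (ℕ.<⇒≢ (s≤s j<q))

  open AddEdge {e₀ = lE a} {x} {y} (λ ()) leaf-isolatedˡ public

  up : ∀ j .{g} .{g′} → H (pv j g) (pv (suc j) g′)
  up j {g} {g′} = lk {pE j (ℕ.≤-pred g′)} (λ ()) p→

  down : ∀ j .{g} .{g′} → H (pv (suc j) g′) (pv j g)
  down j {g} {g′} = sy (up j {g} {g′})

  Br : ∀ {b} → H B (rv b)
  Br = lk (λ ()) r→

  Al : H A (lv a′)
  Al = lk (a′≢a ∘ lE-inj) l→

  above : ∃ λ z → H w₁ z × z ≢ y
  above with suc j ℕ.≟ q
  ... | yes refl = rv b₀ , Br , λ ()
  ... | no ne = pv (3 + j) (s≤s h) , up (2 + j) , pv≢ (ℕ.<⇒≢ (ℕ.m<n⇒m<1+n (ℕ.n<1+n _)) ∘ sym)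
    where h = ℕ.≤∧≢⇒< j<q ne

  below : ∀ i .(h : i ≤ suc q) → ∃ λ z → H (pv i h) z × (∀ {k} .{g} → i ≤ k → z ≢ pv k g) × z ≢ x
  below zero h = lv a′ , Al , (λ _ ()) , a′≢a ∘ lv-inj
  below (suc i) h = pv i (ℕ.<⇒≤ h) , down i , (λ le p → ℕ.1+n≰n (subst (suc i ≤_) (sym (pv-inj p)) le)) , λ ()

  bl = below j (ℕ.m≤n⇒m≤1+n (ℕ.<⇒≤ j<q))

  total : Total H
  total (pv zero _) = _ , up 0 {g′ = s≤s z≤n}
  total (pv (suc i) g) = _ , down i {g = ℕ.<⇒≤ g}
  total (lv c) with c Fin.≟ a
  ... | yes refl = y , xy
  ... | no ne = A , lk (ne ∘ lE-inj) l←
  total (rv b) = B , lk (λ ()) r←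

  dA : Deg H A 2
  dA = degH-off (λ ()) (λ ()) (degD-src (lE a) deg-A)

  dx : Deg H x 1
  dx = degH-x (degD-tgt (lE a) (deg-l a))

  bd : Bad H y w₁ w₂ x (proj₁ above) (proj₁ bl)
  bd = mkBad (up (suc j)) (down j) yx (pv≢ (ℕ.<⇒≢ (ℕ.m<n⇒m<1+n (ℕ.n<1+n j)) ∘ sym)) (λ ()) (λ ())
         (proj₁ (proj₂ above)) (proj₂ (proj₂ above)) (proj₁ (proj₂ bl)) (proj₁ (proj₂ (proj₂ bl)) (ℕ.n≤1+n j))

  hubs : ∀ v → Three H v → v ≡ y ⊎ v ≡ B
  hubs v t with three-H t
  ... | inj₁ refl = ⊥-elim (¬three dA ℕ.≤-refl t)
  ... | inj₂ (inj₁ p) = inj₂ p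
  ... | inj₂ (inj₂ (inj₁ refl)) = ⊥-elim (¬three dx (s≤s z≤n) t)
  ... | inj₂ (inj₂ (inj₂ p)) = inj₁ p

  connected : ∀ {s t} → (∀ k → suc j ≤ k → .(h : k ≤ q) → ¬ Same s t (pv k (ℕ.m≤n⇒m≤1+n h)) (pv (suc k) (s≤s h))) →
              ∀ c → Closed (Del H s t) c → c y ≡ c B
  connected f c cl = climb c (λ k le h → cl (up k , f k le h)) (suc j) ℕ.≤-refl

  tree : TreeData 2 n H
  tree = mkTree sy ir total bd y≢B
    (pv≢ (ℕ.<⇒≢ (ℕ.m<n⇒m<1+n j<q) ∘ sym))
    (λ p → proj₁ (proj₂ (proj₂ bl)) (ℕ.<⇒≤ (ℕ.m<n⇒m<1+n j<q)) (sym p))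
    (degH-y (degD-off (lE a) (λ ()) (λ ()) (deg-int j<q)))
    (degH-off (λ ()) (y≢B ∘ sym) (degD-off (lE a) (λ ()) (λ ()) deg-B))
    hubs
    (connected (λ k le h → off′ (pv≢ (ℕ.<⇒≢ (s≤s le) ∘ sym)) (pv≢ (ℕ.<⇒≢ (ℕ.m<n⇒m<1+n le) ∘ sym))))
    (connected (λ k le h → off (pv≢ (ℕ.<⇒≢ le ∘ sym)) (λ p → proj₁ (proj₂ (proj₂ bl)) (ℕ.<⇒≤ le) (sym p))))

  open TreeBound {2} {n} {q} tree

  cut : Closed (Del H y w₁) (side (suc j))
  cut (inj₁ d , ne) = side-closed {2} {n} {q} {h = j<q} (D⇒G d , ne)
  cut (inj₂ (inj₁ (refl , refl)) , _) = sym (side-≤ {2} {n} {i = suc j} {j = suc j} {h = ℕ.m≤n⇒m≤1+n j<q} ℕ.≤-refl)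
  cut (inj₂ (inj₂ (refl , refl)) , _) = side-≤ {2} {n} {i = suc j} {j = suc j} {h = ℕ.m≤n⇒m≤1+n j<q} ℕ.≤-refl

  sep : side {2} {n} {q} (suc j) y ≢ side {2} {n} {q} (suc j) B
  sep p with trans (sym (side-≤ {2} {n} {i = suc j} {j = suc j} {h = ℕ.m≤n⇒m≤1+n j<q} ℕ.≤-refl)) (trans p (side-B {2} {n} {h = j<q}))
  ... | ()

  module _ (n≥2 : 2 ≤ n) where

    open Two n≥2 refl (λ p → ℕ.n≮0 (subst (j <_) p j<q)) (side (suc j)) cut sep public

  A-nbr : ∀ {v} → H A v → v ≡ pv 1 (s≤s z≤n) ⊎ v ≡ lv a′
  A-nbr h with D-link⁻ (old-nbr (λ ()) (λ ()) h)
  ... | _ , _ , p→ = inj₁ refl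
  ... | _ , ne , l→ {c} with fin2 a′≢a c
  ...   | inj₁ refl = ⊥-elim (ne refl)
  ...   | inj₂ p = inj₂ (cong lv p)

  l-nbr : ∀ {v} → H (lv a′) v → v ≡ A
  l-nbr h = nbr-lv (D⇒G (old-nbr (a′≢a ∘ lv-inj) (λ ()) h))

  B-nbr : ∀ {v} → H B v → v ≡ pv q (ℕ.n≤1+n q) ⊎ ∃ λ b → v ≡ rv b
  B-nbr h = nbr-B (D⇒G (old-nbr (λ ()) (y≢B ∘ sym) h))

  r-nbr : ∀ {b v} → H (rv b) v → v ≡ B
  r-nbr h = nbr-rv (D⇒G (old-nbr (λ ()) (λ ()) h))

  -- For `suc j ≡ q` the vertex `w₁` is `B` itself; another right leaf then provides the second
  -- continuation that `bound-adj` asks for.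
  adjacent : n ≢ 1 → suc j ≡ q → ∃ λ z → H w₁ z × z ≢ y × z ≢ proj₁ above
  adjacent n≢1 eq with proj₁ above ≟ rv b₀
  ... | no ne = rv b₀ , subst (λ t → H t (rv b₀)) (pv-cong (cong suc (sym eq))) Br , (λ ()) , ne ∘ sym
  ... | yes p = rv b′ , subst (λ t → H t (rv b′)) (pv-cong (cong suc (sym eq))) Br , (λ ()) , λ r → proj₂ (another n≢1 b₀) (rv-inj (trans r p))
    where b′ = proj₁ (another n≢1 b₀)

module LeafToInt₀ {n q : ℕ} (a a′ : Fin 2) (a′≢a : a′ ≢ a) (b₀ : Fin n) (0<q : 0 < q) where

  open LeafToInt {j = 0} a a′ a′≢a b₀ 0<q

  short : 2 ≤ n → ∀ {k} → 2 < k → ¬ Family 2 n q k H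
  short n≥2 = bound-short n≥2 (λ _ → A-nbr) (λ _ → l-nbr)

-- Brooms `2 1 q` with `q = 1` or `q = 3`. For `q = 3` the spiders have eight vertices and arms of
-- lengths `1, 2, 4` or `1, 3, 3`. In each case one of the four codes of `bound₄` drops out or
-- coincides with another, which makes `q = 3` exceptional.
module LeafToInt¹ (a a′ : Fin 2) (a′≢a : a′ ≢ a) where

  r₀ : ∀ {m q} (b : Fin 1) → rv {m} {1} {q} b ≡ rv Fin.zero
  r₀ b = cong rv (fin1 b Fin.zero)

  only-r : ∀ {m q} {v w : V m 1 q} → v ≡ w ⊎ (∃ λ b → v ≡ rv b) → v ≡ w ⊎ v ≡ rv Fin.zero
  only-r (inj₁ p) = inj₁ p
  only-r (inj₂ (b , p)) = inj₂ (trans p (r₀ b))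

  module Q₁ where

    open LeafToInt {1} {1} {0} a a′ a′≢a Fin.zero (s≤s z≤n)
    open SmallSpider {1} (TreeBound.tree⇒spider {2} {1} {1} tree refl)

    none : ∀ {k} → 2 < k → ¬ Family 2 1 1 k H
    none = bounded _ (λ s → short-short s (λ ()) (λ _ → only-r ∘ B-nbr) (λ _ → r-nbr) (λ _ → A-nbr) (λ _ → l-nbr))

  module Q₃₀ where

    open LeafToInt {1} {3} {0} a a′ a′≢a Fin.zero (s≤s z≤n)
    open SmallSpider {3} (TreeBound.tree⇒spider {2} {1} {3} tree refl)

    none : ∀ {k} → 3 < k → ¬ Family 2 1 3 k H
    none = bounded _ (λ s → long-short s (λ ()) (λ _ → A-nbr) (λ _ → l-nbr) (side 1) cut
             (side-card {i = 1} (s≤s z≤n)) (side-card′ {i = 1} (s≤s z≤n)))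

  module Q₃₁ where

    open LeafToInt {1} {3} {1} a a′ a′≢a Fin.zero (s≤s (s≤s z≤n))
    open SmallSpider {3} (TreeBound.tree⇒spider {2} {1} {3} tree refl)

    none : ∀ {k} → 3 < k → ¬ Family 2 1 3 k H
    none = bounded _ (λ s → long-long s Br (λ ()) (λ _ → only-r ∘ B-nbr) (λ _ → r-nbr) Al (λ ()) (λ _ → A-nbr) (λ _ → l-nbr))

  module Q₃₂ where

    open LeafToInt {1} {3} {2} a a′ a′≢a Fin.zero (s≤s (s≤s (s≤s z≤n)))
    open SpiderData (TreeBound.tree⇒spider {2} {1} {3} tree refl) using (dv; only)
    open Spider₂ {3} sy ir total (bad-swap bd) dv only

    -- `side 2`, except that the leaf `lv a` hangs on `y` and takes its colour. Cutting `y w₂`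
    -- separates four vertices from four, while `pE 0` separates three from five in the broom.
    c : V 2 1 3 → Bool
    c (pv i _) = i ≤ᵇ 2
    c (lv d) with d Fin.≟ a
    ... | yes _ = false
    ... | no _  = true
    c (rv _) = false

    c-a : c (lv a) ≡ false
    c-a with a Fin.≟ a
    ... | yes _ = refl
    ... | no p  = ⊥-elim (p refl)

    c-a′ : c (lv a′) ≡ true
    c-a′ with a′ Fin.≟ a
    ... | yes p = ⊥-elim (a′≢a p)
    ... | no _  = refl

    cl : Closed (Del H y w₂) c
    cl (inj₂ (inj₁ (refl , refl)) , _) = c-a
    cl (inj₂ (inj₂ (refl , refl)) , _) = sym c-a
    cl (inj₁ d , ne) with D-link⁻ d
    ... | _ , _ , p→ {0} = refl
    ... | _ , _ , p→ {1} = refl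
    ... | _ , _ , p→ {2} = ⊥-elim (ne (inj₂ (refl , refl)))
    ... | _ , _ , p→ {suc (suc (suc _))} = refl
    ... | _ , _ , p← {0} = refl
    ... | _ , _ , p← {1} = refl
    ... | _ , _ , p← {2} = ⊥-elim (ne (inj₁ (refl , refl)))
    ... | _ , _ , p← {suc (suc (suc _))} = refl
    ... | _ , ne′ , l→ {d} with d Fin.≟ a
    ...   | yes refl = ⊥-elim (ne′ refl)
    ...   | no _ = refl
    cl (inj₁ d , ne) | _ , ne′ , l← {d′} with d′ Fin.≟ a
    ...   | yes refl = ⊥-elim (ne′ refl)
    ...   | no _ = refl
    cl (inj₁ d , ne) | _ , _ , r→ = refl
    cl (inj₁ d , ne) | _ , _ , r← = refl

    ct : Card (λ v → c v ≡ true) 4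
    ct = card (A ∷ pv 1 (s≤s z≤n) ∷ pv 2 (s≤s (s≤s z≤n)) ∷ lv a′ ∷ [])
      (((λ ()) ∷ (λ ()) ∷ (λ ()) ∷ []) ∷ ((λ ()) ∷ (λ ()) ∷ []) ∷ ((λ ()) ∷ []) ∷ [] ∷ [])
      (λ { (here refl) → refl ; (there (here refl)) → refl ; (there (there (here refl))) → refl ; (there (there (there (here refl)))) → c-a′ })
      compl refl
      where
      compl : ∀ {v} → c v ≡ true → v ∈ A ∷ pv 1 (s≤s z≤n) ∷ pv 2 (s≤s (s≤s z≤n)) ∷ lv a′ ∷ []
      compl {pv 0 _} _ = here refl
      compl {pv 1 _} _ = there (here refl)
      compl {pv 2 _} _ = there (there (here refl))
      compl {lv d} p with fin2 a′≢a d
      ... | inj₁ refl with trans (sym p) c-a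
      ...   | ()
      compl {lv d} p | inj₂ refl = there (there (there (here refl)))

    cf : Card (λ v → c v ≡ false) 4
    cf = card (pv 3 (s≤s (s≤s (s≤s z≤n))) ∷ B ∷ rv Fin.zero ∷ lv a ∷ [])
      (((λ ()) ∷ (λ ()) ∷ (λ ()) ∷ []) ∷ ((λ ()) ∷ (λ ()) ∷ []) ∷ ((λ ()) ∷ []) ∷ [] ∷ [])
      (λ { (here refl) → refl ; (there (here refl)) → refl ; (there (there (here refl))) → refl ; (there (there (there (here refl)))) → c-a })
      compl refl
      where
      compl : ∀ {v} → c v ≡ false → v ∈ pv 3 (s≤s (s≤s (s≤s z≤n))) ∷ B ∷ rv Fin.zero ∷ lv a ∷ []
      compl {pv 3 _} _ = here refl
      compl {pv 4 _} _ = there (here refl)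
      compl {pv (suc (suc (suc (suc (suc i))))) h} _ = ⊥-elim (too-long (recompute (_ ℕ.≤? 4) h))
        where
        too-long : ¬ 5 + i ≤ 4
        too-long (s≤s (s≤s (s≤s (s≤s ()))))
      compl {rv b} _ = there (there (here (r₀ b)))
      compl {lv d} p with fin2 a′≢a d
      ... | inj₁ refl = there (there (there (here refl)))
      ... | inj₂ refl with trans (sym p) c-a′
      ...   | ()

    none : ∀ {k} → 3 < k → ¬ Family 2 1 3 k H
    none = bounded _ (λ s → long-short s (λ ()) (λ _ → only-r ∘ B-nbr) (λ _ → r-nbr) c cl ct cf)

leaf-to-int : ∀ {n q j k} (a a′ : Fin 2) (a′≢a : a′ ≢ a) (b₀ : Fin n) (j<q : j < q) → Req 2 n q k →
              ¬ Family 2 n q k (Add (D (lE a)) (lv a) (pv (suc j) (ℕ.m≤n⇒m≤1+n j<q)))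
leaf-to-int {n} {q} {j} {k} a a′ a′≢a b₀ j<q req with n ℕ.≟ 1
... | no n≢1 = go (suc j ℕ.≟ q) j<q
  where
  open Req req
  n≥2 = 2≤ b₀ n≢1
  go : Dec (suc j ≡ q) → (j<q : j < q) → ¬ Family 2 n q k (Add (D (lE a)) (lv a) (pv (suc j) (ℕ.m≤n⇒m≤1+n j<q)))
  go (yes eq) j<q = LeafToInt.bound-adj a a′ a′≢a b₀ j<q n≥2 (proj₁ (proj₂ z)) (proj₁ (proj₂ (proj₂ z))) (proj₂ (proj₂ (proj₂ z)))
                      (two refl n≥2 (ℕ.≤-trans (s≤s z≤n) j<q))
    where z = LeafToInt.adjacent a a′ a′≢a b₀ j<q n≢1 eq
  go (no ne) j<q with 3 ℕ.≤? q
  ... | yes q≥3 = LeafToInt.bound-4 a a′ a′≢a b₀ j<q n≥2 (two′ refl n≥2 q≥3)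
  ... | no q<3 = small-q j q ne j<q (ℕ.≰⇒> q<3) (two refl n≥2 (ℕ.≤-trans (s≤s z≤n) j<q))
    where
    -- With `q ≤ 2` and `suc j ≢ q` only `j = 0` is left, so that `w₂` is `A` and its arm has length
    -- two.
    small-q : ∀ j q → suc j ≢ q → (j<q : j < q) → q < 3 → 2 < k → ¬ Family 2 n q k (Add (D (lE a)) (lv a) (pv (suc j) (ℕ.m≤n⇒m≤1+n j<q)))
    small-q zero q _ j<q _ lt = LeafToInt₀.short a a′ a′≢a b₀ j<q n≥2 lt
    small-q (suc j) 1 _ (s≤s ()) _ _
    small-q (suc zero) 2 ne _ _ _ = ⊥-elim (ne refl)
    small-q (suc (suc j)) 2 _ (s≤s (s≤s ())) _ _
    small-q (suc j) (suc (suc (suc q))) _ _ (s≤s (s≤s (s≤s ()))) _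
... | yes refl = go j q j<q b₀ (small refl refl) (small′ refl refl) (small″ refl refl)
  where
  open Req req
  go : ∀ j q → (j<q : j < q) (b₀ : Fin 1) → (q ≡ 1 → 2 < k) → (q ≡ 3 → 3 < k) → (2 ≤ q → q ≢ 3 → 4 < k) →
       ¬ Family 2 1 q k (Add (D (lE a)) (lv a) (pv (suc j) (ℕ.m≤n⇒m≤1+n j<q)))
  go j q j<q b₀ r₁ r₃ r with q ℕ.≟ 1 | q ℕ.≟ 3
  go zero _ (s≤s z≤n) _ r₁ _ _ | yes refl | _ = LeafToInt¹.Q₁.none a a′ a′≢a (r₁ refl)
  go (suc j) _ (s≤s ()) _ _ _ _ | yes refl | _
  go 0 _ (s≤s z≤n) _ _ r₃ _ | no _ | yes refl = LeafToInt¹.Q₃₀.none a a′ a′≢a (r₃ refl)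
  go 1 _ (s≤s (s≤s z≤n)) _ _ r₃ _ | no _ | yes refl = LeafToInt¹.Q₃₁.none a a′ a′≢a (r₃ refl)
  go 2 _ (s≤s (s≤s (s≤s z≤n))) _ _ r₃ _ | no _ | yes refl = LeafToInt¹.Q₃₂.none a a′ a′≢a (r₃ refl)
  go (suc (suc (suc j))) _ (s≤s (s≤s (s≤s ()))) _ _ _ _ | no _ | yes refl
  ... | no q≢1 | no q≢3 = SmallSpider.no-family (TreeBound.tree⇒spider {2} {1} {q} (LeafToInt.tree a a′ a′≢a b₀ j<q) refl) (r (big-q j<q q≢1) q≢3)
    where
    big-q : ∀ {j q} → j < q → q ≢ 1 → 2 ≤ q
    big-q {q = 1} _ p = ⊥-elim (p refl)
    big-q {q = suc (suc q)} _ _ = s≤s (s≤s z≤n)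

module _ {m q m′ n′ q′ : ℕ} {H : Rel (V m′ n′ q′)} (S : SpiderData m H) (m≥3 : 3 ≤ m) where

  open SpiderData S
  open Bad bd

  -- Both long legs have length two, so that each code of the spider comes from the single right leaf.
  short-spider : (∀ x → H z₁ x → x ≡ w₁) → (∀ x → H z₂ x → x ≡ w₂) → ∀ {k} → 1 < k → ¬ Family m 1 q k H
  short-spider f₁ f₂ lt with fourth _≟_ {H = H} dv (s≤s m≥3) w₁ w₂ w₃
  ... | _ , a₄ , r₁ , r₂ , r₃ = bounded (inj₂ (rE Fin.zero) ∷ []) codes lt
    where
    pendant : ∀ {w z} → H v w → H w z → z ≢ v → (∀ x → H z x → x ≡ w) → ∀ {e : GEdge m 1 q} → Del H w z ≅ D e → e ≡ rE Fin.zero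
    pendant {w} {z} h g z≢v f ψ
      with isolated⇒leaf (Fin.fromℕ< (ℕ.≤-trans (s≤s z≤n) m≥3)) Fin.zero ψ {z} alone
         | deg-hub ψ (ℕ.m≤n⇒m≤1+n m≥3) (deg-del-off H (ir h) (z≢v ∘ sym) dv)
      where
      alone : ∀ x → ¬ Del H w z z x
      alone x (h , n) with f x h
      ... | refl = n (inj₂ (refl , refl))
    ... | leafʳ Fin.zero | _ = refl
    ... | leafˡ _ | _ , _ , hl , inj₁ (_ , p) = ⊥-elim (ℕ.1+n≢n p)
    ... | leafˡ _ | _ , _ , hl , inj₂ (_ , refl) = ⊥-elim (ℕ.<⇒≱ (s≤s (s≤s z≤n)) m≥3)
    codes : (s : Share m 1 q H) → Any (Match s) (inj₂ (rE Fin.zero) ∷ [])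
    codes s with Spider.big-bound sy ir total bd dv s m≥3 a₄ r₁ r₂ r₃
    ... | here p = here (pendant a₁ b₁ k₁ f₁ (at s p))
    ... | there (here p) = here (pendant a₂ b₂ k₂ f₂ (at s p))

-- Trees from a removed path edge, and a leaf moved to a leaf.

-- The new edge joins a leaf of the star at A to an inner path vertex, m = 2.
module StarLeafToInt {n q j : ℕ} (a a′ : Fin 2) (a′≢a : a′ ≢ a) (b₀ : Fin n) (j<q : suc j < q) where

  W : Set
  W = V 2 n q

  x y w₁ w₃ : W
  x = lv a
  y = pv (2 + j) (ℕ.m≤n⇒m≤1+n j<q)
  w₁ = pv (3 + j) (s≤s j<q)
  w₃ = pv (suc j) (ℕ.m≤n⇒m≤1+n (ℕ.<⇒≤ j<q))

  y≢B : y ≢ B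
  y≢B = pv≢ (ℕ.<⇒≢ (s≤s j<q))

  ¬adj : ¬ D (pE 0 z≤n) x y
  ¬adj d with D⇒G d
  ... | _ , ()

  open AddEdge {e₀ = pE 0 z≤n} {x} {y} (λ ()) ¬adj public

  up : ∀ j .{g} .{g′} → H (pv (suc j) g) (pv (2 + j) g′)
  up j {g} {g′} = lk {pE (suc j) (ℕ.≤-pred g′)} (λ ()) p→

  down : ∀ j .{g} .{g′} → H (pv (2 + j) g′) (pv (suc j) g)
  down j {g} {g′} = sy (up j {g} {g′})

  Br : ∀ {b} → H B (rv b)
  Br = lk (λ ()) r→

  Al : ∀ {c} → H A (lv c)
  Al = lk (λ ()) l→

  above : ∃ λ z → H w₁ z × z ≢ y
  above with 2 + j ℕ.≟ q
  ... | yes refl = rv b₀ , Br , λ ()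
  ... | no ne = pv (4 + j) (s≤s h) , up (2 + j) , pv≢ (ℕ.<⇒≢ (ℕ.m<n⇒m<1+n (ℕ.n<1+n _)) ∘ sym)
    where h = ℕ.≤∧≢⇒< j<q ne

  total : Total H
  total v = _ , inj₁ (proj₂ (path-nbr a b₀ v))

  bd : Bad H y w₁ x w₃ (proj₁ above) A
  bd = mkBad (up (suc j)) yx (down j) (λ ()) (pv≢ (ℕ.<⇒≢ (ℕ.m<n⇒m<1+n (ℕ.n<1+n _)) ∘ sym)) (λ ())
         (proj₁ (proj₂ above)) (proj₂ (proj₂ above)) (sy Al) (λ ())

  0≢q : 0 ≢ q
  0≢q refl = ℕ.n≮0 j<q

  hubs : ∀ v → Three H v → v ≡ y ⊎ v ≡ B
  hubs v t with three-H t
  ... | inj₁ refl = ⊥-elim (¬three (degH-off (λ ()) (λ ()) (degD-src (pE 0 z≤n) deg-A)) ℕ.≤-refl t)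
  ... | inj₂ (inj₁ p) = inj₂ p
  ... | inj₂ (inj₂ (inj₁ refl)) = ⊥-elim (¬three (degH-x (degD-off (pE 0 z≤n) (λ ()) (λ ()) (deg-l a))) ℕ.≤-refl t)
  ... | inj₂ (inj₂ (inj₂ p)) = inj₁ p

  connected : ∀ {s t} → (∀ k → 2 + j ≤ k → .(h : k ≤ q) → ¬ Same s t (pv k (ℕ.m≤n⇒m≤1+n h)) (pv (suc k) (s≤s h))) →
              ∀ c → Closed (Del H s t) c → c y ≡ c B
  connected {s} {t} f c cl = climb c (λ { (suc k) le h → cl (up k , f (suc k) le h) }) (2 + j) ℕ.≤-refl

  B≢1 : _≢_ {A = W} B (pv 1 (s≤s z≤n))
  B≢1 = pv≢ (λ p → 0≢q (sym (ℕ.suc-injective p)))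

  tree : TreeData 2 n H
  tree = mkTree sy ir total bd y≢B (λ ()) (λ ())
    (degH-y (degD-off (pE 0 z≤n) (λ ()) (λ ()) (deg-int j<q)))
    (degH-off (λ ()) (y≢B ∘ sym) (degD-off (pE 0 z≤n) (λ ()) B≢1 deg-B))
    hubs
    (connected (λ k le h → off′ (pv≢ (ℕ.<⇒≢ (s≤s le) ∘ sym)) (λ ())))
    (connected (λ k le h → off (λ ()) (pv≢ λ p → ℕ.n≮0 (subst (2 + j ≤_) p le))))

  cut : Closed (Del H y w₁) (side (2 + j))
  cut (inj₁ d , ne) = side-closed {2} {n} {q} {h = j<q} (D⇒G d , ne)
  cut (inj₂ (inj₁ (refl , refl)) , _) = sym (side-≤ {2} {n} {i = 2 + j} {j = 2 + j} {h = ℕ.m≤n⇒m≤1+n j<q} ℕ.≤-refl)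
  cut (inj₂ (inj₂ (refl , refl)) , _) = side-≤ {2} {n} {i = 2 + j} {j = 2 + j} {h = ℕ.m≤n⇒m≤1+n j<q} ℕ.≤-refl

  sep : side {2} {n} {q} (2 + j) y ≢ side {2} {n} {q} (2 + j) B
  sep p with trans (sym (side-≤ {2} {n} {i = 2 + j} {j = 2 + j} {h = ℕ.m≤n⇒m≤1+n j<q} ℕ.≤-refl)) (trans p (side-B {2} {n} {h = j<q}))
  ... | ()

  A-nbr : ∀ {v} → H A v → v ≡ lv a ⊎ v ≡ lv a′
  A-nbr h with D-link⁻ (old-nbr (λ ()) (λ ()) h)
  ... | _ , ne , p→ = ⊥-elim (ne refl)
  ... | _ , _ , l→ {c} with fin2 a′≢a c
  ...   | inj₁ p = inj₁ (cong lv p)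
  ...   | inj₂ p = inj₂ (cong lv p)

  l-nbr : ∀ {v} → H (lv a′) v → v ≡ A
  l-nbr h = nbr-lv (D⇒G (old-nbr (a′≢a ∘ lv-inj) (λ ()) h))

  B-nbr : ∀ {v} → H B v → v ≡ pv q (ℕ.n≤1+n q) ⊎ ∃ λ b → v ≡ rv b
  B-nbr h = nbr-B (D⇒G (old-nbr (λ ()) (y≢B ∘ sym) h))

  r-nbr : ∀ {b v} → H (rv b) v → v ≡ B
  r-nbr h = nbr-rv (D⇒G (old-nbr (λ ()) (λ ()) h))

  adjacent : n ≢ 1 → 2 + j ≡ q → ∃ λ z → H w₁ z × z ≢ y × z ≢ proj₁ above
  adjacent n≢1 eq with proj₁ above ≟ rv b₀
  ... | no ne = rv b₀ , subst (λ t → H t (rv b₀)) (pv-cong (cong suc (sym eq))) Br , (λ ()) , ne ∘ sym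
  ... | yes p = rv b′ , subst (λ t → H t (rv b′)) (pv-cong (cong suc (sym eq))) Br , (λ ()) , λ r → proj₂ (another n≢1 b₀) (rv-inj (trans r p))
    where b′ = proj₁ (another n≢1 b₀)

  module _ {k : ℕ} (req : Req 2 n q k) where

    open Req req

    at-least-two : n ≢ 1 → ¬ Family 2 n q k H
    at-least-two n≢1 with 2 + j ℕ.≟ q
    ... | yes eq = bound-adj (proj₁ (proj₂ z)) (proj₁ (proj₂ (proj₂ z))) (proj₂ (proj₂ (proj₂ z))) (two refl n≥2 (ℕ.≤-trans (s≤s z≤n) j<q))
      where
      n≥2 = 2≤ b₀ n≢1
      open TreeBound.Two {2} {n} {q} tree n≥2 refl (0≢q ∘ sym) (side (2 + j)) cut sep
      z = adjacent n≢1 eq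
    ... | no ne = bound-4 (two′ refl n≥2 (ℕ.≤-trans (s≤s (s≤s (s≤s z≤n))) (ℕ.≤∧≢⇒< j<q ne)))
      where
      n≥2 = 2≤ b₀ n≢1
      open TreeBound.Two {2} {n} {q} tree n≥2 refl (0≢q ∘ sym) (side (2 + j)) cut sep

module StarLeafToInt¹ (a a′ : Fin 2) (a′≢a : a′ ≢ a) where

  open LeafToInt¹ a a′ a′≢a using (only-r)

  module Q₃ where

    open StarLeafToInt {1} {3} {0} a a′ a′≢a Fin.zero (s≤s (s≤s z≤n))
    open SmallSpider {3} (TreeBound.tree⇒spider {2} {1} {3} tree refl)

    none : ∀ {k} → 3 < k → ¬ Family 2 1 3 k H
    none = bounded _ (λ s → long-long s Br (λ ()) (λ _ → only-r ∘ B-nbr) (λ _ → r-nbr) Al a′≢ (λ _ → A-nbr) (λ _ → l-nbr))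
      where
      a′≢ : lv a′ ≢ x
      a′≢ p = a′≢a (lv-inj p)

  -- All three arms have length at least two: through `A` to `lv a′`, up towards `B`, and down to
  -- `pv 1`. Hence `bound₁` applies, and a single code remains.
  module Far {q j : ℕ} (j<q : 2 + j < q) where

    open StarLeafToInt {1} {q} {suc j} a a′ a′≢a Fin.zero j<q
    open SmallSpider {q} (TreeBound.tree⇒spider {2} {1} {q} tree refl)

    none : ∀ {k} → 1 < k → ¬ Family 2 1 q k H
    none = bounded _ (λ s → bound₁ s (down j {g = ℕ.m≤n⇒m≤1+n (ℕ.<⇒≤ (ℕ.<⇒≤ j<q))}) (pv≢ (ℕ.<⇒≢ (ℕ.m<n⇒m<1+n (ℕ.n<1+n _))))
             (λ ()) (pv≢ (ℕ.<⇒≢ (ℕ.m<n⇒m<1+n (ℕ.m<n⇒m<1+n (ℕ.n<1+n _))))) z≢x (λ ()))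
      where
      z≢x : proj₁ above ≢ x
      z≢x p with 3 + j ℕ.≟ q | p
      ... | yes refl | ()
      ... | no _ | ()

star-leaf-to-int : ∀ {n q j k} (a a′ : Fin 2) (a′≢a : a′ ≢ a) (b₀ : Fin n) (j<q : suc j < q) → Req 2 n q k →
                   ¬ Family 2 n q k (Add (D (pE 0 z≤n)) (lv a) (pv (2 + j) (ℕ.m≤n⇒m≤1+n j<q)))
star-leaf-to-int {n} {q} {j} {k} a a′ a′≢a b₀ j<q req with n ℕ.≟ 1
... | no n≢1 = StarLeafToInt.at-least-two a a′ a′≢a b₀ j<q req n≢1
... | yes refl = go j q j<q b₀ (small′ refl refl) (small″ refl refl (ℕ.≤-trans (s≤s (s≤s z≤n)) j<q))
  where
  open Req req
  go : ∀ j q → (j<q : suc j < q) (b₀ : Fin 1) → (q ≡ 3 → 3 < k) → (q ≢ 3 → 4 < k) →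
       ¬ Family 2 1 q k (Add (D (pE 0 z≤n)) (lv a) (pv (2 + j) (ℕ.m≤n⇒m≤1+n j<q)))
  go j q j<q b₀ r₃ r with q ℕ.≟ 3
  go 0 _ (s≤s (s≤s z≤n)) _ r₃ _ | yes refl = StarLeafToInt¹.Q₃.none a a′ a′≢a (r₃ refl)
  go (suc j) _ j<q Fin.zero r₃ _ | yes refl = StarLeafToInt¹.Far.none a a′ a′≢a j<q (ℕ.≤-trans (s≤s (s≤s z≤n)) (r₃ refl))
  go j q j<q b₀ _ r | no ne = SmallSpider.no-family (TreeBound.tree⇒spider {2} {1} {q} (StarLeafToInt.tree a a′ a′≢a b₀ j<q) refl) (r ne)

3≤ : ∀ {m} → Fin m → m ≢ 1 → m ≢ 2 → 3 ≤ m
3≤ {1} _ p _ = ⊥-elim (p refl)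
3≤ {2} _ _ p = ⊥-elim (p refl)
3≤ {suc (suc (suc n))} _ _ _ = s≤s (s≤s (s≤s z≤n))

-- The new edge joins a leaf of the star at A to B, m = n + 1 and p ≥ 4.
module StarLeafToB {n q : ℕ} (a : Fin (suc n)) (b₀ : Fin n) where

  W : Set
  W = V (suc n) n (2 + q)

  x w z : W
  x = lv a
  w = pv (2 + q) (ℕ.n≤1+n _)
  z = pv (1 + q) (ℕ.m≤n⇒m≤1+n (ℕ.n≤1+n _))

  ¬adj : ¬ D (pE 0 z≤n) x B
  ¬adj d with D⇒G d
  ... | _ , ()

  open AddEdge {e₀ = pE 0 z≤n} {x} {B} (λ ()) ¬adj public

  Br : ∀ {b} → H B (rv b)
  Br = lk (λ ()) r→

  Al : ∀ {c} → H A (lv c)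
  Al = lk (λ ()) l→

  total : Total H
  total v = _ , inj₁ (proj₂ (path-nbr a b₀ v))

  bd : Bad H B x w (rv b₀) A z
  bd = mkBad yx (lk {pE (2 + q) ℕ.≤-refl} (λ ()) p←) Br (λ ()) (λ ()) (λ ()) (sy Al) (λ ())
         (lk {pE (1 + q) (ℕ.n≤1+n _)} (λ ()) p←) (pv≢ (ℕ.<⇒≢ (ℕ.m<n⇒m<1+n (ℕ.n<1+n _))))

  hubs : ∀ v → Three H v → v ≡ B ⊎ v ≡ A
  hubs v t with three-H t
  ... | inj₁ p = inj₂ p
  ... | inj₂ (inj₁ p) = inj₁ p
  ... | inj₂ (inj₂ (inj₁ refl)) = ⊥-elim (¬three (degH-x (degD-off (pE 0 z≤n) (λ ()) (λ ()) (deg-l a))) ℕ.≤-refl t)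
  ... | inj₂ (inj₂ (inj₂ p)) = inj₁ p

  tree : TreeData (suc n) n H
  tree = mkTree sy ir total bd (λ ()) (λ ()) (λ ())
    (degH-y (degD-off (pE 0 z≤n) (λ ()) (λ ()) deg-B))
    (degH-off (λ ()) (λ ()) (degD-src (pE 0 z≤n) deg-A))
    hubs
    (λ c cl → trans (cl (yx , fan (λ ()) (λ ()))) (cl (sy Al , off (λ ()) (λ ()))))
    (λ c cl → trans (cl (yx , off (λ ()) (λ ())))
                    (cl (sy Al , off (λ ()) (λ ()))))

  l-nbr : ∀ {c} → c ≢ a → ∀ {v} → H (lv c) v → v ≡ A
  l-nbr ne h = nbr-lv (D⇒G (old-nbr (ne ∘ lv-inj) (λ ()) h))

module StarLeafToB¹ (a a′ : Fin 2) (a′≢a : a′ ≢ a) where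

  open StarLeafToB {1} {1} a Fin.zero
  open SmallSpider {3} (TreeBound.tree⇒spider {2} {1} {3} tree refl)

  A-nbr : ∀ {v} → H A v → v ≡ lv a ⊎ v ≡ lv a′
  A-nbr h with D-link⁻ (old-nbr (λ ()) (λ ()) h)
  ... | _ , ne , p→ = ⊥-elim (ne refl)
  ... | _ , _ , l→ {c} with fin2 a′≢a c
  ...   | inj₁ p = inj₁ (cong lv p)
  ...   | inj₂ p = inj₂ (cong lv p)

  z-nbr : ∀ {v} → H z v → v ≡ w ⊎ v ≡ pv 1 (s≤s z≤n)
  z-nbr h with D-link⁻ (old-nbr (λ ()) (λ ()) h)
  ... | _ , _ , p→ = inj₁ refl
  ... | _ , _ , p← = inj₂ refl

  end-nbr : ∀ {v} → H (pv 1 (s≤s z≤n)) v → v ≡ z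
  end-nbr h with D-link⁻ (old-nbr (λ ()) (λ ()) h)
  ... | _ , _ , p→ = refl
  ... | _ , ne , p← = ⊥-elim (ne refl)

  none : ∀ {k} → 3 < k → ¬ Family 2 1 3 k H
  none = bounded _ (λ s → long-long s Al (a′≢a ∘ lv-inj) (λ _ → A-nbr) (λ _ → l-nbr a′≢a)
           (lk {pE 1 (s≤s z≤n)} (λ ()) p←) (λ ()) (λ _ → z-nbr) (λ _ → end-nbr))

star-leaf-to-B : ∀ {n q k} (a : Fin (suc n)) (b₀ : Fin n) → Req (suc n) n (2 + q) k →
                 ¬ Family (suc n) n (2 + q) k (Add (D {q = 2 + q} (pE 0 z≤n)) (lv a) B)
star-leaf-to-B {n} {q} {k} a b₀ req with n ℕ.≟ 1
... | no n≢1 = TreeBound.bound-3 {suc n} {n} {2 + q} (StarLeafToB.tree {n} {q} a b₀) (2≤ b₀ n≢1) (s≤s (2≤ b₀ n≢1)) (lt (big (s≤s (2≤ b₀ n≢1)) (2≤ b₀ n≢1) (s≤s (s≤s z≤n))))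
  where
  open Req req
  lt : 2 < k ⊎ (1 < k × suc n ≢ suc n) → 2 < k
  lt (inj₁ p) = p
  lt (inj₂ (_ , ne)) = ⊥-elim (ne refl)
star-leaf-to-B {q = q} {k} a Fin.zero req | yes refl = go q (small′ refl refl) (small″ refl refl (s≤s (s≤s z≤n)))
  where
  open Req req
  go : ∀ q → (2 + q ≡ 3 → 3 < k) → (2 + q ≢ 3 → 4 < k) → ¬ Family 2 1 (2 + q) k (Add (D {q = 2 + q} (pE 0 z≤n)) (lv a) B)
  go q r₃ r with 2 + q ℕ.≟ 3
  ... | yes refl = StarLeafToB¹.none a (proj₁ (another (λ ()) a)) (proj₂ (another (λ ()) a)) (r₃ refl)
  ... | no ne = SmallSpider.no-family (TreeBound.tree⇒spider {2} {1} {2 + q} (StarLeafToB.tree {1} {q} a Fin.zero) refl) (r ne)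

-- Connection of `y` and `B` within the far side of the path edge. Colourings are tested on that
-- side only, so the connection survives every cut on the near side.
JoinedToB : ∀ {m n q} (i : ℕ) → i ≤ q → V m n q → Set
JoinedToB {m} {n} {q} i h y = ∀ (c : V m n q → Bool) →
  (∀ {u v} → side i u ≡ false → side i v ≡ false → D {m} {n} {q} (pE i h) u v → c u ≡ c v) → c y ≡ c B

-- The new edge joins a left leaf to a vertex y beyond the removed path edge i, 2 ≤ i.
module LeftLeaf {m n q i : ℕ} (i<q : 2 + i < q) (a a′ : Fin m) (a′≢a : a′ ≢ a) (b₀ : Fin n) (y : V m n q)
  (y-side : side {m} {n} {q} (2 + i) y ≡ false) (y≢B : y ≢ B {m} {n} {q}) (dy : Deg (D {m} {n} {q} (pE (2 + i) (ℕ.<⇒≤ i<q))) y 1)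
  (y-con : JoinedToB {m} {n} {q} (2 + i) (ℕ.<⇒≤ i<q) y) where

  W : Set
  W = V m n q

  e₀ : GEdge m n q
  e₀ = pE (2 + i) (ℕ.<⇒≤ i<q)

  2≤q : 2 ≤ q
  2≤q = ℕ.≤-trans (s≤s (s≤s z≤n)) i<q

  x w z : W
  x = lv a
  w = pv 1 (s≤s z≤n)
  z = pv 2 (s≤s (ℕ.≤-trans (s≤s z≤n) 2≤q))

  sideᵂ : W → Bool
  sideᵂ = side (2 + i)

  beyond : ∀ {v} → sideᵂ v ≡ true → y ≢ v
  beyond p refl with trans (sym p) y-side
  ... | ()

  w-side : sideᵂ w ≡ true
  w-side = side-≤ {m} {n} {q} {2 + i} {1} {s≤s z≤n} (s≤s z≤n)

  z-side : sideᵂ z ≡ true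
  z-side = side-≤ {m} {n} {q} {2 + i} {2} {s≤s (ℕ.≤-trans (s≤s z≤n) 2≤q)} (s≤s (s≤s z≤n))

  ¬adj : ¬ D e₀ x y
  ¬adj d = beyond {A} refl (nbr-lv (D⇒G d))

  open AddEdge {e₀ = e₀} {x} {y} (beyond {x} refl ∘ sym) ¬adj public

  Al : ∀ {c} → H A (lv c)
  Al = lk (λ ()) l→

  A-w : H A w
  A-w = lk {pE 0 z≤n} (λ ()) p→

  w-z : H w z
  w-z = lk {pE 1 (ℕ.≤-trans (s≤s z≤n) 2≤q)} (λ ()) p→

  total : Total H
  total v = _ , inj₁ (proj₂ (path-nbr a b₀ v))

  bd : Bad H A x w (lv a′) y z
  bd = mkBad Al A-w Al (λ ()) (a′≢a ∘ sym ∘ lv-inj) (λ ()) xy (beyond {A} refl) w-z (λ ())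

  connected : ∀ {s t} → x ≢ s → x ≢ t → sideᵂ s ≡ true → sideᵂ t ≡ true → ∀ c → Closed (Del H s t) c → c A ≡ c B
  connected {s} {t} p r ps pt c cl = trans (cl (Al , off′ p r)) (trans (cl (xy , off p r)) (y-con c far))
    where
    far : ∀ {u v} → sideᵂ u ≡ false → sideᵂ v ≡ false → D e₀ u v → c u ≡ c v
    far {u} {v} su sv d = cl (inj₁ d , off (λ { refl → clash ps su }) (λ { refl → clash pt su }))
      where
      clash : ∀ {b : Bool} → b ≡ true → b ≡ false → ⊥
      clash refl ()

  hubs : ∀ v → Three H v → v ≡ A ⊎ v ≡ B
  hubs v t with three-H t
  ... | inj₁ p = inj₁ p
  ... | inj₂ (inj₁ p) = inj₂ p
  ... | inj₂ (inj₂ (inj₁ refl)) = ⊥-elim (¬three (degH-x (degD-off e₀ (λ ()) (λ ()) (deg-l a))) ℕ.≤-refl t)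
  ... | inj₂ (inj₂ (inj₂ refl)) = ⊥-elim (¬three (degH-y dy) ℕ.≤-refl t)

  B≢ : ∀ {j} .{g : j ≤ suc q} → j ≤ q → _≢_ {A = W} B (pv j g)
  B≢ le = pv≢ (ℕ.<⇒≢ (s≤s le) ∘ sym)

  tree : TreeData m n H
  tree = mkTree sy ir total bd (λ ()) (B≢ (ℕ.≤-trans (s≤s z≤n) 2≤q)) (B≢ 2≤q)
    (degH-off (λ ()) (beyond {A} refl ∘ sym) (degD-off e₀ (λ ()) (λ ()) deg-A))
    (degH-off (λ ()) (y≢B ∘ sym) (degD-off e₀ (B≢ (ℕ.<⇒≤ i<q)) (B≢ i<q) deg-B))
    hubs
    (connected {A} {w} (λ ()) (λ ()) refl w-side)
    (connected {w} {z} (λ ()) (λ ()) w-side z-side)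

  open TreeBound {m} {n} {q} tree

  -- Cutting `A x` leaves the leaf `x` with the far part, to which the new edge joins it; all other
  -- vertices have the colour given by `side`.
  cutc : W → Bool
  cutc (pv j h) = sideᵂ (pv j h)
  cutc (rv b) = false
  cutc (lv c) with c Fin.≟ a
  ... | yes _ = false
  ... | no _  = true

  cut-x : cutc x ≡ false
  cut-x with a Fin.≟ a
  ... | yes _ = refl
  ... | no p = ⊥-elim (p refl)

  cut-y : ∀ v → sideᵂ v ≡ false → cutc v ≡ false
  cut-y (pv j h) p = p
  cut-y (rv b) p = refl

  cut : Closed (Del H A x) cutc
  cut (inj₂ (inj₁ (refl , refl)) , _) = trans cut-x (sym (cut-y y y-side))
  cut (inj₂ (inj₂ (refl , refl)) , _) = trans (cut-y y y-side) (sym cut-x)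
  cut (inj₁ d , ne) with D-link⁻ d
  ... | _ , ne′ , p→ = side-closed {h = ℕ.<⇒≤ i<q} d
  ... | _ , ne′ , p← = side-closed {h = ℕ.<⇒≤ i<q} d
  ... | _ , _ , r→ = side-closed {h = ℕ.<⇒≤ i<q} d
  ... | _ , _ , r← = side-closed {h = ℕ.<⇒≤ i<q} d
  ... | _ , ne′ , l→ {c} with c Fin.≟ a
  ...   | yes refl = ⊥-elim (ne (inj₁ (refl , refl)))
  ...   | no _ = refl
  cut (inj₁ d , ne) | _ , ne′ , l← {c} with c Fin.≟ a
  ...   | yes refl = ⊥-elim (ne (inj₂ (refl , refl)))
  ...   | no _ = refl

  sep : cutc A ≢ cutc B
  sep p with trans p (side-B {m} {n} {h = ℕ.<⇒≤ i<q})
  ... | ()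

  module _ {k : ℕ} (req : Req m n q k) where

    open Req req

    n≥2-bound : 2 ≤ n → ¬ Family m n q k H
    n≥2-bound n≥2 with m ℕ.≟ 2
    ... | yes m≡2 = Two.bound-4 n≥2 m≡2 (λ { refl → ℕ.n≮0 i<q }) cutc cut sep (two′ m≡2 n≥2 (ℕ.≤-trans (s≤s (s≤s (s≤s z≤n))) i<q))
    ... | no m≢2 with big m≥3 n≥2 2≤q
      where
      m≥3 = 3≤ a (λ { refl → a′≢a (fin1 a′ a) }) m≢2
    ...   | inj₁ lt = bound-3 n≥2 (3≤ a (λ { refl → a′≢a (fin1 a′ a) }) m≢2) lt
    ...   | inj₂ (lt , ne) = bound-2 n≥2 (3≤ a (λ { refl → a′≢a (fin1 a′ a) }) m≢2) ne lt

    n≡1-bound : n ≡ 1 → m ≢ 2 → ¬ Family m n q k H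
    n≡1-bound refl m≢2 = BigSpider.no-family (tree⇒spider refl) m≥3 (single refl m≥3 2≤q)
      where
      m≥3 = 3≤ a (λ { refl → a′≢a (fin1 a′ a) }) m≢2

    small-bound : n ≡ 1 → m ≡ 2 → q ≢ 3 → ¬ Family m n q k H
    small-bound refl refl q≢3 = SmallSpider.no-family (tree⇒spider refl) (small″ refl refl 2≤q q≢3)

module LeftLeaf¹ (a a′ : Fin 2) (a′≢a : a′ ≢ a) (y : V 2 1 3) (y-side : side {2} {1} {3} 2 y ≡ false) (y≢B : y ≢ B {2} {1} {3})
  (dy : Deg (D {2} {1} {3} (pE 2 (s≤s (s≤s z≤n)))) y 1) (y-con : JoinedToB {2} {1} {3} 2 (s≤s (s≤s z≤n)) y) where

  open LeftLeaf {i = 0} ℕ.≤-refl a a′ a′≢a Fin.zero y y-side y≢B dy y-con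
  open SmallSpider {3} (TreeBound.tree⇒spider {2} {1} {3} tree refl)
  open LeafToInt¹.Q₃₂ a a′ a′≢a using (ct; cf; c)

  w-nbr : ∀ {v} → H w v → v ≡ A ⊎ v ≡ z
  w-nbr h with D-link⁻ (old-nbr (λ ()) (beyond {w} refl ∘ sym) h)
  ... | _ , _ , p→ = inj₂ refl
  ... | _ , _ , p← = inj₁ refl

  z-nbr : ∀ {v} → H z v → v ≡ w
  z-nbr h with D-link⁻ (old-nbr (λ ()) (beyond {z} refl ∘ sym) h)
  ... | _ , ne , p→ = ⊥-elim (ne refl)
  ... | _ , _ , p← = refl

  same-colour : ∀ v → c v ≡ cutc v
  same-colour (pv 0 _) = refl
  same-colour (pv 1 _) = refl
  same-colour (pv 2 _) = refl
  same-colour (pv (suc (suc (suc i))) _) = refl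
  same-colour (rv b) = refl
  same-colour (lv d) with d Fin.≟ a
  ... | yes _ = refl
  ... | no _ = refl

  none : ∀ {k} → 3 < k → ¬ Family 2 1 3 k H
  none = bounded _ (λ s → long-short s (λ ()) (λ _ → w-nbr) (λ _ → z-nbr) cutc cut
           (card-≐ (λ {v} p → trans (sym (same-colour v)) p) (λ {v} p → trans (same-colour v) p) ct)
           (card-≐ (λ {v} p → trans (sym (same-colour v)) p) (λ {v} p → trans (same-colour v) p) cf))

left-leaf : ∀ {m n q i k} (i<q : 2 + i < q) (a a′ : Fin m) (a′≢a : a′ ≢ a) (b₀ : Fin n) (y : V m n q)
  (y-side : side (2 + i) y ≡ false) (y≢B : y ≢ B) (dy : Deg (D (pE (2 + i) (ℕ.<⇒≤ i<q))) y 1) →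
  (∀ c → (∀ {u v} → side (2 + i) u ≡ false → side (2 + i) v ≡ false → D (pE (2 + i) (ℕ.<⇒≤ i<q)) u v → c u ≡ c v) → c y ≡ c B) →
  Req m n q k → ¬ Family m n q k (Add (D (pE (2 + i) (ℕ.<⇒≤ i<q))) (lv a) y)
left-leaf {m} {n} {q} {i} {k} i<q a a′ a′≢a b₀ y ys yB dy yc req with n ℕ.≟ 1 | m ℕ.≟ 2 | q ℕ.≟ 3
... | no n≢1 | _ | _ = LeftLeaf.n≥2-bound i<q a a′ a′≢a b₀ y ys yB dy yc req (2≤ b₀ n≢1)
... | yes n≡1 | no m≢2 | _ = LeftLeaf.n≡1-bound i<q a a′ a′≢a b₀ y ys yB dy yc req n≡1 m≢2
... | yes n≡1 | yes m≡2 | no q≢3 = LeftLeaf.small-bound i<q a a′ a′≢a b₀ y ys yB dy yc req n≡1 m≡2 q≢3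
left-leaf {i = zero} i<q a a′ a′≢a Fin.zero y ys yB dy yc req | yes refl | yes refl | yes refl =
  LeftLeaf¹.none a a′ a′≢a y ys yB dy yc (Req.small′ req refl refl refl)
left-leaf {i = suc i} (s≤s (s≤s (s≤s ()))) _ _ _ _ _ _ _ _ _ _ | yes refl | yes refl | yes refl

-- The new edge joins A to a right leaf after removing the first path edge, p ≥ 4.
module HubToRight {m n q : ℕ} (a₀ : Fin m) (b b′ : Fin n) (b′≢b : b′ ≢ b) where

  W : Set
  W = V m n (2 + q)

  y w z : W
  y = rv b
  w = pv (2 + q) (ℕ.n≤1+n _)
  z = pv (1 + q) (ℕ.m≤n⇒m≤1+n (ℕ.n≤1+n _))

  ¬adj : ¬ D (pE 0 z≤n) A y
  ¬adj d with D⇒G d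
  ... | _ , ()

  open AddEdge {e₀ = pE 0 z≤n} {A} {y} (λ ()) ¬adj public

  Br : ∀ {b} → H B (rv b)
  Br = lk (λ ()) r→

  Al : ∀ {c} → H A (lv c)
  Al = lk (λ ()) l→

  total : Total H
  total v = _ , inj₁ (proj₂ (path-nbr a₀ b v))

  bd : Bad H B y w (rv b′) A z
  bd = mkBad Br (lk {pE (2 + q) ℕ.≤-refl} (λ ()) p←) Br (λ ()) (b′≢b ∘ sym ∘ rv-inj) (λ ()) yx (λ ())
         (lk {pE (1 + q) (ℕ.n≤1+n _)} (λ ()) p←) (λ ())

  hubs : ∀ v → Three H v → v ≡ B ⊎ v ≡ A
  hubs v t with three-H t
  ... | inj₁ p = inj₂ p
  ... | inj₂ (inj₁ p) = inj₁ p
  ... | inj₂ (inj₂ (inj₁ p)) = inj₂ p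
  ... | inj₂ (inj₂ (inj₂ refl)) = ⊥-elim (¬three (degH-y (degD-off (pE 0 z≤n) (λ ()) (λ ()) (deg-r b))) ℕ.≤-refl t)

  tree : TreeData n m H
  tree = mkTree sy ir total bd (λ ()) (λ ()) (λ ())
    (degH-off (λ ()) (λ ()) (degD-off (pE 0 z≤n) (λ ()) (λ ()) deg-B))
    (degH-x (degD-src (pE 0 z≤n) deg-A))
    hubs
    (λ c cl → trans (cl (Br {b} , fan (λ ()) (λ ()))) (cl (yx , off (λ ()) (λ ()))))
    (λ c cl → trans (cl (Br {b} , off (λ ()) (λ ()))) (cl (yx , off (λ ()) (λ ()))))

  cutc : W → Bool
  cutc (pv i h) = side {m} {n} 0 (pv i h)
  cutc (lv _) = true
  cutc (rv c) with c Fin.≟ b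
  ... | yes _ = true
  ... | no _  = false

  cut-y : cutc y ≡ true
  cut-y with b Fin.≟ b
  ... | yes _ = refl
  ... | no p = ⊥-elim (p refl)

  cut : Closed (Del H B y) cutc
  cut (inj₂ (inj₁ (refl , refl)) , _) = sym cut-y
  cut (inj₂ (inj₂ (refl , refl)) , _) = cut-y
  cut (inj₁ d , ne) with D-link⁻ d
  ... | _ , ne′ , p→ = side-closed {h = z≤n} d
  ... | _ , ne′ , p← = side-closed {h = z≤n} d
  ... | _ , _ , l→ = refl
  ... | _ , _ , l← = refl
  ... | _ , _ , r→ {c} with c Fin.≟ b
  ...   | yes refl = ⊥-elim (ne (inj₁ (refl , refl)))
  ...   | no _ = refl
  cut (inj₁ d , ne) | _ , _ , r← {c} with c Fin.≟ b
  ...   | yes refl = ⊥-elim (ne (inj₂ (refl , refl)))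
  ...   | no _ = refl

  sep : cutc B ≢ cutc A
  sep ()

  open TreeBound {n} {m} {2 + q} tree

  y-nbr : ∀ {v} → v ≢ b → ∀ {u} → H (rv v) u → u ≡ B
  y-nbr ne h = nbr-rv (D⇒G (old-nbr (λ ()) (ne ∘ rv-inj) h))

  n≢1 : n ≢ 1
  n≢1 refl = b′≢b (fin1 b′ b)

module HubToRight₀ {m n : ℕ} (a₀ : Fin m) (b b′ : Fin n) (b′≢b : b′ ≢ b) where

  open HubToRight {q = 0} a₀ b b′ b′≢b

  w-nbr : ∀ {v} → H w v → v ≡ B ⊎ v ≡ z
  w-nbr h with D-link⁻ (old-nbr (λ ()) (λ ()) h)
  ... | _ , _ , p→ = inj₁ refl
  ... | _ , _ , p← = inj₂ refl

  z-nbr : ∀ {v} → H z v → v ≡ w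
  z-nbr h with D-link⁻ (old-nbr (λ ()) (λ ()) h)
  ... | _ , _ , p→ = refl
  ... | _ , ne , p← = ⊥-elim (ne refl)

  none : 2 ≤ m → n ≡ 2 → ∀ {k} → 2 < k → ¬ Family n m 2 k H
  none m≥2 n≡2 = TreeBound.Two.bound-short {n} {m} tree m≥2 n≡2 (λ ()) cutc cut sep (λ _ → w-nbr) (λ _ → z-nbr)

module HubToRight₁ (b b′ : Fin 2) (b′≢b : b′ ≢ b) where

  open HubToRight {1} {2} {1} Fin.zero b b′ b′≢b
  open SmallSpider {3} (TreeBound.tree⇒spider {2} {1} {3} tree refl)

  A-nbr : ∀ {v} → H A v → v ≡ y ⊎ v ≡ lv Fin.zero
  A-nbr (inj₂ (inj₁ (_ , p))) = inj₁ p
  A-nbr (inj₁ d) with D-link⁻ d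
  ... | _ , ne , p→ = ⊥-elim (ne refl)
  ... | _ , _ , l→ {Fin.zero} = inj₂ refl

  l-nbr : ∀ {v} → H (lv Fin.zero) v → v ≡ A
  l-nbr h = nbr-lv (D⇒G (old-nbr (λ ()) (λ ()) h))

  z-nbr : ∀ {v} → H z v → v ≡ w ⊎ v ≡ pv 1 (s≤s z≤n)
  z-nbr h with D-link⁻ (old-nbr (λ ()) (λ ()) h)
  ... | _ , _ , p→ = inj₁ refl
  ... | _ , _ , p← = inj₂ refl

  end-nbr : ∀ {v} → H (pv 1 (s≤s z≤n)) v → v ≡ z
  end-nbr h with D-link⁻ (old-nbr (λ ()) (λ ()) h)
  ... | _ , _ , p→ = refl
  ... | _ , ne , p← = ⊥-elim (ne refl)

  none : ∀ {k} → 3 < k → ¬ Family 2 1 3 k H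
  none = bounded _ (λ s → long-long s Al (λ ()) (λ _ → A-nbr) (λ _ → l-nbr)
           (lk {pE 1 (s≤s z≤n)} (λ ()) p←) (λ ()) (λ _ → z-nbr) (λ _ → end-nbr))

hub-to-right : ∀ {m n q k} (a₀ : Fin m) (b b′ : Fin n) → b′ ≢ b → Req n m (2 + q) k →
               ¬ Family m n (2 + q) k (Add (D {q = 2 + q} (pE 0 z≤n)) A (rv b))
hub-to-right {m} {n} {q} {k} a₀ b b′ b′≢b req fam with m ℕ.≟ 1 | n ℕ.≟ 2
... | no m≢1 | no n≢2 = go (big n≥3 m≥2 (s≤s (s≤s z≤n)))
  where
  open Req req
  m≥2 = 2≤ a₀ m≢1
  n≥3 = 3≤ b (λ { refl → b′≢b (fin1 b′ b) }) n≢2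
  tr = HubToRight.tree {q = q} a₀ b b′ b′≢b
  go : 2 < k ⊎ (1 < k × n ≢ suc m) → ⊥
  go (inj₁ lt) = TreeBound.bound-3 {n} {m} {2 + q} tr m≥2 n≥3 lt (family-reflect fam)
  go (inj₂ (lt , ne)) = TreeBound.bound-2 {n} {m} {2 + q} tr m≥2 n≥3 ne lt (family-reflect fam)
... | no m≢1 | yes n≡2 = go q (λ { refl → two n≡2 m≥2 (s≤s z≤n) }) (two′ n≡2 m≥2) fam
  where
  open Req req
  m≥2 = 2≤ a₀ m≢1
  go : ∀ q → (q ≡ 0 → 2 < k) → (3 ≤ 2 + q → 3 < k) → ¬ Family m n (2 + q) k (Add (D {q = 2 + q} (pE 0 z≤n)) A (rv b))
  go zero r _ f = HubToRight₀.none a₀ b b′ b′≢b m≥2 n≡2 (r refl) (family-reflect f)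
  go (suc q) _ r f = TreeBound.Two.bound-4 (HubToRight.tree {q = suc q} a₀ b b′ b′≢b) m≥2 n≡2 (λ ())
    (HubToRight.cutc {q = suc q} a₀ b b′ b′≢b) (HubToRight.cut {q = suc q} a₀ b b′ b′≢b) (HubToRight.sep {q = suc q} a₀ b b′ b′≢b) (r (s≤s (s≤s (s≤s z≤n)))) (family-reflect f)
... | yes refl | no n≢2 = BigSpider.no-family (TreeBound.tree⇒spider {n} {1} {2 + q} (HubToRight.tree {q = q} a₀ b b′ b′≢b) refl) n≥3
                            (Req.single req refl n≥3 (s≤s (s≤s z≤n))) (family-reflect fam)
  where n≥3 = 3≤ b (λ { refl → b′≢b (fin1 b′ b) }) n≢2
hub-to-right {q = q} {k} Fin.zero b b′ b′≢b req fam | yes refl | yes refl = go q (small′ refl refl) (small″ refl refl (s≤s (s≤s z≤n))) fam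
  where
  open Req req
  go : ∀ q → (2 + q ≡ 3 → 3 < k) → (2 + q ≢ 3 → 4 < k) → ¬ Family 1 2 (2 + q) k (Add (D {q = 2 + q} (pE 0 z≤n)) A (rv b))
  go q r₃ r f with 2 + q ℕ.≟ 3
  ... | yes refl = HubToRight₁.none b b′ b′≢b (r₃ refl) (family-reflect f)
  ... | no ne = SmallSpider.no-family (TreeBound.tree⇒spider {2} {1} {2 + q} (HubToRight.tree {q = q} Fin.zero b b′ b′≢b) refl) (r ne) (family-reflect f)

-- m = 1, the isolated leaf is attached to a right leaf.
module LeafToLeaf {n r : ℕ} (a : Fin 1) (b b′ : Fin n) (b′≢b : b′ ≢ b) where

  W : Set
  W = V 1 n (suc r)

  x y w z : W
  x = lv a
  y = rv b
  w = pv (suc r) (ℕ.n≤1+n _)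
  z = pv r (ℕ.m≤n⇒m≤1+n (ℕ.n≤1+n _))

  open AddEdge {e₀ = lE a} {x} {y} (λ ()) leaf-isolatedˡ public

  Br : ∀ {b} → H B (rv b)
  Br = lk (λ ()) r→

  w-z : H w z
  w-z = lk {pE r (ℕ.n≤1+n _)} (λ ()) p←

  total : Total H
  total (pv zero _) = pv 1 (s≤s z≤n) , lk {pE 0 z≤n} (λ ()) p→
  total (pv (suc i) g) = pv i (ℕ.<⇒≤ g) , lk {pE i (ℕ.≤-pred g)} (λ ()) p←
  total (lv c) = y , subst (λ d → H (lv d) y) (fin1 a c) xy
  total (rv b) = B , lk (λ ()) r←

  spider : SpiderData n H
  spider = mkSpider sy ir total
    (mkBad Br (lk {pE (suc r) ℕ.≤-refl} (λ ()) p←) Br (λ ()) (b′≢b ∘ sym ∘ rv-inj) (λ ()) yx (λ ()) w-z (λ ()))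
    (degH-off (λ ()) (λ ()) (degD-off (lE a) (λ ()) (λ ()) deg-B))
    only
    where
    only : ∀ v → Three H v → v ≡ B
    only v t with three-H t
    ... | inj₁ refl = ⊥-elim (¬three (degH-off (λ ()) (λ ()) (degD-src (lE a) deg-A)) (s≤s z≤n) t)
    ... | inj₂ (inj₁ p) = p
    ... | inj₂ (inj₂ (inj₁ refl)) = ⊥-elim (¬three (degH-x (degD-tgt (lE a) (deg-l a))) (s≤s z≤n) t)
    ... | inj₂ (inj₂ (inj₂ refl)) = ⊥-elim (¬three (degH-y (degD-off (lE a) (λ ()) (λ ()) (deg-r b))) ℕ.≤-refl t)

  x-nbr : ∀ {v} → H x v → v ≡ y
  x-nbr (inj₁ d) = ⊥-elim (leaf-isolatedˡ d)
  x-nbr (inj₂ (inj₁ (_ , p))) = p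

  y-nbr : ∀ {v} → H y v → v ≡ B ⊎ v ≡ x
  y-nbr (inj₁ d) = inj₁ (nbr-rv (D⇒G d))
  y-nbr (inj₂ (inj₂ (_ , p))) = inj₂ p

  A-nbr : ∀ {v} → H A v → v ≡ pv 1 (s≤s z≤n)
  A-nbr h with D-link⁻ (old-nbr (λ ()) (λ ()) h)
  ... | _ , _ , p→ = refl
  ... | _ , ne , l→ {c} = ⊥-elim (ne (cong lE (fin1 c a)))

module LeafToLeaf₀ {n : ℕ} (a : Fin 1) (b b′ : Fin n) (b′≢b : b′ ≢ b) where

  open LeafToLeaf {n} {0} a b b′ b′≢b

  large : 3 ≤ n → ∀ {k} → 1 < k → ¬ Family n 1 1 k H
  large n≥3 = short-spider spider n≥3 (λ _ → x-nbr) (λ _ → A-nbr)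

module LeafToLeaf₀₂ (a : Fin 1) (b b′ : Fin 2) (b′≢b : b′ ≢ b) where

  open LeafToLeaf {2} {0} a b b′ b′≢b
  open SmallSpider {1} spider

  w-nbr : ∀ {v} → H w v → v ≡ B ⊎ v ≡ z
  w-nbr h with D-link⁻ (old-nbr (λ ()) (λ ()) h)
  ... | _ , _ , p→ = inj₁ refl
  ... | _ , _ , p← = inj₂ refl

  none : ∀ {k} → 2 < k → ¬ Family 2 1 1 k H
  none = bounded _ (λ s → short-short s (λ ()) (λ _ → y-nbr) (λ _ → x-nbr) (λ _ → w-nbr) (λ _ → A-nbr))

module LeafToLeaf₂ (a : Fin 1) (b b′ : Fin 2) (b′≢b : b′ ≢ b) where

  open LeafToLeaf {2} {2} a b b′ b′≢b
  open SpiderData spider using (bd; dv; only)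
  open Spider₂ {3} sy ir total (bad-swap bd) dv only

  c : W → Bool
  c (pv j _) = j ≤ᵇ 3
  c (lv _) = false
  c (rv _) = false

  cl : Closed (Del H B w) c
  cl (inj₂ (inj₁ (refl , refl)) , _) = refl
  cl (inj₂ (inj₂ (refl , refl)) , _) = refl
  cl (inj₁ d , ne) with D-link⁻ d
  ... | _ , _ , p→ {0} = refl
  ... | _ , _ , p→ {1} = refl
  ... | _ , _ , p→ {2} = refl
  ... | _ , _ , p→ {3} = ⊥-elim (ne (inj₂ (refl , refl)))
  ... | _ , _ , p→ {suc (suc (suc (suc _)))} = refl
  ... | _ , _ , p← {0} = refl
  ... | _ , _ , p← {1} = refl
  ... | _ , _ , p← {2} = refl
  ... | _ , _ , p← {3} = ⊥-elim (ne (inj₁ (refl , refl)))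
  ... | _ , _ , p← {suc (suc (suc (suc _)))} = refl
  ... | _ , ne′ , l→ {c} = ⊥-elim (ne′ (cong lE (fin1 c a)))
  ... | _ , ne′ , l← {c} = ⊥-elim (ne′ (cong lE (fin1 c a)))
  ... | _ , _ , r→ = refl
  ... | _ , _ , r← = refl

  ct : Card (λ v → c v ≡ true) 4
  ct = card (A ∷ pv 1 (s≤s z≤n) ∷ z ∷ w ∷ [])
    (((λ ()) ∷ (λ ()) ∷ (λ ()) ∷ []) ∷ ((λ ()) ∷ (λ ()) ∷ []) ∷ ((λ ()) ∷ []) ∷ [] ∷ [])
    (λ { (here refl) → refl ; (there (here refl)) → refl ; (there (there (here refl))) → refl ; (there (there (there (here refl)))) → refl })
    compl refl
    where
    compl : ∀ {v} → c v ≡ true → v ∈ A ∷ pv 1 (s≤s z≤n) ∷ z ∷ w ∷ []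
    compl {pv 0 _} _ = here refl
    compl {pv 1 _} _ = there (here refl)
    compl {pv 2 _} _ = there (there (here refl))
    compl {pv 3 _} _ = there (there (there (here refl)))

  cf : Card (λ v → c v ≡ false) 4
  cf = card (B ∷ x ∷ y ∷ rv b′ ∷ [])
    (((λ ()) ∷ (λ ()) ∷ (λ ()) ∷ []) ∷ ((λ ()) ∷ (λ ()) ∷ []) ∷ ((b′≢b ∘ sym ∘ rv-inj) ∷ []) ∷ [] ∷ [])
    (λ { (here refl) → refl ; (there (here refl)) → refl ; (there (there (here refl))) → refl ; (there (there (there (here refl)))) → refl })
    compl refl
    where
    compl : ∀ {v} → c v ≡ false → v ∈ B ∷ x ∷ y ∷ rv b′ ∷ []
    compl {pv 4 _} _ = here refl
    compl {pv (suc (suc (suc (suc (suc i))))) h} _ = ⊥-elim (too-long (recompute (_ ℕ.≤? 4) h))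
      where
      too-long : ¬ 5 + i ≤ 4
      too-long (s≤s (s≤s (s≤s (s≤s ()))))
    compl {lv d} _ = there (here (cong lv (fin1 d a)))
    compl {rv d} _ with fin2 b′≢b d
    ... | inj₁ refl = there (there (here refl))
    ... | inj₂ refl = there (there (there (here refl)))

  none : ∀ {k} → 3 < k → ¬ Family 2 1 3 k H
  none = bounded _ (λ s → long-short s (λ ()) (λ _ → y-nbr) (λ _ → x-nbr) c cl ct cf)

leaf-to-leaf : ∀ {n r k} (a : Fin 1) (b b′ : Fin n) → b′ ≢ b → Req n 1 (suc r) k →
               ¬ Family 1 n (suc r) k (Add (D {q = suc r} (lE a)) (lv a) (rv b))
leaf-to-leaf {n} {r} {k} a b b′ b′≢b req fam with n ℕ.≟ 2
... | no n≢2 = go r (pair refl n≥3) (single refl n≥3) fam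
  where
  open Req req
  n≥3 = 3≤ b (λ { refl → b′≢b (fin1 b′ b) }) n≢2
  go : ∀ r → (suc r ≡ 1 → 1 < k) → (2 ≤ suc r → 2 < k) → ¬ Family 1 n (suc r) k (Add (D {q = suc r} (lE a)) (lv a) (rv b))
  go zero r₁ _ f = LeafToLeaf₀.large a b b′ b′≢b n≥3 (r₁ refl) (family-reflect f)
  go (suc r) _ r₂ f = BigSpider.no-family (LeafToLeaf.spider {n} {suc r} a b b′ b′≢b) n≥3 (r₂ (s≤s (s≤s z≤n))) (family-reflect f)
... | yes refl = go r (small refl refl) (small′ refl refl) (small″ refl refl) fam
  where
  open Req req
  go : ∀ r → (suc r ≡ 1 → 2 < k) → (suc r ≡ 3 → 3 < k) → (2 ≤ suc r → suc r ≢ 3 → 4 < k) →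
       ¬ Family 1 2 (suc r) k (Add (D {q = suc r} (lE a)) (lv a) (rv b))
  go 0 r₁ _ _ f = LeafToLeaf₀₂.none a b b′ b′≢b (r₁ refl) (family-reflect f)
  go 2 _ r₃ _ f = LeafToLeaf₂.none a b b′ b′≢b (r₃ refl) (family-reflect f)
  go 1 _ _ r f = SmallSpider.no-family (LeafToLeaf.spider {2} {1} a b b′ b′≢b) (r (s≤s (s≤s z≤n)) (λ ())) (family-reflect f)
  go (suc (suc (suc r))) _ _ s f = SmallSpider.no-family (LeafToLeaf.spider {2} {3 + r} a b b′ b′≢b) (s (s≤s (s≤s z≤n)) (λ ())) (family-reflect f)

-- The types of new edges for each kind of removed edge.

family-iso : ∀ {m n q k} {V W : Set} {H : Rel V} {H′ : Rel W} → H ≅ H′ → Family m n q k H → Family m n q k H′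
family-iso φ fam = record
  { sh = λ i → share (to φ (fa (sh fam i))) (to φ (fb (sh fam i))) (pres φ (fab (sh fam i))) (e (sh fam i))
                 (≅-trans (≅-sym (≅-del φ (fa (sh fam i)) (fb (sh fam i)))) (iso (sh fam i)))
  ; f-inj = λ i j p → f-inj fam i j (same-to⁻ φ p)
  ; e-inj = e-inj fam }

-- The fields correspond to the values of `m` that are degree sums of a pair not containing the
-- isolated leaf: `1 + 1`, `1 + 2`, `2 + 2`, `1 + (n + 1)` and `2 + (n + 1)`. Each asks `k` to
-- exceed the number of codes found for that pair.
record LeafReq (m n q k : ℕ) : Set where
  field
    m-2   : m ≡ 2 → 2 < k
    m-3   : m ≡ 3 → 1 ≤ q → (3 ≤ n → 1 < k) × (n ≤ 2 → 2 < k) × (2 ≤ q → 2 < k)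
    m-4   : m ≡ 4 → 2 ≤ q → 1 < k × (n ≡ 2 → 2 < k)
    m-n+2 : m ≡ 2 + n → (q ≢ 1 → 2 < k) × (q ≡ 1 → n ≢ 1 → 4 < k) × (q ≡ 1 → n ≡ 1 → 3 < k)
    m-n+3 : m ≡ 3 + n → 2 ≤ q → 1 < k

-- An implication, so that a pair can be settled in either way: by an isomorphism that ignores the
-- family, or by showing that no family of this size exists (`never`). The symmetries of the pair
-- are `via`, `flip` and `reflected`.
Solve : ∀ {m n q} → ℕ → GEdge m n q → V m n q → V m n q → Set
Solve {m} {n} {q} k e₀ x y = Family m n q k (Add (D e₀) x y) → Add (D e₀) x y ≅ G {m} {n} {q}

module _ {m n q k : ℕ} where

  via : ∀ {e₀ : GEdge m n q} {x y} (φ : D e₀ ≅ D e₀) → Solve k e₀ (to φ x) (to φ y) → Solve k e₀ x y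
  via φ s fam = ≅-trans (≅-add φ _ _) (s (family-iso (≅-add φ _ _) fam))

  flip : ∀ {e₀ : GEdge m n q} {x y} → Solve k e₀ y x → Solve k e₀ x y
  flip s fam = ≅-trans add-flip (s (family-iso add-flip fam))

  reflected : ∀ {e₀ : GEdge m n q} {x y} → Solve k (ρᴱ e₀) (ρ x) (ρ y) → Solve k e₀ x y
  reflected {e₀} s fam = ≅-trans (≅-add (ρ-D e₀) _ _) (≅-trans (s (family-reflect (family-iso (≅-add (ρ-D e₀) _ _) fam))) ρ-iso)

  never : ∀ {e₀ : GEdge m n q} {x y} → ¬ Family m n q k (Add (D e₀) x y) → Solve k e₀ x y
  never f fam = ⊥-elim (f fam)

module Shift {q : ℕ} where

  private
    H : Rel (V 1 1 q)
    H = Add (D (lE Fin.zero)) (lv Fin.zero) (rv Fin.zero)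

  -- For `m = n = 1` the broom is a path; moving its end vertex `lv` to the other end gives a path
  -- again, with all positions shifted by one.
  fwd bwd : V 1 1 q → V 1 1 q
  fwd (pv zero _) = lv Fin.zero
  fwd (pv (suc i) h) = pv i (ℕ.<⇒≤ h)
  fwd (lv _) = rv Fin.zero
  fwd (rv _) = B
  bwd (pv i h) with i ℕ.≟ suc q
  ... | yes _ = rv Fin.zero
  ... | no ne = pv (suc i) (ℕ.≤∧≢⇒< h ne)
  bwd (lv _) = A
  bwd (rv _) = lv Fin.zero

  bwd-B : bwd B ≡ rv Fin.zero
  bwd-B with suc q ℕ.≟ suc q
  ... | yes _ = refl
  ... | no p = ⊥-elim (p refl)

  bwd-< : ∀ {i} .{g} → i < suc q → .(g′ : suc i ≤ suc q) → bwd (pv i g) ≡ pv (suc i) g′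
  bwd-< {i} l _ with i ℕ.≟ suc q
  ... | yes refl = ⊥-elim (ℕ.<-irrefl refl l)
  ... | no _ = refl

  fwd-bwd : ∀ v → fwd (bwd v) ≡ v
  fwd-bwd (pv i h) with i ℕ.≟ suc q
  ... | yes refl = refl
  ... | no _ = refl
  fwd-bwd (lv Fin.zero) = refl
  fwd-bwd (rv Fin.zero) = refl

  bwd-fwd : ∀ v → bwd (fwd v) ≡ v
  bwd-fwd (pv zero _) = refl
  bwd-fwd (pv (suc i) h) = bwd-< (recompute (_ ℕ.≤? _) h) h
  bwd-fwd (lv Fin.zero) = refl
  bwd-fwd (rv Fin.zero) = bwd-B

  pres-fwd : ∀ {u v} → H u v → G {1} {1} {q} (fwd u) (fwd v)
  pres-fwd (inj₂ (inj₁ (refl , refl))) = _ , r←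
  pres-fwd (inj₂ (inj₂ (refl , refl))) = _ , r→
  pres-fwd (inj₁ d) with D-link⁻ d
  ... | _ , _ , p→ {zero} = _ , l←
  ... | _ , _ , p→ {suc i} {h} = pE i (ℕ.<⇒≤ h) , p→
  ... | _ , _ , p← {zero} = _ , l→
  ... | _ , _ , p← {suc i} {h} = pE i (ℕ.<⇒≤ h) , p←
  ... | _ , ne , l→ {Fin.zero} = ⊥-elim (ne refl)
  ... | _ , ne , l← {Fin.zero} = ⊥-elim (ne refl)
  ... | _ , _ , r→ = pE q ℕ.≤-refl , p→
  ... | _ , _ , r← = pE q ℕ.≤-refl , p←

  step : ∀ i .(h : i ≤ q) .{g g′} → H (bwd (pv i g)) (bwd (pv (suc i) g′))
  step i h with i ℕ.≟ suc q | suc i ℕ.≟ suc q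
  ... | yes refl | _ = ⊥-elim (ℕ.1+n≰n (recompute (_ ℕ.≤? _) h))
  ... | no _ | yes refl = inj₁ (D-link (λ ()) r→)
  ... | no _ | no ne = inj₁ (D-link {e′ = pE (suc i) (ℕ.≤∧≢⇒< h (ne ∘ cong suc))} (λ ()) p→)

  symm : Symm H
  symm = add-symm D-symm

  pres-bwd : ∀ {u v} → G u v → H (bwd u) (bwd v)
  pres-bwd (_ , p→ {i} {h}) = step i h
  pres-bwd (_ , p← {i} {h}) = symm (step i h)
  pres-bwd (_ , l→ {Fin.zero}) = subst (λ t → H t A) (sym (bwd-< {0} {z≤n} (s≤s z≤n) (s≤s z≤n))) (inj₁ (D-link {e′ = pE 0 z≤n} (λ ()) p←))
  pres-bwd (_ , l← {Fin.zero}) = subst (H A) (sym (bwd-< {0} {z≤n} (s≤s z≤n) (s≤s z≤n))) (inj₁ (D-link {e′ = pE 0 z≤n} (λ ()) p→))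
  pres-bwd (_ , r→) = subst (λ t → H t (lv Fin.zero)) (sym bwd-B) (inj₂ (inj₂ (refl , refl)))
  pres-bwd (_ , r←) = subst (H (lv Fin.zero)) (sym bwd-B) (inj₂ (inj₁ (refl , refl)))

  shift : H ≅ G {1} {1} {q}
  shift = mkIso fwd bwd fwd-bwd bwd-fwd pres-fwd pres-bwd

shift-right : ∀ {n q} → n ≡ 1 → (b : Fin n) → Add (D {1} {n} {q} (lE Fin.zero)) (lv Fin.zero) (rv b) ≅ G {1} {n} {q}
shift-right refl Fin.zero = Shift.shift

data LeafKind {m n q : ℕ} (a : Fin m) : V m n q → ℕ → Set where
  isolated : LeafKind a (lv a) 0
  left     : ∀ {a′} → a′ ≢ a → LeafKind a (lv a′) 1
  right    : ∀ b → LeafKind a (rv b) 1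
  hub-A    : LeafKind a A m
  hub-B    : LeafKind a B (suc n)
  inner    : ∀ {j} (h : j < q) → LeafKind a (pv (suc j) (ℕ.m≤n⇒m≤1+n h)) 2

leaf-kind : ∀ {m n q} (a : Fin m) (v : V m n q) → ∃ λ k → LeafKind a v k × Deg (D (lE a)) v k
leaf-kind a (pv zero _) = _ , hub-A , degD-src (lE a) deg-A
leaf-kind {q = q} a (pv (suc j) h) with j ℕ.≟ q
... | yes refl = _ , hub-B , degD-off (lE a) (λ ()) (λ ()) deg-B
... | no ne = _ , inner h′ , degD-off (lE a) (λ ()) (λ ()) (deg-int h′)
  where h′ = ℕ.≤∧≢⇒< (recompute (j ℕ.≤? q) (ℕ.≤-pred h)) ne
leaf-kind a (lv a′) with a′ Fin.≟ a
... | yes refl = _ , isolated , degD-tgt (lE a) (deg-l a)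
... | no ne = _ , left ne , degD-off (lE a) (λ ()) (ne ∘ lv-inj) (deg-l a′)
leaf-kind a (rv b) = _ , right b , degD-off (lE a) (λ ()) (λ ()) (deg-r b)

fin≢1 : ∀ {n} {a b : Fin n} → a ≢ b → n ≢ 1
fin≢1 ne refl = ne (fin1 _ _)

module LeafCase {m n q k : ℕ} (b₀ : Fin n) (tr : Req m n q k) (tr′ : Req n m q k) (lr : LeafReq m n q k) where

  open LeafReq lr

  ℓ-right : m ≡ 1 → (a : Fin m) (b : Fin n) → Solve k (lE {m} {n} {q} a) (lv a) (rv b)
  ℓ-right refl Fin.zero b = go q tr′
    where
    go : ∀ q → Req n 1 q k → Solve k (lE {1} {n} {q} Fin.zero) (lv Fin.zero) (rv b)
    -- For `q = 0` the vertex `A` has become a leaf of `B`, so it can be exchanged with `rv b`.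
    go zero _ _ = restore φ (inj₂ (swap-off (_≟_ {1} {n} {0}) {rv b} {A} {lv Fin.zero} (λ ()) (λ ()) , swap-u (_≟_ {1} {n} {0}) (rv b) A))
      where
      φ : D (lE {1} {n} {0} Fin.zero) ≅ D (lE Fin.zero)
      φ = restore-swap (rv b) A (λ { _ d → f d }) (λ { _ d → g d })
        where
        f : ∀ {w} → D (lE Fin.zero) (rv b) w → D (lE Fin.zero) A w
        f d with nbr-rv (D⇒G d)
        ... | refl = D-link {e′ = pE 0 z≤n} (λ ()) p→
        g : ∀ {w} → D (lE Fin.zero) A w → D (lE Fin.zero) (rv b) w
        g d with D-link⁻ d
        ... | _ , _ , p→ = D-link (λ ()) r←
        ... | _ , ne , l→ {c} = ⊥-elim (ne (cong lE (fin1 c Fin.zero)))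
    go (suc r) req with n ℕ.≟ 1
    go (suc r) req | yes n≡1 = λ _ → shift-right n≡1 b
    go (suc r) req | no n≢1 = never (leaf-to-leaf Fin.zero b _ (proj₂ (another n≢1 b)) req)

  ℓ-B : m ≡ suc n → (a : Fin m) → Solve k (lE {m} {n} {q} a) (lv a) B
  ℓ-B refl a _ = Mirror.leaf-to-B a

  ℓ-inner : m ≡ 2 → (a : Fin m) → ∀ {j} (h : j < q) → Solve k (lE {m} {n} {q} a) (lv a) (pv (suc j) (ℕ.m≤n⇒m≤1+n h))
  ℓ-inner refl a h = never (leaf-to-int a _ (proj₂ (another (λ ()) a)) b₀ h tr)

  left-right : m ≡ 2 → (a : Fin m) → ∀ {a′} → a′ ≢ a → ∀ b → Solve k (lE {m} {n} {q} a) (lv a′) (rv b)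
  left-right refl a {a′} ne b with n ℕ.≟ 1
  ... | yes n≡1 = never (bounded _ (LeafLeaf.bound¹ a a′ ne b n≡1) (m-2 refl))
  ... | no n≢1 = never (bounded _ (LeafLeaf.bound a a′ ne b n≢1) (m-2 refl))

  left-B : m ≡ 2 + n → (a : Fin m) → ∀ {a′} → a′ ≢ a → Solve k (lE {m} {n} {q} a) (lv a′) B
  left-B refl a {a′} ne = go n q a a′ ne b₀ (m-n+2 refl)
    where
    go : ∀ n q (a a′ : Fin (2 + n)) → a′ ≢ a → Fin n → (q ≢ 1 → 2 < k) × (q ≡ 1 → n ≢ 1 → 4 < k) × (q ≡ 1 → n ≡ 1 → 3 < k) →
         Solve k (lE {2 + n} {n} {q} a) (lv a′) B
    go (suc n) 0 a a′ ne _ (r , _) = never (bounded _ (LeafHub₀.bound a a′ ne) (r λ ()))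
    go (suc n) (suc (suc q)) a a′ ne _ (r , _) = never (bounded _ (LeafHub₂.bound a a′ ne) (r λ ()))
    go 1 1 a a′ ne _ (_ , _ , r) = never (bounded _ (LeafHub₁¹.bound a a′ ne) (r refl refl))
    go (suc (suc n)) 1 a a′ ne _ (_ , r , _) = never (bounded _ (LeafHub₁.bound a a′ ne) (r refl λ ()))

  left-inner : m ≡ 3 → (a : Fin m) → ∀ {a′} → a′ ≢ a → ∀ {j} (h : j < q) → Solve k (lE {m} {n} {q} a) (lv a′) (pv (suc j) (ℕ.m≤n⇒m≤1+n h))
  left-inner refl a {a′} ne {zero} h with 3 ℕ.≤? n
  ... | yes n≥3 = never (bounded _ (LeafInt₀.bound₁ a b₀ a′ ne h n≥3) (proj₁ (m-3 refl h) n≥3))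
  ... | no n<3 = never (bounded _ (LeafInt₀.bound₂ a b₀ a′ ne h) (proj₁ (proj₂ (m-3 refl h)) (ℕ.≤-pred (ℕ.≰⇒> n<3))))
  left-inner refl a {a′} ne {suc j} h = never (bounded _ (LeafInt₊.bound a b₀ a′ ne h)
    (proj₂ (proj₂ (m-3 refl (ℕ.≤-trans (s≤s z≤n) h))) (ℕ.≤-trans (s≤s (s≤s z≤n)) h)))

  right-right : m ≡ 2 → (a : Fin m) → ∀ {b b′} → b ≢ b′ → Solve k (lE {m} {n} {q} a) (rv b) (rv b′)
  right-right refl a {b} {b′} ne = never (bounded _ (RightLeaves.bound a b b′ ne) (ℕ.<⇒≤ (m-2 refl)))

  right-inner : m ≡ 3 → (a : Fin m) → ∀ b {j} (h : j < q) → Solve k (lE {m} {n} {q} a) (rv b) (pv (suc j) (ℕ.m≤n⇒m≤1+n h))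
  right-inner refl a b h = go b h (m-3 refl (ℕ.≤-trans (s≤s z≤n) h))
    where
    go : ∀ {n q j} (b : Fin n) (h : j < q) → (3 ≤ n → 1 < k) × (n ≤ 2 → 2 < k) × (2 ≤ q → 2 < k) →
         Solve k (lE {3} {n} {q} a) (rv b) (pv (suc j) (ℕ.m≤n⇒m≤1+n h))
    go {n} {suc q} {j} b h (r₁ , r₂ , r₃) with n ℕ.≟ 1
    go {_} {suc q} {j} Fin.zero h (r₁ , r₂ , r₃) | yes refl = never (bounded _ (RightInt¹.bound a h) (r₂ (s≤s z≤n)))
    go {n} {suc q} {j} b h (r₁ , r₂ , r₃) | no n≢1 with j ℕ.≟ q
    go {n} {suc q} {j} b h (r₁ , r₂ , r₃) | no n≢1 | no ne = never (bounded _ (RightIntInner.bound a b _ (proj₂ (another n≢1 b)) j<q) (r₃ (ℕ.≤-trans (s≤s (s≤s z≤n)) j<q)))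
      where
      j<q : suc j < suc q
      j<q = s≤s (ℕ.≤∧≢⇒< (ℕ.≤-pred h) ne)
    go {n} {suc q} {j} b h (r₁ , r₂ , r₃) | no n≢1 | yes refl with 3 ℕ.≤? n
    ... | yes n≥3 = never (bounded _ (RightIntTop.bound₁ a b _ (proj₂ (another n≢1 b)) n≥3) (r₁ n≥3))
    ... | no n<3 = never (bounded _ (RightIntTop.bound₂ a b _ (proj₂ (another n≢1 b))) (r₂ (ℕ.≤-pred (ℕ.≰⇒> n<3))))

  int-B : m ≡ 3 + n → (a : Fin m) → ∀ {j} (h : j < q) → suc j ≢ q → Solve k (lE {m} {n} {q} a) (pv (suc j) (ℕ.m≤n⇒m≤1+n h)) B
  int-B refl a h ne = never (bounded _ (IntHub.bound a b₀ h′) (m-n+3 refl (ℕ.≤-trans (s≤s (s≤s z≤n)) h′)))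
    where h′ = ℕ.≤∧≢⇒< h ne

  int-int : m ≡ 4 → (a : Fin m) → ∀ {i j} (hᵢ : i < q) (h : j < q) → suc i < j → Solve k (lE {m} {n} {q} a) (pv (suc i) (ℕ.m≤n⇒m≤1+n hᵢ)) (pv (suc j) (ℕ.m≤n⇒m≤1+n h))
  int-int refl a hᵢ h lt with n ℕ.≟ 2
  ... | yes n≡2 = never (bounded _ (IntInt.bound₂ a b₀ lt h) (proj₂ (m-4 refl q≥2) n≡2))
    where q≥2 = ℕ.≤-trans (s≤s (s≤s z≤n)) (ℕ.<-trans lt h)
  ... | no n≢2 = never (bounded _ (λ s → IntInt.bound₁ a b₀ lt h s n≢2) (proj₁ (m-4 refl q≥2)))
    where q≥2 = ℕ.≤-trans (s≤s (s≤s z≤n)) (ℕ.<-trans lt h)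

  adjacent : ∀ {a} {x y : V m n q} {P : Set} → ∀ {d} → ¬ D (lE a) x y → d ≢ lE a → Link d x y → P
  adjacent ¬d ne l = ⊥-elim (¬d (D-link ne l))

  up-step : ∀ {a i} (hᵢ : i < q) (h : suc i < q) → D {m} {n} (lE a) (pv (suc i) (ℕ.m≤n⇒m≤1+n hᵢ)) (pv (suc (suc i)) (ℕ.m≤n⇒m≤1+n h))
  up-step hᵢ h = D-link {e′ = pE _ hᵢ} (λ ()) p→

  sum-m : ∀ {i} → m + suc i ≢ m
  sum-m {i} p = ℕ.1+n≰n (ℕ.≤-trans (ℕ.m≤m+n (suc m) i) (ℕ.≤-reflexive (trans (sym (ℕ.+-suc m i)) p)))

  -- After the removal the ends of `lE a` have degrees `m` and `0`, which gives the sum `m`. Unless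
  -- the pair is `A` with the isolated leaf, is adjacent already, or cannot have this sum, the
  -- equation fixes `m` in terms of the kinds of its members.
  solve : ∀ (a : Fin m) {x y i j} → LeafKind a x i → LeafKind a y j → i + j ≡ m → x ≢ y → ¬ D (lE a) x y → Solve k (lE {m} {n} {q} a) x y
  solve a isolated isolated _ ne _ = ⊥-elim (ne refl)
  solve a isolated (left ne) p _ _ = ⊥-elim (fin≢1 ne (sym p))
  solve a isolated (right b) p _ _ = ℓ-right (sym p) a b
  solve a isolated hub-A _ _ _ _ = restore D-id (inj₂ (refl , refl))
  solve a isolated hub-B p _ _ = ℓ-B (sym p) a
  solve a isolated (inner h) p _ _ = ℓ-inner (sym p) a h
  solve a (left ne) isolated p _ _ = ⊥-elim (fin≢1 ne (sym p))
  solve a (left {a₁} ne₁) (left {a₂} ne₂) p ne _ = ⊥-elim (crowd (sym p) ne₁ ne₂ (λ { refl → ne refl }))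
    where
    crowd : ∀ {m} {a a₁ a₂ : Fin m} → m ≡ 2 → a₁ ≢ a → a₂ ≢ a → a₁ ≢ a₂ → ⊥
    crowd {a₂ = a₂} refl n₁ n₂ n₁₂ with fin2 n₁ a₂
    ... | inj₁ r = n₂ r
    ... | inj₂ r = n₁₂ (sym r)
  solve a (left ne) (right b) p _ _ = left-right (sym p) a ne b
  solve a (left ne) hub-A p _ ¬d = adjacent ¬d (ne ∘ lE-inj) l←
  solve a (left ne) hub-B p _ _ = left-B (sym p) a ne
  solve a (left ne) (inner h) p _ _ = left-inner (sym p) a ne h
  solve a (right b) isolated p _ _ = flip (ℓ-right (sym p) a b)
  solve a (right b) (left ne) p _ _ = flip (left-right (sym p) a ne b)
  solve a (right b) (right b′) p ne _ = right-right (sym p) a (λ { refl → ne refl })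
  solve a (right b) hub-A p _ _ = ⊥-elim (ℕ.1+n≢n p)
  solve a (right b) hub-B p _ ¬d = adjacent ¬d (λ ()) r←
  solve a (right b) (inner h) p _ _ = right-inner (sym p) a b h
  solve a hub-A isolated _ _ _ _ = restore D-id (inj₁ (refl , refl))
  solve a hub-A (left ne) _ _ ¬d = adjacent ¬d (ne ∘ lE-inj) l→
  solve a hub-A (right b) p _ _ = ⊥-elim (sum-m p)
  solve a hub-A hub-A _ ne _ = ⊥-elim (ne refl)
  solve a hub-A hub-B p _ _ = ⊥-elim (sum-m p)
  solve a hub-A (inner h) p _ _ = ⊥-elim (sum-m p)
  solve a hub-B isolated p _ _ = flip (ℓ-B (sym (trans (sym (ℕ.+-identityʳ _)) p)) a)
  solve a hub-B (left ne) p _ _ = flip (left-B (trans (sym p) (ℕ.+-comm _ 1)) a ne)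
  solve a hub-B (right b) _ _ ¬d = adjacent ¬d (λ ()) r→
  solve a hub-B hub-A p _ _ = ⊥-elim (sum-m (trans (ℕ.+-comm m _) p))
  solve a hub-B hub-B _ ne _ = ⊥-elim (ne refl)
  solve a hub-B (inner {j} h) p _ ¬d with suc j ℕ.≟ q
  ... | yes refl = adjacent ¬d (λ ()) (p← {h = ℕ.≤-refl})
  ... | no ne = flip (int-B (trans (sym p) (ℕ.+-comm _ 2)) a h ne)
  solve a (inner h) isolated p _ _ = flip (ℓ-inner (sym p) a h)
  solve a (inner h) (left ne) p _ _ = flip (left-inner (sym p) a ne h)
  solve a (inner h) (right b) p _ _ = flip (right-inner (sym p) a b h)
  solve a (inner h) hub-A p _ _ = ⊥-elim (sum-m (trans (ℕ.+-comm m _) p))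
  solve a (inner {j} h) hub-B p _ ¬d with suc j ℕ.≟ q
  ... | yes refl = adjacent ¬d (λ ()) (p→ {h = ℕ.≤-refl})
  ... | no ne = int-B (sym p) a h ne
  solve a (inner {i} hᵢ) (inner {j} hⱼ) p ne ¬d with ℕ.<-cmp i j
  ... | tri≈ _ refl _ = ⊥-elim (ne refl)
  ... | tri< i<j _ _ with suc i ℕ.≟ j
  ...   | yes refl = ⊥-elim (¬d (up-step hᵢ hⱼ))
  ...   | no r = int-int (sym p) a hᵢ hⱼ (ℕ.≤∧≢⇒< i<j r)
  solve a (inner {i} hᵢ) (inner {j} hⱼ) p ne ¬d | tri> _ _ j<i with suc j ℕ.≟ i
  ...   | yes refl = ⊥-elim (¬d (D-symm (up-step hⱼ hᵢ)))
  ...   | no r = flip (int-int (sym p) a hⱼ hᵢ (ℕ.≤∧≢⇒< j<i r))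

-- Demands of new edges with both ends on one side of a removed path edge. By `same-side-bound`
-- there are two codes, so `2 < k` always suffices; one code remains when the second index is out of
-- range (`first` with `q = 1`, `n ≥ 4`), equals the first (`m = n`, `q = 2`), or is excluded by the
-- hub degrees. `low` lists the values of `m` for which a pair beyond `pE 0`, other than two
-- vertices of degree one, has degree sum `m + 1`.
record SideReq (m n q k : ℕ) : Set where
  field
    first : 1 ≤ q → m ≡ 1 → 2 < k ⊎ (1 < k × q ≡ 1 × 4 ≤ n)
    low   : 2 ≤ q → m ≡ 2 ⊎ m ≡ 3 ⊎ m ≡ 1 + n ⊎ m ≡ 2 + n → 2 < k
    mid   : 2 ≤ q → 2 < k ⊎ (1 < k × m ≡ n × q ≡ 2) ⊎ (1 < k × 3 ≤ m × m ≢ n × m ≢ suc n × n ≢ suc m)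

data StartKind {m n q : ℕ} : V m n q → ℕ → Set where
  hub-A  : StartKind A m
  hub-B  : StartKind B (suc n)
  left   : ∀ a → StartKind (lv a) 1
  right  : ∀ b → StartKind (rv b) 1
  end    : 1 ≤ q → StartKind (pv 1 (s≤s z≤n)) 1
  inner  : ∀ {j} (h : suc j < q) → StartKind (pv (2 + j) (ℕ.m≤n⇒m≤1+n h)) 2

start-kind : ∀ {m n q} → q ≢ 0 → (v : V m n q) → ∃ λ k → StartKind v k × Deg (D (pE 0 z≤n)) v k
start-kind q≢0 (lv a) = _ , left a , degD-off (pE 0 z≤n) (λ ()) (λ ()) (deg-l a)
start-kind q≢0 (rv b) = _ , right b , degD-off (pE 0 z≤n) (λ ()) (λ ()) (deg-r b)
start-kind q≢0 (pv zero _) = _ , hub-A , degD-src (pE 0 z≤n) deg-A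
start-kind {q = q} q≢0 (pv (suc j) h) with j ℕ.≟ q
... | yes refl = _ , hub-B , degD-off (pE 0 z≤n) (λ ()) (λ { refl → q≢0 refl }) deg-B
start-kind {q = q} q≢0 (pv 1 h) | no ne = _ , end 1≤q , degD-tgt (pE 0 z≤n) (deg-int 1≤q)
  where 1≤q = ℕ.≤∧≢⇒< z≤n ne
start-kind {q = q} q≢0 (pv (suc (suc j)) h) | no ne = _ , inner h′ , degD-off (pE 0 z≤n) (λ ()) (λ ()) (deg-int h′)
  where h′ = ℕ.≤∧≢⇒< (recompute (suc j ℕ.≤? q) (ℕ.≤-pred h)) ne

data CentreKind {m n : ℕ} : V m n 0 → ℕ → Set where
  hub-A : CentreKind A m
  hub-B : CentreKind B n
  left  : ∀ a → CentreKind (lv a) 1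
  right : ∀ b → CentreKind (rv b) 1

centre-kind : ∀ {m n} (v : V m n 0) → ∃ λ k → CentreKind v k × Deg (D (pE 0 z≤n)) v k
centre-kind (lv a) = _ , left a , degD-off (pE 0 z≤n) (λ ()) (λ ()) (deg-l a)
centre-kind (rv b) = _ , right b , degD-off (pE 0 z≤n) (λ ()) (λ ()) (deg-r b)
centre-kind (pv 0 _) = _ , hub-A , degD-src (pE 0 z≤n) deg-A
centre-kind (pv 1 _) = _ , hub-B , degD-tgt (pE 0 z≤n) deg-B
centre-kind (pv (suc (suc i)) h) = ⊥-elim (too-long (recompute (_ ℕ.≤? 1) h))
  where
  too-long : ¬ 2 + i ≤ 1
  too-long (s≤s ())

data MidKind {m n q : ℕ} (i : ℕ) : V m n q → Set where
  left  : ∀ a → MidKind i (lv a)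
  right : ∀ b → MidKind i (rv b)
  near  : ∀ .{h} → MidKind i (pv i h)
  far   : ∀ .{h} → MidKind i (pv (suc i) h)

-- No vertex becomes isolated when an inner path edge is cut, and both its ends are left with degree
-- one. A degree sum of two thus forces two vertices of degree one, which are leaves or ends of the
-- cut.
mid-kind : ∀ {m n q i} (a₀ : Fin m) (b₀ : Fin n) (i<q : suc i < q) (v : V m n q) →
           ∃ λ k → Deg (D (pE (suc i) (ℕ.<⇒≤ i<q))) v (suc k) × (k ≡ 0 → MidKind (suc i) v)
mid-kind {m} {n} {q} {i} a₀ b₀ i<q = go
  where
  e₀ : GEdge m n q
  e₀ = pE (suc i) (ℕ.<⇒≤ i<q)
  pos : ∀ {n} → Fin n → ∃ λ k → n ≡ suc k
  pos {suc n} _ = n , refl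
  go : ∀ v → ∃ λ k → Deg (D e₀) v (suc k) × (k ≡ 0 → MidKind (suc i) v)
  go (lv a) = 0 , degD-off e₀ (λ ()) (λ ()) (deg-l a) , λ _ → left a
  go (rv b) = 0 , degD-off e₀ (λ ()) (λ ()) (deg-r b) , λ _ → right b
  go (pv zero _) = m , degD-off e₀ (λ ()) (λ ()) deg-A , λ p → ⊥-elim (ℕ.1+n≢0 (trans (sym (proj₂ (pos a₀))) p))
  go (pv (suc j) h) with j ℕ.≟ q | j ℕ.≟ i | j ℕ.≟ suc i
  ... | yes refl | _ | _ = n , degD-off e₀ (λ { refl → ℕ.1+n≰n (ℕ.<⇒≤ i<q) }) (λ { refl → ℕ.1+n≰n i<q }) deg-B
                       , λ p → ⊥-elim (ℕ.1+n≢0 (trans (sym (proj₂ (pos b₀))) p))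
  ... | no _ | yes refl | _ = 0 , degD-src e₀ (deg-int (ℕ.<⇒≤ i<q)) , λ _ → near
  ... | no _ | no _ | yes refl = 0 , degD-tgt e₀ (deg-int i<q) , λ _ → far
  ... | no ne | no p | no r = 1 , degD-off e₀ (pv≢ (p ∘ ℕ.suc-injective)) (pv≢ (r ∘ ℕ.suc-injective))
                                (deg-int (ℕ.≤∧≢⇒< (recompute (j ℕ.≤? q) (ℕ.≤-pred h)) ne)) , λ ()

solve-eq : ∀ {m n q k} {e₀ : GEdge m n q} {x x′ y y′} → x ≡ x′ → y ≡ y′ → Solve k e₀ x y → Solve k e₀ x′ y′
solve-eq refl refl s = s

module StarLeafToB₁ {m n : ℕ} (a : Fin m) where

  private
    w : V m n 1
    w = pv 1 (s≤s z≤n)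
    H H′ : Rel (V m n 1)
    H  = Add (D (pE 0 z≤n)) (lv a) B
    H′ = Add (D (lE a)) (lv a) B

  σ : V m n 1 → V m n 1
  σ = swap _≟_ w (lv a)

  σ-w : σ w ≡ lv a
  σ-w = swap-u _≟_ w (lv a)

  σ-l : σ (lv a) ≡ w
  σ-l = swap-v _≟_ w (lv a)

  σ-c : ∀ {c} → c ≢ a → σ (lv c) ≡ lv c
  σ-c ne = swap-off (_≟_ {m} {n} {1}) {w} {lv a} (λ ()) (ne ∘ lv-inj)

  A-leaf : ∀ c → Dec (c ≡ a) → H′ A (σ (lv c))
  A-leaf c (yes refl) = subst (H′ A) (sym σ-l) (inj₁ (D-link {e′ = pE 0 z≤n} (λ ()) p→))
  A-leaf c (no ne) = subst (H′ A) (sym (σ-c ne)) (inj₁ (D-link (ne ∘ lE-inj) l→))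

  fwd : ∀ {u v} → H u v → H′ (σ u) (σ v)
  fwd (inj₂ (inj₁ (refl , refl))) = subst (λ t → H′ t B) (sym σ-l) (inj₁ (D-link {e′ = pE 1 ℕ.≤-refl} (λ ()) p→))
  fwd (inj₂ (inj₂ (refl , refl))) = subst (H′ B) (sym σ-l) (inj₁ (D-link {e′ = pE 1 ℕ.≤-refl} (λ ()) p←))
  fwd (inj₁ d) with D-link⁻ d
  ... | _ , ne , p→ {0} = ⊥-elim (ne refl)
  ... | _ , ne , p← {0} = ⊥-elim (ne refl)
  ... | _ , _ , p→ {1} = subst (λ t → H′ t B) (sym σ-w) (inj₂ (inj₁ (refl , refl)))
  ... | _ , _ , p← {1} = subst (H′ B) (sym σ-w) (inj₂ (inj₂ (refl , refl)))
  ... | _ , _ , p→ {suc (suc i)} {h} = ⊥-elim (long (recompute (_ ℕ.≤? 1) h))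
    where
    long : ¬ 2 + i ≤ 1
    long (s≤s ())
  ... | _ , _ , p← {suc (suc i)} {h} = ⊥-elim (long (recompute (_ ℕ.≤? 1) h))
    where
    long : ¬ 2 + i ≤ 1
    long (s≤s ())
  ... | _ , _ , r→ = inj₁ (D-link (λ ()) r→)
  ... | _ , _ , r← = inj₁ (D-link (λ ()) r←)
  ... | _ , _ , l→ {c} = A-leaf c (c Fin.≟ a)
  ... | _ , _ , l← {c} = add-symm {E = D (lE a)} {lv a} {B} D-symm {A} {σ (lv c)} (A-leaf c (c Fin.≟ a))

  bwd : ∀ {u v} → H′ u v → H (σ u) (σ v)
  bwd (inj₂ (inj₁ (refl , refl))) = subst (λ t → H t B) (sym σ-l) (inj₁ (D-link {e′ = pE 1 ℕ.≤-refl} (λ ()) p→))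
  bwd (inj₂ (inj₂ (refl , refl))) = subst (H B) (sym σ-l) (inj₁ (D-link {e′ = pE 1 ℕ.≤-refl} (λ ()) p←))
  bwd (inj₁ d) with D-link⁻ d
  ... | _ , ne , p→ {0} = subst (H A) (sym σ-w) (inj₁ (D-link (λ ()) l→))
  ... | _ , ne , p← {0} = subst (λ t → H t A) (sym σ-w) (inj₁ (D-link (λ ()) l←))
  ... | _ , _ , p→ {1} = subst (λ t → H t B) (sym σ-w) (inj₂ (inj₁ (refl , refl)))
  ... | _ , _ , p← {1} = subst (H B) (sym σ-w) (inj₂ (inj₂ (refl , refl)))
  ... | _ , _ , p→ {suc (suc i)} {h} = ⊥-elim (long (recompute (_ ℕ.≤? 1) h))
    where
    long : ¬ 2 + i ≤ 1
    long (s≤s ())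
  ... | _ , _ , p← {suc (suc i)} {h} = ⊥-elim (long (recompute (_ ℕ.≤? 1) h))
    where
    long : ¬ 2 + i ≤ 1
    long (s≤s ())
  ... | _ , _ , r→ = inj₁ (D-link (λ ()) r→)
  ... | _ , _ , r← = inj₁ (D-link (λ ()) r←)
  ... | _ , ne , l→ {c} = subst (H A) (sym (σ-c {c} λ { refl → ne refl })) (inj₁ (D-link (λ ()) l→))
  ... | _ , ne , l← {c} = subst (λ t → H t A) (sym (σ-c {c} λ { refl → ne refl })) (inj₁ (D-link (λ ()) l←))

  -- For `q = 1` the middle vertex `w` and the leaf `lv a` trade places: with `A w` removed and
  -- `lv a` joined to `B`, it is `w` that has become the leaf moved from `A` to `B`.
  exchange : H ≅ H′
  exchange = mkIso σ σ (swap-invol _≟_ w (lv a)) (swap-invol _≟_ w (lv a)) fwd bwd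

module CentreCase {m n k : ℕ} (a₀ : Fin m) (b₀ : Fin n) where

  private
    e₀ : GEdge m n 0
    e₀ = pE 0 z≤n

  A-right : n ≡ 1 → ∀ b → Solve k e₀ A (rv b)
  A-right refl Fin.zero = via (ReverseRight.rev-isoʳ z≤n)
    (solve-eq (sym (ReverseRight.revʳ-left z≤n {j = 0} z≤n)) (sym (ReverseRight.revʳ-rv z≤n)) (λ _ → restore D-id (inj₁ (refl , refl))))

  left-B : m ≡ 1 → ∀ a → Solve k e₀ (lv a) B
  left-B refl a = via (Reverse.rev-iso z≤n) (λ _ → restore D-id (inj₁ (refl , refl)))

  left-right : m ≡ 1 → n ≡ 1 → ∀ a b → Solve k e₀ (lv a) (rv b)
  left-right refl n≡1 a b = via (Reverse.rev-iso z≤n) (A-right n≡1 b)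

  two : ∀ {m n} → Fin m → Fin n → 2 ≡ m + n → m ≡ 1 × n ≡ 1
  two {1} {1} _ _ _ = refl , refl
  two {1} {suc (suc n)} _ _ ()
  two {suc (suc m)} {suc n} _ _ p = ⊥-elim (ℕ.1+n≢0 (trans (sym (ℕ.+-suc m n)) (sym (ℕ.suc-injective (ℕ.suc-injective p)))))

  solve : ∀ {x y i j} → CentreKind x i → CentreKind y j → i + j ≡ m + n → x ≢ y → ¬ D e₀ x y → Solve k e₀ x y
  solve hub-A hub-A _ ne _ = ⊥-elim (ne refl)
  solve hub-A hub-B _ _ _ = λ _ → restore D-id (inj₁ (refl , refl))
  solve hub-A (left a) _ _ ¬d = ⊥-elim (¬d (D-link (λ ()) l→))
  solve hub-A (right b) p _ _ = A-right (sym (ℕ.+-cancelˡ-≡ m _ _ p)) b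
  solve hub-B hub-A _ _ _ = λ _ → restore D-id (inj₂ (refl , refl))
  solve hub-B hub-B _ ne _ = ⊥-elim (ne refl)
  solve hub-B (left a) p _ _ = flip (left-B (sym (ℕ.+-cancelʳ-≡ n _ _ (trans (ℕ.+-comm 1 n) p))) a)
  solve hub-B (right b) _ _ ¬d = ⊥-elim (¬d (D-link (λ ()) r→))
  solve (left a) hub-A _ _ ¬d = ⊥-elim (¬d (D-link (λ ()) l←))
  solve (left a) hub-B p _ _ = left-B (sym (ℕ.+-cancelʳ-≡ n _ _ p)) a
  solve (left a) (left a′) p ne _ = ⊥-elim (fin≢1 {a = a} {a′} (λ { refl → ne refl }) (proj₁ (two a b₀ p)))
  solve (left a) (right b) p _ _ = left-right (proj₁ (two a b p)) (proj₂ (two a b p)) a b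
  solve (right b) hub-A p _ _ = flip (A-right (sym (ℕ.+-cancelˡ-≡ m _ _ (trans (ℕ.+-comm m 1) p))) b)
  solve (right b) hub-B _ _ ¬d = ⊥-elim (¬d (D-link (λ ()) r←))
  solve (right b) (left a) p _ _ = flip (left-right (proj₁ (two a b p)) (proj₂ (two a b p)) a b)
  solve (right b) (right b′) p ne _ = ⊥-elim (fin≢1 {a = b} {b′} (λ { refl → ne refl }) (proj₂ (two a₀ b p)))

module StartCase {m n q k : ℕ} (a₀ : Fin m) (b₀ : Fin n) (q≢0 : q ≢ 0)
  (tr : Req m n q k) (tr′ : Req n m q k) (sr : SideReq m n q k) where

  open SideReq sr

  private
    e₀ : GEdge m n q
    e₀ = pE 0 z≤n
    1≤q : 1 ≤ q
    1≤q = ℕ.≤∧≢⇒< z≤n (q≢0 ∘ sym)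

  A-end : ∀ .{h} → Solve k e₀ A (pv 1 h)
  A-end _ = restore D-id (inj₁ (refl , refl))

  same : ∀ {x y : V m n q} → side 0 x ≡ false → side 0 y ≡ false → 2 < k → Solve k e₀ x y
  same p r lt = never (same-side-bound z≤n (trans p (sym r)) a₀ b₀ lt)

  A-right : ∀ b → Solve k e₀ A (rv b)
  A-right b with n ℕ.≟ 1
  ... | yes n≡1 = lone n≡1 b
    where
    lone : n ≡ 1 → (b : Fin n) → Solve k e₀ A (rv b)
    lone refl Fin.zero = via (ReverseRight.rev-isoʳ z≤n)
      (solve-eq (sym (ReverseRight.revʳ-left z≤n {j = 0} z≤n)) (sym (ReverseRight.revʳ-rv z≤n)) A-end)
  ... | no n≢1 = go q q≢0 tr′
    where
    go : ∀ q → q ≢ 0 → Req n m q k → Solve k (pE {m} {n} {q} 0 z≤n) A (rv b)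
    go 0 ne _ = ⊥-elim (ne refl)
    go (suc (suc q)) _ req = never (hub-to-right a₀ b _ (proj₂ (another n≢1 b)) req)
    -- For `q = 1` the vertex `pv 1` is now a leaf of `B`, like `rv b`, and the two can be
    -- exchanged.
    go 1 _ _ _ = restore φ (inj₁ (sym (swap-off (_≟_ {m} {n} {1}) {rv b} {pv 1 (s≤s z≤n)} {A} (λ ()) (λ ())) , swap-u (_≟_ {m} {n} {1}) (rv b) (pv 1 (s≤s z≤n))))
      where
      w : V m n 1
      w = pv 1 (s≤s z≤n)
      φ : D (pE {m} {n} {1} 0 z≤n) ≅ D (pE 0 z≤n)
      φ = restore-swap (rv b) w (λ { _ d → f d }) (λ { _ d → g d })
        where
        f : ∀ {v} → D (pE 0 z≤n) (rv b) v → D (pE 0 z≤n) w v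
        f d with nbr-rv (D⇒G d)
        ... | refl = D-link {e′ = pE 1 ℕ.≤-refl} (λ ()) p→
        g : ∀ {v} → D (pE 0 z≤n) w v → D (pE 0 z≤n) (rv b) v
        g d with D-link⁻ d
        ... | _ , _ , p→ = D-link (λ ()) r←
        ... | _ , ne , p← = ⊥-elim (ne refl)

  left-flip : m ≡ 1 → ∀ a {y} → side 0 y ≡ false → Solve k e₀ A y → Solve k e₀ (lv a) y
  left-flip refl a {y} p s = via (Reverse.rev-iso z≤n) (solve-eq refl (sym (fixed y p)) s)
    where
    fixed : ∀ y → side 0 y ≡ false → Reverse.rev {n} {q} z≤n y ≡ y
    fixed (pv (suc j) h) _ = Reverse.rev-> z≤n (s≤s z≤n)
    fixed (rv b) _ = refl

  left-inner : m ≡ 2 → ∀ a {j} (h : suc j < q) → Solve k e₀ (lv a) (pv (2 + j) (ℕ.m≤n⇒m≤1+n h))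
  left-inner refl a h = never (star-leaf-to-int a _ (proj₂ (another (λ ()) a)) b₀ h tr)

  left-B : m ≡ suc n → ∀ a → Solve k e₀ (lv a) B
  left-B refl a = go q q≢0 tr
    where
    go : ∀ q → q ≢ 0 → Req (suc n) n q k → Solve k (pE {suc n} {n} {q} 0 z≤n) (lv a) B
    go 0 ne _ = ⊥-elim (ne refl)
    go 1 _ _ _ = ≅-trans (StarLeafToB₁.exchange a) (Mirror.leaf-to-B a)
    go (suc (suc q)) _ req = never (star-leaf-to-B a b₀ req)

  same-1 : m ≡ 1 → ∀ {x y : V m n q} → side 0 x ≡ false → side 0 y ≡ false → Solve k e₀ x y
  same-1 m≡1 {x} {y} p r with first 1≤q m≡1
  ... | inj₁ lt = same p r lt
  ... | inj₂ (lt , q≡1 , n≥4) = never (bounded (inj₂ e₀ ∷ []) codes lt)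
    where
    codes : ∀ s → Any (Match s) (inj₂ e₀ ∷ [])
    codes s with same-side z≤n (trans p (sym r)) a₀ b₀ (iso s)
    ... | j , g , eq , inj₁ (_ , refl) = here eq
    -- The second index would need `n ≤ m + suc j ≤ 3`, as `m = 1` and `j ≤ q = 1`.
    ... | j , g , eq , inj₂ (_ , t) = ⊥-elim (ℕ.<⇒≱ small n≥4)
      where
      small : n < 4
      small = s≤s (ℕ.≤-trans (ℕ.≤-trans (ℕ.m≤m+n n (suc q)) (ℕ.≤-reflexive (sym t)))
        (ℕ.≤-trans (ℕ.+-mono-≤ (ℕ.≤-reflexive m≡1) (s≤s (ℕ.≤-trans g (ℕ.≤-reflexive q≡1)))) (s≤s (s≤s (s≤s z≤n)))))

  suc-m : ∀ {i} → i + 1 ≡ m + 1 → m ≡ i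
  suc-m p = sym (ℕ.+-cancelʳ-≡ 1 _ _ p)

  m+1 : ∀ {i} → i ≡ m + 1 → m ≡ pred i
  m+1 p = sym (trans (cong pred p) (cong pred (ℕ.+-comm m 1)))

  solve : ∀ {x y i j} → StartKind x i → StartKind y j → i + j ≡ m + 1 → x ≢ y → ¬ D e₀ x y → Solve k e₀ x y
  solve hub-A hub-A _ ne _ = ⊥-elim (ne refl)
  solve hub-A hub-B p _ _ = ⊥-elim (none b₀ (ℕ.+-cancelˡ-≡ m _ _ p))
    where
    none : ∀ {n} → Fin n → suc n ≢ 1
    none {suc n} _ ()
  solve hub-A (left a) _ _ ¬d = ⊥-elim (¬d (D-link (λ ()) l→))
  solve hub-A (right b) _ _ _ = A-right b
  solve hub-A (end _) _ _ _ = A-end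
  solve hub-A (inner h) p _ _ = contradiction (ℕ.+-cancelˡ-≡ m _ _ p) λ ()
  solve hub-B hub-A p _ _ = ⊥-elim (none b₀ (ℕ.+-cancelˡ-≡ m _ _ (trans (ℕ.+-comm m _) p)))
    where
    none : ∀ {n} → Fin n → suc n ≢ 1
    none {suc n} _ ()
  solve hub-B hub-B _ ne _ = ⊥-elim (ne refl)
  solve hub-B (left a) p _ _ = flip (left-B (suc-m p) a)
  solve hub-B (right b) _ _ ¬d = ⊥-elim (¬d (D-link (λ ()) r→))
  solve hub-B (end _) p _ ¬d with q ℕ.≟ 1
  ... | yes refl = ⊥-elim (¬d (D-link {e′ = pE 1 ℕ.≤-refl} (λ ()) p←))
  ... | no ne = same refl refl (low (ℕ.≤∧≢⇒< 1≤q (ne ∘ sym)) (inj₂ (inj₂ (inj₁ (suc-m p)))))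
  solve hub-B (inner h) p _ _ = same refl refl (low (ℕ.≤-trans (s≤s (s≤s z≤n)) h) (inj₂ (inj₂ (inj₂ (trans (m+1 p) (ℕ.+-comm n 2))))))
  solve (left a) hub-A _ _ ¬d = ⊥-elim (¬d (D-link (λ ()) l←))
  solve (left a) hub-B p _ _ = left-B (m+1 p) a
  solve (left a) (left a′) p ne _ = ⊥-elim (fin≢1 {a = a} {a′} (λ { refl → ne refl }) (m+1 p))
  solve (left a) (right b) p _ _ = left-flip (m+1 p) a refl (A-right b)
  solve (left a) (end _) p _ _ = left-flip (m+1 p) a refl A-end
  solve (left a) (inner h) p _ _ = left-inner (m+1 p) a h
  solve (right b) hub-A _ _ _ = flip (A-right b)
  solve (right b) hub-B _ _ ¬d = ⊥-elim (¬d (D-link (λ ()) r←))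
  solve (right b) (left a) p _ _ = flip (left-flip (m+1 p) a refl (A-right b))
  solve (right b) (right b′) p _ _ = same-1 (m+1 p) refl refl
  solve (right b) (end _) p _ _ = same-1 (m+1 p) refl refl
  solve (right b) (inner h) p _ _ = same refl refl (low (ℕ.≤-trans (s≤s (s≤s z≤n)) h) (inj₁ (m+1 p)))
  solve (end _) hub-A _ _ _ = flip A-end
  solve (end _) hub-B p _ ¬d with q ℕ.≟ 1
  ... | yes refl = ⊥-elim (¬d (D-link {e′ = pE 1 ℕ.≤-refl} (λ ()) p→))
  ... | no ne = same refl refl (low (ℕ.≤∧≢⇒< 1≤q (ne ∘ sym)) (inj₂ (inj₂ (inj₁ (m+1 p)))))
  solve (end _) (left a) p _ _ = flip (left-flip (m+1 p) a refl A-end)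
  solve (end _) (right b) p _ _ = same-1 (m+1 p) refl refl
  solve (end _) (end _) _ ne _ = ⊥-elim (ne refl)
  solve (end _) (inner h) p _ _ = same refl refl (low (ℕ.≤-trans (s≤s (s≤s z≤n)) h) (inj₁ (m+1 p)))
  solve (inner h) hub-A p _ _ = contradiction (ℕ.+-cancelˡ-≡ m _ _ (trans (ℕ.+-comm m _) p)) λ ()
  solve (inner h) hub-B p _ _ = same refl refl (low (ℕ.≤-trans (s≤s (s≤s z≤n)) h) (inj₂ (inj₂ (inj₂ (m+1 p)))))
  solve (inner h) (left a) p _ _ = flip (left-inner (m+1 p) a h)
  solve (inner h) (right b) p _ _ = same refl refl (low (ℕ.≤-trans (s≤s (s≤s z≤n)) h) (inj₁ (m+1 p)))
  solve (inner h) (end _) p _ _ = same refl refl (low (ℕ.≤-trans (s≤s (s≤s z≤n)) h) (inj₁ (m+1 p)))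
  solve (inner h) (inner _) p _ _ = same refl refl (low (ℕ.≤-trans (s≤s (s≤s z≤n)) h) (inj₂ (inj₁ (m+1 p))))

-- With `pE 1` removed, `pv 1` hangs from `A` like a left leaf.
leaf-end-swap : ∀ {m n q} (a : Fin m) (i<q : 1 < q) → D (pE {m} {n} {q} 1 (ℕ.<⇒≤ i<q)) ≅ D (pE 1 (ℕ.<⇒≤ i<q))
leaf-end-swap {m} {n} {q} a i<q = restore-swap (lv a) w (λ _ → f) (λ _ → g)
  where
  w : V m n q
  w = pv 1 (s≤s z≤n)
  f : ∀ {v} → D (pE 1 (ℕ.<⇒≤ i<q)) (lv a) v → D (pE 1 (ℕ.<⇒≤ i<q)) w v
  f d with nbr-lv (D⇒G d)
  ... | refl = D-link {e′ = pE 0 z≤n} (λ ()) p←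
  g : ∀ {v} → D (pE 1 (ℕ.<⇒≤ i<q)) w v → D (pE 1 (ℕ.<⇒≤ i<q)) (lv a) v
  g d with D-link⁻ d
  ... | _ , ne , p→ = ⊥-elim (ne refl)
  ... | _ , _ , p← = D-link (λ ()) l←
  ... | _ , _ , r→ = ⊥-elim (ℕ.n≮0 i<q)

-- Joining `lv a` to the far end gives back the broom in two situations: for `m = 1` the left part
-- is a path that can be reversed, and for `i = 0` the near end is a leaf of `A` like `lv a`.
-- Otherwise `A` acquires a second long arm and `left-leaf` applies.
left-far : ∀ {m n q k i} (a : Fin m) (b₀ : Fin n) (i<q : suc i < q) → Req m n q k →
           Solve k (pE (suc i) (ℕ.<⇒≤ i<q)) (lv a) (pv {m} {n} (2 + i) (ℕ.m≤n⇒m≤1+n i<q))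
left-far {m} {n} {q} {k} {i} a b₀ i<q req with m ℕ.≟ 1
... | yes m≡1 = lone m≡1 a
  where
  lone : m ≡ 1 → (a : Fin m) → Solve k (pE (suc i) (ℕ.<⇒≤ i<q)) (lv a) (pv {m} {n} (2 + i) (ℕ.m≤n⇒m≤1+n i<q))
  lone refl a = via (Reverse.rev-iso (ℕ.<⇒≤ i<q)) (solve-eq refl (sym (Reverse.rev-> (ℕ.<⇒≤ i<q) (ℕ.n<1+n (suc i)))) (λ _ → restore D-id (inj₁ (refl , refl))))
... | no m≢1 = go i i<q
  where
  go : ∀ i (i<q : suc i < q) → Solve k (pE (suc i) (ℕ.<⇒≤ i<q)) (lv a) (pv {m} {n} (2 + i) (ℕ.m≤n⇒m≤1+n i<q))
  go zero i<q _ = restore φ (inj₁ (sw , swap-off (_≟_ {m} {n} {q}) {lv a} {w} (λ ()) (λ ())))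
    where
    w : V m n q
    w = pv 1 (s≤s z≤n)
    sw = swap-u (_≟_ {m} {n} {q}) (lv a) w
    φ : D (pE {m} {n} {q} 1 (ℕ.<⇒≤ i<q)) ≅ D (pE 1 (ℕ.<⇒≤ i<q))
    φ = leaf-end-swap a i<q
  go (suc i) i<q = never (left-leaf i<q a _ (proj₂ (another m≢1 a)) b₀ y (side-> {m} {n} {q} {2 + i} {3 + i} {ℕ.m≤n⇒m≤1+n i<q} (ℕ.n<1+n _))
    (pv≢ (ℕ.<⇒≢ (s≤s i<q))) (degD-tgt (pE (2 + i) (ℕ.<⇒≤ i<q)) (deg-int i<q))
    (λ c f → climb c {3 + i} (λ k le h → f (side-> {m} {n} {q} {2 + i} {k} {ℕ.m≤n⇒m≤1+n h} le)
        (side-> {m} {n} {q} {2 + i} {suc k} {s≤s h} (ℕ.m≤n⇒m≤1+n le)) (D-link {e′ = pE k h} (λ p → ℕ.<⇒≢ le (sym (pE-inj p))) p→)) (3 + i) ℕ.≤-refl)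
    req)
    where
    y : V m n q
    y = pv (3 + i) (ℕ.m≤n⇒m≤1+n i<q)

solve-resp : ∀ {m n q k} {d d′ : GEdge m n q} {x x′ y y′} → d ≡ d′ → x ≡ x′ → y ≡ y′ → Solve k d x y → Solve k d′ x′ y′
solve-resp refl refl refl s = s

module MidCase {m n q k i : ℕ} (a₀ : Fin m) (b₀ : Fin n) (i<q : suc i < q)
  (tr : Req m n q k) (tr′ : Req n m q k) (sr : SideReq m n q k) where

  open SideReq sr

  private
    h : suc i ≤ q
    h = ℕ.<⇒≤ i<q
    e₀ : GEdge m n q
    e₀ = pE (suc i) h

  near-right : ∀ b .{g} → Solve k e₀ (pv (suc i) g) (rv b)
  near-right b {g} = reflected (solve-resp (sym (pE-cong eq₁)) (sym (pv-cong eq₂)) refl (flip (left-far b a₀ i′<q tr′)))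
    where
    i′ = q ∸ (2 + i)
    eq₁ : q ∸ suc i ≡ suc i′
    eq₁ = ℕ.+-∸-assoc 1 i<q
    eq₂ : q ∸ i ≡ 2 + i′
    eq₂ = trans (ℕ.+-∸-assoc 1 h) (cong suc eq₁)
    i′<q : suc i′ < q
    i′<q = subst (_< q) eq₁ (ℕ.∸-monoʳ-< {q} {suc i} {0} (s≤s z≤n) h)

  left-right : ∀ a b → Solve k e₀ (lv a) (rv b)
  left-right a b with m ℕ.≟ 1 | n ℕ.≟ 1
  ... | yes m≡1 | _ = lone m≡1 a
    where
    lone : m ≡ 1 → (a : Fin m) → Solve k e₀ (lv a) (rv b)
    lone refl a = via (Reverse.rev-iso h) (near-right b)
  ... | no _ | yes n≡1 = lone n≡1 b
    where
    lone : n ≡ 1 → (b : Fin n) → Solve k e₀ (lv a) (rv b)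
    lone refl Fin.zero = via (ReverseRight.rev-isoʳ h) (solve-eq refl (sym (ReverseRight.revʳ-rv h)) (left-far a Fin.zero i<q tr))
  ... | no m≢1 | no _ = go i i<q (near-right b)
    where
    go : ∀ i (i<q : suc i < q) → Solve k (pE {m} {n} (suc i) (ℕ.<⇒≤ i<q)) (pv (suc i) (ℕ.m≤n⇒m≤1+n (ℕ.<⇒≤ i<q))) (rv b) →
         Solve k (pE {m} {n} (suc i) (ℕ.<⇒≤ i<q)) (lv a) (rv b)
    go zero i<q s = via φ (solve-eq (sym (swap-u (_≟_ {m} {n} {q}) (lv a) w)) (sym (swap-off (_≟_ {m} {n} {q}) {lv a} {w} {rv b} (λ ()) (λ ()))) s)
      where
      w : V m n q
      w = pv 1 (s≤s z≤n)
      φ : D (pE {m} {n} {q} 1 (ℕ.<⇒≤ i<q)) ≅ D (pE 1 (ℕ.<⇒≤ i<q))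
      φ = leaf-end-swap a i<q
    go (suc i) i<q _ = never (left-leaf i<q a _ (proj₂ (another m≢1 a)) b₀ (rv b) refl (λ ())
      (degD-off (pE (2 + i) (ℕ.<⇒≤ i<q)) (λ ()) (λ ()) (deg-r b))
      (λ c f → f {rv b} {B} refl (side-B {m} {n} {h = ℕ.<⇒≤ i<q}) (D-link (λ ()) r←)) tr)

  B-deg : Deg (D e₀) B (suc n)
  B-deg = degD-off e₀ (λ { refl → ℕ.1+n≰n h }) (λ { refl → ℕ.1+n≰n i<q }) deg-B

  hub≢ : ∀ {x} → Deg (D e₀) x 1 → B ≢ x
  hub≢ d refl = ℕ.1+n≢0 (trans (sym (proj₂ (pos b₀))) (ℕ.suc-injective (card-unique
    B-deg d)))
    where
    pos : ∀ {n} → Fin n → ∃ λ k → n ≡ suc k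
    pos {suc n} _ = n , refl

  -- Since the ends lie on one side, at most two edges of the broom are possible. For `m = n` and
  -- `q = 2` both are the middle edge. In the last case the second one would put `A` into the part
  -- of `B`, where only `B` can have three neighbours; its degree after the cut, `n` or `suc n`,
  -- would have to be `m` or `suc m`.
  same : ∀ {x y} → Deg (D e₀) x 1 → Deg (D e₀) y 1 → x ≢ y → ¬ D e₀ x y → side (suc i) x ≡ side (suc i) y → Solve k e₀ x y
  same {x} {y} dx dy x≢y ¬d xy with mid (ℕ.≤-trans (s≤s (s≤s z≤n)) i<q)
  ... | inj₁ lt = never (same-side-bound h xy a₀ b₀ lt)
  ... | inj₂ (inj₁ (lt , m≡n , q≡2)) = never (bounded (inj₂ e₀ ∷ []) codes lt)
    where
    codes : ∀ s → Any (Match s) (inj₂ e₀ ∷ [])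
    codes s with same-side h xy a₀ b₀ (iso s)
    ... | j , g , eq , inj₁ (_ , refl) = here eq
    ... | j , g , eq , inj₂ (_ , t) = here (trans eq (pE-cong (middle i i<q q≡2 (ℕ.+-cancelˡ-≡ n _ _ (subst (λ m → m + suc j ≡ n + suc (q ∸ suc i)) m≡n t)))))
      where
      middle : ∀ {q j} i → suc i < q → q ≡ 2 → suc j ≡ suc (q ∸ suc i) → j ≡ suc i
      middle zero _ refl refl = refl
      middle (suc i) (s≤s (s≤s ())) refl
  ... | inj₂ (inj₂ (lt , m≥3 , m≢n , m≢1+n , n≢1+m)) = never (bounded (inj₂ e₀ ∷ []) codes lt)
    where
    open AddEdge {e₀ = e₀} x≢y ¬d hiding (xy)
    dB : Deg H B (suc n)
    dB = degH-off (hub≢ dx) (hub≢ dy) B-deg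
    codes : ∀ s → Any (Match s) (inj₂ e₀ ∷ [])
    codes s with same-side h xy a₀ b₀ (iso s)
    ... | j , g , eq , inj₁ (_ , refl) = here eq
    ... | j , g , eq , inj₂ (off-side , _) = ⊥-elim (wrong (degA-back (iso s)))
      where
      F : Rel (V m n q)
      F = Del H (fa s) (fb s)
      A-deg : ∀ {a b} {d : GEdge m n q} → HubDeg d a b → a ≡ m ⊎ a ≡ suc m
      A-deg hl = inj₁ refl
      A-deg hr = inj₂ refl
      A-deg (h00 _) = inj₁ refl
      A-deg (h0 _) = inj₁ refl
      A-deg (hq _) = inj₂ refl
      A-deg (hi _) = inj₂ refl
      not-B : ∀ {a} → a ≡ m ⊎ a ≡ suc m → ¬ Deg F B a
      not-B {a} am d with deg-drop _≟_ sy ir (fab s) dB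
      ... | k′ , le , d′ with card-unique d d′ | card-≤ proj₁ d′ dB
      ...   | refl | ge with ℕ.m≤n⇒m<n∨m≡n le | am
      ...     | inj₂ refl | inj₁ refl = m≢n refl
      ...     | inj₂ refl | inj₂ refl = n≢1+m refl
      ...     | inj₁ lt | inj₁ refl = m≢1+n (ℕ.≤-antisym ge lt)
      ...     | inj₁ lt | inj₂ refl = m≢n (ℕ.suc-injective (ℕ.≤-antisym ge lt))
      a≥3 : ∀ {a} → a ≡ m ⊎ a ≡ suc m → 3 ≤ a
      a≥3 (inj₁ refl) = m≥3
      a≥3 (inj₂ refl) = ℕ.m≤n⇒m≤1+n m≥3
      small : ∀ {v} → Deg H v 2 → ¬ Three F v
      small d t = ¬three d ℕ.≤-refl (three-mono {E = F} {F = H} proj₁ t)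
      wrong : ∃ (λ a → ∃ λ b → HubDeg (e s) a b × Deg F (from (iso s) A) a × Deg F (from (iso s) B) b) → ⊥
      wrong (_ , _ , hd , da , _) with three-H (three-mono {E = F} {F = H} proj₁ (three da (a≥3 (A-deg hd))))
      ... | inj₁ p with trans (sym off-side) (cong (side (suc i)) p)
      ...   | ()
      wrong (_ , _ , hd , da , _) | inj₂ (inj₁ p) = not-B (A-deg hd) (deg-resp F p da)
      wrong (_ , _ , hd , da , _) | inj₂ (inj₂ (inj₁ p)) = small (degH-x dx) (three (deg-resp F p da) (a≥3 (A-deg hd)))
      wrong (_ , _ , hd , da , _) | inj₂ (inj₂ (inj₂ p)) = small (degH-y dy) (three (deg-resp F p da) (a≥3 (A-deg hd)))

  side-near : ∀ .{g} → side {m} {n} {q} (suc i) (pv (suc i) g) ≡ true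
  side-near {g} = side-≤ {m} {n} {q} {suc i} {suc i} {g} ℕ.≤-refl

  side-far : ∀ .{g} → side {m} {n} {q} (suc i) (pv (2 + i) g) ≡ false
  side-far {g} = side-> {m} {n} {q} {suc i} {2 + i} {g} (ℕ.n<1+n _)

  solve : ∀ {x y} → Deg (D e₀) x 1 → Deg (D e₀) y 1 → MidKind (suc i) x → MidKind (suc i) y → x ≢ y → ¬ D e₀ x y → Solve k e₀ x y
  solve dx dy (left a) (left a′) ne ¬d = same dx dy ne ¬d refl
  solve dx dy (left a) (right b) ne ¬d = left-right a b
  solve dx dy (left a) (near {g}) ne ¬d = same dx dy ne ¬d (sym (side-near {g}))
  solve dx dy (left a) far ne ¬d = left-far a b₀ i<q tr
  solve dx dy (right b) (left a) ne ¬d = flip (left-right a b)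
  solve dx dy (right b) (right b′) ne ¬d = same dx dy ne ¬d refl
  solve dx dy (right b) near ne ¬d = flip (near-right b)
  solve dx dy (right b) (far {g}) ne ¬d = same dx dy ne ¬d (sym (side-far {g}))
  solve dx dy (near {g}) (left a) ne ¬d = same dx dy ne ¬d (side-near {g})
  solve dx dy near (right b) ne ¬d = near-right b
  solve dx dy near near ne ¬d = ⊥-elim (ne refl)
  solve dx dy near far ne ¬d = λ _ → restore D-id (inj₁ (refl , refl))
  solve dx dy far (left a) ne ¬d = flip (left-far a b₀ i<q tr)
  solve dx dy (far {g}) (right b) ne ¬d = same dx dy ne ¬d (side-far {g})
  solve dx dy far near ne ¬d = λ _ → restore D-id (inj₂ (refl , refl))
  solve dx dy far far ne ¬d = ⊥-elim (ne refl)

-- All removed edges together.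

record Reqs (m n q k : ℕ) : Set where
  field
    tree  : Req m n q k
    tree′ : Req n m q k
    leaf  : LeafReq m n q k
    leaf′ : LeafReq n m q k
    sides  : SideReq m n q k
    sides′ : SideReq n m q k

reqs-sym : ∀ {m n q k} → Reqs m n q k → Reqs n m q k
reqs-sym r = record { tree = tree′ ; tree′ = tree ; leaf = leaf′ ; leaf′ = leaf ; sides = sides′ ; sides′ = sides }
  where open Reqs r

-- What the first common decard supplies. Degrees are taken after the edge is cut, so that equality
-- of the edge degrees reads `kx + ky ≡ s + t`, without subtraction.
record Base {m n q : ℕ} (d : GEdge m n q) (x y : V m n q) : Set where
  field
    x≢y : x ≢ y
    new : ¬ D d x y
    {kx ky s t} : ℕ
    deg-x : Deg (D d) x kx
    deg-y : Deg (D d) y ky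
    deg-s : Deg (D d) (src d) s
    deg-t : Deg (D d) (tgt d) t
    sums  : kx + ky ≡ s + t

base-reflect : ∀ {m n q} {d : GEdge m n q} {x y} → Base d x y → Base (ρᴱ d) (ρ x) (ρ y)
base-reflect {d = d} {x} {y} b with link⇒same (ρ-link (link d))
... | inj₁ (p , r) = record
  { x≢y = x≢y ∘ to-inj ρ-iso ; new = new ∘ reflect (ρ-D d) ; deg-x = deg-iso (ρ-D d) deg-x ; deg-y = deg-iso (ρ-D d) deg-y
  ; deg-s = deg-resp (D (ρᴱ d)) p (deg-iso (ρ-D d) deg-s) ; deg-t = deg-resp (D (ρᴱ d)) r (deg-iso (ρ-D d) deg-t) ; sums = sums }
  where open Base b
... | inj₂ (p , r) = record
  { x≢y = x≢y ∘ to-inj ρ-iso ; new = new ∘ reflect (ρ-D d) ; deg-x = deg-iso (ρ-D d) deg-x ; deg-y = deg-iso (ρ-D d) deg-y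
  ; deg-s = deg-resp (D (ρᴱ d)) r (deg-iso (ρ-D d) deg-t) ; deg-t = deg-resp (D (ρᴱ d)) p (deg-iso (ρ-D d) deg-s) ; sums = trans sums (ℕ.+-comm s t) }
  where open Base b

solve-leaf : ∀ {m n q k} → Fin n → Reqs m n q k → ∀ a {x y} → Base (lE {m} {n} {q} a) x y → Solve k (lE a) x y
solve-leaf {m} b₀ r a {x} {y} b with leaf-kind a x | leaf-kind a y
... | i , kx′ , dx | j , ky′ , dy = LeafCase.solve b₀ tree tree′ leaf a kx′ ky′
  (trans (cong₂ _+_ (card-unique dx deg-x) (card-unique dy deg-y)) (trans sums
    (trans (cong₂ _+_ (card-unique deg-s (degD-src (lE a) deg-A)) (card-unique deg-t (degD-tgt (lE a) (deg-l a)))) (ℕ.+-identityʳ m)))) x≢y new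
  where
  open Reqs r
  open Base b

solve-start : ∀ {m n q k} → Fin m → Fin n → Reqs m n q k → ∀ {x y} → Base (pE {m} {n} {q} 0 z≤n) x y → Solve k (pE 0 z≤n) x y
solve-start {q = zero} a₀ b₀ r {x} {y} b with centre-kind x | centre-kind y
... | i , kx′ , dx | j , ky′ , dy = CentreCase.solve a₀ b₀ kx′ ky′
  (trans (cong₂ _+_ (card-unique dx deg-x) (card-unique dy deg-y)) (trans sums
    (cong₂ _+_ (card-unique deg-s (degD-src (pE 0 z≤n) deg-A)) (card-unique deg-t (degD-tgt (pE 0 z≤n) deg-B))))) x≢y new
  where open Base b
solve-start {q = suc q} a₀ b₀ r {x} {y} b with start-kind (λ ()) x | start-kind (λ ()) y
... | i , kx′ , dx | j , ky′ , dy = StartCase.solve a₀ b₀ (λ ()) tree tree′ sides kx′ ky′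
  (trans (cong₂ _+_ (card-unique dx deg-x) (card-unique dy deg-y)) (trans sums
    (cong₂ _+_ (card-unique deg-s (degD-src (pE 0 z≤n) deg-A)) (card-unique deg-t (degD-tgt (pE 0 z≤n) (deg-int (s≤s z≤n))))))) x≢y new
  where
  open Reqs r
  open Base b

solve-mid : ∀ {m n q k i} → Fin m → Fin n → Reqs m n q k → (i<q : suc i < q) → ∀ {x y} →
            Base (pE {m} {n} {q} (suc i) (ℕ.<⇒≤ i<q)) x y → Solve k (pE (suc i) (ℕ.<⇒≤ i<q)) x y
solve-mid {m} {n} {q} {k} {i} a₀ b₀ r i<q {x} {y} b with mid-kind a₀ b₀ i<q x | mid-kind a₀ b₀ i<q y
... | i′ , dx , kx′ | j′ , dy , ky′ = go i′ j′ dx dy kx′ ky′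
  (trans (cong₂ _+_ (card-unique dx deg-x) (card-unique dy deg-y)) (trans sums
    (cong₂ _+_ (card-unique deg-s (degD-src e₀ (deg-int (ℕ.<⇒≤ i<q)))) (card-unique deg-t (degD-tgt e₀ (deg-int i<q))))))
  where
  open Reqs r
  open Base b
  e₀ : GEdge m n q
  e₀ = pE (suc i) (ℕ.<⇒≤ i<q)
  go : ∀ i′ j′ → Deg (D e₀) x (suc i′) → Deg (D e₀) y (suc j′) → (i′ ≡ 0 → MidKind (suc i) x) → (j′ ≡ 0 → MidKind (suc i) y) →
       suc i′ + suc j′ ≡ 2 → Solve k e₀ x y
  go zero zero dx dy f g _ = MidCase.solve a₀ b₀ i<q tree tree′ sides dx dy (f refl) (g refl) x≢y new
  go zero (suc j′) _ _ _ _ ()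
  go (suc i′) j′ _ _ _ _ p = contradiction (trans (sym (ℕ.+-suc i′ j′)) (ℕ.suc-injective (ℕ.suc-injective p))) λ ()

solve-edge : ∀ {m n q k} → Fin m → Fin n → Reqs m n q k → ∀ d {x y} → Base {m} {n} {q} d x y → Solve k d x y
solve-edge a₀ b₀ r d b with kind d
... | leafˡ a = solve-leaf b₀ r a b
... | leafʳ c = reflected (solve-leaf a₀ (reqs-sym r) c (base-reflect b))
... | path zero _ = solve-start a₀ b₀ r b
... | path (suc i) h with ℕ.m≤n⇒m<n∨m≡n h
...   | inj₁ i<q = solve-mid a₀ b₀ r i<q b
-- The last path edge is the first one of the reflected broom.
solve-edge {m} {n} {q} {k} a₀ b₀ r _ {x} {y} b | path (suc i) h | inj₂ refl =
  reflected (subst (λ d → Solve k d (ρ x) (ρ y)) first-edge (solve-start b₀ a₀ (reqs-sym r) (subst (λ d → Base d (ρ x) (ρ y)) (sym first-edge) (base-reflect b))))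
  where
  first-edge : pE {n} {m} {suc i} 0 z≤n ≡ ρᴱ (pE (suc i) h)
  first-edge = pE-cong (sym (ℕ.n∸n≡0 (suc i)))

-- From Boolean adjacency matrices to relations.

⟦_⟧ : ∀ {n} → Adj n → Rel (Fin n)
⟦ a ⟧ i j = a i j ≡ true

T⇒≡ : ∀ {b} → T b → b ≡ true
T⇒≡ {true} _ = refl

≡⇒T : ∀ {b} → b ≡ true → T b
≡⇒T refl = _

∧-true : ∀ {a b} → a ∧ b ≡ true → a ≡ true × b ≡ true
∧-true {true} p = refl , p

∨-true : ∀ {a b} → a ∨ b ≡ true → a ≡ true ⊎ b ≡ true
∨-true {true} _ = inj₁ refl
∨-true {false} p = inj₂ p

∧-intro : ∀ {a b} → a ≡ true → b ≡ true → a ∧ b ≡ true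
∧-intro refl p = p

∨-introˡ : ∀ {a b} → a ≡ true → a ∨ b ≡ true
∨-introˡ refl = refl

∨-introʳ : ∀ {a b} → b ≡ true → a ∨ b ≡ true
∨-introʳ {true} _ = refl
∨-introʳ {false} p = p

≡true-≡ : ∀ {a b : Bool} → (a ≡ true → b ≡ true) → (b ≡ true → a ≡ true) → a ≡ b
≡true-≡ {true} f _ = sym (f refl)
≡true-≡ {false} {false} _ _ = refl
≡true-≡ {false} {true} _ g = g refl

Iso⇒≅ : ∀ {n n′} {a : Adj n} {b : Adj n′} → Iso a b → ⟦ a ⟧ ≅ ⟦ b ⟧
Iso⇒≅ (f , h) = record
  { to = Inverse.to f ; from = Inverse.from f ; to-from = Inverse.strictlyInverseˡ f ; from-to = Inverse.strictlyInverseʳ f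
  ; pres = λ p → trans (sym (h _ _)) p ; reflect = λ p → trans (h _ _) p }

≅⇒Iso : ∀ {n n′} {a : Adj n} {b : Adj n′} → ⟦ a ⟧ ≅ ⟦ b ⟧ → Iso a b
≅⇒Iso φ = mk↔ₛ′ (to φ) (from φ) (to-from φ) (from-to φ) , λ i j → ≡true-≡ (pres φ) (reflect φ)

≡ᵇ-true : ∀ {i j} → (i ≡ᵇ j) ≡ true → i ≡ j
≡ᵇ-true {i} {j} p = ℕ.≡ᵇ⇒≡ i j (≡⇒T p)

≡ᵇ-intro : ∀ {i j} → i ≡ j → (i ≡ᵇ j) ≡ true
≡ᵇ-intro {i} {j} p = T⇒≡ (ℕ.≡⇒≡ᵇ i j p)

<ᵇ-true : ∀ {i j} → (i <ᵇ j) ≡ true → i < j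
<ᵇ-true {i} {j} p = ℕ.<ᵇ⇒< i j (≡⇒T p)

<ᵇ-intro : ∀ {i j} → i < j → (i <ᵇ j) ≡ true
<ᵇ-intro p = T⇒≡ (ℕ.<⇒<ᵇ p)

≤ᵇ-true : ∀ {i j} → (i ≤ᵇ j) ≡ true → i ≤ j
≤ᵇ-true {i} {j} p = ℕ.≤ᵇ⇒≤ i j (≡⇒T p)

≤ᵇ-intro : ∀ {i j} → i ≤ j → (i ≤ᵇ j) ≡ true
≤ᵇ-intro p = T⇒≡ (ℕ.≤⇒≤ᵇ p)

module _ {n : ℕ} {a : Adj n} where

  deleteEdge≅ : (d : Edge a) → ⟦ deleteEdge d ⟧ ≅ Del ⟦ a ⟧ (Edge.u d) (Edge.v d)
  deleteEdge≅ d = ≅-id fwd bwd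
    where
    hits : Fin n → Fin n → Bool
    hits i j = ((toℕ i ≡ᵇ toℕ (Edge.u d)) ∧ (toℕ j ≡ᵇ toℕ (Edge.v d))) ∨ ((toℕ i ≡ᵇ toℕ (Edge.v d)) ∧ (toℕ j ≡ᵇ toℕ (Edge.u d)))
    eq : ∀ {i j : Fin n} → i ≡ j → (toℕ i ≡ᵇ toℕ j) ≡ true
    eq {i} refl = ≡ᵇ-intro {toℕ i} refl
    eq⁻ : ∀ {i j : Fin n} → (toℕ i ≡ᵇ toℕ j) ≡ true → i ≡ j
    eq⁻ p = Fin.toℕ-injective (≡ᵇ-true p)
    same⇒hits : ∀ {i j} → Same (Edge.u d) (Edge.v d) i j → hits i j ≡ true
    same⇒hits (inj₁ (p , r)) = ∨-introˡ (∧-intro (eq p) (eq r))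
    same⇒hits {i} {j} (inj₂ (p , r)) = ∨-introʳ {(toℕ i ≡ᵇ toℕ (Edge.u d)) ∧ (toℕ j ≡ᵇ toℕ (Edge.v d))} (∧-intro (eq p) (eq r))
    hits⇒same : ∀ {i j} → hits i j ≡ true → Same (Edge.u d) (Edge.v d) i j
    hits⇒same p with ∨-true p
    ... | inj₁ r = inj₁ (eq⁻ (proj₁ (∧-true r)) , eq⁻ (proj₂ (∧-true r)))
    ... | inj₂ r = inj₂ (eq⁻ (proj₁ (∧-true r)) , eq⁻ (proj₂ (∧-true r)))
    not-true : ∀ {b} → not b ≡ true → b ≢ true
    not-true {true} ()
    not-intro : ∀ {b} → b ≢ true → not b ≡ true
    not-intro {true} p = ⊥-elim (p refl)
    not-intro {false} _ = refl
    fwd : ∀ {i j} → ⟦ deleteEdge d ⟧ i j → Del ⟦ a ⟧ (Edge.u d) (Edge.v d) i j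
    fwd p = proj₁ (∧-true p) , not-true (proj₂ (∧-true p)) ∘ same⇒hits
    bwd : ∀ {i j} → Del ⟦ a ⟧ (Edge.u d) (Edge.v d) i j → ⟦ deleteEdge d ⟧ i j
    bwd (p , r) = ∧-intro p (not-intro (r ∘ hits⇒same))

  deg-card : ∀ x → Deg ⟦ a ⟧ x (deg a x)
  deg-card x = card (filter P? (allFin n)) (Unique.filter⁺ P? (Unique.allFin⁺ n))
    (λ m → proj₂ (∈.∈-filter⁻ P? {xs = allFin n} m)) (λ p → ∈.∈-filter⁺ P? (∈.∈-allFin _) p) (count (allFin n))
    where
    P? : ∀ y → Dec (a x y ≡ true)
    P? y = a x y Bool.≟ true
    count : ∀ xs → length (filter P? xs) ≡ sum (map (λ y → if a x y then 1 else 0) xs)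
    count [] = refl
    count (y ∷ xs) with a x y
    ... | true  = cong suc (count xs)
    ... | false = count xs

  edge-distinct : ∀ (d d′ : Edge a) → Same (Edge.u d) (Edge.v d) (Edge.u d′) (Edge.v d′) → Edge.u d ≡ Edge.u d′ × Edge.v d ≡ Edge.v d′
  edge-distinct d d′ (inj₁ (p , r)) = sym p , sym r
  edge-distinct d d′ (inj₂ (p , r)) = ⊥-elim (ℕ.<-asym (Edge.u<v d) (subst₂ Fin._<_ p r (Edge.u<v d′)))

  make-edge : Irr ⟦ a ⟧ → Symm ⟦ a ⟧ → ∀ {x y} → ⟦ a ⟧ x y → Σ (Edge a) λ d → Same x y (Edge.u d) (Edge.v d)
  make-edge ir sy {x} {y} h with Fin.<-cmp x y
  ... | tri< lt _ _ = edge x y lt h , inj₁ (refl , refl)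
  ... | tri≈ _ eq _ = ⊥-elim (ir h eq)
  ... | tri> _ _ gt = edge y x gt (sy h) , inj₂ (refl , refl)

module Encode (m n q : ℕ) where

  p N : ℕ
  p = 2 + q
  N = m + n + p

  code : V m n q → ℕ
  code (pv i _) = i
  code (lv a) = p + toℕ a
  code (rv b) = p + m + toℕ b

  N≡ : N ≡ p + m + n
  N≡ = trans (ℕ.+-comm (m + n) p) (sym (ℕ.+-assoc p m n))

  path< : ∀ {i} → .(i ≤ suc q) → i < p
  path< {i} h = s≤s (recompute (i ℕ.≤? suc q) h)

  code< : ∀ v → code v < N
  code< v = subst (code v <_) (sym N≡) (go v)
    where
    go : ∀ v → code v < p + m + n
    go (pv i h) = ℕ.≤-trans (path< h) (ℕ.≤-trans (ℕ.m≤m+n p m) (ℕ.m≤m+n (p + m) n))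
    go (lv a) = ℕ.≤-trans (ℕ.+-monoʳ-< p (Fin.toℕ<n a)) (ℕ.m≤m+n (p + m) n)
    go (rv b) = ℕ.+-monoʳ-< (p + m) (Fin.toℕ<n b)

  left< : ∀ a → code (lv a) < p + m
  left< a = ℕ.+-monoʳ-< p (Fin.toℕ<n a)

  left≥ : ∀ a → p ≤ code (lv a)
  left≥ a = ℕ.m≤m+n p (toℕ a)

  right≥ : ∀ b → p + m ≤ code (rv b)
  right≥ b = ℕ.m≤m+n (p + m) (toℕ b)

  code-inj : ∀ {u v} → code u ≡ code v → u ≡ v
  code-inj {pv i _} {pv j _} eq = pv-cong eq
  code-inj {lv a} {lv b} eq = cong lv (Fin.toℕ-injective (ℕ.+-cancelˡ-≡ p _ _ eq))
  code-inj {rv a} {rv b} eq = cong rv (Fin.toℕ-injective (ℕ.+-cancelˡ-≡ (p + m) _ _ eq))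
  code-inj {pv i h} {lv a} eq = ⊥-elim (ℕ.<⇒≱ (path< h) (subst (p ≤_) (sym eq) (left≥ a)))
  code-inj {lv a} {pv i h} eq = ⊥-elim (ℕ.<⇒≱ (path< h) (subst (p ≤_) eq (left≥ a)))
  code-inj {pv i h} {rv b} eq = ⊥-elim (ℕ.<⇒≱ (path< h) (subst (p ≤_) (sym eq) (ℕ.≤-trans (ℕ.m≤m+n p m) (right≥ b))))
  code-inj {rv b} {pv i h} eq = ⊥-elim (ℕ.<⇒≱ (path< h) (subst (p ≤_) eq (ℕ.≤-trans (ℕ.m≤m+n p m) (right≥ b))))
  code-inj {lv a} {rv b} eq = ⊥-elim (ℕ.<⇒≱ (left< a) (subst (p + m ≤_) (sym eq) (right≥ b)))
  code-inj {rv b} {lv a} eq = ⊥-elim (ℕ.<⇒≱ (left< a) (subst (p + m ≤_) eq (right≥ b)))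

  decode : ∀ k → k < N → ∃ λ v → code v ≡ k
  decode k lt with k ℕ.<? p | k ℕ.<? p + m
  ... | yes l | _ = pv k (ℕ.≤-pred l) , refl
  ... | no l | yes l′ = lv (Fin.fromℕ< j<m) , trans (cong (p +_) (Fin.toℕ-fromℕ< j<m)) (ℕ.m+[n∸m]≡n (ℕ.≮⇒≥ l))
    where
    j<m : k ∸ p < m
    j<m = ℕ.+-cancelˡ-< p _ _ (subst (_< p + m) (sym (ℕ.m+[n∸m]≡n (ℕ.≮⇒≥ l))) l′)
  ... | no _ | no l′ = rv (Fin.fromℕ< j<n) , trans (cong (p + m +_) (Fin.toℕ-fromℕ< j<n)) (ℕ.m+[n∸m]≡n (ℕ.≮⇒≥ l′))
    where
    j<n : k ∸ (p + m) < n
    j<n = ℕ.+-cancelˡ-< (p + m) _ _ (subst₂ _<_ (sym (ℕ.m+[n∸m]≡n (ℕ.≮⇒≥ l′))) N≡ lt)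

  dec : Fin N → V m n q
  dec i = proj₁ (decode (toℕ i) (Fin.toℕ<n i))

  code-dec : ∀ i → code (dec i) ≡ toℕ i
  code-dec i = proj₂ (decode (toℕ i) (Fin.toℕ<n i))

  enc : V m n q → Fin N
  enc v = Fin.fromℕ< (code< v)

  dec-enc : ∀ v → dec (enc v) ≡ v
  dec-enc v = code-inj (trans (code-dec (enc v)) (Fin.toℕ-fromℕ< (code< v)))

  enc-dec : ∀ i → enc (dec i) ≡ i
  enc-dec i = Fin.toℕ-injective (trans (Fin.toℕ-fromℕ< (code< (dec i))) (code-dec i))

  -- Path vertices are numbered below `p`, left leaves from `p` to below `p + m`, right leaves from
  -- there on. Comparison with `p` and `p + m` rules out the wrong kinds of vertices in each
  -- disjunct.
  rel : ∀ u v → broomRel m n p (code u) (code v) ≡ true → G u v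
  rel u v h with ∨-true {(code v ≡ᵇ suc (code u)) ∧ (code v <ᵇ p)} h
  ... | inj₁ r = step u v (≡ᵇ-true (proj₁ (∧-true r))) (<ᵇ-true (proj₂ (∧-true r)))
    where
    step : ∀ u v → code v ≡ suc (code u) → code v < p → G u v
    step (pv i _) (pv .(suc i) h′) refl _ = pE i (ℕ.≤-pred h′) , p→
    step _ (lv a) _ lt = ⊥-elim (ℕ.<⇒≱ lt (left≥ a))
    step _ (rv b) _ lt = ⊥-elim (ℕ.<⇒≱ lt (ℕ.≤-trans (ℕ.m≤m+n p m) (right≥ b)))
    step (lv a) (pv j h′) eq lt = ⊥-elim (ℕ.<⇒≱ lt (subst (p ≤_) (sym eq) (ℕ.m≤n⇒m≤1+n (left≥ a))))
    step (rv b) (pv j h′) eq lt = ⊥-elim (ℕ.<⇒≱ lt (subst (p ≤_) (sym eq) (ℕ.m≤n⇒m≤1+n (ℕ.≤-trans (ℕ.m≤m+n p m) (right≥ b)))))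
  ... | inj₂ r with ∨-true {(code u ≡ᵇ 0) ∧ (p ≤ᵇ code v) ∧ (code v <ᵇ p + m)} r
  ...   | inj₁ s = leaf u v (≡ᵇ-true (proj₁ (∧-true s))) (≤ᵇ-true (proj₁ (∧-true (proj₂ (∧-true {code u ≡ᵇ 0} s)))))
                     (<ᵇ-true (proj₂ (∧-true {p ≤ᵇ code v} (proj₂ (∧-true {code u ≡ᵇ 0} s)))))
    where
    leaf : ∀ u v → code u ≡ 0 → p ≤ code v → code v < p + m → G u v
    leaf (pv zero _) (lv a) _ _ _ = _ , l→
    leaf _ (pv i h′) _ le _ = ⊥-elim (ℕ.<⇒≱ (path< h′) le)
    leaf _ (rv b) _ _ lt = ⊥-elim (ℕ.<⇒≱ lt (right≥ b))
  ...   | inj₂ s = leaf u v (≡ᵇ-true (proj₁ (∧-true s))) (≤ᵇ-true (proj₁ (∧-true (proj₂ (∧-true {code u ≡ᵇ p ∸ 1} s)))))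
    where
    leaf : ∀ u v → code u ≡ suc q → p + m ≤ code v → G u v
    leaf (pv .(suc q) _) (rv b) refl _ = _ , r→
    leaf _ (pv i h′) _ le = ⊥-elim (ℕ.<⇒≱ (path< h′) (ℕ.≤-trans (ℕ.m≤m+n p m) le))
    leaf _ (lv a) _ le = ⊥-elim (ℕ.<⇒≱ (left< a) le)
    leaf (lv a) (rv b) eq _ = ⊥-elim (ℕ.<⇒≱ (ℕ.n<1+n (suc q)) (subst (p ≤_) eq (left≥ a)))
    leaf (rv c) (rv b) eq _ = ⊥-elim (ℕ.<⇒≱ (ℕ.n<1+n (suc q)) (subst (p ≤_) eq (ℕ.≤-trans (ℕ.m≤m+n p m) (right≥ c))))

  rel-src : ∀ e → broomRel m n p (code (src e)) (code (tgt e)) ≡ true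
  rel-src (pE i h) = ∨-introˡ (∧-intro (≡ᵇ-intro {suc i} refl) (<ᵇ-intro (s≤s (s≤s (recompute (i ℕ.≤? q) h)))))
  rel-src (lE a) = ∨-introʳ {(code (lv a) ≡ᵇ 1) ∧ (code (lv a) <ᵇ p)} (∨-introˡ (∧-intro refl (∧-intro (≤ᵇ-intro (left≥ a)) (<ᵇ-intro (left< a)))))
  rel-src (rE b) = ∨-introʳ {(code (rv b) ≡ᵇ suc (suc q)) ∧ (code (rv b) <ᵇ p)}
    (∨-introʳ {(suc q ≡ᵇ 0) ∧ (p ≤ᵇ code (rv b)) ∧ (code (rv b) <ᵇ p + m)}
      (∧-intro (≡ᵇ-intro {suc q} refl) (∧-intro (≤ᵇ-intro (right≥ b)) (<ᵇ-intro (subst (code (rv b) <_) N≡ (code< (rv b)))))))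

  adj-true : ∀ u v → G u v → broomRel m n p (code u) (code v) ∨ broomRel m n p (code v) (code u) ≡ true
  adj-true u v (d , l) with link⇒same l
  ... | inj₁ (refl , refl) = ∨-introˡ (rel-src d)
  ... | inj₂ (refl , refl) = ∨-introʳ {broomRel m n p (code u) (code v)} (rel-src d)

  broom≅ : ⟦ DoubleBroom m n p ⟧ ≅ G {m} {n} {q}
  broom≅ = mkIso dec enc dec-enc enc-dec (λ {i} {j} → fwd {i} {j}) (λ {u} {v} → bwd {u} {v})
    where
    fwd : ∀ {i j} → ⟦ DoubleBroom m n p ⟧ i j → G (dec i) (dec j)
    fwd {i} {j} h with ∨-true {broomRel m n p (toℕ i) (toℕ j)} h
    ... | inj₁ r = rel _ _ (subst₂ (λ x y → broomRel m n p x y ≡ true) (sym (code-dec i)) (sym (code-dec j)) r)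
    ... | inj₂ r = G-symm (rel _ _ (subst₂ (λ x y → broomRel m n p x y ≡ true) (sym (code-dec j)) (sym (code-dec i)) r))
    bwd : ∀ {u v} → G u v → ⟦ DoubleBroom m n p ⟧ (enc u) (enc v)
    bwd {u} {v} g = subst₂ (λ x y → broomRel m n p x y ∨ broomRel m n p y x ≡ true)
      (sym (Fin.toℕ-fromℕ< (code< u))) (sym (Fin.toℕ-fromℕ< (code< v))) (adj-true u v g)

-- Transfer of both bounds to the definition of adern.

SameDegree : ∀ {m n q} {W : Set} (H : Rel W) → W → W → GEdge m n q → Set
SameDegree H x y d = ∃ λ a → ∃ λ b → ∃ λ s → ∃ λ t →
  Deg H x (suc a) × Deg H y (suc b) × Deg G (src d) (suc s) × Deg G (tgt d) (suc t) × a + b ≡ s + t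

-- Such a graph shows that `k` decards, and hence fewer, may fail to determine the broom. It lives
-- on the vertices of the broom, and `H?` turns the relation into a Boolean adjacency matrix.
record Adversary (m n q k : ℕ) : Set₁ where
  field
    H      : Rel (V m n q)
    H-symm : Symm H
    H-irr  : Irr H
    H?     : ∀ u v → Dec (H u v)
    family : Family m n q k H
    degree : ∀ i → SameDegree H (fa (sh family i)) (fb (sh family i)) (e (sh family i))
    differ : ¬ (H ≅ G {m} {n} {q})

module Transfer (m n q : ℕ) where

  open Encode m n q

  private
    𝔾 : Adj N
    𝔾 = DoubleBroom m n p

  edge-link : (σ : Edge 𝔾) → G {m} {n} {q} (dec (Edge.u σ)) (dec (Edge.v σ))
  edge-link σ = pres broom≅ {Edge.u σ} {Edge.v σ} (Edge.isAdj σ)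

  edge-of : Edge 𝔾 → GEdge m n q
  edge-of σ = proj₁ (edge-link σ)

  edge-same : (σ : Edge 𝔾) → Same (src (edge-of σ)) (tgt (edge-of σ)) (dec (Edge.u σ)) (dec (Edge.v σ))
  edge-same σ = link⇒same (proj₂ (edge-link σ))

  deck≅ : (σ : Edge 𝔾) → ⟦ deleteEdge σ ⟧ ≅ D (edge-of σ)
  deck≅ σ = ≅-trans (deleteEdge≅ σ) (≅-trans (≅-del broom≅ _ _) (≅-trans (del-same (same-sym (edge-same σ))) (≅-sym (D≅Del _))))

  edge-of-inj : (σ σ′ : Edge 𝔾) → edge-of σ ≡ edge-of σ′ → Edge.u σ ≡ Edge.u σ′ × Edge.v σ ≡ Edge.v σ′
  edge-of-inj σ σ′ eq = edge-distinct σ σ′ (same-to⁻ broom≅ {Edge.u σ} {Edge.v σ} {Edge.u σ′} {Edge.v σ′}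
    (same-trans (same-sym (edge-same σ)) (subst (λ d → Same (src d) (tgt d) (dec (Edge.u σ′)) (dec (Edge.v σ′))) (sym eq) (edge-same σ′))))

  deg-pos : ∀ {V : Set} {E : Rel V} {x y k} → E x y → Deg E x k → ∃ λ j → k ≡ suc j
  deg-pos {k = suc k} _ _ = k , refl
  deg-pos {k = zero} h (card [] _ _ c _) with c h
  ... | ()
  deg-pos {k = zero} h (card (_ ∷ _) _ _ _ ())

  module _ {k : ℕ} (reqs : Reqs m n q (suc k)) (a₀ : Fin m) (b₀ : Fin n) where

    -- `K` is its first decard plus the cut edge `x y`, hence isomorphic to `Add (D e₀)` with the
    -- images of `x` and `y`, and the whole family moves along. The degree condition is used for the
    -- index zero only, an index that `suc k` guarantees.
    all-determine : AllDetermine 𝔾 (suc k)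
    all-determine σ σ-inj n′ K τ τ-inj same = ≅⇒Iso (≅-trans K≅H (≅-trans (solve-edge a₀ b₀ reqs e₀ base fam′) (≅-sym broom≅)))
      where
      E : Rel (Fin n′)
      E = ⟦ adj K ⟧
      E-symm : Symm E
      E-symm {i} {j} h = trans (Graph.sym K j i) h
      E-irr : Irr E
      E-irr {i} h refl with trans (sym h) (irrefl K i)
      ... | ()
      ψ : ∀ i → Del E (Edge.u (τ i)) (Edge.v (τ i)) ≅ D (edge-of (σ i))
      ψ i = ≅-trans (≅-sym (deleteEdge≅ (τ i))) (≅-trans (Iso⇒≅ (proj₁ (same i))) (deck≅ (σ i)))
      fam : Family m n q (suc k) E
      fam = record
        { sh = λ i → share (Edge.u (τ i)) (Edge.v (τ i)) (Edge.isAdj (τ i)) (edge-of (σ i)) (ψ i)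
        ; f-inj = λ i j s → let p , r = edge-distinct (τ i) (τ j) s in τ-inj i j p r
        ; e-inj = λ i j s → let p , r = edge-of-inj (σ i) (σ j) s in σ-inj i j p r }
      τ₀ = τ Fin.zero
      σ₀ = σ Fin.zero
      x y : Fin n′
      x = Edge.u τ₀
      y = Edge.v τ₀
      e₀ = edge-of σ₀
      x≢y : x ≢ y
      x≢y = E-irr (Edge.isAdj τ₀)
      K≅H : E ≅ Add (D e₀) (to (ψ Fin.zero) x) (to (ψ Fin.zero) y)
      K≅H = ≅-trans (≅-sym (add-del Fin._≟_ (Edge.isAdj τ₀) E-symm)) (≅-add (ψ Fin.zero) x y)
      fam′ = family-iso K≅H fam
      dx = deg-pos {E = E} (Edge.isAdj τ₀) (deg-card {a = adj K} x)
      dy = deg-pos {E = E} (E-symm (Edge.isAdj τ₀)) (deg-card {a = adj K} y)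
      du = deg-pos {E = ⟦ 𝔾 ⟧} {x = Edge.u σ₀} {y = Edge.v σ₀} (Edge.isAdj σ₀) (deg-card {a = 𝔾} (Edge.u σ₀))
      dv = deg-pos {E = ⟦ 𝔾 ⟧} {x = Edge.v σ₀} {y = Edge.u σ₀} (reflect broom≅ {Edge.v σ₀} {Edge.u σ₀} (G-symm (edge-link σ₀))) (deg-card {a = 𝔾} (Edge.v σ₀))
      -- Both ends of an edge have positive degree, so the `∸ 2` in `edgeDeg` takes one from each.
      total : ∀ {a b c d} → a ≡ suc b → c ≡ suc d → a + c ∸ 2 ≡ b + d
      total {b = b} {d = d} refl refl = cong pred (ℕ.+-suc b d)
      u≢v : Edge.u σ₀ ≢ Edge.v σ₀
      u≢v eq = Fin.<⇒≢ (Edge.u<v σ₀) eq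
      G-u : Deg (G {m} {n} {q}) (dec (Edge.u σ₀)) (suc (proj₁ du))
      G-u = deg-iso broom≅ (subst (Deg ⟦ 𝔾 ⟧ _) (proj₂ du) (deg-card {a = 𝔾} (Edge.u σ₀)))
      G-v : Deg (G {m} {n} {q}) (dec (Edge.v σ₀)) (suc (proj₁ dv))
      G-v = deg-iso broom≅ (subst (Deg ⟦ 𝔾 ⟧ _) (proj₂ dv) (deg-card {a = 𝔾} (Edge.v σ₀)))
      sum-eq : proj₁ dx + proj₁ dy ≡ proj₁ du + proj₁ dv
      sum-eq = trans (sym (total (proj₂ dx) (proj₂ dy))) (trans (proj₂ (same Fin.zero)) (total (proj₂ du) (proj₂ dv)))
      ends : Σ ℕ λ s → Σ ℕ λ t → Deg (D e₀) (src e₀) s × Deg (D e₀) (tgt e₀) t × proj₁ dx + proj₁ dy ≡ s + t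
      ends with edge-same σ₀
      ... | inj₁ (p , r) = _ , _ , degD-src e₀ (deg-resp G p G-u) , degD-tgt e₀ (deg-resp G r G-v) , sum-eq
      ... | inj₂ (p , r) = _ , _ , degD-src e₀ (deg-resp G r G-v) , degD-tgt e₀ (deg-resp G p G-u) , trans sum-eq (ℕ.+-comm (proj₁ du) (proj₁ dv))
      base : Base e₀ (to (ψ Fin.zero) x) (to (ψ Fin.zero) y)
      base = record
        { x≢y = x≢y ∘ to-inj (ψ Fin.zero)
        ; new = λ d → proj₂ (reflect (ψ Fin.zero) d) (inj₁ (refl , refl))
        ; deg-x = deg-iso (ψ Fin.zero) (deg-del E x≢y (Edge.isAdj τ₀) (subst (Deg E x) (proj₂ dx) (deg-card {a = adj K} x)))
        ; deg-y = deg-iso (ψ Fin.zero) (deg-delʳ E x≢y (E-symm (Edge.isAdj τ₀)) (subst (Deg E y) (proj₂ dy) (deg-card {a = adj K} y)))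
        ; deg-s = proj₁ (proj₂ (proj₂ ends))
        ; deg-t = proj₁ (proj₂ (proj₂ (proj₂ ends)))
        ; sums = proj₂ (proj₂ (proj₂ (proj₂ ends))) }

  module _ {k : ℕ} (adv : Adversary m n q k) where

    open Adversary adv

    private
      K : Adj N
      K i j with H? (dec i) (dec j)
      ... | yes _ = true
      ... | no _ = false

    K-true : ∀ {i j} → ⟦ K ⟧ i j → H (dec i) (dec j)
    K-true {i} {j} p with H? (dec i) (dec j) | p
    ... | yes h | _ = h
    ... | no _ | ()

    K-intro : ∀ {i j} → H (dec i) (dec j) → ⟦ K ⟧ i j
    K-intro {i} {j} h with H? (dec i) (dec j)
    ... | yes _ = refl
    ... | no r = ⊥-elim (r h)

    K≅H : ⟦ K ⟧ ≅ H
    K≅H = record { to = dec ; from = enc ; to-from = dec-enc ; from-to = enc-dec ; pres = λ {i} {j} → K-true {i} {j} ; reflect = λ {i} {j} → K-intro {i} {j} }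

    K-symm : Symm ⟦ K ⟧
    K-symm {i} {j} p = K-intro {j} {i} (H-symm (K-true {i} {j} p))

    K-irr : Irr ⟦ K ⟧
    K-irr {i} {j} p eq = H-irr (K-true {i} {j} p) (cong dec eq)

    graph : Graph N
    graph = record
      { adj = K
      ; sym = λ i j → ≡true-≡ (K-symm {i} {j}) (K-symm {j} {i})
      ; irrefl = λ i → not-self i }
      where
      not-self : ∀ i → K i i ≡ false
      not-self i with H? (dec i) (dec i)
      ... | yes h = ⊥-elim (H-irr h refl)
      ... | no _ = refl

    τ-edge : (s : Share m n q H) → Σ (Edge K) λ d → Same (enc (fa s)) (enc (fb s)) (Edge.u d) (Edge.v d)
    τ-edge s = make-edge (λ {i} {j} → K-irr {i} {j}) (λ {i} {j} → K-symm {i} {j}) (K-intro (subst₂ H (sym (dec-enc _)) (sym (dec-enc _)) (fab s)))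

    σ-edge : (s : Share m n q H) → Σ (Edge 𝔾) λ d → Same (enc (src (e s))) (enc (tgt (e s))) (Edge.u d) (Edge.v d)
    σ-edge s = make-edge (λ {i} {j} h eq → G-irr (pres broom≅ {i} {j} h) (cong dec eq)) (λ {i} {j} h → reflect broom≅ {j} {i} (G-symm (pres broom≅ {i} {j} h)))
                 (back broom≅ {src (e s)} {tgt (e s)} (_ , link (e s)))

    edge-degree : ∀ {E : Adj N} {a b x y} (d : Edge E) → Same x y (Edge.u d) (Edge.v d) → Deg ⟦ E ⟧ x (suc a) → Deg ⟦ E ⟧ y (suc b) → edgeDeg d ≡ a + b
    edge-degree {E} {a} {b} d (inj₁ (refl , refl)) dx dy =
      trans (cong (_∸ 2) (cong₂ _+_ (card-unique (deg-card {a = E} (Edge.u d)) dx) (card-unique (deg-card {a = E} (Edge.v d)) dy))) (cong pred (ℕ.+-suc a b))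
    edge-degree {E} {a} {b} d (inj₂ (refl , refl)) dx dy =
      trans (cong (_∸ 2) (cong₂ _+_ (card-unique (deg-card {a = E} (Edge.u d)) dy) (card-unique (deg-card {a = E} (Edge.v d)) dx))) (trans (cong pred (ℕ.+-suc b a)) (ℕ.+-comm b a))

    same-decard : ∀ i → SameDecard (proj₁ (τ-edge (sh family i))) (proj₁ (σ-edge (sh family i)))
    same-decard i = ≅⇒Iso (≅-trans (deleteEdge≅ d) (≅-trans (del-same (same-sym ds)) (≅-trans (≅-sym (≅-del (≅-sym K≅H) _ _)) (≅-trans (iso s) (≅-trans (D≅Del (e s))
        (≅-trans (≅-del (≅-sym broom≅) _ _) (≅-trans (del-same ds′) (≅-sym (deleteEdge≅ d′)))))))))
      , degs (degree i)
      where
      s = sh family i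
      d = proj₁ (τ-edge s)
      ds = proj₂ (τ-edge s)
      d′ = proj₁ (σ-edge s)
      ds′ = proj₂ (σ-edge s)
      degs : SameDegree H (fa s) (fb s) (e s) → edgeDeg d ≡ edgeDeg d′
      degs (_ , _ , _ , _ , dx , dy , du , dv , eq) = trans (edge-degree d ds (deg-iso (≅-sym K≅H) dx) (deg-iso (≅-sym K≅H) dy))
        (trans eq (sym (edge-degree d′ ds′ (deg-iso (≅-sym broom≅) du) (deg-iso (≅-sym broom≅) dv))))

    -- The first `j` of the `k` common decards are a common family as well, so a single H refutes
    -- every `j ≤ k`.
    refutes : ∀ {j} → j ≤ k → ¬ AllDetermine 𝔾 j
    refutes {j} le det = differ (≅-trans (≅-sym K≅H) (≅-trans (Iso⇒≅ (det (λ i → proj₁ (σ-edge (s i))) σ-inj N graph (λ i → proj₁ (τ-edge (s i))) τ-inj (λ i → same-decard (lift i)))) broom≅))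
      where
      lift : Fin j → Fin k
      lift i = Fin.inject≤ i le
      s : Fin j → Share m n q H
      s i = sh family (lift i)
      merge : ∀ {x y x′ y′ u v u′ v′ : Fin N} → Same x y u v → Same x′ y′ u′ v′ → u ≡ u′ → v ≡ v′ → Same x y x′ y′
      merge p r refl refl = same-trans p (same-sym r)
      σ-inj : EdgeInjective (λ i → proj₁ (σ-edge (s i)))
      σ-inj i i′ p r = Fin.inject≤-injective le le i i′ (e-inj family _ _ (link-unique (link (e (s i)))
        (same⇒link (same-sym (same-to⁻ (≅-sym broom≅) {src (e (s i))} {tgt (e (s i))} {src (e (s i′))} {tgt (e (s i′))}
          (merge (proj₂ (σ-edge (s i))) (proj₂ (σ-edge (s i′))) p r))))))
      τ-inj : EdgeInjective (λ i → proj₁ (τ-edge (s i)))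
      τ-inj i i′ p r = Fin.inject≤-injective le le i i′ (f-inj family _ _ (same-to⁻ (≅-sym K≅H) (merge (proj₂ (τ-edge (s i))) (proj₂ (τ-edge (s i′))) p r)))

-- Graphs with many decards in common with the broom.

-- The graph G − e + xy, and its decards: besides that of xy, those of the edges d ≠ e of G for
-- which a permutation σ of the vertices carries the remaining edges to those of some G − e′.
-- The permutation π records the effect of σ on edges, with xy in place of e and e′ in place of d.
module Rewire {m n q : ℕ} (e₀ : GEdge m n q) (x y : V m n q) where

  record Move : Set where
    field
      d e′      : GEdge m n q
      d≢e₀      : d ≢ e₀
      σ σ⁻      : V m n q → V m n q
      σσ⁻       : ∀ v → σ (σ⁻ v) ≡ v
      σ⁻σ       : ∀ v → σ⁻ (σ v) ≡ v
      π π⁻      : GEdge m n q → GEdge m n q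
      ππ⁻       : ∀ g → π (π⁻ g) ≡ g
      π⁻π       : ∀ g → π⁻ (π g) ≡ g
      πd        : π d ≡ e′
      old       : ∀ g → g ≢ e₀ → g ≢ d → Same (src (π g)) (tgt (π g)) (σ (src g)) (σ (tgt g))
      fresh     : Same (src (π e₀)) (tgt (π e₀)) (σ x) (σ y)
      {α β s t} : ℕ
      deg-α     : Deg (D e′) (σ (src d)) α
      deg-β     : Deg (D e′) (σ (tgt d)) β
      deg-s     : Deg G (src e′) (suc s)
      deg-t     : Deg G (tgt e′) (suc t)
      sums      : α + β ≡ s + t

  module Rewired (x≢y : x ≢ y) (unlinked : ∀ {g} → ¬ Link g x y) where

    xy-new : ¬ D e₀ x y
    xy-new ((_ , l) , _) = unlinked l

    H : Rel (V m n q)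
    H = Add (D e₀) x y

    H-irr : Irr H
    H-irr = add-irr x≢y D-irr

    H-symm : Symm H
    H-symm = add-symm D-symm

    H? : ∀ u v → Dec (H u v)
    H? u v with G? u v | same? _≟_ (src e₀) (tgt e₀) u v | same? _≟_ x y u v
    ... | _      | _      | yes s = yes (inj₂ s)
    ... | no ¬g  | _      | no ¬s = no λ { (inj₁ d) → ¬g (D⇒G d) ; (inj₂ s) → ¬s s }
    ... | yes g  | no ¬o  | no ¬s = yes (inj₁ (g , ¬o))
    ... | yes g  | yes o  | no ¬s = no λ { (inj₁ (_ , ¬o)) → ¬o o ; (inj₂ s) → ¬s s }

    base-share : Share m n q H
    base-share = share x y (inj₂ (inj₁ (refl , refl))) e₀ (del-add xy-new D-symm)

    xy≢d : (mv : Move) → ¬ Same x y (src (Move.d mv)) (tgt (Move.d mv))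
    xy≢d mv s = xy-new (D-link (Move.d≢e₀ mv) (same⇒link (same-sym s)))

    module _ (mv : Move) where

      open Move mv

      move-iso : Del H (src d) (tgt d) ≅ D e′
      move-iso = mkIso σ σ⁻ σσ⁻ σ⁻σ fwd bwd
        where
        lands : ∀ {g u v} → g ≢ d → Same (src (π g)) (tgt (π g)) (σ u) (σ v) → D e′ (σ u) (σ v)
        lands ne at′ = D-link (λ p → ne (trans (sym (π⁻π _)) (trans (cong π⁻ (trans p (sym πd))) (π⁻π _)))) (same⇒link at′)
        fwd : ∀ {u v} → Del H (src d) (tgt d) u v → D e′ (σ u) (σ v)
        fwd (inj₁ h , ¬s) with D-link⁻ h
        ... | g , ne , l with link⇒same l
        ...   | inj₁ (refl , refl) = lands g≢d (old g ne g≢d)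
          where g≢d = λ { refl → ¬s (inj₁ (refl , refl)) }
        ...   | inj₂ (refl , refl) = lands g≢d (same-swap (old g ne g≢d))
          where g≢d = λ { refl → ¬s (inj₂ (refl , refl)) }
        fwd (inj₂ (inj₁ (refl , refl)) , _) = lands (≢-sym d≢e₀) fresh
        fwd (inj₂ (inj₂ (refl , refl)) , _) = lands (≢-sym d≢e₀) (same-swap fresh)
        unmap : ∀ {a b u v} → Same (σ a) (σ b) u v → Same a b (σ⁻ u) (σ⁻ v)
        unmap (inj₁ (refl , refl)) = inj₁ (σ⁻σ _ , σ⁻σ _)
        unmap (inj₂ (refl , refl)) = inj₂ (σ⁻σ _ , σ⁻σ _)
        bwd : ∀ {u v} → D e′ u v → Del H (src d) (tgt d) (σ⁻ u) (σ⁻ v)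
        bwd {u} {v} h with D-link⁻ h
        ... | g′ , ne , l = from-link (π⁻ g′) (sym (ππ⁻ g′))
          where
          -- As `π` is a bijection with `π d ≡ e′`, each edge of `D e′` is the image of `e₀`, which
          -- stands for the new edge, or of an edge of `D e₀` other than `d`.
          from-link : ∀ g → g′ ≡ π g → Del H (src d) (tgt d) (σ⁻ u) (σ⁻ v)
          from-link g refl with g ≟ᴱ e₀
          ... | yes refl = inj₂ new , λ o → xy≢d mv (same-trans new (same-sym o))
            where new = unmap (same-trans (same-sym fresh) (link⇒same l))
          ... | no g≢e₀ = inj₁ (D-link g≢e₀ (same⇒link now)) , λ o → g≢d (link-unique (same⇒link now) (same⇒link o))
            where
            g≢d : g ≢ d
            g≢d refl = ne πd
            now = unmap (same-trans (same-sym (old g g≢e₀ g≢d)) (link⇒same l))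

      move-share : Share m n q H
      move-share = share (src d) (tgt d) (inj₁ (D-link d≢e₀ (link d))) e′ move-iso

    lift-degrees : ∀ {a b f j k} (φ : Del H a b ≅ D {m} {n} {q} f) → H a b → Deg (D f) (to φ a) j → Deg (D f) (to φ b) k →
                   Deg H a (suc j) × Deg H b (suc k)
    lift-degrees {a} {b} φ h da db = lift (deg-add (Del H a b) a≢b (λ r → proj₂ r (inj₁ (refl , refl))) (down a da))
                                   , lift (deg-addʳ (Del H a b) a≢b (λ r → proj₂ r (inj₂ (refl , refl))) (down b db))
      where
      a≢b : a ≢ b
      a≢b = H-irr h
      down : ∀ v {k} → Deg (D _) (to φ v) k → Deg (Del H a b) v k
      down v d = subst (λ w → Deg (Del H a b) w _) (from-to φ v) (deg-iso (≅-sym φ) d)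
      lift : ∀ {v k} → Deg (Add (Del H a b) a b) v k → Deg H v k
      lift d = deg-iso (add-del _≟_ h H-symm) d

    module _ {α β s t : ℕ} (dx : Deg (D e₀) x α) (dy : Deg (D e₀) y β) (ds : Deg G (src e₀) (suc s)) (dt : Deg G (tgt e₀) (suc t))
             (sums : α + β ≡ s + t) where

      adversary : ∀ {k} (mv : Fin k → Move) → (∀ i j → Move.d (mv i) ≡ Move.d (mv j) → i ≡ j) →
                  (∀ i j → Move.e′ (mv i) ≡ Move.e′ (mv j) → i ≡ j) → (∀ i → Move.e′ (mv i) ≢ e₀) →
                  ¬ (H ≅ G {m} {n} {q}) → Adversary m n q (suc k)
      adversary {k} mv d-inj e′-inj e′≢e₀ ne = record
        { H = H ; H-symm = H-symm ; H-irr = H-irr ; H? = H?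
        ; family = record { sh = shares ; f-inj = f-inj′ ; e-inj = e-inj′ }
        ; degree = degrees
        ; differ = ne }
        where
        shares : Fin (suc k) → Share m n q H
        shares Fin.zero = base-share
        shares (Fin.suc i) = move-share (mv i)
        f-inj′ : ∀ i j → Same (fa (shares i)) (fb (shares i)) (fa (shares j)) (fb (shares j)) → i ≡ j
        f-inj′ Fin.zero Fin.zero _ = refl
        f-inj′ Fin.zero (Fin.suc j) s = ⊥-elim (xy≢d (mv j) s)
        f-inj′ (Fin.suc i) Fin.zero s = ⊥-elim (xy≢d (mv i) (same-sym s))
        f-inj′ (Fin.suc i) (Fin.suc j) s = cong Fin.suc (d-inj i j (sym (link-unique (link (Move.d (mv j))) (same⇒link s))))
        e-inj′ : ∀ i j → e (shares i) ≡ e (shares j) → i ≡ j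
        e-inj′ Fin.zero Fin.zero _ = refl
        e-inj′ Fin.zero (Fin.suc j) p = ⊥-elim (e′≢e₀ j (sym p))
        e-inj′ (Fin.suc i) Fin.zero p = ⊥-elim (e′≢e₀ i p)
        e-inj′ (Fin.suc i) (Fin.suc j) p = cong Fin.suc (e′-inj i j p)
        degrees : ∀ i → SameDegree H (fa (shares i)) (fb (shares i)) (e (shares i))
        degrees Fin.zero = _ , _ , _ , _ , proj₁ both′ , proj₂ both′ , ds , dt , sums
          where both′ = lift-degrees (iso base-share) (fab base-share) dx dy
        degrees (Fin.suc i) = _ , _ , _ , _ , proj₁ both′ , proj₂ both′ , Move.deg-s (mv i) , Move.deg-t (mv i) , Move.sums (mv i)
          where both′ = lift-degrees (move-iso (mv i)) (fab (move-share (mv i))) (Move.deg-α (mv i)) (Move.deg-β (mv i))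

connected : ∀ {m n q} {c : V m n q → Bool} → Closed G c → ∀ v → c v ≡ c A
connected {q = q} {c} cl = go
  where
  along : ∀ j → .(g : j ≤ suc q) → c (pv j g) ≡ c A
  along zero g = refl
  along (suc j) g = trans (cl (pE j (ℕ.≤-pred g) , p←)) (along j (ℕ.<⇒≤ g))
  go : ∀ v → c v ≡ c A
  go (pv j g) = along j g
  go (lv a) = cl (_ , l←)
  go (rv b) = trans (cl (_ , r←)) (along (suc q) ℕ.≤-refl)

differ-split : ∀ {m n q} {W : Set} {H : Rel W} {c : W → Bool} → Closed H c → ∀ u v → c u ≢ c v → ¬ (H ≅ G {m} {n} {q})
differ-split {c = c} cl u v ne φ = ne (trans (colour u) (sym (colour v)))
  where
  colour : ∀ u → c u ≡ c (from φ A)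
  colour u = trans (cong c (sym (from-to φ u))) (connected (closed-iso φ {c} cl) (to φ u))

differ-isolated : ∀ {m n q} {W : Set} {H : Rel W} u → (∀ w → ¬ H u w) → ¬ (H ≅ G {m} {n} {q})
differ-isolated {H = H} u lone φ = neighbour (to φ u) (λ w g → lone (from φ w) (subst (λ x → H x (from φ w)) (from-to φ u) (back φ {to φ u} {w} g)))
  where
  neighbour : ∀ v → ¬ (∀ w → ¬ G v w)
  neighbour (pv zero h) n = n (pv 1 (s≤s z≤n)) (pE 0 z≤n , p→)
  neighbour (pv (suc j) h) n = n (pv j (ℕ.<⇒≤ h)) (pE j (ℕ.≤-pred h) , p←)
  neighbour (lv a) n = n A (_ , l←)
  neighbour (rv b) n = n B (_ , r←)

differ-bushy : ∀ {m n q} {W : Set} {H : Rel W} {v w₁ w₂ w₃ z₁ z₂} → H v w₁ → H v w₂ → H v w₃ → w₁ ≢ w₂ → w₁ ≢ w₃ → w₂ ≢ w₃ →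
               H w₁ z₁ → z₁ ≢ v → H w₂ z₂ → z₂ ≢ v → ¬ (H ≅ G {m} {n} {q})
differ-bushy a₁ a₂ a₃ n₁ n₂ n₃ b₁ k₁ b₂ k₂ φ =
  bushy (pres φ a₁) (pres φ a₂) (pres φ a₃) (n₁ ∘ to-inj φ) (n₂ ∘ to-inj φ) (n₃ ∘ to-inj φ)
    (pres φ b₁) (k₁ ∘ to-inj φ) (pres φ b₂) (k₂ ∘ to-inj φ)

deg-pv : ∀ {m n q} i (h : i ≤ q) → ∃ λ t → Deg (G {m} {n} {q}) (pv (suc i) (s≤s h)) (suc t)
deg-pv {n = n} {q} i h with i ℕ.≟ q
... | yes refl = n , deg-B
... | no ne = 1 , deg-int (ℕ.≤∧≢⇒< h ne)

split-by-side : ∀ {m n q i} .{h : i ≤ q} {x y : V m n q} → side i x ≡ side i y → ¬ (Add (D (pE i h)) x y ≅ G {m} {n} {q})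
split-by-side {m} {n} {q} {i} {h} {x} {y} eq = differ-split closed A B (λ p → case (trans (sym (side-A {m} {n} {q} {i} {h})) (trans p (side-B {m} {n} {q} {i} {h}))))
  where
  closed : Closed (Add (D (pE i h)) x y) (side i)
  closed (inj₁ d) = side-closed {h = h} d
  closed (inj₂ (inj₁ (refl , refl))) = eq
  closed (inj₂ (inj₂ (refl , refl))) = sym eq
  case : true ≢ false
  case ()

leaf-cut : ∀ {m n q} {a} {x y : V m n q} → lv a ≢ x → lv a ≢ y → ¬ (Add (D (lE a)) x y ≅ G {m} {n} {q})
leaf-cut {a = a} p r = differ-isolated (lv a) λ { w (inj₁ d) → leaf-isolatedˡ d ; w (inj₂ s) → off p r s }

adversary-reflect : ∀ {m n q k} → Adversary m n q k → Adversary n m q k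
adversary-reflect {m} {n} {q} adv = record
  { H = λ u v → H (ρ u) (ρ v) ; H-symm = H-symm ; H-irr = λ h → H-irr h ∘ cong ρ ; H? = λ u v → H? (ρ u) (ρ v)
  ; family = family-iso back-iso (family-reflect family)
  ; degree = degrees
  ; differ = λ φ → differ (≅-trans back-iso (≅-trans φ ρ-iso)) }
  where
  open Adversary adv
  back-iso : H ≅ (λ u v → H (ρ u) (ρ v))
  back-iso = mkIso ρ ρ ρ-invol ρ-invol (λ h → subst₂ H (sym (ρ-invol _)) (sym (ρ-invol _)) h) id
  degrees : ∀ i → SameDegree (λ u v → H (ρ u) (ρ v)) (ρ (fa (sh family i))) (ρ (fb (sh family i))) (ρᴱ (e (sh family i)))
  degrees i with degree i
  ... | a , b , s , t , da , db , ds , dt , eq with link⇒same (ρ-link (link (e (sh family i))))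
  ...   | inj₁ (p , r) = a , b , s , t , deg-iso back-iso da , deg-iso back-iso db , deg-resp G p (deg-iso ρ-iso ds) , deg-resp G r (deg-iso ρ-iso dt) , eq
  ...   | inj₂ (p , r) = a , b , t , s , deg-iso back-iso da , deg-iso back-iso db , deg-resp G r (deg-iso ρ-iso dt) , deg-resp G p (deg-iso ρ-iso ds)
                       , trans eq (ℕ.+-comm s t)

-- The value one requires that no decards at all fail to determine the broom; any other graph shows
-- this, here one with an isolated vertex.
adversary₀ : ∀ {m n q} → Adversary (suc m) n q 0
adversary₀ {m} {n} {q} = record
  { H = D (lE 0F) ; H-symm = D-symm ; H-irr = D-irr ; H? = H?′
  ; family = record { sh = λ () ; f-inj = λ () ; e-inj = λ () } ; degree = λ ()
  ; differ = differ-isolated (lv 0F) λ _ → leaf-isolatedˡ }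
  where
  H?′ : ∀ u v → Dec (D {suc m} {n} {q} (lE 0F) u v)
  H?′ u v with G? u v | same? _≟_ A (lv 0F) u v
  ... | no ¬g | _ = no (¬g ∘ D⇒G)
  ... | yes g | yes o = no λ { (_ , ¬o) → ¬o o }
  ... | yes g | no ¬o = yes (g , ¬o)

-- With `pE 0` cut, `pv 1` and `rv 0F` are both leaves of `B`, so the new edge forms a triangle; the
-- degrees `1 + 1` match `m + 1` for `m = 1`. `A` and its leaf are split off.
triangle₁ : ∀ {n} → Adversary 1 (suc n) 1 1
triangle₁ {n} = adversary (degD-tgt (pE 0 z≤n) (deg-int (s≤s z≤n))) (degD-off (pE 0 z≤n) (λ ()) (λ ()) (deg-r 0F)) deg-A (deg-int (s≤s z≤n)) refl
              (λ ()) (λ ()) (λ ()) (λ ()) (split-by-side {h = z≤n} refl)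
  where open Rewire.Rewired {1} {suc n} {1} (pE 0 z≤n) (pv 1 (s≤s z≤n)) (rv 0F) (λ ()) (λ ())

-- The degrees `1 + 2` match `m = 3`; the new edge forms a triangle with `A`, and `lv 0F` stays
-- isolated.
triangle₃ : ∀ {n} → Adversary 3 n 1 1
triangle₃ {n} = adversary (degD-off (lE 0F) (λ ()) (λ ()) (deg-l 1F)) (degD-off (lE 0F) (λ ()) (λ ()) (deg-int (s≤s z≤n))) deg-A (deg-l 0F) refl
              (λ ()) (λ ()) (λ ()) (λ ()) (leaf-cut (λ ()) (λ ()))
  where open Rewire.Rewired {3} {n} {1} (lE 0F) (lv 1F) (pv 1 (s≤s z≤n)) (λ ()) (λ ())

-- A path of at least four vertices has an inner edge. After cutting `pE 1`, both `lv 0F` and `pv 1`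
-- are leaves of `A`, so joining them keeps the degree sum for all leaf numbers and leaves the hubs
-- separated.
triangle : ∀ {m n q} → Adversary (suc m) n (2 + q) 1
triangle {m} {n} {q} = adversary (degD-off d (λ ()) (λ ()) (deg-l 0F)) (degD-src d (deg-int (s≤s z≤n))) (deg-int (s≤s z≤n)) (deg-int (s≤s (s≤s z≤n))) refl
              (λ ()) (λ ()) (λ ()) (λ ()) (split-by-side {h = s≤s z≤n} refl)
  where
  d = pE 1 (s≤s z≤n)
  open Rewire.Rewired {suc m} {n} {2 + q} d (lv 0F) (pv 1 (s≤s z≤n)) (λ ()) (λ ())

module PathToLeaf {n r : ℕ} where

  private
    q = 3 + r
    v₁ v₂ v₃ : V 2 n q
    v₁ = pv 1 (s≤s z≤n)
    v₂ = pv 2 (s≤s (s≤s z≤n))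
    v₃ = pv 3 (s≤s (s≤s (s≤s z≤n)))
    e₁ e₂ e₀ : GEdge 2 n q
    e₀ = pE 0 z≤n
    e₁ = pE 1 (s≤s z≤n)
    e₂ = pE 2 (s≤s (s≤s z≤n))

  open Rewire e₀ v₂ (lv 0F)
  open Rewired (λ ()) (λ ())

  -- In H the vertex `pv 2` carries the arm `pv 1`, of length one, and the arm `lv 0F`, `A`,
  -- `lv 1F`. Cutting off `pv 1` leaves the broom without the leaf `lv 0F`, up to exchanging `pv 1`
  -- and `lv 0F`.
  toLeaf : Move
  toLeaf = record
    { d = e₁ ; e′ = lE 0F ; d≢e₀ = λ ()
    ; σ = σ ; σ⁻ = σ ; σσ⁻ = σσ ; σ⁻σ = σσ ; π = π ; π⁻ = π⁻ ; ππ⁻ = ππ⁻ ; π⁻π = π⁻π ; πd = refl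
    ; old = old ; fresh = inj₂ (refl , refl)
    ; deg-α = degD-tgt (lE 0F) (deg-l 0F) ; deg-β = degD-off (lE 0F) (λ ()) (λ ()) (deg-int (s≤s (s≤s z≤n)))
    ; deg-s = deg-A ; deg-t = deg-l 0F ; sums = refl }
    where
    σ : V 2 n q → V 2 n q
    σ (pv 1 _) = lv 0F
    σ (lv 0F) = v₁
    σ v = v
    σσ : ∀ v → σ (σ v) ≡ v
    σσ (pv 0 _) = refl
    σσ (pv 1 _) = refl
    σσ (pv (suc (suc _)) _) = refl
    σσ (lv 0F) = refl
    σσ (lv 1F) = refl
    σσ (rv _) = refl
    π π⁻ : GEdge 2 n q → GEdge 2 n q
    π (pE 0 _) = e₁
    π (pE 1 _) = lE 0F
    π (lE 0F) = e₀
    π g = g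
    π⁻ (pE 0 _) = lE 0F
    π⁻ (pE 1 _) = e₀
    π⁻ (lE 0F) = e₁
    π⁻ g = g
    ππ⁻ : ∀ g → π (π⁻ g) ≡ g
    ππ⁻ (pE 0 _) = refl
    ππ⁻ (pE 1 _) = refl
    ππ⁻ (pE (suc (suc _)) _) = refl
    ππ⁻ (lE 0F) = refl
    ππ⁻ (lE 1F) = refl
    ππ⁻ (rE _) = refl
    π⁻π : ∀ g → π⁻ (π g) ≡ g
    π⁻π (pE 0 _) = refl
    π⁻π (pE 1 _) = refl
    π⁻π (pE (suc (suc _)) _) = refl
    π⁻π (lE 0F) = refl
    π⁻π (lE 1F) = refl
    π⁻π (rE _) = refl
    old : ∀ g → g ≢ e₀ → g ≢ e₁ → Same (src (π g)) (tgt (π g)) (σ (src g)) (σ (tgt g))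
    old (pE 0 _) ne _ = ⊥-elim (ne refl)
    old (pE 1 _) _ ne = ⊥-elim (ne refl)
    old (pE (suc (suc _)) _) _ _ = inj₁ (refl , refl)
    old (lE 0F) _ _ = inj₁ (refl , refl)
    old (lE 1F) _ _ = inj₁ (refl , refl)
    old (rE _) _ _ = inj₁ (refl , refl)

  -- Cut between `pv 3` and `pv 4`, the part around `pv 2` has two arms of length one and one of
  -- length three. So has the part around `A` in the broom without that edge; `σ` exchanges `pv 2`
  -- and `A`.
  exchange : Move
  exchange = record
    { d = e₃ ; e′ = e₃ ; d≢e₀ = λ ()
    ; σ = σ ; σ⁻ = σ ; σσ⁻ = σσ ; σ⁻σ = σσ ; π = π ; π⁻ = π ; ππ⁻ = ππ ; π⁻π = ππ ; πd = refl
    ; old = old ; fresh = inj₁ (refl , refl)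
    ; deg-α = degD-off e₃ (λ ()) (λ ()) (deg-l 1F) ; deg-β = degD-tgt e₃ (proj₂ deg-4)
    ; deg-s = deg-int (s≤s (s≤s (s≤s z≤n))) ; deg-t = proj₂ deg-4 ; sums = refl }
    where
    e₃ : GEdge 2 n q
    e₃ = pE 3 (s≤s (s≤s (s≤s z≤n)))
    deg-4 = deg-pv 3 (s≤s (s≤s (s≤s z≤n)))
    σ : V 2 n q → V 2 n q
    σ (pv 0 _) = v₂
    σ (pv 1 _) = lv 0F
    σ (pv 2 _) = A
    σ (pv 3 _) = lv 1F
    σ (lv 0F) = v₁
    σ (lv 1F) = v₃
    σ v = v
    σσ : ∀ v → σ (σ v) ≡ v
    σσ (pv 0 _) = refl
    σσ (pv 1 _) = refl
    σσ (pv 2 _) = refl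
    σσ (pv 3 _) = refl
    σσ (pv (suc (suc (suc (suc _)))) _) = refl
    σσ (lv 0F) = refl
    σσ (lv 1F) = refl
    σσ (rv _) = refl
    π : GEdge 2 n q → GEdge 2 n q
    π (pE 1 _) = lE 0F
    π (pE 2 _) = lE 1F
    π (lE 0F) = e₁
    π (lE 1F) = e₂
    π g = g
    ππ : ∀ g → π (π g) ≡ g
    ππ (pE 0 _) = refl
    ππ (pE 1 _) = refl
    ππ (pE 2 _) = refl
    ππ (pE (suc (suc (suc _))) _) = refl
    ππ (lE 0F) = refl
    ππ (lE 1F) = refl
    ππ (rE _) = refl
    old : ∀ g → g ≢ e₀ → g ≢ e₃ → Same (src (π g)) (tgt (π g)) (σ (src g)) (σ (tgt g))
    old (pE 0 _) ne _ = ⊥-elim (ne refl)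
    old (pE 1 _) _ _ = inj₂ (refl , refl)
    old (pE 2 _) _ _ = inj₁ (refl , refl)
    old (pE 3 _) _ ne = ⊥-elim (ne refl)
    old (pE (suc (suc (suc (suc _)))) _) _ _ = inj₁ (refl , refl)
    old (lE 0F) _ _ = inj₂ (refl , refl)
    old (lE 1F) _ _ = inj₁ (refl , refl)
    old (rE _) _ _ = inj₁ (refl , refl)

  path-to-leaf : Adversary 2 n (3 + r) 3
  path-to-leaf = adversary (degD-off e₀ (λ ()) (λ ()) (deg-int (s≤s (s≤s z≤n)))) (degD-off e₀ (λ ()) (λ ()) (deg-l 0F))
    deg-A (deg-int (s≤s z≤n)) refl
    (λ { 0F → toLeaf ; 1F → exchange })
    (λ { 0F 0F _ → refl ; 0F 1F () ; 1F 0F () ; 1F 1F _ → refl })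
    (λ { 0F 0F _ → refl ; 0F 1F () ; 1F 0F () ; 1F 1F _ → refl })
    (λ { 0F () ; 1F () })
    (differ-bushy {w₂ = v₃} {w₃ = v₁} {z₁ = A} (inj₂ (inj₁ (refl , refl))) (inj₁ (D-link {e′ = e₂} (λ ()) p→)) (inj₁ (D-link {e′ = e₁} (λ ()) p←)) (λ ()) (λ ()) (λ ())
      (inj₁ (D-link {e′ = lE 0F} (λ ()) l←)) (λ ())
      (inj₁ (D-link {e′ = pE 3 (s≤s (s≤s (s≤s z≤n)))} (λ ()) (p→ {h₂ = s≤s (s≤s (s≤s (s≤s z≤n)))}))) (λ ()))

open PathToLeaf using (path-to-leaf)

-- Three leaves at A against two leaves and the first path vertex, all hanging from A.
module LeafToPath {n r : ℕ} where

  private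
    q = 2 + r
    v₁ v₂ : V 3 n q
    v₁ = pv 1 (s≤s z≤n)
    v₂ = pv 2 (s≤s (s≤s z≤n))
    e₁ : GEdge 3 n q
    e₁ = pE 1 (s≤s z≤n)

  open Rewire (lE 0F) (lv 1F) v₂
  open Rewired (λ ()) (λ ())

  exchange : Move
  exchange = record
    { d = e₁ ; e′ = lE 1F ; d≢e₀ = λ ()
    ; σ = σ ; σ⁻ = σ⁻ ; σσ⁻ = σσ⁻ ; σ⁻σ = σ⁻σ ; π = π ; π⁻ = π⁻ ; ππ⁻ = ππ⁻ ; π⁻π = π⁻π ; πd = refl
    ; old = old ; fresh = inj₁ (refl , refl)
    ; deg-α = degD-off (lE 1F) (λ ()) (λ ()) (deg-l 0F) ; deg-β = degD-off (lE 1F) (λ ()) (λ ()) (deg-int (s≤s (s≤s z≤n)))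
    ; deg-s = deg-A ; deg-t = deg-l 1F ; sums = refl }
    where
    σ σ⁻ : V 3 n q → V 3 n q
    σ (pv 1 _) = lv 0F
    σ (lv 0F) = lv 1F
    σ (lv 1F) = v₁
    σ v = v
    σ⁻ (pv 1 _) = lv 1F
    σ⁻ (lv 0F) = v₁
    σ⁻ (lv 1F) = lv 0F
    σ⁻ v = v
    σσ⁻ : ∀ v → σ (σ⁻ v) ≡ v
    σσ⁻ (pv 0 _) = refl
    σσ⁻ (pv 1 _) = refl
    σσ⁻ (pv (suc (suc _)) _) = refl
    σσ⁻ (lv 0F) = refl
    σσ⁻ (lv 1F) = refl
    σσ⁻ (lv 2F) = refl
    σσ⁻ (rv _) = refl
    σ⁻σ : ∀ v → σ⁻ (σ v) ≡ v
    σ⁻σ (pv 0 _) = refl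
    σ⁻σ (pv 1 _) = refl
    σ⁻σ (pv (suc (suc _)) _) = refl
    σ⁻σ (lv 0F) = refl
    σ⁻σ (lv 1F) = refl
    σ⁻σ (lv 2F) = refl
    σ⁻σ (rv _) = refl
    π π⁻ : GEdge 3 n q → GEdge 3 n q
    π (pE 0 _) = lE 0F
    π (pE 1 _) = lE 1F
    π (lE 0F) = e₁
    π (lE 1F) = pE 0 z≤n
    π g = g
    π⁻ (pE 0 _) = lE 1F
    π⁻ (pE 1 _) = lE 0F
    π⁻ (lE 0F) = pE 0 z≤n
    π⁻ (lE 1F) = e₁
    π⁻ g = g
    ππ⁻ : ∀ g → π (π⁻ g) ≡ g
    ππ⁻ (pE 0 _) = refl
    ππ⁻ (pE 1 _) = refl
    ππ⁻ (pE (suc (suc _)) _) = refl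
    ππ⁻ (lE 0F) = refl
    ππ⁻ (lE 1F) = refl
    ππ⁻ (lE 2F) = refl
    ππ⁻ (rE _) = refl
    π⁻π : ∀ g → π⁻ (π g) ≡ g
    π⁻π (pE 0 _) = refl
    π⁻π (pE 1 _) = refl
    π⁻π (pE (suc (suc _)) _) = refl
    π⁻π (lE 0F) = refl
    π⁻π (lE 1F) = refl
    π⁻π (lE 2F) = refl
    π⁻π (rE _) = refl
    old : ∀ g → g ≢ lE 0F → g ≢ e₁ → Same (src (π g)) (tgt (π g)) (σ (src g)) (σ (tgt g))
    old (pE 0 _) _ _ = inj₁ (refl , refl)
    old (pE 1 _) _ ne = ⊥-elim (ne refl)
    old (pE (suc (suc _)) _) _ _ = inj₁ (refl , refl)
    old (lE 0F) ne _ = ⊥-elim (ne refl)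
    old (lE 1F) _ _ = inj₁ (refl , refl)
    old (lE 2F) _ _ = inj₁ (refl , refl)
    old (rE _) _ _ = inj₁ (refl , refl)

  leaf-to-path : Adversary 3 n (2 + r) 2
  leaf-to-path = adversary (degD-off (lE 0F) (λ ()) (λ ()) (deg-l 1F)) (degD-off (lE 0F) (λ ()) (λ ()) (deg-int (s≤s (s≤s z≤n))))
    deg-A (deg-l 0F) refl
    (λ { 0F → exchange }) (λ { 0F 0F _ → refl }) (λ { 0F 0F _ → refl }) (λ { 0F () }) (leaf-cut (λ ()) (λ ()))

open LeafToPath using (leaf-to-path)

module Cycle0 {n : ℕ} where

  open Rewire {2} {suc n} {0} (lE 0F) (lv 1F) (rv 0F)
  open Rewired (λ ()) (λ ())

  -- The cycle can branch only at `B`. Turning it over about `B` takes the new edge, which is one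
  -- step away from `B`, to the other edge one step away, so cutting there gives a leaf decard
  -- again; it is charged to `lE 1F` because `lE 0F` stands for the new edge. `Cycle1` and `Cycle2`
  -- treat cycles with one and two more vertices.
  turn : Move
  turn = record
    { d = (lE 1F) ; e′ = lE 1F ; d≢e₀ = λ ()
    ; σ = σ ; σ⁻ = σ ; σσ⁻ = σσ ; σ⁻σ = σσ ; π = π ; π⁻ = π ; ππ⁻ = ππ ; π⁻π = ππ ; πd = refl
    ; old = old ; fresh = inj₂ (refl , refl)
    ; deg-α = degD-off (lE 1F) (λ ()) (λ ()) (deg-r 0F) ; deg-β = degD-off (lE 1F) (λ ()) (λ ()) (deg-l 0F)
    ; deg-s = deg-A ; deg-t = deg-l 1F ; sums = refl }
    where
    σ : V 2 (suc n) 0 → V 2 (suc n) 0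
    σ (lv 0F) = (lv 1F)
    σ (lv 1F) = (lv 0F)
    σ (pv 0 _) = (rv 0F)
    σ (rv 0F) = (pv 0 z≤n)
    σ v = v
    σσ : ∀ v → σ (σ v) ≡ v
    σσ (pv 0 _) = refl
    σσ (pv 1 _) = refl
    σσ (pv (suc (suc _)) _) = refl
    σσ (lv 0F) = refl
    σσ (lv 1F) = refl
    σσ (rv 0F) = refl
    σσ (rv (Fin.suc _)) = refl
    π : GEdge 2 (suc n) 0 → GEdge 2 (suc n) 0
    π (pE 0 _) = (rE 0F)
    π (rE 0F) = (pE 0 z≤n)
    π v = v
    ππ : ∀ v → π (π v) ≡ v
    ππ (pE 0 _) = refl
    ππ (pE (suc _) _) = refl
    ππ (lE 0F) = refl
    ππ (lE 1F) = refl
    ππ (rE 0F) = refl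
    ππ (rE (Fin.suc _)) = refl
    old : ∀ g → g ≢ (lE 0F) → g ≢ (lE 1F) → Same (src (π g)) (tgt (π g)) (σ (src g)) (σ (tgt g))
    old (pE 0 _) _ _ = inj₂ (refl , refl)
    old (pE (suc _) _) _ _ = inj₁ (refl , refl)
    old (lE 0F) ne _ = ⊥-elim (ne refl)
    old (lE 1F) _ ne = ⊥-elim (ne refl)
    old (rE 0F) _ _ = inj₂ (refl , refl)
    old (rE (Fin.suc _)) _ _ = inj₁ (refl , refl)

  cycle : Adversary 2 (suc n) 0 2
  cycle = adversary (degD-off (lE 0F) (λ ()) (λ ()) (deg-l 1F)) (degD-off (lE 0F) (λ ()) (λ ()) (deg-r 0F)) deg-A (deg-l 0F) refl
    (λ { 0F → turn }) (λ { 0F 0F _ → refl }) (λ { 0F 0F _ → refl }) (λ { 0F () }) (leaf-cut (λ ()) (λ ()))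

module Cycle1 {n : ℕ} where

  open Rewire {2} {suc n} {1} (lE 0F) (lv 1F) (rv 0F)
  open Rewired (λ ()) (λ ())

  turn : Move
  turn = record
    { d = (pE 0 z≤n) ; e′ = lE 1F ; d≢e₀ = λ ()
    ; σ = σ ; σ⁻ = σ⁻ ; σσ⁻ = σσ⁻ ; σ⁻σ = σ⁻σ ; π = π ; π⁻ = π⁻ ; ππ⁻ = ππ⁻ ; π⁻π = π⁻π ; πd = refl
    ; old = old ; fresh = inj₁ (refl , refl)
    ; deg-α = degD-off (lE 1F) (λ ()) (λ ()) (deg-l 0F) ; deg-β = degD-off (lE 1F) (λ ()) (λ ()) (deg-r 0F)
    ; deg-s = deg-A ; deg-t = deg-l 1F ; sums = refl }
    where
    σ σ⁻ : V 2 (suc n) 1 → V 2 (suc n) 1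
    σ (pv 1 _) = (rv 0F)
    σ (rv 0F) = (pv 1 (s≤s z≤n))
    σ (lv 1F) = (pv 0 z≤n)
    σ (pv 0 _) = (lv 0F)
    σ (lv 0F) = (lv 1F)
    σ v = v
    σ⁻ (pv 1 _) = (rv 0F)
    σ⁻ (rv 0F) = (pv 1 (s≤s z≤n))
    σ⁻ (lv 1F) = (lv 0F)
    σ⁻ (pv 0 _) = (lv 1F)
    σ⁻ (lv 0F) = (pv 0 z≤n)
    σ⁻ v = v
    σσ⁻ : ∀ v → σ (σ⁻ v) ≡ v
    σσ⁻ (pv 0 _) = refl
    σσ⁻ (pv 1 _) = refl
    σσ⁻ (pv 2 _) = refl
    σσ⁻ (pv (suc (suc (suc _))) _) = refl
    σσ⁻ (lv 0F) = refl
    σσ⁻ (lv 1F) = refl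
    σσ⁻ (rv 0F) = refl
    σσ⁻ (rv (Fin.suc _)) = refl
    σ⁻σ : ∀ v → σ⁻ (σ v) ≡ v
    σ⁻σ (pv 0 _) = refl
    σ⁻σ (pv 1 _) = refl
    σ⁻σ (pv 2 _) = refl
    σ⁻σ (pv (suc (suc (suc _))) _) = refl
    σ⁻σ (lv 0F) = refl
    σ⁻σ (lv 1F) = refl
    σ⁻σ (rv 0F) = refl
    σ⁻σ (rv (Fin.suc _)) = refl
    π π⁻ : GEdge 2 (suc n) 1 → GEdge 2 (suc n) 1
    π (lE 0F) = (pE 0 z≤n)
    π (lE 1F) = (lE 0F)
    π (pE 0 _) = (lE 1F)
    π (pE 1 _) = (rE 0F)
    π (rE 0F) = (pE 1 (s≤s z≤n))
    π v = v
    π⁻ (lE 0F) = (lE 1F)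
    π⁻ (lE 1F) = (pE 0 z≤n)
    π⁻ (pE 0 _) = (lE 0F)
    π⁻ (pE 1 _) = (rE 0F)
    π⁻ (rE 0F) = (pE 1 (s≤s z≤n))
    π⁻ v = v
    ππ⁻ : ∀ v → π (π⁻ v) ≡ v
    ππ⁻ (pE 0 _) = refl
    ππ⁻ (pE 1 _) = refl
    ππ⁻ (pE (suc (suc _)) _) = refl
    ππ⁻ (lE 0F) = refl
    ππ⁻ (lE 1F) = refl
    ππ⁻ (rE 0F) = refl
    ππ⁻ (rE (Fin.suc _)) = refl
    π⁻π : ∀ v → π⁻ (π v) ≡ v
    π⁻π (pE 0 _) = refl
    π⁻π (pE 1 _) = refl
    π⁻π (pE (suc (suc _)) _) = refl
    π⁻π (lE 0F) = refl
    π⁻π (lE 1F) = refl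
    π⁻π (rE 0F) = refl
    π⁻π (rE (Fin.suc _)) = refl
    old : ∀ g → g ≢ (lE 0F) → g ≢ (pE 0 z≤n) → Same (src (π g)) (tgt (π g)) (σ (src g)) (σ (tgt g))
    old (pE 0 _) _ ne = ⊥-elim (ne refl)
    old (pE 1 _) _ _ = inj₂ (refl , refl)
    old (pE (suc (suc _)) _) _ _ = inj₁ (refl , refl)
    old (lE 0F) ne _ = ⊥-elim (ne refl)
    old (lE 1F) _ _ = inj₂ (refl , refl)
    old (rE 0F) _ _ = inj₂ (refl , refl)
    old (rE (Fin.suc _)) _ _ = inj₁ (refl , refl)

  cycle : Adversary 2 (suc n) 1 2
  cycle = adversary (degD-off (lE 0F) (λ ()) (λ ()) (deg-l 1F)) (degD-off (lE 0F) (λ ()) (λ ()) (deg-r 0F)) deg-A (deg-l 0F) refl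
    (λ { 0F → turn }) (λ { 0F 0F _ → refl }) (λ { 0F 0F _ → refl }) (λ { 0F () }) (leaf-cut (λ ()) (λ ()))

module Cycle2 {n : ℕ} where

  open Rewire {2} {suc n} {2} (lE 0F) (lv 1F) (rv 0F)
  open Rewired (λ ()) (λ ())

  turn : Move
  turn = record
    { d = (pE 1 (s≤s z≤n)) ; e′ = lE 1F ; d≢e₀ = λ ()
    ; σ = σ ; σ⁻ = σ⁻ ; σσ⁻ = σσ⁻ ; σ⁻σ = σ⁻σ ; π = π ; π⁻ = π⁻ ; ππ⁻ = ππ⁻ ; π⁻π = π⁻π ; πd = refl
    ; old = old ; fresh = inj₁ (refl , refl)
    ; deg-α = degD-off (lE 1F) (λ ()) (λ ()) (deg-l 0F) ; deg-β = degD-off (lE 1F) (λ ()) (λ ()) (deg-r 0F)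
    ; deg-s = deg-A ; deg-t = deg-l 1F ; sums = refl }
    where
    σ σ⁻ : V 2 (suc n) 2 → V 2 (suc n) 2
    σ (pv 2 _) = (rv 0F)
    σ (rv 0F) = (pv 2 (s≤s (s≤s z≤n)))
    σ (lv 1F) = (pv 1 (s≤s z≤n))
    σ (pv 1 _) = (lv 0F)
    σ (lv 0F) = (lv 1F)
    σ v = v
    σ⁻ (pv 2 _) = (rv 0F)
    σ⁻ (rv 0F) = (pv 2 (s≤s (s≤s z≤n)))
    σ⁻ (lv 1F) = (lv 0F)
    σ⁻ (pv 1 _) = (lv 1F)
    σ⁻ (lv 0F) = (pv 1 (s≤s z≤n))
    σ⁻ v = v
    σσ⁻ : ∀ v → σ (σ⁻ v) ≡ v
    σσ⁻ (pv 0 _) = refl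
    σσ⁻ (pv 1 _) = refl
    σσ⁻ (pv 2 _) = refl
    σσ⁻ (pv 3 _) = refl
    σσ⁻ (pv (suc (suc (suc (suc _)))) _) = refl
    σσ⁻ (lv 0F) = refl
    σσ⁻ (lv 1F) = refl
    σσ⁻ (rv 0F) = refl
    σσ⁻ (rv (Fin.suc _)) = refl
    σ⁻σ : ∀ v → σ⁻ (σ v) ≡ v
    σ⁻σ (pv 0 _) = refl
    σ⁻σ (pv 1 _) = refl
    σ⁻σ (pv 2 _) = refl
    σ⁻σ (pv 3 _) = refl
    σ⁻σ (pv (suc (suc (suc (suc _)))) _) = refl
    σ⁻σ (lv 0F) = refl
    σ⁻σ (lv 1F) = refl
    σ⁻σ (rv 0F) = refl
    σ⁻σ (rv (Fin.suc _)) = refl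
    π π⁻ : GEdge 2 (suc n) 2 → GEdge 2 (suc n) 2
    π (lE 0F) = (pE 1 (s≤s z≤n))
    π (lE 1F) = (pE 0 z≤n)
    π (pE 0 _) = (lE 0F)
    π (pE 1 _) = (lE 1F)
    π (pE 2 _) = (rE 0F)
    π (rE 0F) = (pE 2 (s≤s (s≤s z≤n)))
    π v = v
    π⁻ (lE 0F) = (pE 0 z≤n)
    π⁻ (lE 1F) = (pE 1 (s≤s z≤n))
    π⁻ (pE 0 _) = (lE 1F)
    π⁻ (pE 1 _) = (lE 0F)
    π⁻ (pE 2 _) = (rE 0F)
    π⁻ (rE 0F) = (pE 2 (s≤s (s≤s z≤n)))
    π⁻ v = v
    ππ⁻ : ∀ v → π (π⁻ v) ≡ v
    ππ⁻ (pE 0 _) = refl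
    ππ⁻ (pE 1 _) = refl
    ππ⁻ (pE 2 _) = refl
    ππ⁻ (pE (suc (suc (suc _))) _) = refl
    ππ⁻ (lE 0F) = refl
    ππ⁻ (lE 1F) = refl
    ππ⁻ (rE 0F) = refl
    ππ⁻ (rE (Fin.suc _)) = refl
    π⁻π : ∀ v → π⁻ (π v) ≡ v
    π⁻π (pE 0 _) = refl
    π⁻π (pE 1 _) = refl
    π⁻π (pE 2 _) = refl
    π⁻π (pE (suc (suc (suc _))) _) = refl
    π⁻π (lE 0F) = refl
    π⁻π (lE 1F) = refl
    π⁻π (rE 0F) = refl
    π⁻π (rE (Fin.suc _)) = refl
    old : ∀ g → g ≢ (lE 0F) → g ≢ (pE 1 (s≤s z≤n)) → Same (src (π g)) (tgt (π g)) (σ (src g)) (σ (tgt g))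
    old (pE 0 _) _ _ = inj₁ (refl , refl)
    old (pE 1 _) _ ne = ⊥-elim (ne refl)
    old (pE 2 _) _ _ = inj₂ (refl , refl)
    old (pE (suc (suc (suc _))) _) _ _ = inj₁ (refl , refl)
    old (lE 0F) ne _ = ⊥-elim (ne refl)
    old (lE 1F) _ _ = inj₁ (refl , refl)
    old (rE 0F) _ _ = inj₂ (refl , refl)
    old (rE (Fin.suc _)) _ _ = inj₁ (refl , refl)

  cycle : Adversary 2 (suc n) 2 2
  cycle = adversary (degD-off (lE 0F) (λ ()) (λ ()) (deg-l 1F)) (degD-off (lE 0F) (λ ()) (λ ()) (deg-r 0F)) deg-A (deg-l 0F) refl
    (λ { 0F → turn }) (λ { 0F 0F _ → refl }) (λ { 0F 0F _ → refl }) (λ { 0F () }) (leaf-cut (λ ()) (λ ()))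


reverse-edge : ∀ {m n q} i .(h : i ≤ q) → Same (pv {m} {n} {q} (q ∸ i) (ℕ.m≤n⇒m≤1+n (ℕ.m∸n≤m q i))) (pv (suc (q ∸ i)) (s≤s (ℕ.m∸n≤m q i)))
                 (pv (suc q ∸ i) (ℕ.m∸n≤m (suc q) i)) (pv (q ∸ i) (ℕ.m≤n⇒m≤1+n (ℕ.m∸n≤m q i)))
reverse-edge {q = q} i h = inj₂ (pv-cong (ℕ.+-∸-assoc 1 (recompute (i ℕ.≤? q) h)) , refl)

-- A leaf of B joined to A as well: the graph is symmetric about that leaf.
module CommonLeaf {m q : ℕ} where

  open Rewire {m} {2 + m} {q} (rE 0F) (rv 1F) A public
  open Rewired (λ ()) (λ ()) public

  reverse : Move
  reverse = record
    { d = rE 1F ; e′ = rE 1F ; d≢e₀ = λ ()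
    ; σ = σ ; σ⁻ = σ ; σσ⁻ = σσ ; σ⁻σ = σσ ; π = π ; π⁻ = π ; ππ⁻ = ππ ; π⁻π = ππ ; πd = refl
    ; old = old ; fresh = inj₂ (refl , refl)
    ; deg-α = deg-resp (D (rE 1F)) (sym σB) (degD-off (rE 1F) (λ ()) (λ ()) deg-A) ; deg-β = degD-off (rE 1F) (λ ()) (λ ()) (deg-r 0F)
    ; deg-s = deg-B ; deg-t = deg-r 1F ; sums = trans (ℕ.+-comm (suc m) 1) (sym (ℕ.+-identityʳ _)) }
    where
    σ : V m (2 + m) q → V m (2 + m) q
    σ (pv i _) = pv (suc q ∸ i) (ℕ.m∸n≤m (suc q) i)
    σ (lv a) = rv (Fin.suc (Fin.suc a))
    σ (rv 0F) = rv 1F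
    σ (rv 1F) = rv 0F
    σ (rv (Fin.suc (Fin.suc a))) = lv a
    σσ : ∀ v → σ (σ v) ≡ v
    σσ (pv i h) = pv-cong (ℕ.m∸[m∸n]≡n (recompute (i ℕ.≤? suc q) h))
    σσ (lv a) = refl
    σσ (rv 0F) = refl
    σσ (rv 1F) = refl
    σσ (rv (Fin.suc (Fin.suc a))) = refl
    σB : σ B ≡ A
    σB = pv-cong (ℕ.n∸n≡0 q)
    π : GEdge m (2 + m) q → GEdge m (2 + m) q
    π (pE i _) = pE (q ∸ i) (ℕ.m∸n≤m q i)
    π (lE a) = rE (Fin.suc (Fin.suc a))
    π (rE (Fin.suc (Fin.suc a))) = lE a
    π g = g
    ππ : ∀ g → π (π g) ≡ g
    ππ (pE i h) = pE-cong (ℕ.m∸[m∸n]≡n (recompute (i ℕ.≤? q) h))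
    ππ (lE a) = refl
    ππ (rE 0F) = refl
    ππ (rE 1F) = refl
    ππ (rE (Fin.suc (Fin.suc a))) = refl
    old : ∀ g → g ≢ rE 0F → g ≢ rE 1F → Same (src (π g)) (tgt (π g)) (σ (src g)) (σ (tgt g))
    old (pE i h) _ _ = reverse-edge {m} {2 + m} i h
    old (lE _) _ _ = inj₁ (refl , refl)
    old (rE 0F) ne _ = ⊥-elim (ne refl)
    old (rE 1F) _ ne = ⊥-elim (ne refl)
    old (rE (Fin.suc (Fin.suc _))) _ _ = inj₁ (σB , refl)

  from-moves : ∀ {k} (mv : Fin k → Move) → (∀ i j → Move.d (mv i) ≡ Move.d (mv j) → i ≡ j) →
               (∀ i j → Move.e′ (mv i) ≡ Move.e′ (mv j) → i ≡ j) → (∀ i → Move.e′ (mv i) ≢ rE 0F) → Adversary m (2 + m) q (suc k)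
  from-moves mv d-inj e′-inj e′≢e₀ = adversary (degD-off (rE 0F) (λ ()) (λ ()) (deg-r 1F)) (degD-off (rE 0F) (λ ()) (λ ()) deg-A) deg-B (deg-r 0F)
    (sym (ℕ.+-identityʳ _)) mv d-inj e′-inj e′≢e₀
    (differ-isolated (rv 0F) λ { w (inj₁ d) → leaf-isolatedʳ d ; w (inj₂ s) → off (λ ()) (λ ()) s })

common-leaf : ∀ {m q} → Adversary m (2 + m) q 2
common-leaf = from-moves (λ { 0F → reverse }) (λ { 0F 0F _ → refl }) (λ { 0F 0F _ → refl }) (λ { 0F () })
  where open CommonLeaf

-- On a path of three vertices the common leaf and the middle vertex are interchangeable.
module CommonLeaf₁ {m : ℕ} where

  open CommonLeaf {suc m} {1}

  exchange : Move
  exchange = record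
    { d = pE 0 z≤n ; e′ = rE 2F ; d≢e₀ = λ ()
    ; σ = σ ; σ⁻ = σ⁻ ; σσ⁻ = σσ⁻ ; σ⁻σ = σ⁻σ ; π = π ; π⁻ = π⁻ ; ππ⁻ = ππ⁻ ; π⁻π = π⁻π ; πd = refl
    ; old = old ; fresh = inj₂ (refl , refl)
    ; deg-α = degD-off (rE 2F) (λ ()) (λ ()) deg-A ; deg-β = degD-off (rE 2F) (λ ()) (λ ()) (deg-r 0F)
    ; deg-s = deg-B ; deg-t = deg-r 2F ; sums = trans (ℕ.+-comm (2 + m) 1) (sym (ℕ.+-identityʳ _)) }
    where
    σ σ⁻ : V (suc m) (3 + m) 1 → V (suc m) (3 + m) 1
    σ (rv 0F) = (rv 2F)
    σ (rv 2F) = (rv 1F)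
    σ (rv 1F) = (pv 1 (s≤s z≤n))
    σ (pv 1 _) = (rv 0F)
    σ v = v
    σ⁻ (rv 0F) = (pv 1 (s≤s z≤n))
    σ⁻ (rv 2F) = (rv 0F)
    σ⁻ (rv 1F) = (rv 2F)
    σ⁻ (pv 1 _) = (rv 1F)
    σ⁻ v = v
    σσ⁻ : ∀ v → σ (σ⁻ v) ≡ v
    σσ⁻ (pv 0 _) = refl
    σσ⁻ (pv 1 _) = refl
    σσ⁻ (pv 2 _) = refl
    σσ⁻ (pv (suc (suc (suc _))) _) = refl
    σσ⁻ (lv _) = refl
    σσ⁻ (rv 0F) = refl
    σσ⁻ (rv 1F) = refl
    σσ⁻ (rv 2F) = refl
    σσ⁻ (rv (Fin.suc (Fin.suc (Fin.suc _)))) = refl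
    σ⁻σ : ∀ v → σ⁻ (σ v) ≡ v
    σ⁻σ (pv 0 _) = refl
    σ⁻σ (pv 1 _) = refl
    σ⁻σ (pv 2 _) = refl
    σ⁻σ (pv (suc (suc (suc _))) _) = refl
    σ⁻σ (lv _) = refl
    σ⁻σ (rv 0F) = refl
    σ⁻σ (rv 1F) = refl
    σ⁻σ (rv 2F) = refl
    σ⁻σ (rv (Fin.suc (Fin.suc (Fin.suc _)))) = refl
    π π⁻ : GEdge (suc m) (3 + m) 1 → GEdge (suc m) (3 + m) 1
    π (rE 0F) = (pE 0 z≤n)
    π (pE 0 _) = (rE 2F)
    π (rE 2F) = (rE 1F)
    π (rE 1F) = (pE 1 (s≤s z≤n))
    π (pE 1 _) = (rE 0F)
    π v = v
    π⁻ (rE 0F) = (pE 1 (s≤s z≤n))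
    π⁻ (pE 0 _) = (rE 0F)
    π⁻ (rE 2F) = (pE 0 z≤n)
    π⁻ (rE 1F) = (rE 2F)
    π⁻ (pE 1 _) = (rE 1F)
    π⁻ v = v
    ππ⁻ : ∀ v → π (π⁻ v) ≡ v
    ππ⁻ (pE 0 _) = refl
    ππ⁻ (pE 1 _) = refl
    ππ⁻ (pE (suc (suc _)) _) = refl
    ππ⁻ (lE _) = refl
    ππ⁻ (rE 0F) = refl
    ππ⁻ (rE 1F) = refl
    ππ⁻ (rE 2F) = refl
    ππ⁻ (rE (Fin.suc (Fin.suc (Fin.suc _)))) = refl
    π⁻π : ∀ v → π⁻ (π v) ≡ v
    π⁻π (pE 0 _) = refl
    π⁻π (pE 1 _) = refl
    π⁻π (pE (suc (suc _)) _) = refl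
    π⁻π (lE _) = refl
    π⁻π (rE 0F) = refl
    π⁻π (rE 1F) = refl
    π⁻π (rE 2F) = refl
    π⁻π (rE (Fin.suc (Fin.suc (Fin.suc _)))) = refl
    old : ∀ g → g ≢ (rE 0F) → g ≢ (pE 0 z≤n) → Same (src (π g)) (tgt (π g)) (σ (src g)) (σ (tgt g))
    old (pE 0 _) _ ne = ⊥-elim (ne refl)
    old (pE 1 _) _ _ = inj₂ (refl , refl)
    old (pE (suc (suc _)) _) _ _ = inj₁ (refl , refl)
    old (lE _) _ _ = inj₁ (refl , refl)
    old (rE 0F) ne _ = ⊥-elim (ne refl)
    old (rE 1F) _ _ = inj₂ (refl , refl)
    old (rE 2F) _ _ = inj₁ (refl , refl)
    old (rE (Fin.suc (Fin.suc (Fin.suc _)))) _ _ = inj₁ (refl , refl)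

  common-leaf₃ : Adversary (suc m) (3 + m) 1 3
  common-leaf₃ = from-moves (λ { 0F → reverse ; 1F → exchange })
    (λ { 0F 0F _ → refl ; 0F 1F () ; 1F 0F () ; 1F 1F _ → refl }) (λ { 0F 0F _ → refl ; 0F 1F () ; 1F 0F () ; 1F 1F _ → refl }) (λ { 0F () ; 1F () })

open CommonLeaf₁ using (common-leaf₃)

module CommonLeaf₂ {m : ℕ} where

  open CommonLeaf {2 + m} {1}

  -- The four edges of the cycle `A`, `pv 1`, `B`, `rv 1F` are equivalent, and each is charged to a
  -- right leaf edge of its own. This takes four right leaves, so it is available for at least two
  -- left leaves only; with one left leaf `common-leaf₃` stops at three.
  flipped : Move
  flipped = record
    { d = pE 1 (s≤s z≤n) ; e′ = rE 3F ; d≢e₀ = λ ()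
    ; σ = σ ; σ⁻ = σ⁻ ; σσ⁻ = σσ⁻ ; σ⁻σ = σ⁻σ ; π = π ; π⁻ = π⁻ ; ππ⁻ = ππ⁻ ; π⁻π = π⁻π ; πd = refl
    ; old = old ; fresh = inj₁ (refl , refl)
    ; deg-α = degD-off (rE 3F) (λ ()) (λ ()) (deg-r 1F) ; deg-β = degD-off (rE 3F) (λ ()) (λ ()) deg-A
    ; deg-s = deg-B ; deg-t = deg-r 3F ; sums = sym (ℕ.+-identityʳ _) }
    where
    σ σ⁻ : V (2 + m) (4 + m) 1 → V (2 + m) (4 + m) 1
    σ (pv 0 _) = (pv 2 (s≤s (s≤s z≤n)))
    σ (pv 2 _) = (pv 0 z≤n)
    σ (rv 1F) = (pv 1 (s≤s z≤n))
    σ (pv 1 _) = (rv 1F)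
    σ (rv 0F) = (rv 3F)
    σ (lv 0F) = (rv 0F)
    σ (lv 1F) = (rv 2F)
    σ (lv (Fin.suc (Fin.suc a))) = (rv (Fin.suc (Fin.suc (Fin.suc (Fin.suc a)))))
    σ (rv 2F) = (lv 0F)
    σ (rv 3F) = (lv 1F)
    σ (rv (Fin.suc (Fin.suc (Fin.suc (Fin.suc a))))) = (lv (Fin.suc (Fin.suc a)))
    σ v = v
    σ⁻ (pv 0 _) = (pv 2 (s≤s (s≤s z≤n)))
    σ⁻ (pv 2 _) = (pv 0 z≤n)
    σ⁻ (rv 1F) = (pv 1 (s≤s z≤n))
    σ⁻ (pv 1 _) = (rv 1F)
    σ⁻ (rv 0F) = (lv 0F)
    σ⁻ (lv 0F) = (rv 2F)
    σ⁻ (lv 1F) = (rv 3F)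
    σ⁻ (lv (Fin.suc (Fin.suc a))) = (rv (Fin.suc (Fin.suc (Fin.suc (Fin.suc a)))))
    σ⁻ (rv 2F) = (lv 1F)
    σ⁻ (rv 3F) = (rv 0F)
    σ⁻ (rv (Fin.suc (Fin.suc (Fin.suc (Fin.suc a))))) = (lv (Fin.suc (Fin.suc a)))
    σ⁻ v = v
    σσ⁻ : ∀ v → σ (σ⁻ v) ≡ v
    σσ⁻ (pv 0 _) = refl
    σσ⁻ (pv 1 _) = refl
    σσ⁻ (pv 2 _) = refl
    σσ⁻ (pv (suc (suc (suc _))) _) = refl
    σσ⁻ (lv 0F) = refl
    σσ⁻ (lv 1F) = refl
    σσ⁻ (lv (Fin.suc (Fin.suc a))) = refl
    σσ⁻ (rv 0F) = refl
    σσ⁻ (rv 1F) = refl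
    σσ⁻ (rv 2F) = refl
    σσ⁻ (rv 3F) = refl
    σσ⁻ (rv (Fin.suc (Fin.suc (Fin.suc (Fin.suc a))))) = refl
    σ⁻σ : ∀ v → σ⁻ (σ v) ≡ v
    σ⁻σ (pv 0 _) = refl
    σ⁻σ (pv 1 _) = refl
    σ⁻σ (pv 2 _) = refl
    σ⁻σ (pv (suc (suc (suc _))) _) = refl
    σ⁻σ (lv 0F) = refl
    σ⁻σ (lv 1F) = refl
    σ⁻σ (lv (Fin.suc (Fin.suc a))) = refl
    σ⁻σ (rv 0F) = refl
    σ⁻σ (rv 1F) = refl
    σ⁻σ (rv 2F) = refl
    σ⁻σ (rv 3F) = refl
    σ⁻σ (rv (Fin.suc (Fin.suc (Fin.suc (Fin.suc a))))) = refl
    π π⁻ : GEdge (2 + m) (4 + m) 1 → GEdge (2 + m) (4 + m) 1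
    π (rE 0F) = (pE 1 (s≤s z≤n))
    π (rE 1F) = (pE 0 z≤n)
    π (pE 0 _) = (rE 1F)
    π (pE 1 _) = (rE 3F)
    π (lE 0F) = (rE 0F)
    π (lE 1F) = (rE 2F)
    π (lE (Fin.suc (Fin.suc a))) = (rE (Fin.suc (Fin.suc (Fin.suc (Fin.suc a)))))
    π (rE 2F) = (lE 0F)
    π (rE 3F) = (lE 1F)
    π (rE (Fin.suc (Fin.suc (Fin.suc (Fin.suc a))))) = (lE (Fin.suc (Fin.suc a)))
    π v = v
    π⁻ (rE 0F) = (lE 0F)
    π⁻ (rE 1F) = (pE 0 z≤n)
    π⁻ (pE 0 _) = (rE 1F)
    π⁻ (pE 1 _) = (rE 0F)
    π⁻ (lE 0F) = (rE 2F)
    π⁻ (lE 1F) = (rE 3F)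
    π⁻ (lE (Fin.suc (Fin.suc a))) = (rE (Fin.suc (Fin.suc (Fin.suc (Fin.suc a)))))
    π⁻ (rE 2F) = (lE 1F)
    π⁻ (rE 3F) = (pE 1 (s≤s z≤n))
    π⁻ (rE (Fin.suc (Fin.suc (Fin.suc (Fin.suc a))))) = (lE (Fin.suc (Fin.suc a)))
    π⁻ v = v
    ππ⁻ : ∀ v → π (π⁻ v) ≡ v
    ππ⁻ (pE 0 _) = refl
    ππ⁻ (pE 1 _) = refl
    ππ⁻ (pE (suc (suc _)) _) = refl
    ππ⁻ (lE 0F) = refl
    ππ⁻ (lE 1F) = refl
    ππ⁻ (lE (Fin.suc (Fin.suc a))) = refl
    ππ⁻ (rE 0F) = refl
    ππ⁻ (rE 1F) = refl
    ππ⁻ (rE 2F) = refl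
    ππ⁻ (rE 3F) = refl
    ππ⁻ (rE (Fin.suc (Fin.suc (Fin.suc (Fin.suc a))))) = refl
    π⁻π : ∀ v → π⁻ (π v) ≡ v
    π⁻π (pE 0 _) = refl
    π⁻π (pE 1 _) = refl
    π⁻π (pE (suc (suc _)) _) = refl
    π⁻π (lE 0F) = refl
    π⁻π (lE 1F) = refl
    π⁻π (lE (Fin.suc (Fin.suc a))) = refl
    π⁻π (rE 0F) = refl
    π⁻π (rE 1F) = refl
    π⁻π (rE 2F) = refl
    π⁻π (rE 3F) = refl
    π⁻π (rE (Fin.suc (Fin.suc (Fin.suc (Fin.suc a))))) = refl
    old : ∀ g → g ≢ (rE 0F) → g ≢ (pE 1 (s≤s z≤n)) → Same (src (π g)) (tgt (π g)) (σ (src g)) (σ (tgt g))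
    old (pE 0 _) _ _ = inj₁ (refl , refl)
    old (pE 1 _) _ ne = ⊥-elim (ne refl)
    old (pE (suc (suc i)) h) _ _ = ⊥-elim (ℕ.<⇒≱ (s≤s (s≤s z≤n)) (recompute ((2 + i) ℕ.≤? 1) h))
    old (lE 0F) _ _ = inj₁ (refl , refl)
    old (lE 1F) _ _ = inj₁ (refl , refl)
    old (lE (Fin.suc (Fin.suc a))) _ _ = inj₁ (refl , refl)
    old (rE 0F) ne _ = ⊥-elim (ne refl)
    old (rE 1F) _ _ = inj₁ (refl , refl)
    old (rE 2F) _ _ = inj₁ (refl , refl)
    old (rE 3F) _ _ = inj₁ (refl , refl)
    old (rE (Fin.suc (Fin.suc (Fin.suc (Fin.suc a))))) _ _ = inj₁ (refl , refl)

  common-leaf₄ : Adversary (2 + m) (4 + m) 1 4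
  common-leaf₄ = from-moves (λ { 0F → reverse ; 1F → CommonLeaf₁.exchange ; 2F → flipped })
    (λ { 0F 0F _ → refl ; 1F 1F _ → refl ; 2F 2F _ → refl ; 0F 1F () ; 0F 2F () ; 1F 0F () ; 1F 2F () ; 2F 0F () ; 2F 1F () })
    (λ { 0F 0F _ → refl ; 1F 1F _ → refl ; 2F 2F _ → refl ; 0F 1F () ; 0F 2F () ; 1F 0F () ; 1F 2F () ; 2F 0F () ; 2F 1F () })
    (λ { 0F () ; 1F () ; 2F () })

open CommonLeaf₂ using (common-leaf₄)

ρ-same : ∀ {m n q} (g : GEdge m n q) {u v} → Same (src g) (tgt g) u v → Same (src (ρᴱ g)) (tgt (ρᴱ g)) (ρ u) (ρ v)
ρ-same g s = link⇒same (ρ-link (same⇒link {e = g} s))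

ρ-degrees : ∀ {m n q} (g : GEdge m n q) {s t} → Deg G (src g) (suc s) → Deg G (tgt g) (suc t) →
            ∃ λ s′ → ∃ λ t′ → Deg G (src (ρᴱ g)) (suc s′) × Deg G (tgt (ρᴱ g)) (suc t′) × s + t ≡ s′ + t′
ρ-degrees g {s} {t} ds dt with link⇒same (ρ-link (link g))
... | inj₁ (p , r) = s , t , deg-resp G p (deg-iso ρ-iso ds) , deg-resp G r (deg-iso ρ-iso dt) , refl
... | inj₂ (p , r) = t , s , deg-resp G r (deg-iso ρ-iso dt) , deg-resp G p (deg-iso ρ-iso ds) , ℕ.+-comm s t

module _ {m n q : ℕ} {e₀ : GEdge m n q} {x y : V m n q} where

  -- Conjugation by the reflection; it lets the graph on the broom `2 1 q` reuse the moves found on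
  -- `1 2 q`.
  move-reflect : Rewire.Move e₀ x y → Rewire.Move (ρᴱ e₀) (ρ x) (ρ y)
  move-reflect mv = record
    { d = ρᴱ d ; e′ = ρᴱ e′ ; d≢e₀ = λ p → d≢e₀ (trans (sym (ρᴱ-invol _)) (trans (cong ρᴱ p) (ρᴱ-invol _)))
    ; σ = ρ ∘ σ ∘ ρ ; σ⁻ = ρ ∘ σ⁻ ∘ ρ ; σσ⁻ = cancel σ σ⁻ σσ⁻ ; σ⁻σ = cancel σ⁻ σ σ⁻σ
    ; π = ρᴱ ∘ π ∘ ρᴱ ; π⁻ = ρᴱ ∘ π⁻ ∘ ρᴱ ; ππ⁻ = cancelᴱ π π⁻ ππ⁻ ; π⁻π = cancelᴱ π⁻ π π⁻π
    ; πd = trans (cong (ρᴱ ∘ π) (ρᴱ-invol d)) (cong ρᴱ πd)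
    ; old = λ g ne ne′ → old′ g (ρᴱ g) refl (λ p → ne (trans (sym (ρᴱ-invol g)) (cong ρᴱ p))) (λ p → ne′ (trans (sym (ρᴱ-invol g)) (cong ρᴱ p)))
    ; fresh = subst₂ (λ u v → Same (src (ρᴱ (π (ρᴱ (ρᴱ e₀))))) (tgt (ρᴱ (π (ρᴱ (ρᴱ e₀))))) (ρ (σ u)) (ρ (σ v))) (sym (ρ-invol x)) (sym (ρ-invol y))
        (subst (λ g → Same (src (ρᴱ (π g))) (tgt (ρᴱ (π g))) (ρ (σ x)) (ρ (σ y))) (sym (ρᴱ-invol e₀)) (ρ-same (π e₀) fresh))
    ; deg-α = proj₁ (proj₂ (proj₂ αβ)) ; deg-β = proj₁ (proj₂ (proj₂ (proj₂ αβ)))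
    ; deg-s = proj₁ (proj₂ (proj₂ st)) ; deg-t = proj₁ (proj₂ (proj₂ (proj₂ st)))
    ; sums = trans (sym (proj₂ (proj₂ (proj₂ (proj₂ αβ))))) (trans sums (proj₂ (proj₂ (proj₂ (proj₂ st))))) }
    where
    open Rewire.Move mv
    cancel : ∀ (f g : V m n q → V m n q) → (∀ v → f (g v) ≡ v) → ∀ v → ρ (f (ρ (ρ (g (ρ v))))) ≡ v
    cancel f g h v = trans (cong (ρ ∘ f) (ρ-invol _)) (trans (cong ρ (h _)) (ρ-invol v))
    cancelᴱ : ∀ (f g : GEdge m n q → GEdge m n q) → (∀ v → f (g v) ≡ v) → ∀ v → ρᴱ (f (ρᴱ (ρᴱ (g (ρᴱ v))))) ≡ v
    cancelᴱ f g h v = trans (cong (ρᴱ ∘ f) (ρᴱ-invol _)) (trans (cong ρᴱ (h _)) (ρᴱ-invol v))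
    map-ends : ∀ {u v u′ v′ : V m n q} {a b : V n m q} (f : V m n q → V m n q) → Same u v (ρ a) (ρ b) → Same (ρ (f u)) (ρ (f v)) (ρ (f (ρ a))) (ρ (f (ρ b)))
    map-ends f (inj₁ (p , r)) = inj₁ (cong (ρ ∘ f) p , cong (ρ ∘ f) r)
    map-ends f (inj₂ (p , r)) = inj₂ (cong (ρ ∘ f) p , cong (ρ ∘ f) r)
    old′ : ∀ g g′ → ρᴱ g ≡ g′ → g′ ≢ e₀ → g′ ≢ d → Same (src (ρᴱ (π g′))) (tgt (ρᴱ (π g′))) (ρ (σ (ρ (src g)))) (ρ (σ (ρ (tgt g))))
    old′ g _ refl ne ne′ = same-trans (ρ-same (π (ρᴱ g)) (old (ρᴱ g) ne ne′))
      (map-ends {src (ρᴱ g)} {tgt (ρᴱ g)} {A} {A} {src g} {tgt g} σ (link⇒same (ρ-link (link g))))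
    αβ : ∃ λ α′ → ∃ λ β′ → Deg (D (ρᴱ e′)) (ρ (σ (ρ (src (ρᴱ d))))) α′ × Deg (D (ρᴱ e′)) (ρ (σ (ρ (tgt (ρᴱ d))))) β′ × α + β ≡ α′ + β′
    αβ with subst₂ (λ u v → Same (src d) (tgt d) u v) refl refl (subst (λ g → Same (src g) (tgt g) (ρ (src (ρᴱ d))) (ρ (tgt (ρᴱ d)))) (ρᴱ-invol d) (link⇒same (ρ-link (link (ρᴱ d)))))
    ... | inj₁ (p , r) = α , β , deg-iso (ρ-D e′) (deg-resp (D e′) (cong σ (sym p)) deg-α) , deg-iso (ρ-D e′) (deg-resp (D e′) (cong σ (sym r)) deg-β) , refl
    ... | inj₂ (p , r) = β , α , deg-iso (ρ-D e′) (deg-resp (D e′) (cong σ (sym p)) deg-β) , deg-iso (ρ-D e′) (deg-resp (D e′) (cong σ (sym r)) deg-α) , ℕ.+-comm α β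
    st = ρ-degrees e′ deg-s deg-t

-- A and B joined through a leaf of B, in place of the first path edge.
module Bypass {m r : ℕ} where

  private
    q = 2 + r
    e₀ : GEdge m (suc m) q
    e₀ = pE 0 z≤n

  open Rewire {m} {suc m} {q} e₀ A (rv 0F) public
  open Rewired (λ ()) (λ ()) public

  -- Cutting `rv 0F` from `B` leaves a star at `A` with `suc m` leaves and a component in which `B`
  -- has `m` leaves and the long path. As there are `suc m` right leaves, this is the mirror image
  -- of the broom without its last path edge.
  reverse : Move
  reverse = record
    { d = rE 0F ; e′ = pE q ℕ.≤-refl ; d≢e₀ = λ ()
    ; σ = σ ; σ⁻ = σ ; σσ⁻ = σσ ; σ⁻σ = σσ ; π = π ; π⁻ = π⁻ ; ππ⁻ = ππ⁻ ; π⁻π = π⁻π ; πd = refl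
    ; old = old ; fresh = inj₁ (refl , refl)
    ; deg-α = deg-resp (D _) (sym σB) (degD-off (pE q ℕ.≤-refl) (λ ()) (λ ()) deg-A) ; deg-β = degD-off (pE q ℕ.≤-refl) (λ ()) (λ ()) (deg-r 0F)
    ; deg-s = deg-int ℕ.≤-refl ; deg-t = deg-B ; sums = ℕ.+-comm (suc m) 1 }
    where
    σ : V m (suc m) q → V m (suc m) q
    σ (pv i _) = pv (suc q ∸ i) (ℕ.m∸n≤m (suc q) i)
    σ (lv a) = rv (Fin.suc a)
    σ (rv 0F) = rv 0F
    σ (rv (Fin.suc a)) = lv a
    σσ : ∀ v → σ (σ v) ≡ v
    σσ (pv i h) = pv-cong (ℕ.m∸[m∸n]≡n (recompute (i ℕ.≤? suc q) h))
    σσ (lv a) = refl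
    σσ (rv 0F) = refl
    σσ (rv (Fin.suc a)) = refl
    σB : σ B ≡ A
    σB = pv-cong (ℕ.n∸n≡0 q)
    π π⁻ : GEdge m (suc m) q → GEdge m (suc m) q
    π (pE zero _) = rE 0F
    π (pE (suc i) _) = pE (q ∸ suc i) (ℕ.m∸n≤m q (suc i))
    π (lE a) = rE (Fin.suc a)
    π (rE 0F) = pE q ℕ.≤-refl
    π (rE (Fin.suc a)) = lE a
    lower : (k : ℕ) → .(k ≤ q) → GEdge m (suc m) q
    lower zero _ = rE 0F
    lower (suc k) h = pE (suc k) h
    π⁻ (pE i _) = lower (q ∸ i) (ℕ.m∸n≤m q i)
    π⁻ (lE a) = rE (Fin.suc a)
    π⁻ (rE 0F) = pE 0 z≤n
    π⁻ (rE (Fin.suc a)) = lE a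
    π-lower : ∀ k .(h : k ≤ q) → π (lower k h) ≡ pE (q ∸ k) (ℕ.m∸n≤m q k)
    π-lower zero _ = refl
    π-lower (suc k) _ = refl
    lower-cong : ∀ {k l} .{h : k ≤ q} .{h′ : l ≤ q} → k ≡ l → lower k h ≡ lower l h′
    lower-cong refl = refl
    ππ⁻ : ∀ g → π (π⁻ g) ≡ g
    ππ⁻ (pE i h) = trans (π-lower (q ∸ i) (ℕ.m∸n≤m q i)) (pE-cong (ℕ.m∸[m∸n]≡n (recompute (i ℕ.≤? q) h)))
    ππ⁻ (lE a) = refl
    ππ⁻ (rE 0F) = refl
    ππ⁻ (rE (Fin.suc a)) = refl
    π⁻π : ∀ g → π⁻ (π g) ≡ g
    π⁻π (pE zero _) = refl
    π⁻π (pE (suc i) h) = lower-cong {h = ℕ.m∸n≤m q (q ∸ suc i)} {h′ = h} (ℕ.m∸[m∸n]≡n (recompute (suc i ℕ.≤? q) h))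
    π⁻π (lE a) = refl
    π⁻π (rE 0F) = lower-cong {h = ℕ.m∸n≤m q q} {h′ = z≤n} (ℕ.n∸n≡0 q)
    π⁻π (rE (Fin.suc a)) = refl
    old : ∀ g → g ≢ e₀ → g ≢ rE 0F → Same (src (π g)) (tgt (π g)) (σ (src g)) (σ (tgt g))
    old (pE zero _) ne _ = ⊥-elim (ne refl)
    old (pE (suc i) h) _ _ = reverse-edge {m} {suc m} (suc i) h
    old (lE _) _ _ = inj₁ (refl , refl)
    old (rE 0F) _ ne = ⊥-elim (ne refl)
    old (rE (Fin.suc _)) _ _ = inj₁ (σB , refl)

bypass-move : ∀ {m r k} → let open Bypass {suc m} {r} in (mv : Fin k → Move) → (∀ i j → Move.d (mv i) ≡ Move.d (mv j) → i ≡ j) →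
              (∀ i j → Move.e′ (mv i) ≡ Move.e′ (mv j) → i ≡ j) → (∀ i → Move.e′ (mv i) ≢ pE 0 z≤n) → Adversary (suc m) (2 + m) (2 + r) (suc k)
bypass-move {m} {r} mv d-inj e′-inj e′≢e₀ = adversary (degD-src (pE 0 z≤n) deg-A) (degD-off (pE 0 z≤n) (λ ()) (λ ()) (deg-r 0F)) deg-A (deg-int (s≤s z≤n)) refl
  mv d-inj e′-inj e′≢e₀
  (differ-bushy {v = B} {w₁ = pv (2 + r) (ℕ.n≤1+n _)} {w₃ = rv 1F} {z₁ = pv (1 + r) (ℕ.≤-trans (ℕ.n≤1+n _) (ℕ.n≤1+n _))} {z₂ = A}
    (inj₁ (D-link {e′ = pE (2 + r) ℕ.≤-refl} (λ ()) p←)) (inj₁ (D-link {e′ = rE 0F} (λ ()) r→)) (inj₁ (D-link {e′ = rE 1F} (λ ()) r→)) (λ ()) (λ ()) (λ ())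
    (inj₁ (D-link {e′ = pE (1 + r) (ℕ.n≤1+n _)} (λ ()) p←)) (λ p → ℕ.<⇒≢ (s≤s (s≤s (ℕ.n≤1+n r))) (pv-inj p)) (inj₂ (inj₂ (refl , refl))) (λ ()))
  where open Bypass {suc m} {r}

bypass : ∀ {m r} → Adversary (suc m) (2 + m) (2 + r) 2
bypass = bypass-move (λ { 0F → reverse }) (λ { 0F 0F _ → refl }) (λ { 0F 0F _ → refl }) (λ { 0F () })
  where open Bypass

module Bypass₁ {r : ℕ} where

  private
    q = 2 + r
    v₁ : V 1 2 q
    v₁ = pv 1 (s≤s z≤n)
    e₁ : GEdge 1 2 q
    e₁ = pE 1 (s≤s z≤n)

  open Bypass {1} {r}

  -- With rv 1 removed the graph is a path, which is reversed beyond A.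
  rotate : Move
  rotate = record
    { d = rE 1F ; e′ = rE 1F ; d≢e₀ = λ ()
    ; σ = σ ; σ⁻ = σ ; σσ⁻ = σσ ; σ⁻σ = σσ ; π = π ; π⁻ = π ; ππ⁻ = ππ ; π⁻π = ππ ; πd = refl
    ; old = old ; fresh = inj₁ (refl , refl)
    ; deg-α = deg-resp (D _) (sym σB) (degD-off (rE 1F) (λ ()) (λ ()) (deg-int (s≤s (s≤s z≤n)))) ; deg-β = degD-tgt (rE 1F) (deg-r 1F)
    ; deg-s = deg-B ; deg-t = deg-r 1F ; sums = refl }
    where
    σ : V 1 2 q → V 1 2 q
    σ (pv 1 _) = rv 0F
    σ (pv (suc (suc i)) _) = pv (2 + (suc r ∸ i)) (s≤s (s≤s (ℕ.m∸n≤m (suc r) i)))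
    σ (rv 0F) = v₁
    σ v = v
    σσ : ∀ v → σ (σ v) ≡ v
    σσ (pv 0 _) = refl
    σσ (pv 1 _) = refl
    σσ (pv (suc (suc i)) h) = pv-cong (cong (2 +_) (ℕ.m∸[m∸n]≡n (ℕ.≤-pred (ℕ.≤-pred (recompute (2 + i ℕ.≤? suc q) h)))))
    σσ (lv 0F) = refl
    σσ (rv 0F) = refl
    σσ (rv 1F) = refl
    σB : σ B ≡ pv 2 (s≤s (s≤s z≤n))
    σB = pv-cong (cong (2 +_) (ℕ.n∸n≡0 r))
    π : GEdge 1 2 q → GEdge 1 2 q
    π (pE 1 _) = rE 0F
    π (pE (suc (suc i)) _) = pE (2 + (r ∸ i)) (s≤s (s≤s (ℕ.m∸n≤m r i)))
    π (rE 0F) = e₁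
    π g = g
    ππ : ∀ g → π (π g) ≡ g
    ππ (pE 0 _) = refl
    ππ (pE 1 _) = refl
    ππ (pE (suc (suc i)) h) = pE-cong (cong (2 +_) (ℕ.m∸[m∸n]≡n (ℕ.≤-pred (ℕ.≤-pred (recompute (2 + i ℕ.≤? q) h)))))
    ππ (lE 0F) = refl
    ππ (rE 0F) = refl
    ππ (rE 1F) = refl
    old : ∀ g → g ≢ pE 0 z≤n → g ≢ rE 1F → Same (src (π g)) (tgt (π g)) (σ (src g)) (σ (tgt g))
    old (pE 0 _) ne _ = ⊥-elim (ne refl)
    old (pE 1 _) _ _ = inj₂ (refl , refl)
    old (pE (suc (suc i)) h) _ _ = inj₂ (pv-cong (cong (2 +_) (ℕ.+-∸-assoc 1 (ℕ.≤-pred (ℕ.≤-pred (recompute (2 + i ℕ.≤? q) h))))) , refl)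
    old (lE 0F) _ _ = inj₁ (refl , refl)
    old (rE 0F) _ _ = inj₂ (σB , refl)
    old (rE 1F) _ ne = ⊥-elim (ne refl)

  bypass₃ : Adversary 1 2 (2 + r) 3
  bypass₃ = bypass-move (λ { 0F → reverse ; 1F → rotate })
    (λ { 0F 0F _ → refl ; 0F 1F () ; 1F 0F () ; 1F 1F _ → refl }) (λ { 0F 0F _ → refl ; 0F 1F () ; 1F 0F () ; 1F 1F _ → refl }) (λ { 0F () ; 1F () })

open Bypass₁ using (bypass₃)

-- The position of a path vertex relative to B = pv (suc t).
data Position (t : ℕ) : ℕ → Set where
  under : ∀ {i} → i < t → Position t i
  exact : Position t t
  over  : Position t (suc t)

position : ∀ t {i} → .(i ≤ suc t) → Position t i
position t {i} h with ℕ.<-cmp i t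
... | tri< lt _ _ = under lt
... | tri≈ _ refl _ = exact
... | tri> _ _ gt with ℕ.≤-antisym gt (recompute (i ℕ.≤? suc t) h)
...   | refl = over

position-under : ∀ {t i} .{h : i ≤ suc t} (lt : i < t) → position t h ≡ under lt
position-under {t} {h = h} lt with position t h
... | under lt′ = cong under (ℕ.<-irrelevant lt′ lt)
... | exact = ⊥-elim (ℕ.<-irrefl refl lt)
... | over = ⊥-elim (ℕ.<⇒≱ lt (ℕ.n≤1+n _))

position-exact : ∀ {t} .{h : t ≤ suc t} → position t h ≡ exact
position-exact {t} {h} with position t h
... | under lt = ⊥-elim (ℕ.<-irrefl refl lt)
... | exact = refl

position-over : ∀ {t} .{h : suc t ≤ suc t} → position t h ≡ over
position-over {t} {h} with position t h
... | under lt = ⊥-elim (ℕ.<⇒≱ lt (ℕ.n≤1+n _))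
... | over = refl

-- The broom is a path; all but its first two vertices are closed up to a cycle.
module PathCycle {r : ℕ} where

  private
    q = suc r
    e₀ : GEdge 1 1 q
    e₀ = pE 0 z≤n

  open Rewire {1} {1} {q} e₀ (pv 1 (s≤s z≤n)) (rv 0F)
  open Rewired (λ ()) (λ ())

  rotate : Move
  rotate = record
    { d = rE 0F ; e′ = pE q ℕ.≤-refl ; d≢e₀ = λ ()
    ; σ = σ ; σ⁻ = σ⁻ ; σσ⁻ = σσ⁻ ; σ⁻σ = σ⁻σ ; π = π ; π⁻ = π⁻ ; ππ⁻ = ππ⁻ ; π⁻π = π⁻π ; πd = refl
    ; old = old ; fresh = inj₁ (refl , refl)
    ; deg-α = degD-src (pE q ℕ.≤-refl) (deg-int ℕ.≤-refl) ; deg-β = degD-off (pE q ℕ.≤-refl) (λ ()) (λ ()) (deg-l 0F)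
    ; deg-s = deg-int ℕ.≤-refl ; deg-t = deg-B ; sums = refl }
    where
    σ σ⁻ : V 1 1 q → V 1 1 q
    σ (pv zero _) = B
    σ (pv (suc i) h) = pv i (ℕ.<⇒≤ h)
    σ (lv a) = rv a
    σ (rv a) = lv a
    up : ∀ {i} → Position q i → V 1 1 q
    up (under {i} lt) = pv (suc i) (ℕ.m≤n⇒m≤1+n lt)
    up exact = B
    up over = A
    σ⁻ (pv i h) = up (position q h)
    σ⁻ (lv a) = rv a
    σ⁻ (rv a) = lv a
    σσ⁻ : ∀ v → σ (σ⁻ v) ≡ v
    σσ⁻ (pv i h) with position q h
    ... | under _ = refl
    ... | exact = refl
    ... | over = refl
    σσ⁻ (lv a) = refl
    σσ⁻ (rv a) = refl
    σ⁻σ : ∀ v → σ⁻ (σ v) ≡ v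
    σ⁻σ (pv zero _) = cong up (position-over {q} {ℕ.≤-refl})
    σ⁻σ (pv (suc i) h) with position q {i} (ℕ.<⇒≤ h)
    ... | under _ = refl
    ... | exact = refl
    ... | over = ⊥-elim (ℕ.1+n≰n (recompute (_ ℕ.≤? _) h))
    σ⁻σ (lv a) = refl
    σ⁻σ (rv a) = refl
    π π⁻ : GEdge 1 1 q → GEdge 1 1 q
    π (pE zero _) = lE 0F
    π (pE (suc i) h) = pE i (ℕ.<⇒≤ h)
    π (lE a) = rE a
    π (rE a) = pE q ℕ.≤-refl
    upᴱ : ∀ {i} → .(i ≤ q) → Position q i → GEdge 1 1 q
    upᴱ _ (under {i} lt) = pE (suc i) lt
    upᴱ _ exact = rE 0F
    upᴱ h over = rE 0F
    π⁻ (pE i h) = upᴱ h (position q (ℕ.m≤n⇒m≤1+n h))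
    π⁻ (lE a) = e₀
    π⁻ (rE a) = lE a
    ππ⁻ : ∀ g → π (π⁻ g) ≡ g
    ππ⁻ (pE i h) with position q {i} (ℕ.m≤n⇒m≤1+n h)
    ... | under _ = refl
    ... | exact = refl
    ... | over = ⊥-elim (ℕ.1+n≰n (recompute (_ ℕ.≤? _) h))
    ππ⁻ (lE 0F) = refl
    ππ⁻ (rE a) = refl
    π⁻π : ∀ g → π⁻ (π g) ≡ g
    π⁻π (pE zero _) = refl
    π⁻π (pE (suc i) h) = cong (upᴱ (ℕ.<⇒≤ h)) (position-under {h = ℕ.≤-trans (ℕ.<⇒≤ h) (ℕ.n≤1+n q)} (recompute (_ ℕ.≤? _) h))
    π⁻π (lE a) = refl
    π⁻π (rE 0F) = cong (upᴱ ℕ.≤-refl) (position-exact {q} {ℕ.n≤1+n q})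
    old : ∀ g → g ≢ e₀ → g ≢ rE 0F → Same (src (π g)) (tgt (π g)) (σ (src g)) (σ (tgt g))
    old (pE zero _) ne _ = ⊥-elim (ne refl)
    old (pE (suc _) _) _ _ = inj₁ (refl , refl)
    old (lE _) _ _ = inj₁ (refl , refl)
    old (rE 0F) _ ne = ⊥-elim (ne refl)

  path-cycle : Adversary 1 1 (suc r) 2
  path-cycle = adversary (degD-tgt e₀ (deg-int (s≤s z≤n))) (degD-off e₀ (λ ()) (λ ()) (deg-r 0F)) deg-A (deg-int (s≤s z≤n)) refl
    (λ { 0F → rotate }) (λ { 0F 0F _ → refl }) (λ { 0F 0F _ → refl }) (λ { 0F () }) (split-by-side {h = z≤n} refl)

open PathCycle using (path-cycle)

module LengthenLeaf {n r : ℕ} where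

  private
    q = 2 + r
    v₁ v₂ : V (2 + n) 1 q
    v₁ = pv 1 (s≤s z≤n)
    v₂ = pv 2 (s≤s (s≤s z≤n))
    e₁ e₂ : GEdge (2 + n) 1 q
    e₁ = pE 1 (s≤s z≤n)
    e₂ = pE 2 (s≤s (s≤s z≤n))
    open-2 = deg-pv {2 + n} {1} {q} 2 (s≤s (s≤s z≤n))

  open Rewire {2 + n} {1} {q} (rE 0F) (rv 0F) (lv 0F)
  open Rewired (λ ()) (λ ())

  -- After the cut the arm `lv 0F`, `rv 0F` takes the place of the first two inner path vertices and
  -- `pv 1` that of a leaf of `A`; the rest of the path moves up by one, its old end `B` becoming an
  -- inner vertex or the new hub's neighbour, so that the decard is that of `pE 2`.
  shift : Move
  shift = record
    { d = e₁ ; e′ = e₂ ; d≢e₀ = λ ()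
    ; σ = σ ; σ⁻ = σ⁻ ; σσ⁻ = σσ⁻ ; σ⁻σ = σ⁻σ ; π = π ; π⁻ = π⁻ ; ππ⁻ = ππ⁻ ; π⁻π = π⁻π ; πd = πd
    ; old = old ; fresh = inj₂ (refl , refl)
    ; deg-α = degD-off e₂ (λ ()) (λ ()) (deg-l 0F) ; deg-β = deg-resp (D e₂) (sym σ₂) (degD-tgt e₂ (proj₂ open-2))
    ; deg-s = deg-int (s≤s (s≤s z≤n)) ; deg-t = proj₂ open-2 ; sums = refl }
    where
    σ σ⁻ : V (2 + n) 1 q → V (2 + n) 1 q
    up : ∀ {i} → Position q i → V (2 + n) 1 q
    up (under {i} lt) = pv (suc i) (ℕ.m≤n⇒m≤1+n lt)
    up exact = B
    up over = rv 0F
    σ (pv 0 _) = A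
    σ (pv 1 _) = lv 0F
    σ (pv (suc (suc i)) h) = up (position q h)
    σ (lv 0F) = v₁
    σ (lv a) = lv a
    σ (rv 0F) = v₂
    σ⁻ (pv 0 _) = A
    σ⁻ (pv 1 _) = lv 0F
    σ⁻ (pv 2 _) = rv 0F
    σ⁻ (pv (suc (suc (suc i))) h) = pv (2 + i) (ℕ.<⇒≤ h)
    σ⁻ (lv 0F) = v₁
    σ⁻ (lv a) = lv a
    σ⁻ (rv 0F) = B
    σ₂ : σ v₂ ≡ pv 3 (s≤s (s≤s (s≤s z≤n)))
    σ₂ with position q {2} (s≤s (s≤s z≤n))
    ... | under _ = refl
    ... | exact = refl
    σσ⁻ : ∀ v → σ (σ⁻ v) ≡ v
    σσ⁻ (pv 0 _) = refl
    σσ⁻ (pv 1 _) = refl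
    σσ⁻ (pv 2 _) = refl
    σσ⁻ (pv (suc (suc (suc i))) h) with position q {2 + i} (ℕ.<⇒≤ h)
    ... | under _ = refl
    ... | exact = refl
    ... | over = ⊥-elim (ℕ.1+n≰n (recompute (_ ℕ.≤? _) h))
    σσ⁻ (lv 0F) = refl
    σσ⁻ (lv (Fin.suc _)) = refl
    σσ⁻ (rv 0F) = cong up (position-over {q} {ℕ.≤-refl})
    σ⁻σ : ∀ v → σ⁻ (σ v) ≡ v
    σ⁻σ (pv 0 _) = refl
    σ⁻σ (pv 1 _) = refl
    σ⁻σ (pv (suc (suc i)) h) with position q h
    ... | under _ = refl
    ... | exact = refl
    ... | over = refl
    σ⁻σ (lv 0F) = refl
    σ⁻σ (lv (Fin.suc _)) = refl
    σ⁻σ (rv 0F) = refl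
    π π⁻ : GEdge (2 + n) 1 q → GEdge (2 + n) 1 q
    upᴱ : ∀ {i} → Position q i → GEdge (2 + n) 1 q
    upᴱ (under {i} lt) = pE (suc i) lt
    upᴱ exact = rE 0F
    upᴱ over = rE 0F
    π (pE zero _) = lE 0F
    π (pE (suc i) h) = upᴱ (position q (ℕ.m≤n⇒m≤1+n h))
    π (lE 0F) = pE 0 z≤n
    π (lE a) = lE a
    π (rE 0F) = e₁
    π⁻ (pE 0 _) = lE 0F
    π⁻ (pE 1 _) = rE 0F
    π⁻ (pE (suc (suc i)) h) = pE (suc i) (ℕ.<⇒≤ h)
    π⁻ (lE 0F) = pE 0 z≤n
    π⁻ (lE a) = lE a
    π⁻ (rE 0F) = pE q ℕ.≤-refl
    πd : π e₁ ≡ e₂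
    πd = cong upᴱ (position-under {q} {1} {s≤s z≤n} (s≤s (s≤s z≤n)))
    ππ⁻ : ∀ g → π (π⁻ g) ≡ g
    ππ⁻ (pE 0 _) = refl
    ππ⁻ (pE 1 _) = refl
    ππ⁻ (pE (suc (suc i)) h) = cong upᴱ (position-under {h = ℕ.m≤n⇒m≤1+n (ℕ.<⇒≤ h)} (recompute (_ ℕ.≤? _) h))
    ππ⁻ (lE 0F) = refl
    ππ⁻ (lE (Fin.suc _)) = refl
    ππ⁻ (rE 0F) = cong upᴱ (position-exact {q} {ℕ.n≤1+n q})
    π⁻π : ∀ g → π⁻ (π g) ≡ g
    π⁻π (pE zero _) = refl
    π⁻π (pE (suc i) h) with position q {suc i} (ℕ.m≤n⇒m≤1+n h)
    ... | under _ = refl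
    ... | exact = refl
    ... | over = ⊥-elim (ℕ.1+n≰n (recompute (_ ℕ.≤? _) h))
    π⁻π (lE 0F) = refl
    π⁻π (lE (Fin.suc _)) = refl
    π⁻π (rE 0F) = refl
    old : ∀ g → g ≢ rE 0F → g ≢ e₁ → Same (src (π g)) (tgt (π g)) (σ (src g)) (σ (tgt g))
    old (pE 0 _) _ _ = inj₁ (refl , refl)
    old (pE 1 _) _ ne = ⊥-elim (ne refl)
    old (pE (suc (suc i)) h) _ _ with ℕ.m≤n⇒m<n∨m≡n (recompute (_ ℕ.≤? q) h)
    ... | inj₂ refl rewrite position-exact {q} {ℕ.n≤1+n q} | position-over {q} {ℕ.≤-refl} = inj₁ (refl , refl)
    ... | inj₁ lt rewrite position-under {h = ℕ.m≤n⇒m≤1+n h} lt = tail (position q {3 + i} (s≤s h))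
      where
      tail : (w : Position q (3 + i)) → Same (pv (3 + i) (ℕ.m≤n⇒m≤1+n lt)) (pv (4 + i) (s≤s lt)) (pv (3 + i) (ℕ.m≤n⇒m≤1+n lt)) (up w)
      tail (under _) = inj₁ (refl , refl)
      tail exact = inj₁ (refl , refl)
      tail over = ⊥-elim (ℕ.1+n≰n lt)
    old (lE 0F) _ _ = inj₁ (refl , refl)
    old (lE (Fin.suc _)) _ _ = inj₁ (refl , refl)
    old (rE 0F) ne _ = ⊥-elim (ne refl)

  lengthen-leaf : Adversary (2 + n) 1 (2 + r) 2
  lengthen-leaf = adversary (degD-tgt (rE 0F) (deg-r 0F)) (degD-off (rE 0F) (λ ()) (λ ()) (deg-l 0F)) deg-B (deg-r 0F) refl
    (λ { 0F → shift }) (λ { 0F 0F _ → refl }) (λ { 0F 0F _ → refl }) (λ { 0F () })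
    (differ-bushy {v = A} {w₁ = v₁} {w₂ = lv 0F} {w₃ = lv 1F} {z₁ = v₂} {z₂ = rv 0F} (inj₁ (D-link {e′ = pE 0 z≤n} (λ ()) p→)) (inj₁ (D-link {e′ = lE 0F} (λ ()) l→))
      (inj₁ (D-link {e′ = lE 1F} (λ ()) l→)) (λ ()) (λ ()) (λ ()) (inj₁ (D-link {e′ = e₁} (λ ()) p→)) (λ ()) (inj₂ (inj₂ (refl , refl))) (λ ()))

open LengthenLeaf using (lengthen-leaf)

-- A cycle through B, next to the star of A.
module StarCycle {m r : ℕ} where

  private
    q = 3 + r
    e₁ eₗ : GEdge (suc m) (suc m) q
    e₁ = pE 1 (s≤s z≤n)
    eₗ = pE (2 + r) (ℕ.n≤1+n _)
    v₁ v₂ vₗ : V (suc m) (suc m) q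
    v₁ = pv 1 (s≤s z≤n)
    v₂ = pv 2 (s≤s (s≤s z≤n))
    vₗ = pv q (ℕ.n≤1+n q)

  open Rewire {suc m} {suc m} {q} e₁ v₂ (rv 0F)
  open Rewired (λ ()) (λ ())

  -- The cycle is opened at its other edge one step away from `B`, and the equal leaf numbers let
  -- `A` and `B` trade places. The edge `eₗ` is the last but one of the path, so it differs from
  -- `e₁` only when the path has at least five vertices.
  exchange : Move
  exchange = record
    { d = eₗ ; e′ = eₗ ; d≢e₀ = λ ()
    ; σ = σ ; σ⁻ = σ ; σσ⁻ = σσ ; σ⁻σ = σσ ; π = π ; π⁻ = π ; ππ⁻ = ππ ; π⁻π = ππ ; πd = π-under (s≤s (s≤s (s≤s ℕ.≤-refl)))
    ; old = old ; fresh = inj₂ (σ-under (s≤s (s≤s (s≤s z≤n))) , refl)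
    ; deg-α = deg-resp (D eₗ) (sym (σ-under ℕ.≤-refl)) (degD-src eₗ (deg-int (ℕ.n≤1+n _)))
    ; deg-β = deg-resp (D eₗ) (sym σ-exact) (degD-off eₗ (λ ()) (λ ()) (deg-l 0F))
    ; deg-s = deg-int (ℕ.n≤1+n _) ; deg-t = deg-int ℕ.≤-refl ; sums = refl }
    where
    σ : V (suc m) (suc m) q → V (suc m) (suc m) q
    tip : ∀ {i} → Position q i → V (suc m) (suc m) q
    tip (under {i} lt) = pv i (ℕ.m≤n⇒m≤1+n (ℕ.<⇒≤ lt))
    tip exact = lv 0F
    tip over = A
    σ (pv 0 _) = B
    σ (pv 1 _) = rv 0F
    σ (pv (suc (suc i)) h) = tip (position q h)
    σ (lv 0F) = vₗ
    σ (lv (Fin.suc a)) = rv (Fin.suc a)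
    σ (rv 0F) = v₁
    σ (rv (Fin.suc a)) = lv (Fin.suc a)
    σ-under : ∀ {i} .{h} → 2 + i < q → σ (pv (2 + i) h) ≡ pv (2 + i) h
    σ-under {h = h} lt = cong tip (position-under {h = h} lt)
    σ-exact : σ vₗ ≡ lv 0F
    σ-exact = cong tip (position-exact {q} {ℕ.n≤1+n q})
    σ-over : σ B ≡ A
    σ-over = cong tip (position-over {q} {ℕ.≤-refl})
    σσ : ∀ v → σ (σ v) ≡ v
    σσ (pv 0 _) = σ-over
    σσ (pv 1 _) = refl
    σσ (pv (suc (suc i)) h) with position q h
    ... | under lt = σ-under lt
    ... | exact = refl
    ... | over = refl
    σσ (lv 0F) = σ-exact
    σσ (lv (Fin.suc _)) = refl
    σσ (rv 0F) = refl
    σσ (rv (Fin.suc _)) = refl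
    π : GEdge (suc m) (suc m) q → GEdge (suc m) (suc m) q
    tipᴱ : ∀ {i} → Position q i → GEdge (suc m) (suc m) q
    tipᴱ (under {i} lt) = pE i (ℕ.<⇒≤ lt)
    tipᴱ exact = lE 0F
    tipᴱ over = lE 0F
    π (pE zero _) = rE 0F
    π (pE (suc i) h) = tipᴱ (position q (ℕ.m≤n⇒m≤1+n h))
    π (lE 0F) = pE q ℕ.≤-refl
    π (lE (Fin.suc a)) = rE (Fin.suc a)
    π (rE 0F) = pE 0 z≤n
    π (rE (Fin.suc a)) = lE (Fin.suc a)
    π-under : ∀ {i} .{h} → suc i < q → π (pE (suc i) h) ≡ pE (suc i) h
    π-under {h = h} lt = cong tipᴱ (position-under {h = ℕ.m≤n⇒m≤1+n h} lt)
    π-exact : π (pE q ℕ.≤-refl) ≡ lE 0F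
    π-exact = cong tipᴱ (position-exact {q} {ℕ.n≤1+n q})
    ππ : ∀ g → π (π g) ≡ g
    ππ (pE zero _) = refl
    ππ (pE (suc i) h) with position q {suc i} (ℕ.m≤n⇒m≤1+n h)
    ... | under lt = π-under lt
    ... | exact = refl
    ... | over = ⊥-elim (ℕ.1+n≰n (recompute (_ ℕ.≤? _) h))
    ππ (lE 0F) = π-exact
    ππ (lE (Fin.suc _)) = refl
    ππ (rE 0F) = refl
    ππ (rE (Fin.suc _)) = refl
    old : ∀ g → g ≢ e₁ → g ≢ eₗ → Same (src (π g)) (tgt (π g)) (σ (src g)) (σ (tgt g))
    old (pE 0 _) _ _ = inj₁ (refl , refl)
    old (pE 1 _) ne _ = ⊥-elim (ne refl)
    old (pE (suc (suc i)) h) _ ne with ℕ.m≤n⇒m<n∨m≡n (recompute (_ ℕ.≤? q) h)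
    ... | inj₂ refl rewrite position-exact {q} {ℕ.n≤1+n q} | position-over {q} {ℕ.≤-refl} = inj₂ (refl , refl)
    ... | inj₁ lt with ℕ.m≤n⇒m<n∨m≡n lt
    ...   | inj₂ refl = ⊥-elim (ne refl)
    ...   | inj₁ lt′ rewrite position-under {h = ℕ.m≤n⇒m≤1+n h} lt | position-under {h = s≤s h} lt′ = inj₁ (refl , refl)
    old (lE 0F) _ _ = inj₂ (refl , refl)
    old (lE (Fin.suc _)) _ _ = inj₁ (refl , refl)
    old (rE 0F) _ _ = inj₁ (σ-over , refl)
    old (rE (Fin.suc _)) _ _ = inj₁ (σ-over , refl)

  star-cycle : Adversary (suc m) (suc m) (3 + r) 2
  star-cycle = adversary (degD-tgt e₁ (deg-int (s≤s (s≤s z≤n)))) (degD-off e₁ (λ ()) (λ ()) (deg-r 0F)) (deg-int (s≤s z≤n)) (deg-int (s≤s (s≤s z≤n))) refl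
    (λ { 0F → exchange }) (λ { 0F 0F _ → refl }) (λ { 0F 0F _ → refl }) (λ { 0F () }) (split-by-side {h = s≤s z≤n} refl)

open StarCycle using (star-cycle)

-- The decard of the fourth edge is that of another edge when q = 2 and when q > 3.
module Bypassʳ {r : ℕ} where

  private
    q = 2 + r
    e₁ e₂ eₗ : GEdge 2 1 q
    e₁ = pE 1 (s≤s z≤n)
    e₂ = pE 2 (s≤s (s≤s z≤n))
    eₗ = pE q ℕ.≤-refl
    v₁ v₂ v₃ : V 2 1 q
    v₁ = pv 1 (s≤s z≤n)
    v₂ = pv 2 (s≤s (s≤s z≤n))
    v₃ = pv 3 (s≤s (s≤s (s≤s z≤n)))

  open Rewire {2} {1} {q} eₗ B (lv 0F)
  open Rewired (λ ()) (λ ())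

  σ σ⁻ : V 2 1 q → V 2 1 q
  up² : ∀ {i} → Position q i → V 2 1 q
  up² (under {i} lt) = pv (2 + i) (s≤s lt)
  up² exact = rv 0F
  up² over = v₂
  σ (pv 0 _) = A
  σ (pv 1 _) = lv 0F
  σ (pv (suc (suc i)) h) = up² (position q h)
  σ (lv 0F) = v₁
  σ (lv a) = lv a
  σ (rv 0F) = v₃
  σ⁻ (pv 0 _) = A
  σ⁻ (pv 1 _) = lv 0F
  σ⁻ (pv 2 _) = B
  σ⁻ (pv 3 _) = rv 0F
  σ⁻ (pv (suc (suc (suc (suc i)))) h) = pv (2 + i) (ℕ.<⇒≤ (ℕ.<⇒≤ h))
  σ⁻ (lv 0F) = v₁
  σ⁻ (lv a) = lv a
  σ⁻ (rv 0F) = pv q (ℕ.n≤1+n q)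

  σ-over : σ B ≡ v₂
  σ-over = cong up² (position-over {q} {ℕ.≤-refl})

  σσ⁻ : ∀ v → σ (σ⁻ v) ≡ v
  σσ⁻ (pv 0 _) = refl
  σσ⁻ (pv 1 _) = refl
  σσ⁻ (pv 2 _) = σ-over
  σσ⁻ (pv 3 _) = refl
  σσ⁻ (pv (suc (suc (suc (suc i)))) h) = cong up² (position-under {q} {2 + i} {ℕ.<⇒≤ (ℕ.<⇒≤ h)} (ℕ.≤-pred (recompute (_ ℕ.≤? _) h)))
  σσ⁻ (lv 0F) = refl
  σσ⁻ (lv (Fin.suc _)) = refl
  σσ⁻ (rv 0F) = cong up² (position-exact {q} {ℕ.n≤1+n q})

  σ⁻σ : ∀ v → σ⁻ (σ v) ≡ v
  σ⁻σ (pv 0 _) = refl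
  σ⁻σ (pv 1 _) = refl
  σ⁻σ (pv (suc (suc i)) h) with position q h
  ... | under _ = refl
  ... | exact = refl
  ... | over = refl
  σ⁻σ (lv 0F) = refl
  σ⁻σ (lv (Fin.suc _)) = refl
  σ⁻σ (rv 0F) = refl

  π π⁻ : GEdge 2 1 q → GEdge 2 1 q
  up²ᴱ : ∀ {i} → .(i ≤ suc q) → Position q i → GEdge 2 1 q
  up²ᴱ _ (under {i} lt) = pE (suc i) lt
  up²ᴱ _ exact = rE 0F
  up²ᴱ _ over = e₁
  π (pE zero _) = lE 0F
  π (pE (suc i) h) = up²ᴱ (s≤s h) (position q {2 + i} (s≤s h))
  π (lE 0F) = pE 0 z≤n
  π (lE a) = lE a
  π (rE 0F) = e₂
  π⁻ (pE 0 _) = lE 0F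
  π⁻ (pE 1 _) = eₗ
  π⁻ (pE 2 _) = rE 0F
  π⁻ (pE (suc (suc (suc i))) h) = pE (suc i) (ℕ.<⇒≤ (ℕ.<⇒≤ h))
  π⁻ (lE 0F) = pE 0 z≤n
  π⁻ (lE a) = lE a
  π⁻ (rE 0F) = pE (suc r) (ℕ.n≤1+n _)

  π-over : π eₗ ≡ e₁
  π-over = cong (up²ᴱ ℕ.≤-refl) (position-over {q} {ℕ.≤-refl})

  ππ⁻ : ∀ g → π (π⁻ g) ≡ g
  ππ⁻ (pE 0 _) = refl
  ππ⁻ (pE 1 _) = π-over
  ππ⁻ (pE 2 _) = refl
  ππ⁻ (pE (suc (suc (suc i))) h) = cong (up²ᴱ (ℕ.<⇒≤ (s≤s (ℕ.<⇒≤ h)))) (position-under {q} {2 + i} {ℕ.<⇒≤ (s≤s (ℕ.<⇒≤ h))} (recompute (_ ℕ.≤? _) h))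
  ππ⁻ (lE 0F) = refl
  ππ⁻ (lE (Fin.suc _)) = refl
  ππ⁻ (rE 0F) = cong (up²ᴱ (ℕ.n≤1+n q)) (position-exact {q} {ℕ.n≤1+n q})

  π⁻π : ∀ g → π⁻ (π g) ≡ g
  π⁻π (pE zero _) = refl
  π⁻π (pE (suc i) h) with position q {2 + i} (s≤s h)
  ... | under _ = refl
  ... | exact = refl
  ... | over = refl
  π⁻π (lE 0F) = refl
  π⁻π (lE (Fin.suc _)) = refl
  π⁻π (rE 0F) = refl

  old : ∀ g → g ≢ eₗ → g ≢ e₁ → Same (src (π g)) (tgt (π g)) (σ (src g)) (σ (tgt g))
  old (pE 0 _) _ _ = inj₁ (refl , refl)
  old (pE 1 _) _ ne = ⊥-elim (ne refl)
  old (pE (suc (suc i)) h) ne _ with ℕ.m≤n⇒m<n∨m≡n (recompute (_ ℕ.≤? q) h)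
  ... | inj₂ refl = ⊥-elim (ne refl)
  ... | inj₁ lt with ℕ.m≤n⇒m<n∨m≡n lt
  ...   | inj₂ refl rewrite position-under {q} {1 + r} {ℕ.<⇒≤ (ℕ.n≤1+n q)} ℕ.≤-refl | position-exact {q} {ℕ.n≤1+n q} = inj₁ (refl , refl)
  ...   | inj₁ lt′ rewrite position-under {q} {2 + i} {ℕ.m≤n⇒m≤1+n h} lt | position-under {q} {3 + i} {s≤s h} lt′ = inj₁ (refl , refl)
  old (lE 0F) _ _ = inj₁ (refl , refl)
  old (lE (Fin.suc _)) _ _ = inj₁ (refl , refl)
  old (rE 0F) _ _ = inj₁ (σ-over , refl)

  -- `σ` moves the tail of the path up by two, so the cut at `e₁` is charged to the edge two places
  -- further: `rE 0F` for `q = 2` and `pE 3` for larger `q`. For `q = 3` the latter is `eₗ`, already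
  -- used for the new edge; hence the exception for a path of five vertices.
  slide : ∀ (e′ : GEdge 2 1 q) {w α β s t} → e₁ ≢ eₗ → π e₁ ≡ e′ → σ v₂ ≡ w → Deg (D e′) (lv 0F) α → Deg (D e′) w β →
           Deg G (src e′) (suc s) → Deg G (tgt e′) (suc t) → α + β ≡ s + t → Move
  slide e′ ne eq refl dα dβ ds dt sums = record
    { d = e₁ ; e′ = e′ ; d≢e₀ = ne
    ; σ = σ ; σ⁻ = σ⁻ ; σσ⁻ = σσ⁻ ; σ⁻σ = σ⁻σ ; π = π ; π⁻ = π⁻ ; ππ⁻ = ππ⁻ ; π⁻π = π⁻π ; πd = eq
    ; old = old ; fresh = subst (λ g → Same (src g) (tgt g) (σ B) v₁) (sym π-over) (inj₂ (σ-over , refl))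
    ; deg-α = dα ; deg-β = dβ ; deg-s = ds ; deg-t = dt ; sums = sums }

  with-slide : (mv : Move) → Move.d mv ≡ e₁ → Move.e′ mv ≢ eₗ → Move.e′ mv ≢ pE 0 z≤n → (∀ a → Move.e′ mv ≢ lE a) → Adversary 2 1 q 4
  with-slide mv d≡ ne ne₀ ne₁ = adversary (degD-tgt eₗ deg-B) (degD-off eₗ (λ ()) (λ ()) (deg-l 0F)) (deg-int ℕ.≤-refl) deg-B refl
    moves d-inj e′-inj e′≢e₀
    (differ-bushy {v = A} {w₁ = v₁} {w₂ = lv 0F} {w₃ = lv 1F} {z₁ = v₂} {z₂ = B} (inj₁ (D-link {e′ = pE 0 z≤n} (λ ()) p→)) (inj₁ (D-link {e′ = lE 0F} (λ ()) l→))
      (inj₁ (D-link {e′ = lE 1F} (λ ()) l→)) (λ ()) (λ ()) (λ ()) (inj₁ (D-link {e′ = e₁} (λ p → ne₁₂ (trans d≡ p)) p→)) (λ ()) (inj₂ (inj₂ (refl , refl))) (λ ()))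
    where
    ne₁₂ : Move.d mv ≢ eₗ
    ne₁₂ = Move.d≢e₀ mv
    moves : Fin 3 → Move
    moves 0F = move-reflect (Bypass.reverse {1} {r})
    moves 1F = move-reflect (Bypass₁.rotate {r})
    moves 2F = mv
    d-inj : ∀ i j → Move.d (moves i) ≡ Move.d (moves j) → i ≡ j
    d-inj 0F 0F _ = refl
    d-inj 1F 1F _ = refl
    d-inj 2F 2F _ = refl
    d-inj 0F 1F ()
    d-inj 1F 0F ()
    d-inj 0F 2F p with trans p d≡
    ... | ()
    d-inj 1F 2F p with trans p d≡
    ... | ()
    d-inj 2F 0F p with trans (sym p) d≡
    ... | ()
    d-inj 2F 1F p with trans (sym p) d≡
    ... | ()
    zero-edge : Move.e′ (moves 0F) ≡ pE 0 z≤n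
    zero-edge = pE-cong (ℕ.n∸n≡0 q)
    e′-inj : ∀ i j → Move.e′ (moves i) ≡ Move.e′ (moves j) → i ≡ j
    e′-inj 0F 0F _ = refl
    e′-inj 1F 1F _ = refl
    e′-inj 2F 2F _ = refl
    e′-inj 0F 1F ()
    e′-inj 1F 0F ()
    e′-inj 0F 2F p = ⊥-elim (ne₀ (trans (sym p) zero-edge))
    e′-inj 1F 2F p = ⊥-elim (ne₁ _ (sym p))
    e′-inj 2F 0F p = ⊥-elim (ne₀ (trans p zero-edge))
    e′-inj 2F 1F p = ⊥-elim (ne₁ _ p)
    e′≢e₀ : ∀ i → Move.e′ (moves i) ≢ eₗ
    e′≢e₀ 0F p with trans (sym zero-edge) p
    ... | ()
    e′≢e₀ 1F ()
    e′≢e₀ 2F = ne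

bypass₄ : Adversary 2 1 2 4
bypass₄ = with-slide (slide (rE 0F) (λ ()) (cong (up²ᴱ {2} (s≤s (s≤s z≤n))) (position-exact {2} {s≤s (s≤s z≤n)})) (cong up² (position-exact {2} {s≤s (s≤s z≤n)}))
  (degD-off (rE 0F) (λ ()) (λ ()) (deg-l 0F)) (degD-tgt (rE 0F) (deg-r 0F)) deg-B (deg-r 0F) refl) refl (λ ()) (λ ()) (λ _ ())
  where open Bypassʳ {0}

bypass₄′ : ∀ {r} → Adversary 2 1 (4 + r) 4
bypass₄′ {r} = with-slide (slide e₃ (λ ()) (cong (up²ᴱ 2≤q) (position-under {q} {2} {2≤q} 2<q)) (cong up² (position-under {q} {2} {2≤q} 2<q))
  (degD-off e₃ (λ ()) (λ ()) (deg-l 0F)) (degD-tgt e₃ (proj₂ deg-4)) (deg-int 2<q) (proj₂ deg-4) refl) refl (λ ()) (λ ()) (λ _ ())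
  where
  open Bypassʳ {2 + r}
  q = 4 + r
  2<q : 2 < q
  2<q = s≤s (s≤s (s≤s z≤n))
  2≤q : 2 ≤ suc q
  2≤q = s≤s (s≤s z≤n)
  e₃ : GEdge 2 1 q
  e₃ = pE 3 (s≤s (s≤s (s≤s z≤n)))
  deg-4 = deg-pv {2} {1} {q} 3 (s≤s (s≤s (s≤s z≤n)))

-- Demands for each value of adern, and the case distinction.

module _ {m n q : ℕ} where

  adern : ∀ {k} → Fin m → Fin n → Reqs m n q (suc k) → Adversary m n q k → AdernIs (DoubleBroom m n (2 + q)) (suc k)
  adern a b reqs adv = Transfer.all-determine m n q reqs a b , λ j lt → Transfer.refutes m n q adv (ℕ.≤-pred lt)

private
  2<3+ : ∀ {k} → 2 < 3 + k
  2<3+ = s≤s (s≤s (s≤s z≤n))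

  3<4+ : ∀ {k} → 3 < 4 + k
  3<4+ = s≤s 2<3+

  -- With `2 < k` the tree demands are met except for `m = 2`, where three or four codes can occur.
  tree-req : ∀ {m n q k} → 2 < k → (m ≡ 2 → 2 ≤ n → 3 ≤ q → 3 < k) → (n ≡ 1 → m ≡ 2 → 2 ≤ q → 3 < k × (q ≢ 3 → 4 < k)) → Req m n q k
  tree-req lt two two-one = record
    { big = λ _ _ _ → inj₁ lt ; two = λ _ _ _ → lt ; two′ = two ; single = λ _ _ _ → lt ; pair = λ _ _ _ → ℕ.<⇒≤ lt
    ; small = λ _ _ _ → lt ; small′ = λ { p r refl → proj₁ (two-one p r (s≤s (s≤s z≤n))) } ; small″ = λ p r le → proj₂ (two-one p r le) }

  leaf-req : ∀ {m n q k} → 2 < k → (m ≡ 2 + n → q ≡ 1 → 3 < k × (n ≢ 1 → 4 < k)) → LeafReq m n q k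
  leaf-req lt h = record
    { m-2 = λ _ → lt ; m-3 = λ _ _ → (λ _ → ℕ.<⇒≤ lt) , (λ _ → lt) , (λ _ → lt) ; m-4 = λ _ _ → ℕ.<⇒≤ lt , λ _ → lt
    ; m-n+2 = λ p → (λ _ → lt) , (λ r ne → proj₂ (h p r) ne) , (λ r _ → proj₁ (h p r)) ; m-n+3 = λ _ _ → ℕ.<⇒≤ lt }

  side-req : ∀ {m n q k} → 2 < k → SideReq m n q k
  side-req lt = record { first = λ _ _ → inj₁ lt ; low = λ _ _ → lt ; mid = λ _ → inj₁ lt }

reqs-5 : ∀ {m n q} → Reqs m n q 5
reqs-5 = record
  { tree = tree-req 2<3+ (λ _ _ _ → 3<4+) (λ _ _ _ → 3<4+ , λ _ → ℕ.≤-refl) ; tree′ = tree-req 2<3+ (λ _ _ _ → 3<4+) (λ _ _ _ → 3<4+ , λ _ → ℕ.≤-refl)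
  ; leaf = leaf-req 2<3+ (λ _ _ → 3<4+ , λ _ → ℕ.≤-refl) ; leaf′ = leaf-req 2<3+ (λ _ _ → 3<4+ , λ _ → ℕ.≤-refl)
  ; sides = side-req 2<3+ ; sides′ = side-req 2<3+ }

reqs-4 : ∀ {m n q} → (n ≡ 1 → m ≡ 2 → 2 ≤ q → q ≡ 3) → (m ≡ 1 → n ≡ 2 → 2 ≤ q → q ≡ 3) →
         (m ≡ 2 + n → q ≡ 1 → n ≡ 1) → (n ≡ 2 + m → q ≡ 1 → m ≡ 1) → Reqs m n q 4
reqs-4 h h′ l l′ = record
  { tree = tree-req 2<3+ (λ _ _ _ → 3<4+) (λ p r s → 3<4+ , λ ne → ⊥-elim (ne (h p r s)))
  ; tree′ = tree-req 2<3+ (λ _ _ _ → 3<4+) (λ p r s → 3<4+ , λ ne → ⊥-elim (ne (h′ p r s)))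
  ; leaf = leaf-req 2<3+ (λ p r → 3<4+ , λ ne → ⊥-elim (ne (l p r))) ; leaf′ = leaf-req 2<3+ (λ p r → 3<4+ , λ ne → ⊥-elim (ne (l′ p r)))
  ; sides = side-req 2<3+ ; sides′ = side-req 2<3+ }

reqs-3 : ∀ {m n q} → (m ≡ 2 → 2 ≤ n → ¬ 3 ≤ q) → (n ≡ 2 → 2 ≤ m → ¬ 3 ≤ q) → (n ≡ 1 → m ≡ 2 → ¬ 2 ≤ q) → (m ≡ 1 → n ≡ 2 → ¬ 2 ≤ q) →
         (m ≡ 2 + n → q ≢ 1) → (n ≡ 2 + m → q ≢ 1) → Reqs m n q 3
reqs-3 t t′ h h′ l l′ = record
  { tree = tree-req 2<3+ (λ p r s → ⊥-elim (t p r s)) (λ p r s → ⊥-elim (h p r s))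
  ; tree′ = tree-req 2<3+ (λ p r s → ⊥-elim (t′ p r s)) (λ p r s → ⊥-elim (h′ p r s))
  ; leaf = leaf-req 2<3+ (λ p r → ⊥-elim (l p r)) ; leaf′ = leaf-req 2<3+ (λ p r → ⊥-elim (l′ p r))
  ; sides = side-req 2<3+ ; sides′ = side-req 2<3+ }

-- The restrictions, seen from the hub with `m` leaves, under which `k = 2` meets all demands;
-- `long` concerns paths of at least four vertices.
record Half₂ (m n q : ℕ) : Set where
  field
    m≢2   : m ≢ 2
    m≢2+n : m ≢ 2 + n
    at-3  : m ≡ 3 → 3 ≤ n × q ≤ 1
    at-1  : m ≡ 1 → q ≡ 1 × 4 ≤ n
    long  : 2 ≤ q → 4 ≤ m × 4 ≤ n × m ≢ suc n × n ≢ suc m × (m ≡ n → q ≡ 2)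

reqs-2 : ∀ {m n q} → Half₂ m n q → Half₂ n m q → Reqs m n q 2
reqs-2 {m} {n} {q} h h′ = record { tree = tree₂ h ; tree′ = tree₂ h′ ; leaf = leaf₂ h ; leaf′ = leaf₂ h′ ; sides = side₂ h ; sides′ = side₂ h′ }
  where
  tree₂ : ∀ {m n} → Half₂ m n q → Req m n q 2
  tree₂ h = record
    { big = λ _ _ le → inj₂ (ℕ.≤-refl , proj₁ (proj₂ (proj₂ (long le)))) ; two = λ p → ⊥-elim (m≢2 p) ; two′ = λ p → ⊥-elim (m≢2 p)
    ; single = λ { refl _ le → ⊥-elim (ℕ.<⇒≱ (s≤s (s≤s z≤n)) (proj₁ (proj₂ (long le)))) } ; pair = λ _ _ _ → ℕ.≤-refl
    ; small = λ _ p → ⊥-elim (m≢2 p) ; small′ = λ _ p → ⊥-elim (m≢2 p) ; small″ = λ _ p → ⊥-elim (m≢2 p) }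
    where open Half₂ h
  leaf₂ : ∀ {m n} → Half₂ m n q → LeafReq m n q 2
  leaf₂ h = record
    { m-2 = λ p → ⊥-elim (m≢2 p)
    ; m-3 = λ p _ → (λ _ → ℕ.≤-refl) , (λ le → ⊥-elim (ℕ.<⇒≱ (proj₁ (at-3 p)) le)) , (λ le → ⊥-elim (ℕ.<⇒≱ le (proj₂ (at-3 p))))
    ; m-4 = λ _ le → ℕ.≤-refl , λ { refl → ⊥-elim (ℕ.<⇒≱ (s≤s (s≤s (s≤s z≤n))) (proj₁ (proj₂ (long le)))) }
    ; m-n+2 = λ p → ⊥-elim (m≢2+n p) ; m-n+3 = λ _ _ → ℕ.≤-refl }
    where open Half₂ h
  side₂ : ∀ {m n} → Half₂ m n q → SideReq m n q 2
  side₂ {m} {n} h = record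
    { first = λ _ p → inj₂ (ℕ.≤-refl , at-1 p)
    ; low = λ le → λ { (inj₁ p) → ⊥-elim (m≢2 p)
                     ; (inj₂ (inj₁ refl)) → ⊥-elim (ℕ.1+n≰n (proj₁ (long le)))
                     ; (inj₂ (inj₂ (inj₁ p))) → ⊥-elim (proj₁ (proj₂ (proj₂ (long le))) p)
                     ; (inj₂ (inj₂ (inj₂ p))) → ⊥-elim (m≢2+n p) }
    ; mid = λ le → let le-m , _ , a , b , c = long le in inj₂ (split le-m a b c (m ℕ.≟ n)) }
    where
    open Half₂ h
    split : 4 ≤ m → m ≢ suc n → n ≢ suc m → (m ≡ n → q ≡ 2) → Dec (m ≡ n) →
            (1 < 2 × m ≡ n × q ≡ 2) ⊎ (1 < 2 × 3 ≤ m × m ≢ n × m ≢ suc n × n ≢ suc m)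
    split _ _ _ c (yes p) = inj₁ (ℕ.≤-refl , p , c p)
    split le a b _ (no p) = inj₂ (ℕ.≤-refl , ℕ.<⇒≤ le , p , a , b)

-- By `triangle` a single decard never suffices for `q ≥ 2`, whence the bound on `q`. What remains
-- to be excluded are small leaf numbers and a difference of two.
reqs-1 : ∀ {m n q} → q ≤ 1 → (1 ≤ q → 4 ≤ m × 4 ≤ n) → m ≢ 2 → n ≢ 2 → m ≢ 2 + n → n ≢ 2 + m → Reqs m n q 1
reqs-1 {q = q} q≤1 big m≢2 n≢2 m≢2+n n≢2+m = record
  { tree = tree₁ m≢2 (proj₂ ∘ big) ; tree′ = tree₁ n≢2 (proj₁ ∘ big)
  ; leaf = leaf₁ m≢2 (proj₁ ∘ big) m≢2+n ; leaf′ = leaf₁ n≢2 (proj₂ ∘ big) n≢2+m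
  ; sides = side₁ (proj₁ ∘ big) ; sides′ = side₁ (proj₂ ∘ big) }
  where
  short : ¬ 2 ≤ q
  short le = ℕ.<⇒≱ le q≤1
  1≱4 : ¬ 4 ≤ 1
  1≱4 (s≤s ())
  3≱4 : ¬ 4 ≤ 3
  3≱4 = ℕ.1+n≰n
  tree₁ : ∀ {m n} → m ≢ 2 → (1 ≤ q → 4 ≤ n) → Req m n q 1
  tree₁ m≢2 large = record
    { big = λ _ _ le → ⊥-elim (short le) ; two = λ p → ⊥-elim (m≢2 p) ; two′ = λ p → ⊥-elim (m≢2 p) ; single = λ _ _ le → ⊥-elim (short le)
    ; pair = λ { refl _ refl → ⊥-elim (1≱4 (large ℕ.≤-refl)) } ; small = λ _ p → ⊥-elim (m≢2 p) ; small′ = λ _ p → ⊥-elim (m≢2 p) ; small″ = λ _ p → ⊥-elim (m≢2 p) }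
  leaf₁ : ∀ {m n} → m ≢ 2 → (1 ≤ q → 4 ≤ m) → m ≢ 2 + n → LeafReq m n q 1
  leaf₁ m≢2 large ne = record
    { m-2 = λ p → ⊥-elim (m≢2 p) ; m-3 = λ { refl le → ⊥-elim (3≱4 (large le)) } ; m-4 = λ _ le → ⊥-elim (short le)
    ; m-n+2 = λ p → ⊥-elim (ne p) ; m-n+3 = λ _ le → ⊥-elim (short le) }
  side₁ : ∀ {m n} → (1 ≤ q → 4 ≤ m) → SideReq m n q 1
  side₁ large = record
    { first = λ { le refl → ⊥-elim (1≱4 (large le)) } ; low = λ le → ⊥-elim (short le) ; mid = λ le → ⊥-elim (short le) }

private
  ¬2≤1 : ¬ 2 ≤ 1
  ¬2≤1 (s≤s ())

  no-excess : ∀ {m n} → m ≤ n → m ≢ 2 + n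
  no-excess le refl = ℕ.<⇒≱ (ℕ.≤-trans (ℕ.n<1+n _) (ℕ.n≤1+n _)) le

  large≢ : ∀ {k m} → suc k ≤ m → m ≢ k
  large≢ le refl = ℕ.1+n≰n le

adern-1 : ∀ {m n p} → 1 ≤ m → m ≤ n → 2 ≤ p → CaseAdern1 m n p → AdernIs (DoubleBroom m n p) 1
adern-1 {suc m} {suc n} _ m≤n _ (inj₁ (refl , m≢2 , n≢2 , ne)) = adern 0F 0F
  (reqs-1 z≤n (λ ()) m≢2 n≢2 (no-excess m≤n) (λ p → ne (trans (ℕ.+-comm (suc m) 2) (sym p)))) adversary₀
adern-1 {suc m} {suc n} _ m≤n _ (inj₂ (refl , m≥4 , ne)) = adern 0F 0F
  (reqs-1 ℕ.≤-refl (λ _ → m≥4 , ℕ.≤-trans m≥4 m≤n) (large≢ (ℕ.<⇒≤ m≥4)) (large≢ (ℕ.<⇒≤ (ℕ.≤-trans m≥4 m≤n))) (no-excess m≤n)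
    (λ p → ne (trans (ℕ.+-comm (suc m) 2) (sym p)))) adversary₀

adern-5 : ∀ {m n p} → CaseAdern5 m n p → AdernIs (DoubleBroom m n p) 5
adern-5 (inj₁ (refl , refl , refl)) = adern 0F 0F reqs-5 (adversary-reflect bypass₄)
adern-5 (inj₂ (inj₁ (refl , refl , s≤s (s≤s (s≤s (s≤s (s≤s (s≤s _)))))))) = adern 0F 0F reqs-5 (adversary-reflect bypass₄′)
adern-5 {m} (inj₂ (inj₂ (p , refl , s≤s (s≤s _)))) with trans p (ℕ.+-comm m 2)
... | refl = adern 0F 0F reqs-5 common-leaf₄

adern-4 : ∀ {m n p} → m ≤ n → CaseAdern4 m n p → AdernIs (DoubleBroom m n p) 4
adern-4 _ (inj₁ (refl , refl , refl)) = adern 0F 0F (reqs-4 (λ ()) (λ _ _ _ → refl) (λ ()) (λ ())) bypass₃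
adern-4 _ (inj₂ (inj₁ (refl , refl , refl))) = adern 0F 0F (reqs-4 (λ ()) (λ _ ()) (λ ()) (λ _ _ → refl)) common-leaf₃
adern-4 (s≤s (s≤s _)) (inj₂ (inj₂ (refl , s≤s (s≤s (s≤s (s≤s (s≤s _))))))) = adern 0F 0F (reqs-4 (λ ()) (λ ()) (λ _ ()) (λ _ ())) path-to-leaf

adern-1-2 : ∀ {p} → 2 ≤ p → p ≤ 3 → AdernIs (DoubleBroom 1 2 p) 3
adern-1-2 {2} _ _ = adern 0F 0F (reqs-3 (λ ()) (λ _ _ ()) (λ ()) (λ _ _ ()) (λ ()) (λ ())) (adversary-reflect Cycle0.cycle)
adern-1-2 {3} _ _ = adern 0F 0F (reqs-3 (λ ()) (λ _ le _ → ¬2≤1 le) (λ ()) (λ _ _ → ¬2≤1) (λ ()) (λ ())) (adversary-reflect Cycle1.cycle)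
adern-1-2 {1} (s≤s ()) _
adern-1-2 {suc (suc (suc (suc _)))} _ (s≤s (s≤s (s≤s ())))

adern-2-n : ∀ {n p} → 2 ≤ n → 2 ≤ p → p ≤ 4 → ¬ (n ≡ 4 × p ≡ 3) → AdernIs (DoubleBroom 2 n p) 3
adern-2-n {p = 2} (s≤s (s≤s _)) _ _ _ = adern 0F 0F (reqs-3 (λ _ _ ()) (λ _ _ ()) (λ ()) (λ ()) (λ ()) (λ _ ())) Cycle0.cycle
adern-2-n {p = 3} (s≤s (s≤s _)) _ _ ne = adern 0F 0F
  (reqs-3 (λ { _ _ (s≤s ()) }) (λ { _ _ (s≤s ()) }) (λ ()) (λ ()) (λ ()) (λ { refl _ → ne (refl , refl) })) Cycle1.cycle
adern-2-n {p = 4} (s≤s (s≤s _)) _ _ _ = adern 0F 0F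
  (reqs-3 (λ { _ _ (s≤s (s≤s ())) }) (λ { _ _ (s≤s (s≤s ())) }) (λ ()) (λ ()) (λ ()) (λ _ ())) Cycle2.cycle
adern-2-n {p = 1} _ (s≤s ()) _ _
adern-2-n {p = suc (suc (suc (suc (suc _))))} _ _ (s≤s (s≤s (s≤s (s≤s ())))) _

adern-3-n : ∀ {n p} → 3 ≤ n → 4 ≤ p → AdernIs (DoubleBroom 3 n p) 3
adern-3-n (s≤s (s≤s (s≤s _))) (s≤s (s≤s (s≤s (s≤s _)))) = adern 0F 0F (reqs-3 (λ ()) (λ ()) (λ ()) (λ ()) (λ _ ()) (λ _ ())) leaf-to-path

adern-excess : ∀ {m p} → 1 ≤ m → m ≢ 2 → 2 ≤ p → p ≢ 3 → AdernIs (DoubleBroom m (2 + m) p) 3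
adern-excess (s≤s _) m≢2 (s≤s (s≤s _)) p≢3 = adern 0F 0F
  (reqs-3 (⊥-elim ∘ m≢2) (λ ()) (λ ()) (λ _ ()) (λ _ eq → p≢3 (cong (2 +_) eq)) (λ _ eq → p≢3 (cong (2 +_) eq))) common-leaf

adern-3 : ∀ {m n p} → 1 ≤ m → m ≤ n → 2 ≤ p → CaseAdern3 m n p → AdernIs (DoubleBroom m n p) 3
adern-3 _ _ _ (inj₁ (refl , refl , s≤s (s≤s (s≤s _)))) = adern 0F 0F (reqs-3 (λ ()) (λ ()) (λ _ ()) (λ _ ()) (λ ()) (λ ())) path-cycle
adern-3 _ _ p≥2 (inj₂ (inj₁ (refl , refl , p≤3))) = adern-1-2 p≥2 p≤3
adern-3 _ _ _ (inj₂ (inj₂ (inj₁ (refl , s≤s (s≤s (s≤s (s≤s _))) , s≤s (s≤s (s≤s (s≤s _))))))) = adern 0F 0F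
  (reqs-3 (λ ()) (λ ()) (λ ()) (λ _ ()) (λ ()) (λ ())) (adversary-reflect lengthen-leaf)
adern-3 _ m≤n p≥2 (inj₂ (inj₂ (inj₂ (inj₁ (refl , p≤4 , ne))))) = adern-2-n m≤n p≥2 p≤4 ne
adern-3 _ m≤n _ (inj₂ (inj₂ (inj₂ (inj₂ (inj₁ (refl , p≥4)))))) = adern-3-n m≤n p≥4
adern-3 _ _ _ (inj₂ (inj₂ (inj₂ (inj₂ (inj₂ (inj₁ (s≤s (s≤s (s≤s (s≤s _))) , refl , s≤s (s≤s (s≤s (s≤s (s≤s _)))))))))))  = adern 0F 0F
  (reqs-3 (λ ()) (λ ()) (λ ()) (λ ()) (λ _ ()) (λ _ ())) star-cycle
adern-3 {m} _ _ _ (inj₂ (inj₂ (inj₂ (inj₂ (inj₂ (inj₂ (inj₁ (s≤s (s≤s (s≤s (s≤s _))) , p , s≤s (s≤s (s≤s (s≤s _)))))))))))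
  with trans p (ℕ.+-comm m 1)
... | refl = adern 0F 0F (reqs-3 (λ ()) (λ ()) (λ ()) (λ ()) (λ _ ()) (λ _ ())) bypass
adern-3 {m} m≥1 _ p≥2 (inj₂ (inj₂ (inj₂ (inj₂ (inj₂ (inj₂ (inj₂ (inj₁ (m≢2 , _ , p , p≢3))))))))) with trans p (ℕ.+-comm m 2)
... | refl = adern-excess m≥1 m≢2 p≥2 p≢3
adern-3 _ _ _ (inj₂ (inj₂ (inj₂ (inj₂ (inj₂ (inj₂ (inj₂ (inj₂ (refl , refl , refl))))))))) = adern 0F 0F
  (reqs-3 (λ ()) (λ ()) (λ ()) (λ ()) (λ ()) (λ _ ())) common-leaf

-- What the other cases leave over for `1 ≤ m ≤ n` and `p ≥ 2`, solved into four explicit families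
-- in place of four negated disjunctions.
data CaseAdern2 : ℕ → ℕ → ℕ → Set where
  case-1     : ∀ n → CaseAdern2 1 (4 + n) 3
  case-3     : ∀ n → n ≢ 2 → CaseAdern2 3 (3 + n) 3
  case-equal : ∀ m → CaseAdern2 (4 + m) (4 + m) 4
  case-wide  : ∀ m n q → CaseAdern2 (4 + m) (7 + m + n) (4 + q)

adern-2 : ∀ {m n p} → CaseAdern2 m n p → AdernIs (DoubleBroom m n p) 2
adern-2 (case-1 n) = adern 0F 0F (reqs-2
  (record { m≢2 = λ () ; m≢2+n = λ () ; at-3 = λ () ; at-1 = λ _ → refl , s≤s (s≤s (s≤s (s≤s z≤n))) ; long = ⊥-elim ∘ ¬2≤1 })
  (record { m≢2 = λ () ; m≢2+n = λ () ; at-3 = λ () ; at-1 = λ () ; long = ⊥-elim ∘ ¬2≤1 })) triangle₁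
adern-2 (case-3 n ne) = adern 0F 0F (reqs-2
  (record { m≢2 = λ () ; m≢2+n = λ () ; at-3 = λ _ → s≤s (s≤s (s≤s z≤n)) , ℕ.≤-refl ; at-1 = λ () ; long = ⊥-elim ∘ ¬2≤1 })
  (record { m≢2 = λ () ; m≢2+n = λ { refl → ne refl } ; at-3 = λ _ → ℕ.≤-refl , ℕ.≤-refl ; at-1 = λ () ; long = ⊥-elim ∘ ¬2≤1 })) triangle₃
adern-2 (case-equal m) = adern 0F 0F (reqs-2 half half) triangle
  where
  half : Half₂ (4 + m) (4 + m) 2
  half = record
    { m≢2 = λ () ; m≢2+n = no-excess ℕ.≤-refl ; at-3 = λ () ; at-1 = λ ()
    ; long = λ _ → s≤s (s≤s (s≤s (s≤s z≤n))) , s≤s (s≤s (s≤s (s≤s z≤n))) , (λ p → ℕ.1+n≢n (sym p)) , (λ p → ℕ.1+n≢n (sym p)) , λ _ → refl }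
adern-2 (case-wide m n q) = adern 0F 0F (reqs-2
  (record { m≢2 = λ () ; m≢2+n = gap 4 ∘ cancel 4 ; at-3 = λ () ; at-1 = λ ()
          ; long = λ _ → 4≤ , 4≤ , gap 3 ∘ cancel 4 , gap 1 ∘ sym ∘ cancel 5 , ⊥-elim ∘ gap 2 ∘ cancel 4 })
  (record { m≢2 = λ () ; m≢2+n = gap 0 ∘ sym ∘ cancel 6 ; at-3 = λ () ; at-1 = λ ()
          ; long = λ _ → 4≤ , 4≤ , gap 1 ∘ sym ∘ cancel 5 , gap 3 ∘ cancel 4 , ⊥-elim ∘ gap 2 ∘ cancel 4 ∘ sym })) triangle
  where
  4≤ : ∀ {k} → 4 ≤ 4 + k
  4≤ = s≤s (s≤s (s≤s (s≤s z≤n)))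
  cancel : ∀ k {i j} → k + i ≡ k + j → i ≡ j
  cancel k = ℕ.+-cancelˡ-≡ k _ _
  gap : ∀ k → m ≢ suc (k + (m + n))
  gap k p = ℕ.<-irrefl p (s≤s (ℕ.≤-trans (ℕ.m≤m+n m n) (ℕ.m≤n+m (m + n) k)))

classify : ∀ m n q → 1 ≤ m → m ≤ n → ¬ CaseAdern1 m n (2 + q) → ¬ CaseAdern5 m n (2 + q) → ¬ CaseAdern4 m n (2 + q) →
           ¬ CaseAdern3 m n (2 + q) → CaseAdern2 m n (2 + q)
classify m n 0 m≥1 m≤n ¬1 _ _ ¬3 = ⊥-elim (¬1 (inj₁ (refl , m≢2 , n≢2 , n≢m+2)))
  where
  m≢2 : m ≢ 2
  m≢2 p = ¬3 (inj₂ (inj₂ (inj₂ (inj₁ (p , s≤s (s≤s z≤n) , λ ())))))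
  n≢2 : n ≢ 2
  n≢2 p = ¬3 (inj₂ (inj₁ (ℕ.≤-antisym (ℕ.≤-pred (ℕ.≤∧≢⇒< (subst (m ≤_) p m≤n) m≢2)) m≥1 , p , s≤s (s≤s z≤n))))
  n≢m+2 : m + 2 ≢ n
  n≢m+2 refl with m ℕ.≟ 3
  ... | yes refl = ¬3 (inj₂ (inj₂ (inj₂ (inj₂ (inj₂ (inj₂ (inj₂ (inj₂ (refl , refl , refl)))))))))
  ... | no m≢3 = ¬3 (inj₂ (inj₂ (inj₂ (inj₂ (inj₂ (inj₂ (inj₂ (inj₁ (m≢2 , m≢3 , refl , λ ())))))))))
classify 1 1 1 _ _ _ _ _ ¬3 = ⊥-elim (¬3 (inj₁ (refl , refl , ℕ.≤-refl)))
classify 1 2 1 _ _ _ _ _ ¬3 = ⊥-elim (¬3 (inj₂ (inj₁ (refl , refl , ℕ.≤-refl))))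
classify 1 3 1 _ _ _ _ ¬4 _ = ⊥-elim (¬4 (inj₂ (inj₁ (refl , refl , refl))))
classify 1 (suc (suc (suc (suc n)))) 1 _ _ _ _ _ _ = case-1 n
classify 2 n 1 _ _ _ ¬5 _ ¬3 = ⊥-elim (¬3 (inj₂ (inj₂ (inj₂ (inj₁ (refl , s≤s (s≤s (s≤s z≤n)) , λ p → ¬5 (inj₂ (inj₂ (proj₁ p , refl , ℕ.≤-refl))))))))) 
classify 3 (suc (suc (suc n))) 1 _ (s≤s (s≤s (s≤s _))) _ ¬5 _ _ = case-3 n λ { refl → ¬5 (inj₂ (inj₂ (refl , refl , s≤s (s≤s z≤n)))) }
classify 3 1 1 _ (s≤s ()) _ _ _ _
classify 3 2 1 _ (s≤s (s≤s ())) _ _ _ _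
classify (suc (suc (suc (suc m)))) n 1 _ _ ¬1 ¬5 _ _ = ⊥-elim (¬1 (inj₂ (refl , s≤s (s≤s (s≤s (s≤s z≤n))) , λ p → ¬5 (inj₂ (inj₂ (sym p , refl , s≤s (s≤s z≤n)))))))
classify 1 1 (suc (suc q)) _ _ _ _ _ ¬3 = ⊥-elim (¬3 (inj₁ (refl , refl , s≤s (s≤s (s≤s z≤n)))))
classify 1 2 2 _ _ _ ¬5 _ _ = ⊥-elim (¬5 (inj₁ (refl , refl , refl)))
classify 1 2 3 _ _ _ _ ¬4 _ = ⊥-elim (¬4 (inj₁ (refl , refl , refl)))
classify 1 2 (suc (suc (suc (suc q)))) _ _ _ ¬5 _ _ = ⊥-elim (¬5 (inj₂ (inj₁ (refl , refl , s≤s (s≤s (s≤s (s≤s (s≤s (s≤s z≤n)))))))))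
classify 1 3 (suc (suc q)) _ _ _ _ _ ¬3 = ⊥-elim (¬3 (inj₂ (inj₂ (inj₂ (inj₂ (inj₂ (inj₂ (inj₂ (inj₁ ((λ ()) , (λ ()) , refl , λ ()))))))))))
classify 1 (suc (suc (suc (suc n)))) (suc (suc q)) _ _ _ _ _ ¬3 = ⊥-elim (¬3 (inj₂ (inj₂ (inj₁ (refl , s≤s (s≤s (s≤s (s≤s z≤n))) , s≤s (s≤s (s≤s (s≤s z≤n))))))))
classify 2 n 2 _ _ _ _ _ ¬3 = ⊥-elim (¬3 (inj₂ (inj₂ (inj₂ (inj₁ (refl , ℕ.≤-refl , λ { (_ , ()) }))))))
classify 2 n (suc (suc (suc q))) _ _ _ _ ¬4 _ = ⊥-elim (¬4 (inj₂ (inj₂ (refl , s≤s (s≤s (s≤s (s≤s (s≤s z≤n))))))))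
classify 3 n (suc (suc q)) _ _ _ _ _ ¬3 = ⊥-elim (¬3 (inj₂ (inj₂ (inj₂ (inj₂ (inj₁ (refl , s≤s (s≤s (s≤s (s≤s z≤n))))))))))
classify (suc (suc (suc (suc m)))) n (suc (suc q)) _ m≤n _ _ _ ¬3 with ℕ.m≤n⇒∃[o]m+o≡n m≤n
... | 0 , refl = level q ¬3
  where
  n≡m : 4 + m + 0 ≡ 4 + m
  n≡m = ℕ.+-identityʳ (4 + m)
  level : ∀ q → ¬ CaseAdern3 (4 + m) (4 + m + 0) (4 + q) → CaseAdern2 (4 + m) (4 + m + 0) (4 + q)
  level 0 _ = subst (λ k → CaseAdern2 (4 + m) k 4) (sym n≡m) (case-equal m)
  level (suc q) ¬3 = ⊥-elim (¬3 (inj₂ (inj₂ (inj₂ (inj₂ (inj₂ (inj₁ (s≤s (s≤s (s≤s (s≤s z≤n))) , n≡m , s≤s (s≤s (s≤s (s≤s (s≤s z≤n))))))))))))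
... | 1 , refl = ⊥-elim (¬3 (inj₂ (inj₂ (inj₂ (inj₂ (inj₂ (inj₂ (inj₁ (s≤s (s≤s (s≤s (s≤s z≤n))) , refl , s≤s (s≤s (s≤s (s≤s z≤n))))))))))))
... | 2 , refl = ⊥-elim (¬3 (inj₂ (inj₂ (inj₂ (inj₂ (inj₂ (inj₂ (inj₂ (inj₁ ((λ ()) , (λ ()) , refl , λ ()))))))))))
-- The leaf numbers differ by at least three; the rewriting brings `4 + m + (3 + d)` into the form
-- `7 + m + d` of `case-wide`.
... | suc (suc (suc d)) , refl = subst (λ k → CaseAdern2 (4 + m) k (4 + q))
  (cong (4 +_) (sym (trans (ℕ.+-suc m (2 + d)) (cong suc (trans (ℕ.+-suc m (1 + d)) (cong suc (ℕ.+-suc m d))))))) (case-wide m d q)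

theorem2 : ∀ (m n p : ℕ) → 1 ≤ m → m ≤ n → 2 ≤ p →
      (CaseAdern1 m n p → AdernIs (DoubleBroom m n p) 1)
    × (CaseAdern5 m n p → AdernIs (DoubleBroom m n p) 5)
    × (CaseAdern4 m n p → AdernIs (DoubleBroom m n p) 4)
    × (CaseAdern3 m n p → AdernIs (DoubleBroom m n p) 3)
    × (¬ CaseAdern1 m n p → ¬ CaseAdern5 m n p → ¬ CaseAdern4 m n p →
         ¬ CaseAdern3 m n p → AdernIs (DoubleBroom m n p) 2)
theorem2 m n (suc (suc q)) m≥1 m≤n p≥2@(s≤s (s≤s _)) =
  adern-1 m≥1 m≤n p≥2 , adern-5 , adern-4 m≤n , adern-3 m≥1 m≤n p≥2 , λ ¬1 ¬5 ¬4 ¬3 → adern-2 (classify m n q m≥1 m≤n ¬1 ¬5 ¬4 ¬3)
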